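{- Let $\Phi$ be an irreducible root system of type $A_n$ or $C_n$ and let $\alpha$ be a long simple root. Then: (1) for every dual order ideal $I$ of $\Phi^+$ with $I\subseteq M_\alpha$, one has $\dim(\mathrm{span}_{\mathbb R} I)=n$ if and only if $I\in\mathcal I_{ab}(\alpha)$; (2) for every $I\in\mathcal I_{ab}(\alpha)$, the border $B(I)$ is a $\mathbb Z$-basis of the root lattice $\sum_{i=1}^n\mathbb Z\alpha_i$; (3) for every $I\in\mathcal I_{ab}(\alpha)$, the collection $\{\mathrm{conv}(B(J)) \mid J\in\mathcal I_{ab}(\alpha),\ J\subseteq I\}$ is a triangulation of $\mathrm{conv}(I)$. In particular, $\{\mathrm{conv}(B(I))\mid I\in\mathcal I_{ab}(\alpha)\}$ is a triangulation of $F_\alpha:=\mathrm{conv}(M_\alpha)$.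
   Context: $\Phi$ is a finite irreducible crystallographic root system in a Euclidean space $E$ with inner product $(-,-)$, $\Pi=\{\alpha_1,\dots,\alpha_n\}$ a basis (numbered as in Bourbaki), $\Phi^+$ the positive roots, $\theta$ the highest root. In type $A_n$ all roots are considered long; in type $C_n$ (Bourbaki numbering) the only long simple root is $\alpha_n$. The root poset is $\Phi^+$ ordered by $\beta\le\gamma$ iff $\gamma-\beta$ is a nonnegative integer combination of simple roots. A dual order ideal is a subset $I\subseteq\Phi^+$ with $\beta\in I,\gamma\ge\beta\Rightarrow\gamma\in I$; it is an abelian ideal if moreover $(I+I)\cap\Phi=\emptyset$. For $\alpha\in\Phi^+$, $M_\alpha=\{\beta\in\Phi^+\mid\beta\ge\alpha\}$. The border of an ideal $I$ is $B(I)=\{\beta\in I\mid$ for all $\gamma_1,\gamma_2\in\Pi$ with $\beta-\gamma_1,\beta-\gamma_2\in\Phi^+$ one has $\beta-\gamma_1-\gamma_2\notin I\}$. Affine setting: let $\hat V=E\oplus\mathbb R\delta$ with the bilinear form extending $(-,-)$ and having $\delta$ in its radical; $\hat\Phi=\{\beta+k\delta\mid\beta\in\Phi,k\in\mathbb Z\}$, $\alpha_0=-\theta+\delta$, $\hat\Pi=\Pi\cup\{\alpha_0\}$, $\hat\Phi^+=\Phi^+\cup\{\beta+k\delta\mid\beta\in\Phi,k\ge1\}$. For $\beta\in\hat\Phi$, $s_\beta(x)=x-\frac{2(x,\beta)}{(\beta,\beta)}\beta$; the affine Weyl group $\hat W$ is generated by $s_\beta$, $\beta\in\hat\Pi$.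 For $w\in\hat W$, $N(w)=\{\beta\in\hat\Phi^+\mid w^{ -1}(\beta)\in-\hat\Phi^+\}$. For each abelian ideal $I$ there is a unique $w_I\in\hat W$ with $N(w_I)=\{\delta-\beta\mid\beta\in I\}$. For a long root $\alpha\in\Phi^+$, $\mathcal I_{ab}(\alpha)=\{I$ abelian ideal $\mid w_I^{ -1}(-\theta+2\delta)=\alpha\}$. A triangulation of a polytope $Q$ is a finite set of geometric simplices whose union is $Q$ and any two of which intersect in a common (possibly empty) face.
   Formalization: Spans, convex hulls and the triangulation conditions (affine independence, union, intersection in a common face) are stated over the rational numbers, for rational points and rational coefficients, instead of over the reals. -}

module Defs where

open import Data.Bool using (Bool; true; false; if_then_else_; _∧_; _∨_)
open import Data.Nat as N using (ℕ; zero; suc; _≤ᵇ_; _<ᵇ_; _≡ᵇ_)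
open import Data.Integer as Z using (ℤ; +_; -[1+_])
open import Data.Rational as Q using (ℚ; 0ℚ; 1ℚ)
open import Data.Rational.Properties as QP using ()
open import Data.Fin using (Fin; toℕ)
open import Data.Fin.Subset using (Subset; _∈_)
open import Data.Vec as V using (Vec; lookup; tabulate)
open import Data.List as L using (List; []; _∷_; allFin; concatMap; length)
open import Data.List.Membership.Propositional renaming (_∈_ to _∈L_)
open import Data.Product using (Σ; _×_; _,_; ∃)
open import Data.Sum using (_⊎_)
open import Relation.Nullary using (¬_; yes; no)
open import Relation.Binary.PropositionalEquality using (_≡_; _≢_)
open import Function.Bundles using (_⇔_)

-- Root systems of type A_n and C_n (Bourbaki numbering), written in
-- coordinates with respect to the simple roots α_1,…,α_n (0-indexed
-- here: α_{k+1} has index k).  A vector of the ambient space E is thus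
-- a Vec of length n; the root lattice is ℤ^n.

data RType : Set where
  A C : RType

ValidRank : RType → ℕ → Set
ValidRank A n = 1 N.≤ n
ValidRank C n = 2 N.≤ n

private
  b2z : Bool → ℤ → ℤ
  b2z b z = if b then z else + 0

coefA : ℕ → ℕ → ℕ → ℤ
coefA i j k = b2z ((i ≤ᵇ k) ∧ (k ≤ᵇ j)) (+ 1)

-- C, ε-description with 0-indexed ε_0,…,ε_{n-1}:
-- ε_a - ε_b (a<b) = α_a + … + α_{b-1}
coefCminus : ℕ → ℕ → ℕ → ℤ
coefCminus a b k = b2z ((a ≤ᵇ k) ∧ (k <ᵇ b)) (+ 1)

-- ε_a + ε_b (a<b) = (α_a+…+α_{b-1}) + 2(α_b+…+α_{n-2}) + α_{n-1}
coefCplus : ℕ → ℕ → ℕ → ℕ → ℤ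
coefCplus n a b k =
  if (a ≤ᵇ k) ∧ (k <ᵇ b) then + 1
  else if (b ≤ᵇ k) ∧ (suc k <ᵇ n) then + 2
  else if suc k ≡ᵇ n then + 1 else + 0

-- 2ε_a = 2(α_a+…+α_{n-2}) + α_{n-1}
coefC2 : ℕ → ℕ → ℕ → ℤ
coefC2 n a k =
  if (a ≤ᵇ k) ∧ (suc k <ᵇ n) then + 2
  else if suc k ≡ᵇ n then + 1 else + 0

vecOf : (n : ℕ) → (ℕ → ℤ) → Vec ℤ n
vecOf n f = tabulate (λ k → f (toℕ k))

posRoots : RType → (n : ℕ) → List (Vec ℤ n)
posRoots A n =
  concatMap (λ i → concatMap (λ j →
     if toℕ i ≤ᵇ toℕ j then vecOf n (coefA (toℕ i) (toℕ j)) ∷ [] else [])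
     (allFin n)) (allFin n)
posRoots C n =
  concatMap (λ a → concatMap (λ b →
     if toℕ a <ᵇ toℕ b
       then vecOf n (coefCminus (toℕ a) (toℕ b)) ∷ vecOf n (coefCplus n (toℕ a) (toℕ b)) ∷ []
       else [])
     (allFin n)) (allFin n)
  L.++ L.map (λ a → vecOf n (coefC2 n (toℕ a))) (allFin n)

highest : RType → (n : ℕ) → Vec ℤ n
highest A n = vecOf n (λ _ → + 1)
highest C n = vecOf n (coefC2 n 0)

simple : (n : ℕ) → Fin n → Vec ℤ n
simple n i = vecOf n (λ k → b2z (k ≡ᵇ toℕ i) (+ 1))

gram : RType → ℕ → ℕ → ℕ → ℤ
gram A n i j =
  if i ≡ᵇ j then + 2
  else if (suc i ≡ᵇ j) ∨ (suc j ≡ᵇ i) then -[1+ 0 ] else + 0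
gram C n i j =
  if i ≡ᵇ j then (if suc i ≡ᵇ n then + 4 else + 2)
  else if (suc i ≡ᵇ j) ∨ (suc j ≡ᵇ i)
    then (if (suc i ≡ᵇ n) ∨ (suc j ≡ᵇ n) then -[1+ 1 ] else -[1+ 0 ])
  else + 0

sumQ : (m : ℕ) → (Fin m → ℚ) → ℚ
sumQ zero    f = 0ℚ
sumQ (suc m) f = f Fin.zero Q.+ sumQ m (λ k → f (Fin.suc k))
  where import Data.Fin as Fin

sumZ : (m : ℕ) → (Fin m → ℤ) → ℤ
sumZ zero    f = + 0
sumZ (suc m) f = f Fin.zero Z.+ sumZ m (λ k → f (Fin.suc k))
  where import Data.Fin as Fin

toQ : ℤ → ℚ
toQ z = z Q./ 1

toQv : ∀ {n} → Vec ℤ n → Vec ℚ n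
toQv = V.map toQ

zeroQv : ∀ {n} → Vec ℚ n
zeroQv = V.replicate _ 0ℚ

ip : (t : RType) (n : ℕ) → Vec ℚ n → Vec ℚ n → ℚ
ip t n x y = sumQ n (λ i → sumQ n (λ j →
  lookup x i Q.* toQ (gram t n (toℕ i) (toℕ j)) Q.* lookup y j))

module Roots (t : RType) (n : ℕ) where

  NR : ℕ
  NR = length (posRoots t n)

  root : Fin NR → Vec ℤ n
  root j = L.lookup (posRoots t n) j

  rootQ : Fin NR → Vec ℚ n
  rootQ j = toQv (root j)

  θ : Vec ℤ n
  θ = highest t n

  IsPosRoot : Vec ℤ n → Set
  IsPosRoot v = v ∈L posRoots t n

  IsRoot : Vec ℤ n → Set
  IsRoot v = IsPosRoot v ⊎ IsPosRoot (V.map Z.-_ v)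

  IsLong : Vec ℤ n → Set
  IsLong v = ip t n (toQv v) (toQv v) ≡ ip t n (toQv θ) (toQv θ)

  -- root poset: β ≤ γ iff γ - β ∈ ℕ-span of Π (coordinatewise ≥ 0)
  _≼_ : Vec ℤ n → Vec ℤ n → Set
  β ≼ γ = ∀ k → lookup β k Z.≤ lookup γ k

  _-v_ : Vec ℤ n → Vec ℤ n → Vec ℤ n
  x -v y = V.zipWith Z._-_ x y

  _+v_ : Vec ℤ n → Vec ℤ n → Vec ℤ n
  x +v y = V.zipWith Z._+_ x y

  RSet : Set
  RSet = Subset NR

  _∈R_ : Vec ℤ n → RSet → Set
  v ∈R I = ∃ λ j → j ∈ I × root j ≡ v

  _⊆_ : RSet → RSet → Set
  I ⊆ J = ∀ j → j ∈ I → j ∈ J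

  DualOrderIdeal : RSet → Set
  DualOrderIdeal I = ∀ j k → j ∈ I → root j ≼ root k → k ∈ I

  AbelianIdeal : RSet → Set
  AbelianIdeal I = DualOrderIdeal I ×
    (∀ j k → j ∈ I → k ∈ I → ¬ IsRoot (root j +v root k))

  InM : Vec ℤ n → Fin NR → Set
  InM α j = α ≼ root j

  InBorder : RSet → Fin NR → Set
  InBorder I j = j ∈ I ×
    (∀ (p q : Fin n) → IsPosRoot (root j -v simple n p) → IsPosRoot (root j -v simple n q)
       → ¬ (((root j -v simple n p) -v simple n q) ∈R I))

  combQ : Vec ℚ NR → Vec ℚ n
  combQ c = tabulate (λ k → sumQ NR (λ j → lookup c j Q.* lookup (rootQ j) k))

  combZ : Vec ℤ NR → Vec ℤ n
  combZ c = tabulate (λ k → sumZ NR (λ j → lookup c j Z.* lookup (root j) k))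

  SupportedQ : (Fin NR → Set) → Vec ℚ NR → Set
  SupportedQ P c = ∀ j → ¬ P j → lookup c j ≡ 0ℚ

  SupportedZ : (Fin NR → Set) → Vec ℤ NR → Set
  SupportedZ P c = ∀ j → ¬ P j → lookup c j ≡ + 0

  -- span_ℚ {β_j | P j} = E , i.e. dim span(P) = n
  SpansE : (Fin NR → Set) → Set
  SpansE P = ∀ (x : Vec ℚ n) → Σ (Vec ℚ NR) λ c → SupportedQ P c × combQ c ≡ x

  ZBasis : (Fin NR → Set) → Set
  ZBasis P =
    (∀ (x : Vec ℤ n) → Σ (Vec ℤ NR) λ c → SupportedZ P c × combZ c ≡ x) ×
    (∀ (c : Vec ℤ NR) → SupportedZ P c → combZ c ≡ V.replicate n (+ 0) → ∀ j → lookup c j ≡ + 0)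

  InConv : (Fin NR → Set) → Vec ℚ n → Set
  InConv P x = Σ (Vec ℚ NR) λ c → SupportedQ P c × (∀ j → 0ℚ Q.≤ lookup c j)
    × sumQ NR (lookup c) ≡ 1ℚ × combQ c ≡ x

  AffIndep : (Fin NR → Set) → Set
  AffIndep P = ∀ (c : Vec ℚ NR) → SupportedQ P c → sumQ NR (lookup c) ≡ 0ℚ
    → combQ c ≡ zeroQv → ∀ j → lookup c j ≡ 0ℚ

  -- The collection {conv(V i) | i : Ix, Sel i} is a triangulation of the
  -- polytope Q: each member is a geometric simplex, their union is Q,
  -- and any two meet in a common face (a face of the simplex conv(V) is
  -- conv(U) for a subset U of its vertex set V; U = ∅ gives ∅).
  Triangulation : {Ix : Set} → (Sel : Ix → Set) → (V : Ix → Fin NR → Set)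
                  → (Q : Vec ℚ n → Set) → Set
  Triangulation {Ix} Sel V Q =
    (∀ i → Sel i → AffIndep (V i)) ×
    (∀ x → Q x ⇔ (Σ Ix λ i → Sel i × InConv (V i) x)) ×
    (∀ i i' → Sel i → Sel i' →
       Σ (Subset NR) λ U → Σ (Subset NR) λ U' →
         (∀ j → j ∈ U → V i j) × (∀ j → j ∈ U' → V i' j) ×
         (∀ x → ((InConv (V i) x × InConv (V i') x) ⇔ InConv (λ j → j ∈ U) x)
              × (InConv (λ j → j ∈ U) x ⇔ InConv (λ j → j ∈ U') x)))

  -- affine root system and affine Weyl group
  -- an element of V̂ = E ⊕ ℝδ is a pair (x , k) meaning x + kδ

  AffVec : Set
  AffVec = Vec ℚ n × ℚ

  negA : AffVec → AffVec
  negA (x , k) = V.map Q.-_ x , Q.- k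

  nat : ℕ → ℚ
  nat m = toQ (+ m)

  IsPosAffRoot : AffVec → Set
  IsPosAffRoot v = Σ (Fin NR) λ j → Σ ℕ λ m →
    (v ≡ (rootQ j , nat m)) ⊎ (v ≡ (V.map Q.-_ (rootQ j) , nat (suc m)))

  IsNegAffRoot : AffVec → Set
  IsNegAffRoot v = IsPosAffRoot (negA v)

  -- s_β(x) = x - (2(x,β)/(β,β)) β   (δ lies in the radical of the form)
  sref : AffVec → AffVec → AffVec
  sref (b , m) (x , k) = V.zipWith (λ xi bi → xi Q.- c Q.* bi) x b , k Q.- c Q.* m
    where
      bb : ℚ
      bb = ip t n b b
      inv : ℚ
      inv with bb QP.≟ 0ℚ
      ... | yes _  = 0ℚ
      ... | no bb≢0 = Q.1/_ bb {{Q.≢-nonZero bb≢0}}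
      c : ℚ
      c = (toQ (+ 2) Q.* ip t n x b) Q.* inv

  affSimple : Fin (suc n) → AffVec
  affSimple Fin.zero    = V.map Q.-_ (toQv θ) , 1ℚ
    where import Data.Fin as Fin
  affSimple (Fin.suc i) = toQv (simple n i) , 0ℚ
    where import Data.Fin as Fin

  -- an element w = s_{i₁} s_{i₂} ⋯ s_{i_r} of Ŵ is given by a word [i₁,…,i_r];
  -- act⁻¹ w x = w⁻¹(x) = s_{i_r} ⋯ s_{i₁}(x)
  Word : Set
  Word = List (Fin (suc n))

  actInv : Word → AffVec → AffVec
  actInv w x = L.foldl (λ y i → sref (affSimple i) y) x w

  InversionSetIs : Word → RSet → Set
  InversionSetIs w I = ∀ (v : AffVec) →
    (IsPosAffRoot v × IsNegAffRoot (actInv w v)) ⇔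
    (Σ (Fin NR) λ j → j ∈ I × v ≡ (V.map Q.-_ (rootQ j) , 1ℚ))

  -- I ∈ 𝓘_ab(α):  I abelian and w_I⁻¹(-θ + 2δ) = α, where w_I is the
  -- (unique) element of Ŵ with N(w_I) = {δ - β | β ∈ I}
  Iab : Vec ℤ n → RSet → Set
  Iab α I = AbelianIdeal I ×
    (Σ Word λ w → InversionSetIs w I ×
        actInv w (V.map Q.-_ (toQv θ) , toQ (+ 2)) ≡ (toQv α , 0ℚ))

{-# OPTIONS --safe #-}
-- Both types are handled as (foldings of) A_h, h = n or 2n − 1: a root of M_α is a cell (a , d) with
-- a ≤ i < d ≤ h, standing for ε_a − ε_d, and in type C the cells (a , d) and (h − d , h − a) give the same
-- root.  A dual order ideal in M_α is then a (symmetric) staircase, and it spans iff it contains the cells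
-- (0 , i + 1) and (i , h).
-- The border of such a staircase is a lattice path; the linear functionals dual to it are read off from
-- its corners, so it is independent, and every other cell is an integral combination of border cells.
-- The simplices are glued along the hyperplanes y_a + y_{d+1} = y_{i+1}, where y_k is the (symmetrised)
-- sum of the first k coordinates: x lies in conv B(J) iff these expressions are ≤ 0 for the cells of J and
-- ≥ 0 for the others.
-- Elements of the affine Weyl group act on positions ε_r − kδ, ordered by r + k(h + 1), and the inversions
-- of w are inversions of the resulting permutation of ℤ.  If w⁻¹(2δ − θ) = α, the coefficient of α takes two
-- consecutive values on the positions 0, …, h, and its jump is located by the invariance of
-- Σ_p (ε_0 − ε_p) modulo h + 1; this forces I ⊆ M_α together with the two required cells.  Conversely
-- w_I moves a ≤ i down by the length of row a of I and d > i up by the length of column d, and it is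
-- built by adding the corners of I one at a time.
module Submission where

open import Defs
open import Algebra.Structures using (IsCommutativeRing)
open import Data.Bool using (Bool; true; false; if_then_else_; _∧_; _∨_; T)
open import Data.Empty using (⊥; ⊥-elim)
open import Data.Fin as F using (Fin; toℕ; fromℕ<)
import Data.Fin.Properties as FP
open import Data.Fin.Subset as S using (Subset; _∈_)
import Data.Fin.Subset.Properties as SP
open import Data.Integer as Z using (ℤ; +_; -[1+_]; _+_; _-_; _*_; -_; _≤_; _<_)
import Data.Integer.Properties as ZP
open import Data.Integer.Tactic.RingSolver using (solve-∀)
open import Data.List as L using (List; []; _∷_; allFin; concatMap)
open import Data.List.Membership.Propositional using (find; lose) renaming (_∈_ to _∈L_)
import Data.List.Membership.Propositional.Properties as LM
open import Data.List.Relation.Binary.Disjoint.Propositional using (Disjoint)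
open import Data.List.Relation.Unary.All as All using (All; []; _∷_)
import Data.List.Relation.Unary.All.Properties as AllP
open import Data.List.Relation.Unary.AllPairs as AP using (AllPairs; []; _∷_)
import Data.List.Relation.Unary.AllPairs.Properties as APP
open import Data.List.Relation.Unary.Any as Any using (Any; here; there)
import Data.List.Relation.Unary.Any.Properties as AnyP
open import Data.List.Relation.Unary.Unique.Propositional using (Unique)
import Data.List.Relation.Unary.Unique.Propositional.Properties as UP
open import Data.Nat as N using (ℕ; zero; suc; z≤n; s≤s; _∸_; _<ᵇ_; _≤ᵇ_; _≡ᵇ_)
import Data.Nat.Properties as NP
import Data.Nat.Tactic.RingSolver as NR
open import Data.Product using (Σ; _×_; _,_; ∃; ∃₂; proj₁; proj₂)
open import Data.Rational as Q using (ℚ; 0ℚ; 1ℚ)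
import Data.Rational.Properties as QP
import Data.Rational.Unnormalised as U
import Data.Rational.Unnormalised.Properties as UQ
open import Data.Sum as Sum using (_⊎_; inj₁; inj₂)
open import Data.Unit using (⊤; tt)
open import Data.Vec as V using (Vec; lookup; tabulate)
import Data.Vec.Properties as VP
open import Function.Base using (_∘_; id; case_of_)
open import Function.Bundles using (_⇔_; mk⇔; Equivalence)
open import Relation.Binary.Definitions using (Tri; tri<; tri≈; tri>)
open import Relation.Binary.PropositionalEquality using (_≡_; _≢_; refl; sym; trans; cong; cong₂; subst; subst₂)
open import Relation.Nullary using (¬_; Dec; yes; no; does)
open import Relation.Nullary.Decidable using (_×-dec_; ¬?; dec-true)

-- In type C a root is seen only through both of its cells: every functional takes on it the sum of
-- its values on a cell and on the mirror cell. Sign conditions are therefore proved cell by cell,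
-- on sets of cells that are stable under the mirror, and a dual functional is only known to be at
-- least 1 on its own root. In type A the mirror is the identity and each cell counts twice, so one
-- argument covers both types. Longness of α means that its step, from i to i + 1, is its own mirror
-- image. Hence α has coefficient 1 in every root of M_α. The ideals inside M_α thus lie in an
-- affine hyperplane off the origin, where linear independence gives affine independence and the
-- weights of a linear combination add up to 1 by themselves; and no sum of two of their roots is a
-- root, so they are abelian.

module FinSum {R : Set} {_⊕_ _⊗_ : R → R → R} {⊖_ : R → R} {0# 1# : R}
  (isCR : IsCommutativeRing _≡_ _⊕_ _⊗_ ⊖_ 0# 1#)
  (sum : (m : ℕ) → (Fin m → R) → R)
  (sum-zero : ∀ f → sum zero f ≡ 0#)
  (sum-suc : ∀ m f → sum (suc m) f ≡ f F.zero ⊕ sum m (f ∘ F.suc)) where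

  open IsCommutativeRing isCR
    using (+-identityˡ; +-identityʳ; distribˡ; zeroʳ; -‿inverseʳ) renaming (+-assoc to ⊕-assoc; +-comm to ⊕-comm)

  sum-cong : ∀ m {f g : Fin m → R} → (∀ k → f k ≡ g k) → sum m f ≡ sum m g
  sum-cong zero {f} {g} e = trans (sum-zero f) (sym (sum-zero g))
  sum-cong (suc m) {f} {g} e = trans (sum-suc m f)
    (trans (cong₂ _⊕_ (e F.zero) (sum-cong m (e ∘ F.suc))) (sym (sum-suc m g)))

  sum-0 : ∀ m {f : Fin m → R} → (∀ k → f k ≡ 0#) → sum m f ≡ 0#
  sum-0 zero {f} e = sum-zero f
  sum-0 (suc m) {f} e = trans (sum-suc m f)
    (trans (cong₂ _⊕_ (e F.zero) (sum-0 m (e ∘ F.suc))) (+-identityˡ 0#))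

  interchange : ∀ a b c d → (a ⊕ b) ⊕ (c ⊕ d) ≡ (a ⊕ c) ⊕ (b ⊕ d)
  interchange a b c d = trans (⊕-assoc a b (c ⊕ d)) (trans (cong (a ⊕_)
    (trans (sym (⊕-assoc b c d)) (trans (cong (_⊕ d) (⊕-comm b c)) (⊕-assoc c b d)))) (sym (⊕-assoc a c (b ⊕ d))))

  sum-⊕ : ∀ m (f g : Fin m → R) → sum m (λ k → f k ⊕ g k) ≡ sum m f ⊕ sum m g
  sum-⊕ zero f g = trans (sum-zero _) (sym (trans (cong₂ _⊕_ (sum-zero f) (sum-zero g)) (+-identityˡ 0#)))
  sum-⊕ (suc m) f g = trans (sum-suc m _)
    (trans (cong (_ ⊕_) (sum-⊕ m (f ∘ F.suc) (g ∘ F.suc)))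
    (trans (interchange _ _ _ _) (sym (cong₂ _⊕_ (sum-suc m f) (sum-suc m g)))))

  sum-⊗ : ∀ m c (f : Fin m → R) → sum m (λ k → c ⊗ f k) ≡ c ⊗ sum m f
  sum-⊗ zero c f = trans (sum-zero _) (sym (trans (cong (c ⊗_) (sum-zero f)) (zeroʳ c)))
  sum-⊗ (suc m) c f = trans (sum-suc m _) (trans (cong (_ ⊕_) (sum-⊗ m c (f ∘ F.suc)))
    (trans (sym (distribˡ c _ _)) (cong (c ⊗_) (sym (sum-suc m f)))))

  sum-⊖ : ∀ m (f g : Fin m → R) → sum m (λ k → f k ⊕ (⊖ g k)) ≡ sum m f ⊕ (⊖ sum m g)
  sum-⊖ m f g = cancel (trans (sym (sum-⊕ m (λ k → f k ⊕ (⊖ g k)) g))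
    (trans (sum-cong m (λ k → minusPlus (f k) (g k))) (sym (minusPlus (sum m f) (sum m g)))))
    where
    minusPlus : ∀ a b → (a ⊕ (⊖ b)) ⊕ b ≡ a
    minusPlus a b = trans (⊕-assoc a _ _) (trans (cong (a ⊕_)
      (trans (⊕-comm _ _) (-‿inverseʳ b))) (+-identityʳ a))
    plusMinus : ∀ a b → (a ⊕ b) ⊕ (⊖ b) ≡ a
    plusMinus a b = trans (⊕-assoc a _ _) (trans (cong (a ⊕_) (-‿inverseʳ b)) (+-identityʳ a))
    cancel : ∀ {a b c} → a ⊕ c ≡ b ⊕ c → a ≡ b
    cancel {a} {b} {c} e = trans (sym (plusMinus a c)) (trans (cong (_⊕ (⊖ c)) e) (plusMinus b c))

  sum-comm : ∀ m l (f : Fin m → Fin l → R) →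
    sum m (λ i → sum l (f i)) ≡ sum l (λ j → sum m (λ i → f i j))
  sum-comm zero l f = trans (sum-zero _) (sym (sum-0 l (λ j → sum-zero _)))
  sum-comm (suc m) l f = trans (sum-suc m _) (trans (cong (sum l (f F.zero) ⊕_) (sum-comm m l (f ∘ F.suc)))
    (trans (sym (sum-⊕ l _ _)) (sum-cong l (λ j → sym (sum-suc m _)))))

module ΣZ = FinSum ZP.+-*-isCommutativeRing sumZ (λ f → refl) (λ m f → refl)
module ΣQ = FinSum QP.+-*-isCommutativeRing sumQ (λ f → refl) (λ m f → refl)

-- Integers inside the rationals; sums, inequalities and indicator functions

toQᵘ : ∀ z → Q.toℚᵘ (toQ z) U.≃ U.mkℚᵘ z 0
toQᵘ z = QP.toℚᵘ-fromℚᵘ (U.mkℚᵘ z 0)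

toQ-+ : ∀ a b → toQ (a + b) ≡ toQ a Q.+ toQ b
toQ-+ a b = QP.toℚᵘ-injective (UQ.≃-trans (toQᵘ (a + b)) (UQ.≃-trans (U.*≡* (lem a b))
  (UQ.≃-sym (UQ.≃-trans (QP.toℚᵘ-homo-+ (toQ a) (toQ b)) (UQ.+-cong (toQᵘ a) (toQᵘ b))))))
  where
  lem : ∀ a b → (a + b) * + 1 ≡ (a * + 1 + b * + 1) * + 1
  lem = solve-∀

toQ-* : ∀ a b → toQ (a * b) ≡ toQ a Q.* toQ b
toQ-* a b = QP.toℚᵘ-injective (UQ.≃-trans (toQᵘ (a * b)) (UQ.≃-trans (U.*≡* refl)
  (UQ.≃-sym (UQ.≃-trans (QP.toℚᵘ-homo-* (toQ a) (toQ b)) (UQ.*-cong (toQᵘ a) (toQᵘ b))))))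

toQ-neg : ∀ a → toQ (- a) ≡ Q.- toQ a
toQ-neg a = QP.toℚᵘ-injective (UQ.≃-trans (toQᵘ (- a))
  (UQ.≃-sym (UQ.≃-trans (QP.toℚᵘ-homo‿- (toQ a)) (UQ.-‿cong (toQᵘ a)))))

toQ-sub : ∀ a b → toQ (a - b) ≡ toQ a Q.- toQ b
toQ-sub a b = trans (toQ-+ a (- b)) (cong (toQ a Q.+_) (toQ-neg b))

toQ-inj : ∀ {a b} → toQ a ≡ toQ b → a ≡ b
toQ-inj {a} {b} e with UQ.≃-trans (UQ.≃-sym (toQᵘ a)) (UQ.≃-trans (QP.toℚᵘ-cong e) (toQᵘ b))
... | U.*≡* q = trans (sym (ZP.*-identityʳ a)) (trans q (ZP.*-identityʳ b))

toQ-mono : ∀ {a b} → a ≤ b → toQ a Q.≤ toQ b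
toQ-mono {a} {b} le = QP.toℚᵘ-cancel-≤ (UQ.≤-respˡ-≃ (UQ.≃-sym (toQᵘ a))
  (UQ.≤-respʳ-≃ (UQ.≃-sym (toQᵘ b)) (U.*≤* (ZP.*-monoʳ-≤-nonNeg (+ 1) le))))

toQ-sum : ∀ m (f : Fin m → ℤ) → toQ (sumZ m f) ≡ sumQ m (toQ ∘ f)
toQ-sum zero f = refl
toQ-sum (suc m) f = trans (toQ-+ (f F.zero) _) (cong (toQ (f F.zero) Q.+_) (toQ-sum m (f ∘ F.suc)))

sumZ-mono : ∀ m {f g : Fin m → ℤ} → (∀ k → f k ≤ g k) → sumZ m f ≤ sumZ m g
sumZ-mono zero h = ZP.≤-refl
sumZ-mono (suc m) h = ZP.+-mono-≤ (h F.zero) (sumZ-mono m (h ∘ F.suc))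

sumQ-mono : ∀ m {f g : Fin m → ℚ} → (∀ k → f k Q.≤ g k) → sumQ m f Q.≤ sumQ m g
sumQ-mono zero h = QP.≤-refl
sumQ-mono (suc m) h = QP.+-mono-≤ (h F.zero) (sumQ-mono m (h ∘ F.suc))

sumQ-nonneg : ∀ m {f : Fin m → ℚ} → (∀ k → 0ℚ Q.≤ f k) → 0ℚ Q.≤ sumQ m f
sumQ-nonneg m {f} h = subst (Q._≤ sumQ m f) (ΣQ.sum-0 m (λ k → refl)) (sumQ-mono m h)

sumQ-single : ∀ m (k : Fin m) {f : Fin m → ℚ} → (∀ j → j ≢ k → f j ≡ 0ℚ) → sumQ m f ≡ f k
sumQ-single (suc m) F.zero {f} h = trans (cong (f F.zero Q.+_) (ΣQ.sum-0 m (λ j → h (F.suc j) (λ ()))))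
  (QP.+-identityʳ _)
sumQ-single (suc m) (F.suc k) {f} h = trans (cong₂ Q._+_ (h F.zero (λ ()))
  (sumQ-single m k (λ j ne → h (F.suc j) (ne ∘ FP.suc-injective)))) (QP.+-identityˡ _)

sumQ-nonpos-zero : ∀ m {f : Fin m → ℚ} → (∀ k → f k Q.≤ 0ℚ) → 0ℚ Q.≤ sumQ m f → ∀ k → f k ≡ 0ℚ
sumQ-nonpos-zero (suc m) {f} h s = go
  where
  tail≤0 : sumQ m (f ∘ F.suc) Q.≤ 0ℚ
  tail≤0 = subst (sumQ m (f ∘ F.suc) Q.≤_) (ΣQ.sum-0 m (λ k → refl)) (sumQ-mono m (h ∘ F.suc))
  go : ∀ k → f k ≡ 0ℚ
  go F.zero = QP.≤-antisym (h F.zero) (QP.≤-trans s (subst (sumQ (suc m) f Q.≤_) (QP.+-identityʳ _)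
    (QP.+-monoʳ-≤ (f F.zero) tail≤0)))
  go (F.suc k) = sumQ-nonpos-zero m (h ∘ F.suc) (QP.≤-trans s (subst (sumQ (suc m) f Q.≤_) (QP.+-identityˡ _)
    (QP.+-monoˡ-≤ _ (h F.zero)))) k

ind : Bool → ℤ
ind b = if b then + 1 else + 0

lookup-ext : ∀ {A : Set} {n} {u v : Vec A n} → (∀ k → lookup u k ≡ lookup v k) → u ≡ v
lookup-ext {u = u} {v} e = trans (sym (VP.tabulate∘lookup u)) (trans (VP.tabulate-cong e) (VP.tabulate∘lookup v))

lookup-vecOf : ∀ n f k → lookup (vecOf n f) k ≡ f (toℕ k)
lookup-vecOf n f k = VP.lookup∘tabulate (f ∘ toℕ) k

vecOf-cong : ∀ n {f g : ℕ → ℤ} → (∀ k → k N.< n → f k ≡ g k) → vecOf n f ≡ vecOf n g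
vecOf-cong n e = VP.tabulate-cong (λ k → e (toℕ k) (FP.toℕ<n k))

-- Linear arithmetic by certificates: the slack of the goal is written as the sum of the slacks of
-- the given inequalities, and that identity is left to the ring solver. `≤-by₂` and `≤-by₃` take
-- more summands; strict inequalities enter through `<⇒+1≤`.
≤-by : ∀ {a b c d} → a ≤ b → b - a ≡ d - c → c ≤ d
≤-by {a} {b} {c} {d} le e = ZP.0≤i-j⇒j≤i (subst (+ 0 ≤_) e (ZP.i≤j⇒0≤j-i le))

≤-by₂ : ∀ {a b a′ b′ c d} → a ≤ b → a′ ≤ b′ → (b - a) + (b′ - a′) ≡ d - c → c ≤ d
≤-by₂ {a} {b} {a′} {b′} {c} {d} le le′ e =
  ZP.0≤i-j⇒j≤i (subst (+ 0 ≤_) e (ZP.+-mono-≤ (ZP.i≤j⇒0≤j-i le) (ZP.i≤j⇒0≤j-i le′)))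

≤-by₃ : ∀ {a b a′ b′ a″ b″ c d} → a ≤ b → a′ ≤ b′ → a″ ≤ b″ → (b - a) + (b′ - a′) + (b″ - a″) ≡ d - c → c ≤ d
≤-by₃ {a} {b} {a′} {b′} {a″} {b″} {c} {d} le le′ le″ e = ZP.0≤i-j⇒j≤i (subst (+ 0 ≤_) e
  (ZP.+-mono-≤ (ZP.+-mono-≤ (ZP.i≤j⇒0≤j-i le) (ZP.i≤j⇒0≤j-i le′)) (ZP.i≤j⇒0≤j-i le″)))

<⇒+1≤ : ∀ {a b} → a < b → a + + 1 ≤ b
<⇒+1≤ {a} l = subst (_≤ _) (ZP.+-comm (+ 1) a) (ZP.i<j⇒suc[i]≤j l)

+1≤⇒< : ∀ {a b} → a + + 1 ≤ b → a < b
+1≤⇒< {a} l = ZP.suc[i]≤j⇒i<j (subst (_≤ _) (ZP.+-comm a (+ 1)) l)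

negQ-involutive : ∀ a → Q.- (Q.- a) ≡ a
negQ-involutive (Q.mkℚ (+ zero) _ _) = refl
negQ-involutive (Q.mkℚ (+ suc _) _ _) = refl
negQ-involutive (Q.mkℚ -[1+ _ ] _ _) = refl

T-true : ∀ {b} → T b → b ≡ true
T-true {true} _ = refl

T-false : ∀ {b} → ¬ T b → b ≡ false
T-false {true} h = ⊥-elim (h tt)
T-false {false} h = refl

opaque
  -- Opaque together with `eqi`, so that both stay atoms in ring identities and are evaluated only
  -- through explicit lemmas. The bound comes first: `lt k` is the indicator of the positions before
  -- k.
  lt : ℕ → ℕ → ℤ
  lt k r = ind (r <ᵇ k)

  lt-yes : ∀ {k r} → r N.< k → lt k r ≡ + 1
  lt-yes h = cong ind (T-true (NP.<⇒<ᵇ h))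

  lt-no : ∀ {k r} → k N.≤ r → lt k r ≡ + 0
  lt-no {k} {r} h = cong ind (T-false (λ c → NP.<⇒≱ (NP.<ᵇ⇒< r k c) h))

  eqi : ℕ → ℕ → ℤ
  eqi a b = ind (a ≡ᵇ b)

  eqi-def : ∀ a b → eqi a b ≡ ind (a ≡ᵇ b)
  eqi-def a b = refl

  eqi-yes : ∀ {a b} → a ≡ b → eqi a b ≡ + 1
  eqi-yes {a} {b} h = cong ind (T-true (NP.≡⇒≡ᵇ a b h))

  eqi-no : ∀ {a b} → a ≢ b → eqi a b ≡ + 0
  eqi-no {a} {b} h = cong ind (T-false (h ∘ NP.≡ᵇ⇒≡ a b))

  eqi≥0 : ∀ a b → + 0 ≤ eqi a b
  eqi≥0 a b with a ≡ᵇ b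
  ... | true = Z.+≤+ z≤n
  ... | false = Z.+≤+ z≤n

  sumZ-eqi : ∀ m (f : ℕ → ℤ) {l} → l N.< m → sumZ m (λ k → f (toℕ k) * eqi (toℕ k) l) ≡ f l
  sumZ-eqi (suc m) f {zero} _ = trans (cong₂ _+_ (ZP.*-identityʳ (f 0))
    (ΣZ.sum-0 m (λ k → ZP.*-zeroʳ (f (suc (toℕ k)))))) (ZP.+-identityʳ (f 0))
  sumZ-eqi (suc m) f {suc l} (s≤s h) = trans (cong₂ _+_ (ZP.*-zeroʳ (f 0)) (sumZ-eqi m (f ∘ suc) h)) (ZP.+-identityˡ _)

eqi-⇔ : ∀ {a b c d} → (a ≡ b → c ≡ d) → (c ≡ d → a ≡ b) → eqi a b ≡ eqi c d
eqi-⇔ {a} {b} f f⁻ with a N.≟ b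
... | yes e = trans (eqi-yes e) (sym (eqi-yes (f e)))
... | no ne = trans (eqi-no ne) (sym (eqi-no (ne ∘ f⁻)))

lt-compl : ∀ {k r k′ r′} → (r N.< k → k′ N.≤ r′) → (k N.≤ r → r′ N.< k′) → lt k r ≡ + 1 - lt k′ r′
lt-compl {k} {r} f f⁻ with r N.<? k
... | yes h = trans (lt-yes h) (sym (cong (λ z → + 1 - z) (lt-no (f h))))
... | no h = trans (lt-no (NP.≮⇒≥ h)) (sym (cong (λ z → + 1 - z) (lt-yes (f⁻ (NP.≮⇒≥ h)))))

lt-suc : ∀ q k → lt (suc q) k ≡ lt q k + eqi k q
lt-suc q k with NP.<-cmp k q
... | tri< a ne _ = trans (lt-yes (NP.m<n⇒m<1+n a)) (sym (cong₂ _+_ (lt-yes a) (eqi-no ne)))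
... | tri≈ _ e _ = trans (lt-yes (NP.≤-reflexive (cong suc e))) (sym (cong₂ _+_ (lt-no (NP.≤-reflexive (sym e))) (eqi-yes e)))
... | tri> _ ne c = trans (lt-no c) (sym (cong₂ _+_ (lt-no (NP.<⇒≤ c)) (eqi-no ne)))

lt-step : ∀ k r → lt k r - lt k (suc r) ≡ eqi (suc r) k
lt-step k r with NP.<-cmp (suc r) k
... | tri< a ne _ = trans (cong₂ _-_ (lt-yes (NP.<⇒≤ a)) (lt-yes a)) (sym (eqi-no ne))
... | tri≈ _ e _ = trans (cong₂ _-_ (lt-yes (NP.≤-reflexive e)) (lt-no (NP.≤-reflexive (sym e)))) (sym (eqi-yes e))
... | tri> _ ne c = trans (cong₂ _-_ (lt-no (NP.≤-pred c)) (lt-no (NP.<⇒≤ c))) (sym (eqi-no ne))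

-- Folding type A: roots as cells, the mirror symmetry and the functionals y_k

hi : RType → ℕ → ℕ
hi A n = n
hi C n = N.pred n N.+ n

-- Both types are treated as (foldings of) type A_hi: the affine simple root joining positions
-- r and r + 1 is α_{cls r}, where the label n stands for α₀.
cls : RType → ℕ → ℕ → ℕ
cls A n r = r
cls C n r = if r <ᵇ n then r else (if r ≡ᵇ hi C n then n else hi C n ∸ suc r)

if-true : ∀ {X : Set} {b} {x y : X} → T b → (if b then x else y) ≡ x
if-true {b = true} _ = refl

if-false : ∀ {X : Set} {b} {x y : X} → ¬ T b → (if b then x else y) ≡ y
if-false {b = true} h = ⊥-elim (h tt)
if-false {b = false} _ = refl

n≤hi : ∀ t n → n N.≤ hi t n
n≤hi A n = NP.≤-refl
n≤hi C n = NP.m≤n+m n (N.pred n)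

n>0 : ∀ t n → ValidRank t n → 0 N.< n
n>0 A n v = v
n>0 C n v = NP.≤-trans (s≤s z≤n) v

hiC : ∀ n → ValidRank C n → suc (hi C n) ≡ n N.+ n
hiC (suc n) v = refl

n<hi : ∀ n → ValidRank C n → n N.< hi C n
n<hi (suc zero) (s≤s ())
n<hi (suc (suc n)) v = NP.m<n+m _ (s≤s z≤n)

cls-id : ∀ t n {r} → r N.< n → cls t n r ≡ r
cls-id A n h = refl
cls-id C n h = if-true (NP.<⇒<ᵇ h)

cls-hi : ∀ t n → ValidRank t n → cls t n (hi t n) ≡ n
cls-hi A n v = refl
cls-hi C n v = trans (if-false (λ c → NP.<⇒≱ (NP.<ᵇ⇒< (hi C n) n c) (n≤hi C n)))
  (if-true (NP.≡⇒≡ᵇ (hi C n) _ refl))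

cls-fold : ∀ n {r} → n N.≤ r → r N.< hi C n → cls C n r ≡ hi C n ∸ suc r
cls-fold n {r} h h′ = trans (if-false (λ c → NP.<⇒≱ (NP.<ᵇ⇒< r n c) h))
  (if-false (λ c → NP.<⇒≢ h′ (NP.≡ᵇ⇒≡ r _ c)))

-- hi ∸ suc r is the mirror image of the step from r to r + 1 under p ↦ hi ∸ p.
flip-lt : ∀ n {r} → n N.≤ r → r N.< hi C n → suc (hi C n ∸ suc r) N.< n
flip-lt n {r} h h′ = subst (N._< n) (NP.+-∸-assoc 1 h′)
  (NP.≤-<-trans (NP.∸-monoʳ-≤ (hi C n) h) (subst (N._< n) (sym (NP.m+n∸n≡m (N.pred n) n)) (predlt n (b n h h′))))
  where
  predlt : ∀ m → 0 N.< m → N.pred m N.< m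
  predlt (suc m) _ = NP.≤-refl
  b : ∀ n → n N.≤ r → r N.< hi C n → 0 N.< n
  b zero _ ()
  b (suc n) _ _ = s≤s z≤n

cls-lt : ∀ t n {r} → r N.< hi t n → cls t n r N.< n
cls-lt A n h = h
cls-lt C n {r} h with r N.<? n
... | yes l = subst (N._< n) (sym (cls-id C n l)) l
... | no l = subst (N._< n) (sym (cls-fold n (NP.≮⇒≥ l) h)) (NP.<⇒≤ (flip-lt n (NP.≮⇒≥ l) h))

flip-ge : ∀ n → ValidRank C n → ∀ {k} → suc k N.< n → n N.≤ hi C n ∸ suc k
flip-ge n v {k} h = NP.≤-trans (NP.≤-reflexive (sym (NP.m+n∸m≡n (N.pred n) n)))
  (NP.∸-monoʳ-≤ (hi C n) (pl n h))
  where
  pl : ∀ n → suc k N.< n → suc k N.≤ N.pred n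
  pl (suc n) (s≤s h) = h

LongIx : RType → ℕ → ℕ → Set
LongIx A n i = i N.< n
LongIx C n i = suc i ≡ n

module Model (t : RType) (n : ℕ) (valid : ValidRank t n) where
  open Roots t n

  h : ℕ
  h = hi t n

  -- `g q` holds the coefficients of ε_0 - ε_q, collected along the steps from 0 to q; differences
  -- of two such paths give all roots.
  g : ℕ → ℕ → ℤ
  g zero k = + 0
  g (suc q) k = g q k + eqi k (cls t n q)

  opaque
    Er : ℕ → ℕ → Vec ℤ n
    Er p q = vecOf n (λ k → g q k - g p k)

    Er-def : ∀ p q → Er p q ≡ vecOf n (λ k → g q k - g p k)
    Er-def p q = refl

    lookup-Er : ∀ p q k → lookup (Er p q) k ≡ g q (toℕ k) - g p (toℕ k)
    lookup-Er p q k = lookup-vecOf n (λ k → g q k - g p k) k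

  φ : (ℕ → ℤ) → Vec ℤ n → ℤ
  φ w v = sumZ n (λ k → w (toℕ k) * lookup v k)

  -- Ψ is a potential for w: along each step it drops by the weight of the simple root labelling
  -- that step, so the value on a path telescopes to its two ends. The functionals y_k, the coroot
  -- pairings and the height are all evaluated in this way.
  φ-g : ∀ (w Ψ : ℕ → ℤ) → (∀ {r} → r N.< h → w (cls t n r) ≡ Ψ r - Ψ (suc r)) →
    ∀ q → q N.≤ h → sumZ n (λ k → w (toℕ k) * g q (toℕ k)) ≡ Ψ 0 - Ψ q
  φ-g w Ψ e zero _ = trans (ΣZ.sum-0 n (λ k → ZP.*-zeroʳ (w (toℕ k)))) (sym (ZP.+-inverseʳ (Ψ 0)))
  φ-g w Ψ e (suc q) le = trans (ΣZ.sum-cong n (λ k → ZP.*-distribˡ-+ (w (toℕ k)) (g q (toℕ k)) _))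
    (trans (ΣZ.sum-⊕ n _ _) (trans (cong₂ _+_ (φ-g w Ψ e q (NP.<⇒≤ le))
    (trans (sumZ-eqi n w (cls-lt t n le)) (e le))) (lem (Ψ 0) (Ψ q) (Ψ (suc q)))))
    where
    lem : ∀ a b c → (a - b) + (b - c) ≡ a - c
    lem = solve-∀

  φ-Er : ∀ (w Ψ : ℕ → ℤ) → (∀ {r} → r N.< h → w (cls t n r) ≡ Ψ r - Ψ (suc r)) →
    ∀ {p q} → p N.≤ h → q N.≤ h → φ w (Er p q) ≡ Ψ p - Ψ q
  φ-Er w Ψ e {p} {q} hp hq = trans (ΣZ.sum-cong n (λ k → trans (cong (w (toℕ k) *_) (lookup-Er p q k))
      (dist (w (toℕ k)) (g q (toℕ k)) (g p (toℕ k)))))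
    (trans (ΣZ.sum-⊖ n _ _) (trans (cong₂ _-_ (φ-g w Ψ e q hq) (φ-g w Ψ e p hp)) (lem (Ψ 0) (Ψ q) (Ψ p))))
    where
    dist : ∀ a b c → a * (b - c) ≡ a * b - a * c
    dist = solve-∀
    lem : ∀ a b c → (a - b) - (a - c) ≡ c - b
    lem = solve-∀

gA : ∀ n v q k → Model.g A n v q k ≡ lt q k
gA n v zero k = sym (lt-no z≤n)
gA n v (suc q) k = trans (cong (_+ eqi k q) (gA n v q k)) (sym (lt-suc q k))

-- A short simple root labels two steps, k and its mirror h - 1 - k, and each contributes once the
-- path has passed it. The long one labels only the middle step, which gives `gC-long`.
gC : ∀ n v q k → q N.≤ hi C n → suc k N.< n → Model.g C n v q k ≡ lt q k + lt q (hi C n ∸ suc k)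
gC n v zero k _ _ = sym (cong₂ _+_ (lt-no z≤n) (lt-no z≤n))
gC n v (suc q) k le h = trans (cong₂ _+_ (gC n v q k (NP.<⇒≤ le) h) step)
  (trans (lem (lt q k) (lt q (hi C n ∸ suc k)) (eqi k q) (eqi (hi C n ∸ suc k) q))
    (sym (cong₂ _+_ (lt-suc q k) (lt-suc q (hi C n ∸ suc k)))))
  where
  lem : ∀ a b c d → (a + b) + (c + d) ≡ (a + c) + (b + d)
  lem = solve-∀
  sk : suc k N.≤ hi C n
  sk = NP.≤-trans (NP.<⇒≤ h) (n≤hi C n)
  step : eqi k (cls C n q) ≡ eqi k q + eqi (hi C n ∸ suc k) q
  step with q N.<? n
  ... | yes l = trans (cong (eqi k) (cls-id C n l)) (trans (sym (ZP.+-identityʳ _))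
    (cong (_+_ (eqi k q)) (sym (eqi-no (λ e → NP.<⇒≱ l (subst (n N.≤_) e (flip-ge n v h)))))))
  ... | no l = trans (cong (eqi k) (cls-fold n (NP.≮⇒≥ l) le)) (trans (eqi-⇔ f f⁻) (trans (sym (ZP.+-identityˡ _))
    (cong (_+ eqi (hi C n ∸ suc k) q) (sym (eqi-no (λ e → l (subst (N._< n) e (NP.<⇒≤ h))))))))
    where
    f : k ≡ hi C n ∸ suc q → hi C n ∸ suc k ≡ q
    f refl = trans (cong (hi C n ∸_) (sym (NP.+-∸-assoc 1 le))) (NP.m∸[m∸n]≡n (NP.<⇒≤ le))
    f⁻ : hi C n ∸ suc k ≡ q → k ≡ hi C n ∸ suc q
    f⁻ refl = sym (trans (cong (hi C n ∸_) (sym (NP.+-∸-assoc 1 sk))) (NP.m∸[m∸n]≡n (NP.<⇒≤ sk)))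

gC-long : ∀ n v q k → q N.≤ hi C n → suc k ≡ n → Model.g C n v q k ≡ lt q k
gC-long n v zero k _ _ = sym (lt-no z≤n)
gC-long n v (suc q) k le h = trans (cong₂ _+_ (gC-long n v q k (NP.<⇒≤ le) h) step) (sym (lt-suc q k))
  where
  step : eqi k (cls C n q) ≡ eqi k q
  step with q N.<? n
  ... | yes l = cong (eqi k) (cls-id C n l)
  ... | no l = trans (eqi-no λ e → NP.<⇒≢ (flip-lt n (NP.≮⇒≥ l) le) (trans (cong suc (trans (sym (cls-fold n (NP.≮⇒≥ l) le)) (sym e))) h))
    (sym (eqi-no (λ e → l (subst (N._< n) e (NP.≤-reflexive h)))))

g-long : ∀ t n v {i q} → LongIx t n i → q N.≤ hi t n → Model.g t n v q i ≡ lt q i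
g-long A n v {i} {q} _ _ = gA n v q i
g-long C n v l le = gC-long n v _ _ le l

mirL mirR : RType → ℕ → ℕ → ℕ → ℕ
mirL A n p q = p
mirL C n p q = hi C n ∸ q
mirR A n p q = q
mirR C n p q = hi C n ∸ p

module Flip (h : ℕ) where
  fl1 : ∀ {p k} → p N.≤ h → k N.< h ∸ p → p N.≤ h ∸ suc k
  fl1 {p} {k} le l = NP.m+n≤o⇒m≤o∸n p (subst (N._≤ h) (NP.+-comm (suc k) p) (NP.m≤o∸n⇒m+n≤o (suc k) le l))

  fl1⁻ : ∀ {p k} → k N.< h → p N.≤ h ∸ suc k → k N.< h ∸ p
  fl1⁻ {p} {k} k<h l = NP.m+n≤o⇒m≤o∸n (suc k) (subst (N._≤ h) (NP.+-comm p (suc k)) (NP.m≤o∸n⇒m+n≤o p k<h l))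

  fl2 : ∀ {p k} → k N.< h → h ∸ p N.≤ k → h ∸ suc k N.< p
  fl2 k<h l = NP.≰⇒> (λ c → NP.<⇒≱ (fl1⁻ k<h c) l)

  fl3 : ∀ {p k} → h ∸ suc k N.< h ∸ p → p N.≤ k
  fl3 l = NP.≮⇒≥ (λ c → NP.<⇒≱ l (NP.∸-monoʳ-≤ h c))

  fl4 : ∀ {p k} → k N.< h → h ∸ p N.≤ h ∸ suc k → k N.< p
  fl4 k<h l = NP.≰⇒> (λ c → NP.<⇒≱ (NP.∸-monoʳ-< (s≤s c) k<h) l)

  flip≤ : ∀ {p q} → q N.≤ h → p N.≤ h ∸ q → q N.≤ h ∸ p
  flip≤ {p} {q} q≤h l = NP.m+n≤o⇒m≤o∸n q (subst (N._≤ h) (NP.+-comm p q) (NP.m≤o∸n⇒m+n≤o p q≤h l))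

  lt-flip : ∀ {p k} → p N.≤ h → k N.< h → lt (h ∸ p) k ≡ + 1 - lt p (h ∸ suc k)
  lt-flip p≤h k<h = lt-compl (fl1 p≤h) (fl2 k<h)

  lt-flip′ : ∀ {p k} → k N.< h → lt (h ∸ p) (h ∸ suc k) ≡ + 1 - lt p k
  lt-flip′ {p} {k} k<h = lt-compl {h ∸ p} {h ∸ suc k} {p} {k} fl3 (fl4 k<h)

-- The mirror reverses a path while keeping the labels of its steps. In coefficients, the two
-- indicators of a short simple root change places, and the single one of the long root is
-- complemented.
Er-mir : ∀ t n v {p q} → p N.≤ hi t n → q N.≤ hi t n →
  Model.Er t n v (mirL t n p q) (mirR t n p q) ≡ Model.Er t n v p q
Er-mir A n v _ _ = refl
Er-mir C n v {p} {q} hp hq = trans (Er-def _ _) (trans (vecOf-cong n go) (sym (Er-def p q)))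
  where
  open Flip (hi C n)
  open Model C n v using (g; Er-def)
  lem : ∀ a b c d → ((+ 1 - b) + (+ 1 - a)) - ((+ 1 - d) + (+ 1 - c)) ≡ (c + d) - (a + b)
  lem = solve-∀
  lem2 : ∀ a b → (+ 1 - a) - (+ 1 - b) ≡ b - a
  lem2 = solve-∀
  go : ∀ k → k N.< n → g (hi C n ∸ p) k - g (hi C n ∸ q) k ≡ g q k - g p k
  go k k<n with suc k N.≟ n
  ... | no ne = trans (cong₂ _-_ (e p hp) (e q hq)) (trans (lem (lt p k) (lt p k′) (lt q k) (lt q k′))
      (sym (cong₂ _-_ (gC n v q k hq l) (gC n v p k hp l))))
    where
    l : suc k N.< n
    l = NP.≤∧≢⇒< k<n ne
    k′ : ℕ
    k′ = hi C n ∸ suc k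
    k<h : k N.< hi C n
    k<h = NP.≤-trans k<n (n≤hi C n)
    e : ∀ r → r N.≤ hi C n → g (hi C n ∸ r) k ≡ (+ 1 - lt r k′) + (+ 1 - lt r k)
    e r hr = trans (gC n v (hi C n ∸ r) k (NP.m∸n≤m (hi C n) r) l) (cong₂ _+_ (lt-flip hr k<h) (lt-flip′ k<h))
  ... | yes e = trans (cong₂ _-_ (e′ p hp) (e′ q hq)) (trans (lem2 (lt p k) (lt q k))
      (sym (cong₂ _-_ (gC-long n v q k hq e) (gC-long n v p k hp e))))
    where
    self : hi C n ∸ suc k ≡ k
    self = trans (cong (_∸ suc k) (trans (cong (λ m → N.pred m N.+ m) (sym e)) refl)) (NP.m+n∸n≡m k (suc k))
    e′ : ∀ r → r N.≤ hi C n → g (hi C n ∸ r) k ≡ + 1 - lt r k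
    e′ r hr = trans (gC-long n v (hi C n ∸ r) k (NP.m∸n≤m (hi C n) r) e)
      (trans (lt-flip hr (NP.≤-trans k<n (n≤hi C n))) (cong (λ m → + 1 - lt r m) self))

-- The functional y_k takes the value [p < k ≤ q] summed over the cell (p , q) and its mirror image.
ywt : RType → ℕ → ℕ → ℕ → ℤ
ywt A n k m = eqi (suc m) k + eqi (suc m) k
ywt C n k m = eqi (suc m) k + eqi (m N.+ k) (hi C n)

ywt-nonneg : ∀ t n k m → + 0 ≤ ywt t n k m
ywt-nonneg A n k m = ZP.+-mono-≤ (eqi≥0 (suc m) k) (eqi≥0 (suc m) k)
ywt-nonneg C n k m = ZP.+-mono-≤ (eqi≥0 (suc m) k) (eqi≥0 (m N.+ k) (hi C n))

-- The potential of y_k. Since the mirror reverses positions, its contribution enters with the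
-- opposite sign.
Ψy : RType → ℕ → ℕ → ℕ → ℤ
Ψy A n k r = lt k r + lt k r
Ψy C n k r = lt k r - lt k (hi C n ∸ r)

ywt-pot : ∀ t n k {r} → r N.< hi t n → ywt t n k (cls t n r) ≡ Ψy t n k r - Ψy t n k (suc r)
ywt-pot A n k {r} l = trans (cong₂ _+_ (sym (lt-step k r)) (sym (lt-step k r))) (lem (lt k r) (lt k (suc r)))
  where
  lem : ∀ a b → (a - b) + (a - b) ≡ (a + a) - (b + b)
  lem = solve-∀
ywt-pot C n k {r} l = trans step (trans (cong₂ _+_ (sym (lt-step k r)) (trans (cong (λ m → eqi m k) (sym s)) (sym (lt-step k r′))))
    (trans (lem (lt k r) (lt k (suc r)) (lt k r′) (lt k (suc r′))) (cong (λ m → (lt k r - lt k m) - (lt k (suc r) - lt k r′)) s)))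
  where
  H r′ : ℕ
  H = hi C n
  r′ = H ∸ suc r
  s : suc r′ ≡ H ∸ r
  s = sym (NP.+-∸-assoc 1 l)
  lem : ∀ a b c d → (a - b) + (c - d) ≡ (a - d) - (b - c)
  lem = solve-∀
  step : ywt C n k (cls C n r) ≡ eqi (suc r) k + eqi (H ∸ r) k
  step with r N.<? n
  ... | yes c = trans (cong (ywt C n k) (cls-id C n c)) (cong (_+_ (eqi (suc r) k))
    (eqi-⇔ {r N.+ k} {H} (λ e → trans (cong (_∸ r) (sym e)) (NP.m+n∸m≡n r k)) (λ e → trans (cong (r N.+_) (sym e)) (NP.m+[n∸m]≡n (NP.<⇒≤ l)))))
  ... | no c = trans (cong (ywt C n k) (cls-fold n (NP.≮⇒≥ c) l)) (trans (ZP.+-comm (eqi (suc r′) k) _) (cong₂ _+_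
    (eqi-⇔ (λ e → NP.+-cancelˡ-≡ r′ (suc r) k (trans (NP.m∸n+n≡m l) (sym e))) (λ e → trans (cong (r′ N.+_) (sym e)) (NP.m∸n+n≡m l)))
    (cong (λ m → eqi m k) s)))

Ucell : ℕ → ℕ → ℕ → ℤ
Ucell k p q = lt k p - lt k q

-- Picks a representative of each mirror pair: the coordinates of a cell and of its mirror add up to
-- 2h in total, so p + q ≤ h holds for one of them at least, and for both only if p + q = h, when
-- the cell is its own mirror.
Can : RType → ℕ → ℕ → ℕ → Set
Can A n p q = ⊤
Can C n p q = p N.+ q N.≤ hi C n

lt-anti : ∀ k {r r′} → r N.≤ r′ → lt k r′ ≤ lt k r
lt-anti k {r} {r′} le with r′ N.<? k
... | yes l = ZP.≤-reflexive (trans (lt-yes l) (sym (lt-yes (NP.≤-<-trans le l))))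
... | no l with r N.<? k
... | yes m = subst₂ _≤_ (sym (lt-no (NP.≮⇒≥ l))) (sym (lt-yes m)) (Z.+≤+ z≤n)
... | no m = ZP.≤-reflexive (trans (lt-no (NP.≮⇒≥ l)) (sym (lt-no (NP.≮⇒≥ m))))

module Cells (t : RType) (n : ℕ) (valid : ValidRank t n) where
  open Roots t n
  open Model t n valid public

  y : ℕ → Vec ℤ n → ℤ
  y k = φ (ywt t n k)

  y-Ψ : ∀ k {p q} → p N.≤ h → q N.≤ h → y k (Er p q) ≡ Ψy t n k p - Ψy t n k q
  y-Ψ k = φ-Er (ywt t n k) (Ψy t n k) (ywt-pot t n k)

  y-mono : ∀ k u v → u ≼ v → y k u ≤ y k v
  y-mono k u v u≼v = sumZ-mono n (λ m → ZP.*-monoˡ-≤-nonNeg (ywt t n k (toℕ m)) {{Z.nonNegative (ywt-nonneg t n k (toℕ m))}} (u≼v m))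

y-Er : ∀ t n v k {p q} → p N.≤ hi t n → q N.≤ hi t n →
  Cells.y t n v k (Model.Er t n v p q) ≡ Ucell k p q + Ucell k (mirL t n p q) (mirR t n p q)
y-Er A n v k {p} {q} hp hq = trans (Cells.y-Ψ A n v k hp hq) (lem (lt k p) (lt k q))
  where
  lem : ∀ a b → (a + a) - (b + b) ≡ (a - b) + (a - b)
  lem = solve-∀
y-Er C n v k {p} {q} hp hq = trans (Cells.y-Ψ C n v k hp hq) (lem (lt k p) (lt k (hi C n ∸ p)) (lt k q) (lt k (hi C n ∸ q)))
  where
  lem : ∀ a a′ b b′ → (a - a′) - (b - b′) ≡ (a - b) + (b′ - a′)
  lem = solve-∀

Ucell-yes : ∀ {k p q} → p N.< k → k N.≤ q → Ucell k p q ≡ + 1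
Ucell-yes l m = cong₂ _-_ (lt-yes l) (lt-no m)

Ucell-no₁ : ∀ {k p q} → p N.≤ q → k N.≤ p → Ucell k p q ≡ + 0
Ucell-no₁ le l = cong₂ _-_ (lt-no l) (lt-no (NP.≤-trans l le))

Ucell-no₂ : ∀ {k p q} → p N.≤ q → q N.< k → Ucell k p q ≡ + 0
Ucell-no₂ le l = cong₂ _-_ (lt-yes (NP.≤-<-trans le l)) (lt-yes l)

Ucell≥0 : ∀ k {p q} → p N.≤ q → + 0 ≤ Ucell k p q
Ucell≥0 k le = ZP.i≤j⇒0≤j-i (lt-anti k le)

mir≤ : ∀ t n {p q} → p N.≤ q → mirL t n p q N.≤ mirR t n p q
mir≤ A n l = l
mir≤ C n l = NP.∸-monoʳ-≤ (hi C n) l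

1≰0 : ¬ (+ 1 ≤ + 0)
1≰0 (Z.+≤+ ())

opaque
  -- The y_k have nonnegative weights and are monotone for the root order, so it suffices to test
  -- two values of k. At k = p + 1 the smaller root has value at least 1, whereas a cell with p < p′
  -- and its mirror, which starts no earlier, give 0. At k = q the mirror terms need not vanish in
  -- type C, but if q′ < q the mirror of (p , q) contributes at least as much as that of (p′ , q′).
  dominance : ∀ t n v {p q p′ q′} → p N.< q → q N.≤ hi t n → Can t n p q →
    p′ N.< q′ → q′ N.≤ hi t n → Can t n p′ q′ →
    Roots._≼_ t n (Model.Er t n v p q) (Model.Er t n v p′ q′) → p′ N.≤ p × q N.≤ q′
  dominance t n v {p} {q} {p′} {q′} l m c l′ m′ c′ dom = p′≤p , NP.≮⇒≥ (second t v c c′ (ymono v dom) p′≤p m m′)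
    where
    ymono : ∀ v → Roots._≼_ t n (Model.Er t n v p q) (Model.Er t n v p′ q′) → ∀ k →
      Ucell k p q + Ucell k (mirL t n p q) (mirR t n p q) ≤ Ucell k p′ q′ + Ucell k (mirL t n p′ q′) (mirR t n p′ q′)
    ymono v dom k = subst₂ _≤_ (y-Er t n v k (NP.≤-trans (NP.<⇒≤ l) m) m) (y-Er t n v k (NP.≤-trans (NP.<⇒≤ l′) m′) m′) (Cells.y-mono t n v k (Model.Er t n v p q) (Model.Er t n v p′ q′) dom)
    ge1 : ∀ {a b} → a ≡ + 1 → + 0 ≤ b → + 1 ≤ a + b
    ge1 refl h = ZP.+-monoʳ-≤ (+ 1) h
    p≤mirL : ∀ t → Can t n p′ q′ → q′ N.≤ hi t n → p′ N.≤ mirL t n p′ q′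
    p≤mirL A _ _ = NP.≤-refl
    p≤mirL C c _ = NP.m+n≤o⇒m≤o∸n p′ c
    p′≤p : p′ N.≤ p
    p′≤p = NP.≮⇒≥ (λ p<p′ → 1≰0 (ZP.≤-trans (ge1 (Ucell-yes {suc p} NP.≤-refl l) (Ucell≥0 (suc p) (mir≤ t n (NP.<⇒≤ l))))
      (ZP.≤-trans (ymono v dom (suc p)) (ZP.≤-reflexive (cong₂ _+_ (Ucell-no₁ (NP.<⇒≤ l′) p<p′)
        (Ucell-no₁ (mir≤ t n (NP.<⇒≤ l′)) (NP.≤-trans p<p′ (p≤mirL t c′ m′))))))))
    second : ∀ t (v : ValidRank t n) → Can t n p q → Can t n p′ q′ →
      (∀ k → Ucell k p q + Ucell k (mirL t n p q) (mirR t n p q) ≤ Ucell k p′ q′ + Ucell k (mirL t n p′ q′) (mirR t n p′ q′)) →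
      p′ N.≤ p → q N.≤ hi t n → q′ N.≤ hi t n → ¬ (q′ N.< q)
    second A v c c′ ym _ m m′ q′<q = 1≰0 (ZP.≤-trans (ge1 (Ucell-yes {q} l NP.≤-refl) (Ucell≥0 q (NP.<⇒≤ l)))
      (ZP.≤-trans (ym q) (ZP.≤-reflexive (cong₂ _+_ (Ucell-no₂ (NP.<⇒≤ l′) q′<q) (Ucell-no₂ (NP.<⇒≤ l′) q′<q)))))
    second C v c c′ ym p′≤p m m′ q′<q = 1≰0 (≤-by₂
      (subst₂ _≤_ (cong₂ _+_ (Ucell-yes {q} l NP.≤-refl) (cong (λ z → lt q (H ∸ q) - z) (lt-no q≤)))
        (cong₂ _+_ (Ucell-no₂ {q} (NP.<⇒≤ l′) q′<q) (cong (λ z → lt q (H ∸ q′) - z) (lt-no (NP.≤-trans q≤ (NP.∸-monoʳ-≤ H p′≤p))))) (ym q))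
      (lt-anti q (NP.∸-monoʳ-≤ H (NP.<⇒≤ q′<q)))
      (lem (lt q (H ∸ q)) (lt q (H ∸ q′))))
      where
      H : ℕ
      H = hi C n
      q≤ : q N.≤ H ∸ p
      q≤ = NP.m+n≤o⇒m≤o∸n q (subst (N._≤ H) (NP.+-comm p q) c)
      lem : ∀ a b → ((+ 0 + (b - + 0)) - (+ 1 + (a - + 0))) + (a - b) ≡ + 0 - + 1
      lem = solve-∀

-- The list of positive roots: its entries are the cells, without repetition

∈-if⁻ : ∀ {X : Set} {b} {xs : List X} {v} → v ∈L (if b then xs else []) → T b × v ∈L xs
∈-if⁻ {b = true} m = tt , m

∈-if⁺ : ∀ {X : Set} {b} {xs : List X} {v} → T b → v ∈L xs → v ∈L (if b then xs else [])
∈-if⁺ {b = true} _ m = m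

unique-if : ∀ {X : Set} b {xs : List X} → Unique xs → Unique (if b then xs else [])
unique-if true u = u
unique-if false u = []

unique-concatMap : ∀ {X Y : Set} (f : X → List Y) {xs} → Unique xs → (∀ x → Unique (f x)) →
  (∀ x x′ {y} → y ∈L f x → y ∈L f x′ → x ≡ x′) → Unique (concatMap f xs)
unique-concatMap f {xs} u uf d = UP.concat⁺ (AllP.map⁺ (All.universal uf xs))
  (APP.map⁺ (AP.map disjoint u))
  where
  disjoint : ∀ {x x′} → x ≢ x′ → Disjoint (f x) (f x′)
  disjoint {x} {x′} ne (m , m′) = ne (d x x′ m m′)

lookup-unique : ∀ {X : Set} {xs : List X} → Unique xs → ∀ i j → L.lookup xs i ≡ L.lookup xs j → i ≡ j
lookup-unique (a ∷ u) F.zero F.zero e = refl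
lookup-unique {xs = x ∷ xs} (a ∷ u) F.zero (F.suc j) e = ⊥-elim (All.lookup a (LM.∈-lookup j) e)
lookup-unique {xs = x ∷ xs} (a ∷ u) (F.suc i) F.zero e = ⊥-elim (All.lookup a (LM.∈-lookup i) (sym e))
lookup-unique (a ∷ u) (F.suc i) (F.suc j) e = cong F.suc (lookup-unique u i j e)

∈-concatMap-allFin⁻ : ∀ {Y : Set} {n} (f : Fin n → List Y) {y} → y ∈L concatMap f (allFin n) → ∃ λ i → y ∈L f i
∈-concatMap-allFin⁻ {n = n} f m with find (LM.∈-concatMap⁻ f {xs = allFin n} m)
... | i , _ , r = i , r

∈-concatMap-allFin⁺ : ∀ {Y : Set} {n} (f : Fin n → List Y) {y} i → y ∈L f i → y ∈L concatMap f (allFin n)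
∈-concatMap-allFin⁺ {n = n} f i m = LM.∈-concatMap⁺ f {xs = allFin n} (lose (LM.∈-allFin i) m)

opaque
  Er-inj : ∀ t n v {p q p′ q′} → p N.< q → q N.≤ hi t n → Can t n p q →
    p′ N.< q′ → q′ N.≤ hi t n → Can t n p′ q′ →
    Model.Er t n v p q ≡ Model.Er t n v p′ q′ → p ≡ p′ × q ≡ q′
  Er-inj t n v l m c l′ m′ c′ e with dominance t n v l m c l′ m′ c′ (λ k → ZP.≤-reflexive (cong (λ u → lookup u k) e))
    | dominance t n v l′ m′ c′ l m c (λ k → ZP.≤-reflexive (cong (λ u → lookup u k) (sym e)))
  ... | a , b | a′ , b′ = NP.≤-antisym a′ a , NP.≤-antisym b b′

ind-∧-≤ : ∀ {i j} k → i N.≤ j → ind ((i ≤ᵇ k) ∧ (k ≤ᵇ j)) ≡ lt (suc j) k - lt i k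
ind-∧-≤ {i} {j} k le with i N.≤? k | k N.≤? j
... | yes a | yes b = trans (cong₂ (λ x y → ind (x ∧ y)) (T-true (NP.≤⇒≤ᵇ a)) (T-true (NP.≤⇒≤ᵇ b)))
  (sym (cong₂ _-_ (lt-yes (s≤s b)) (lt-no a)))
... | yes a | no b = trans (cong₂ (λ x y → ind (x ∧ y)) (T-true (NP.≤⇒≤ᵇ a)) (T-false (λ c → b (NP.≤ᵇ⇒≤ k j c))))
  (sym (cong₂ _-_ (lt-no (NP.≰⇒> b)) (lt-no a)))
... | no a | _ = trans (cong (λ x → ind (x ∧ (k ≤ᵇ j))) (T-false (λ c → a (NP.≤ᵇ⇒≤ i k c))))
  (sym (cong₂ _-_ (lt-yes (s≤s (NP.<⇒≤ (NP.<-≤-trans (NP.≰⇒> a) le)))) (lt-yes (NP.≰⇒> a))))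

ind-∧-< : ∀ {i j} k → i N.≤ j → ind ((i ≤ᵇ k) ∧ (k <ᵇ j)) ≡ lt j k - lt i k
ind-∧-< {i} {j} k le with i N.≤? k | k N.<? j
... | yes a | yes b = trans (cong₂ (λ x y → ind (x ∧ y)) (T-true (NP.≤⇒≤ᵇ a)) (T-true (NP.<⇒<ᵇ b)))
  (sym (cong₂ _-_ (lt-yes b) (lt-no a)))
... | yes a | no b = trans (cong₂ (λ x y → ind (x ∧ y)) (T-true (NP.≤⇒≤ᵇ a)) (T-false (λ c → b (NP.<ᵇ⇒< k j c))))
  (sym (cong₂ _-_ (lt-no (NP.≮⇒≥ b)) (lt-no a)))
... | no a | _ = trans (cong (λ x → ind (x ∧ (k <ᵇ j))) (T-false (λ c → a (NP.≤ᵇ⇒≤ i k c))))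
  (sym (cong₂ _-_ (lt-yes (NP.<-≤-trans (NP.≰⇒> a) le)) (lt-yes (NP.≰⇒> a))))

module RootsA (n : ℕ) (v : ValidRank A n) where
  open Model A n v using (Er; Er-def)

  coefA≡ : ∀ {i j} → i N.≤ j → vecOf n (coefA i j) ≡ Er i (suc j)
  coefA≡ {i} {j} le = trans (vecOf-cong n {coefA i j} {λ k → Model.g A n v (suc j) k - Model.g A n v i k} (λ k _ → trans (ind-∧-≤ k le) (sym (cong₂ _-_ (gA n v (suc j) k) (gA n v i k))))) (sym (Er-def i (suc j)))

  block : Fin n → Fin n → List (Vec ℤ n)
  block i j = if toℕ i ≤ᵇ toℕ j then vecOf n (coefA (toℕ i) (toℕ j)) ∷ [] else []

  row : Fin n → List (Vec ℤ n)
  row i = concatMap (block i) (allFin n)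

  block⁻ : ∀ i j {u} → u ∈L block i j → toℕ i N.≤ toℕ j × u ≡ Er (toℕ i) (suc (toℕ j))
  block⁻ i j m with ∈-if⁻ {b = toℕ i ≤ᵇ toℕ j} m
  ... | b , here e = NP.≤ᵇ⇒≤ (toℕ i) (toℕ j) b , trans e (coefA≡ {toℕ i} {toℕ j} (NP.≤ᵇ⇒≤ (toℕ i) (toℕ j) b))

  row⁻ : ∀ i {u} → u ∈L row i → ∃ λ j → toℕ i N.≤ toℕ j × u ≡ Er (toℕ i) (suc (toℕ j))
  row⁻ i m with ∈-concatMap-allFin⁻ {n = n} (block i) m
  ... | j , m′ = j , block⁻ i j m′

  inj : ∀ (i j i′ j′ : Fin n) {u} → toℕ i N.≤ toℕ j × u ≡ Er (toℕ i) (suc (toℕ j)) →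
    toℕ i′ N.≤ toℕ j′ × u ≡ Er (toℕ i′) (suc (toℕ j′)) → i ≡ i′ × j ≡ j′
  inj i j i′ j′ (l , e) (l′ , e′) with Er-inj A n v (s≤s l) (FP.toℕ<n j) tt (s≤s l′) (FP.toℕ<n j′) tt (trans (sym e) e′)
  ... | a , b = FP.toℕ-injective a , FP.toℕ-injective (NP.suc-injective b)

  unique : Unique (posRoots A n)
  unique = unique-concatMap row (UP.allFin⁺ n)
    (λ i → unique-concatMap (block i) (UP.allFin⁺ n) (λ j → unique-if (toℕ i ≤ᵇ toℕ j) ([] ∷ []))
      (λ j j′ m m′ → proj₂ (inj i j i j′ (block⁻ i j m) (block⁻ i j′ m′))))
    (λ i i′ m m′ → proj₁ (inj i (proj₁ (row⁻ i m)) i′ (proj₁ (row⁻ i′ m′)) (proj₂ (row⁻ i m)) (proj₂ (row⁻ i′ m′))))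

  cell : ∀ {u} → u ∈L posRoots A n → ∃₂ λ p q → p N.< q × q N.≤ n × u ≡ Er p q
  cell m with ∈-concatMap-allFin⁻ {n = n} row m
  ... | i , m′ with row⁻ i m′
  ... | j , l , e = toℕ i , suc (toℕ j) , s≤s l , FP.toℕ<n j , e

  mem : ∀ {p q} → p N.< q → q N.≤ n → Er p q ∈L posRoots A n
  mem {p} {suc q} (s≤s l) m = ∈-concatMap-allFin⁺ row i (∈-concatMap-allFin⁺ (block i) j
    (∈-if⁺ (NP.≤⇒≤ᵇ (subst₂ N._≤_ (sym ei) (sym ej) l)) (here (trans (sym (coefA≡ {p} {q} l)) (cong₂ (λ a b → vecOf n (coefA a b)) (sym ei) (sym ej))))))
    where
    i j : Fin n
    i = fromℕ< (NP.≤-<-trans l m)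
    j = fromℕ< m
    ei : toℕ i ≡ p
    ei = FP.toℕ-fromℕ< (NP.≤-<-trans l m)
    ej : toℕ j ≡ q
    ej = FP.toℕ-fromℕ< m


module CoeffsC (n : ℕ) (v : ValidRank C n) where
  open Model C n v using (Er; Er-def; g)
  open Flip (hi C n)

  H : ℕ
  H = hi C n

  self : ∀ {k} → suc k ≡ n → H ∸ suc k ≡ k
  self {k} e = trans (cong (_∸ suc k) (trans (cong (λ m → N.pred m N.+ m) (sym e)) refl)) (NP.m+n∸n≡m k (suc k))

  n≤flip : ∀ {b} → b N.< n → n N.≤ H ∸ b
  n≤flip {b} l = NP.m+n≤o⇒m≤o∸n n (NP.≤-pred (subst (suc (n N.+ b) N.≤_) (sym (hiC n v)) (NP.+-monoʳ-< n l)))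

  lt-high : ∀ {k q} → k N.< n → n N.≤ q → lt q k ≡ + 1
  lt-high l m = lt-yes (NP.<-≤-trans l m)

  minus≡ : ∀ {a b} → a N.< b → b N.< n → vecOf n (coefCminus a b) ≡ Er a b
  minus≡ {a} {b} l m = trans (vecOf-cong n {coefCminus a b} {λ k → g b k - g a k} (λ k k<n → trans (ind-∧-< k (NP.<⇒≤ l)) (go k k<n))) (sym (Er-def a b))
    where
    bH : b N.≤ H
    bH = NP.≤-trans (NP.<⇒≤ m) (n≤hi C n)
    go : ∀ k → k N.< n → lt (b) k - lt a k ≡ g (b) k - g a k
    go k k<n with suc k N.≟ n
    ... | yes e = sym (cong₂ _-_ (gC-long n v (b) k bH e) (gC-long n v a k (NP.≤-trans (NP.<⇒≤ l) bH) e))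
    ... | no ne = trans (lem (lt (b) k) (lt a k)) (sym (cong₂ _-_
        (trans (gC n v (b) k bH k+1<n) (cong (_+_ (lt (b) k)) (lt-no (NP.≤-trans (NP.<⇒≤ m) (flip-ge n v k+1<n)))))
        (trans (gC n v a k (NP.≤-trans (NP.<⇒≤ l) bH) k+1<n) (cong (_+_ (lt a k)) (lt-no (NP.≤-trans (NP.<⇒≤ l) (NP.≤-trans (NP.<⇒≤ m) (flip-ge n v k+1<n))))))))
      where
      k+1<n : suc k N.< n
      k+1<n = NP.≤∧≢⇒< k<n ne
      lem : ∀ a b → a - b ≡ (a + + 0) - (b + + 0)
      lem = solve-∀

  -- the common coefficients of ε_a + ε_b (a < b) and 2ε_a (a = b)
  Er-flip : ∀ {a b} → a N.≤ b → b N.< n → ∀ {k} → k N.< n →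
    (suc k ≡ n → g (H ∸ b) k - g a k ≡ + 1) ×
    (suc k N.< n → g (H ∸ b) k - g a k ≡ (+ 1 - lt a k) + (+ 1 - lt b k))
  Er-flip {a} {b} l m {k} k<n =
    (λ e → trans (cong₂ _-_ (gC-long n v (H ∸ b) k (NP.m∸n≤m H b) e) (gC-long n v a k aH e))
      (cong₂ _-_ (lt-high k<n (n≤flip m)) (lt-no (NP.≤-pred (subst (a N.<_) (sym e) (NP.≤-<-trans l m)))))) ,
    (λ k+1<n → trans (cong₂ _-_ (trans (gC n v (H ∸ b) k (NP.m∸n≤m H b) k+1<n)
        (cong₂ _+_ (lt-high k<n (n≤flip m)) (lt-flip′ {b} {k} (NP.<-≤-trans k<n (n≤hi C n)))))
      (trans (gC n v a k aH k+1<n) (cong (_+_ (lt a k)) (lt-no (NP.≤-trans (NP.<⇒≤ (NP.≤-<-trans l m)) (flip-ge n v k+1<n))))))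
      (lem (lt a k) (lt b k)))
    where
    aH : a N.≤ H
    aH = NP.≤-trans l (NP.≤-trans (NP.<⇒≤ m) (n≤hi C n))
    lem : ∀ x y → (+ 1 + (+ 1 - y)) - (x + + 0) ≡ (+ 1 - x) + (+ 1 - y)
    lem = solve-∀

  C2≡ : ∀ {a} → a N.< n → vecOf n (coefC2 n a) ≡ Er a (H ∸ a)
  C2≡ {a} m = trans (vecOf-cong n {coefC2 n a} {λ k → g (H ∸ a) k - g a k} go) (sym (Er-def a (H ∸ a)))
    where
    go : ∀ k → k N.< n → coefC2 n a k ≡ g (H ∸ a) k - g a k
    go k k<n with suc k N.≟ n
    ... | yes e = trans (trans (if-false {b = (a ≤ᵇ k) ∧ (suc k <ᵇ n)} (λ c → NP.<⇒≢ (NP.<ᵇ⇒< (suc k) n (∧ʳ (a ≤ᵇ k) c)) e)) (if-true (NP.≡⇒≡ᵇ (suc k) n e))) (sym (proj₁ (Er-flip NP.≤-refl m k<n) e))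
      where
      ∧ʳ : ∀ x {y} → T (x ∧ y) → T y
      ∧ʳ true t = t
    ... | no ne with a N.≤? k
    ... | yes le = trans (cong₂ (λ x y → if x ∧ y then + 2 else (if suc k ≡ᵇ n then + 1 else + 0)) (T-true (NP.≤⇒≤ᵇ le)) (T-true (NP.<⇒<ᵇ (NP.≤∧≢⇒< k<n ne))))
       (sym (trans (proj₂ (Er-flip NP.≤-refl m k<n) (NP.≤∧≢⇒< k<n ne)) (cong₂ (λ x y → (+ 1 - x) + (+ 1 - y)) (lt-no le) (lt-no le))))
    ... | no gt = trans (cong (λ x → if x ∧ (suc k <ᵇ n) then + 2 else (if suc k ≡ᵇ n then + 1 else + 0)) (T-false (λ c → gt (NP.≤ᵇ⇒≤ a k c))))
       (trans (if-false (λ c → ne (NP.≡ᵇ⇒≡ (suc k) n c))) (sym (trans (proj₂ (Er-flip NP.≤-refl m k<n) (NP.≤∧≢⇒< k<n ne)) (cong₂ (λ x y → (+ 1 - x) + (+ 1 - y)) (lt-yes (NP.≰⇒> gt)) (lt-yes (NP.≰⇒> gt))))))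

  plus≡ : ∀ {a b} → a N.< b → b N.< n → vecOf n (coefCplus n a b) ≡ Er a (H ∸ b)
  plus≡ {a} {b} l m = trans (vecOf-cong n {coefCplus n a b} {λ k → g (H ∸ b) k - g a k} go) (sym (Er-def a (H ∸ b)))
    where
    go : ∀ k → k N.< n → coefCplus n a b k ≡ g (H ∸ b) k - g a k
    go k k<n with a N.≤? k | k N.<? b
    ... | no a≰k | _ = trans (cong (λ x → if x ∧ (k <ᵇ b) then + 1 else rest) (T-false (λ c → a≰k (NP.≤ᵇ⇒≤ a k c))))
         (trans (cong (λ x → if x ∧ (suc k <ᵇ n) then + 2 else last) (T-false {b ≤ᵇ k} (λ c → a≰k (NP.≤-trans (NP.<⇒≤ l) (NP.≤ᵇ⇒≤ b k c)))))
         (trans (if-false (λ c → NP.<⇒≢ k+1<n (NP.≡ᵇ⇒≡ (suc k) n c)))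
         (sym (trans (proj₂ (Er-flip (NP.<⇒≤ l) m k<n) k+1<n) (cong₂ (λ x y → (+ 1 - x) + (+ 1 - y)) (lt-yes (NP.≰⇒> a≰k)) (lt-yes (NP.<-trans (NP.≰⇒> a≰k) l)))))))
       where
       last rest : ℤ
       last = if suc k ≡ᵇ n then + 1 else + 0
       rest = if (b ≤ᵇ k) ∧ (suc k <ᵇ n) then + 2 else last
       k+1<n : suc k N.< n
       k+1<n = NP.≤-<-trans (NP.≰⇒> a≰k) (NP.<-trans l m)
    ... | yes a≤k | yes k<b = trans (cong₂ (λ x y → if x ∧ y then + 1 else (if (b ≤ᵇ k) ∧ (suc k <ᵇ n) then + 2 else (if suc k ≡ᵇ n then + 1 else + 0))) (T-true (NP.≤⇒≤ᵇ a≤k)) (T-true (NP.<⇒<ᵇ k<b)))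
         (sym (trans (proj₂ (Er-flip (NP.<⇒≤ l) m k<n) (NP.≤-<-trans k<b m)) (cong₂ (λ x y → (+ 1 - x) + (+ 1 - y)) (lt-no a≤k) (lt-yes k<b))))
    ... | yes a≤k | no k≮b = trans (cong₂ (λ x y → if x ∧ y then + 1 else (if (b ≤ᵇ k) ∧ (suc k <ᵇ n) then + 2 else (if suc k ≡ᵇ n then + 1 else + 0))) (T-true (NP.≤⇒≤ᵇ a≤k)) (T-false (λ c → k≮b (NP.<ᵇ⇒< k b c))))
         (trans (cong (λ x → if x ∧ (suc k <ᵇ n) then + 2 else (if suc k ≡ᵇ n then + 1 else + 0)) (T-true (NP.≤⇒≤ᵇ (NP.≮⇒≥ k≮b)))) fin)
       where
       fin : (if suc k <ᵇ n then + 2 else (if suc k ≡ᵇ n then + 1 else + 0)) ≡ g (H ∸ b) k - g a k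
       fin with suc k N.≟ n
       ... | yes e = trans (if-false {b = suc k <ᵇ n} (λ c → NP.<⇒≢ (NP.<ᵇ⇒< (suc k) n c) e)) (trans (if-true (NP.≡⇒≡ᵇ (suc k) n e)) (sym (proj₁ (Er-flip (NP.<⇒≤ l) m k<n) e)))
       ... | no ne = trans (if-true (NP.<⇒<ᵇ (NP.≤∧≢⇒< k<n ne))) (sym (trans (proj₂ (Er-flip (NP.<⇒≤ l) m k<n) (NP.≤∧≢⇒< k<n ne)) (cong₂ (λ x y → (+ 1 - x) + (+ 1 - y)) (lt-no a≤k) (lt-no (NP.≮⇒≥ k≮b)))))


module RootsC (n : ℕ) (v : ValidRank C n) where
  open Model C n v using (Er)
  open CoeffsC n v

  block : Fin n → Fin n → List (Vec ℤ n)
  block a b = if toℕ a <ᵇ toℕ b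
    then vecOf n (coefCminus (toℕ a) (toℕ b)) ∷ vecOf n (coefCplus n (toℕ a) (toℕ b)) ∷ [] else []

  row : Fin n → List (Vec ℤ n)
  row a = concatMap (block a) (allFin n)

  IsBlock : Fin n → Fin n → Vec ℤ n → Set
  IsBlock a b u = toℕ a N.< toℕ b × ∃ λ q → (q ≡ toℕ b ⊎ q ≡ H ∸ toℕ b) × u ≡ Er (toℕ a) q

  block⁻ : ∀ a b {u} → u ∈L block a b → IsBlock a b u
  block⁻ a b m with ∈-if⁻ {b = toℕ a <ᵇ toℕ b} m
  ... | c , here e = l , toℕ b , inj₁ refl , trans e (minus≡ {toℕ a} {toℕ b} l (FP.toℕ<n b))
    where
    l : toℕ a N.< toℕ b
    l = NP.<ᵇ⇒< (toℕ a) (toℕ b) c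
  ... | c , there (here e) = l , H ∸ toℕ b , inj₂ refl , trans e (plus≡ {toℕ a} {toℕ b} l (FP.toℕ<n b))
    where
    l : toℕ a N.< toℕ b
    l = NP.<ᵇ⇒< (toℕ a) (toℕ b) c

  row⁻ : ∀ a {u} → u ∈L row a → ∃ λ b → IsBlock a b u
  row⁻ a m with ∈-concatMap-allFin⁻ {n = n} (block a) m
  ... | b , m′ = b , block⁻ a b m′

  data Canon (a : ℕ) (u : Vec ℤ n) : Set where
    canon : ∀ q → a N.< q → q N.≤ H → a N.+ q N.≤ H → u ≡ Er a q → Canon a u

  can-flip : ∀ {a b} → a N.≤ b → b N.< n → a N.+ (H ∸ b) N.≤ H
  can-flip {a} {b} l m = NP.≤-trans (NP.+-monoˡ-≤ (H ∸ b) l) (NP.≤-reflexive (NP.m+[n∸m]≡n (NP.≤-trans (NP.<⇒≤ m) (n≤hi C n))))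

  can-low : ∀ {a b} → a N.< b → b N.< n → a N.+ b N.≤ H
  can-low {a} {b} l m = NP.≤-pred (subst (suc (a N.+ b) N.≤_) (sym (hiC n v)) (NP.+-mono-≤ (NP.≤-trans l (NP.<⇒≤ m)) (NP.<⇒≤ m)))

  end : ∀ {a u} → Canon a u → ℕ
  end (canon q _ _ _ _) = q

  canonB : ∀ {a b u} → IsBlock a b u → Σ (Canon (toℕ a) u) λ c → end c ≡ toℕ b ⊎ end c ≡ H ∸ toℕ b
  canonB {a} {b} (l , q , inj₁ e , r) = canon q (subst (toℕ a N.<_) (sym e) l) (subst (N._≤ H) (sym e) (NP.≤-trans (NP.<⇒≤ (FP.toℕ<n b)) (n≤hi C n)))
    (subst (λ z → toℕ a N.+ z N.≤ H) (sym e) (can-low l (FP.toℕ<n b))) r , inj₁ e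
  canonB {a} {b} (l , q , inj₂ e , r) = canon q (subst (toℕ a N.<_) (sym e) (NP.<-≤-trans (FP.toℕ<n a) (n≤flip (FP.toℕ<n b)))) (subst (N._≤ H) (sym e) (NP.m∸n≤m H (toℕ b)))
    (subst (λ z → toℕ a N.+ z N.≤ H) (sym e) (can-flip (NP.<⇒≤ l) (FP.toℕ<n b))) r , inj₂ e

  flip-inj : ∀ {b b′} → b N.< n → b′ N.< n → ∀ {q} → q ≡ b ⊎ q ≡ H ∸ b → q ≡ b′ ⊎ q ≡ H ∸ b′ → b ≡ b′
  flip-inj l l′ (inj₁ e) (inj₁ e′) = trans (sym e) e′
  flip-inj l l′ (inj₁ e) (inj₂ e′) = ⊥-elim (NP.<⇒≱ l (subst (n N.≤_) (trans (sym e′) e) (n≤flip l′)))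
  flip-inj l l′ (inj₂ e) (inj₁ e′) = ⊥-elim (NP.<⇒≱ l′ (subst (n N.≤_) (trans (sym e) e′) (n≤flip l)))
  flip-inj l l′ (inj₂ e) (inj₂ e′) = NP.∸-cancelˡ-≡ (NP.≤-trans (NP.<⇒≤ l) (n≤hi C n)) (NP.≤-trans (NP.<⇒≤ l′) (n≤hi C n)) (trans (sym e) e′)

  inj : ∀ a b a′ b′ {u} → IsBlock a b u → IsBlock a′ b′ u → a ≡ a′ × b ≡ b′
  inj a b a′ b′ i i′ with canonB {a} {b} i | canonB {a′} {b′} i′
  ... | canon q l m c e , z | canon q′ l′ m′ c′ e′ , z′ with Er-inj C n v l m c l′ m′ c′ (trans (sym e) e′)
  ... | ea , eq = FP.toℕ-injective ea , FP.toℕ-injective (flip-inj (FP.toℕ<n b) (FP.toℕ<n b′) z (subst (λ x → x ≡ toℕ b′ ⊎ x ≡ H ∸ toℕ b′) (sym eq) z′))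

  a<flip : ∀ {a} → a N.< n → a N.< H ∸ a
  a<flip m = NP.<-≤-trans m (n≤flip m)

  C2-inj : ∀ (a a′ : Fin n) → vecOf n (coefC2 n (toℕ a)) ≡ vecOf n (coefC2 n (toℕ a′)) → a ≡ a′
  C2-inj a a′ e = FP.toℕ-injective (proj₁ (Er-inj C n v (a<flip (FP.toℕ<n a)) (NP.m∸n≤m H (toℕ a)) (can-flip NP.≤-refl (FP.toℕ<n a))
    (a<flip (FP.toℕ<n a′)) (NP.m∸n≤m H (toℕ a′)) (can-flip NP.≤-refl (FP.toℕ<n a′))
    (trans (sym (C2≡ (FP.toℕ<n a))) (trans e (C2≡ (FP.toℕ<n a′))))))

  block-unique : (a b : Fin n) → Unique (block a b)
  block-unique a b with toℕ a <ᵇ toℕ b in eq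
  ... | false = []
  ... | true = ((λ e → NP.<⇒≢ (NP.<-≤-trans (FP.toℕ<n b) (n≤flip (FP.toℕ<n b)))
      (proj₂ (Er-inj C n v l (NP.≤-trans (NP.<⇒≤ (FP.toℕ<n b)) (n≤hi C n)) (can-low l (FP.toℕ<n b))
        (NP.<-≤-trans (FP.toℕ<n a) (n≤flip (FP.toℕ<n b))) (NP.m∸n≤m H (toℕ b)) (can-flip (NP.<⇒≤ l) (FP.toℕ<n b))
        (trans (sym (minus≡ {toℕ a} {toℕ b} l (FP.toℕ<n b))) (trans e (plus≡ {toℕ a} {toℕ b} l (FP.toℕ<n b))))))) ∷ []) ∷ [] ∷ []
    where
    l : toℕ a N.< toℕ b
    l = NP.<ᵇ⇒< (toℕ a) (toℕ b) (subst T (sym eq) tt)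

  unique : Unique (posRoots C n)
  unique = UP.++⁺ (unique-concatMap row (UP.allFin⁺ n)
      (λ a → unique-concatMap (block a) (UP.allFin⁺ n) (block-unique a)
        (λ b b′ m m′ → proj₂ (inj a b a b′ (block⁻ a b m) (block⁻ a b′ m′))))
      (λ a a′ m m′ → proj₁ (inj a (proj₁ (row⁻ a m)) a′ (proj₁ (row⁻ a′ m′)) (proj₂ (row⁻ a m)) (proj₂ (row⁻ a′ m′)))))
    (UP.map⁺ (λ {a} {a′} → C2-inj a a′) (UP.allFin⁺ n))
    disjoint
    where
    disjoint : ∀ {u} → ¬ (u ∈L concatMap row (allFin n) × u ∈L L.map (λ a → vecOf n (coefC2 n (toℕ a))) (allFin n))
    disjoint (m , m′) with ∈-concatMap-allFin⁻ {n = n} row m | LM.∈-map⁻ (λ a → vecOf n (coefC2 n (toℕ a))) {xs = allFin n} m′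
    ... | a , r | c , _ , e′ with row⁻ a r
    ... | b , ib with canonB {a} {b} ib
    ... | canon q l k x e , z with Er-inj C n v l k x (a<flip (FP.toℕ<n c)) (NP.m∸n≤m H (toℕ c)) (can-flip NP.≤-refl (FP.toℕ<n c)) (trans (sym e) (trans e′ (C2≡ (FP.toℕ<n c))))
    ... | ea , eq = NP.<⇒≢ (proj₁ ib) (trans ea (sym (flip-inj (FP.toℕ<n b) (FP.toℕ<n c) z (inj₂ eq))))

  cell : ∀ {u} → u ∈L posRoots C n → ∃ λ a → Canon a u
  cell m with LM.∈-++⁻ (concatMap row (allFin n)) m
  ... | inj₁ m′ with ∈-concatMap-allFin⁻ {n = n} row m′
  ... | a , r with row⁻ a r
  ... | b , ib = toℕ a , proj₁ (canonB {a} {b} ib)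
  cell m | inj₂ m′ with LM.∈-map⁻ (λ a → vecOf n (coefC2 n (toℕ a))) {xs = allFin n} m′
  ... | c , _ , e′ = toℕ c , canon (H ∸ toℕ c) (a<flip (FP.toℕ<n c)) (NP.m∸n≤m H (toℕ c)) (can-flip NP.≤-refl (FP.toℕ<n c)) (trans e′ (C2≡ (FP.toℕ<n c)))

  mem-canon : ∀ {p q} → p N.< q → q N.≤ H → p N.+ q N.≤ H → Er p q ∈L posRoots C n
  mem-canon {p} {q} l m c = go
    where
    p<n : p N.< n
    p<n = NP.≰⇒> (λ n≤p → NP.<⇒≱ (subst (p N.+ q N.<_) (hiC n v) (s≤s c)) (NP.+-mono-≤ n≤p (NP.≤-trans n≤p (NP.<⇒≤ l))))
    inRow : ∀ {a b u} (a<n : a N.< n) (b<n : b N.< n) → a N.< b → u ∈L (vecOf n (coefCminus a b) ∷ vecOf n (coefCplus n a b) ∷ []) → u ∈L posRoots C n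
    inRow {a} {b} {u} a<n b<n l′ mm = LM.∈-++⁺ˡ (∈-concatMap-allFin⁺ row i (∈-concatMap-allFin⁺ (block i) j
      (∈-if⁺ (NP.<⇒<ᵇ (subst₂ N._<_ (sym ei) (sym ej) l′))
        (subst₂ (λ x y → u ∈L (vecOf n (coefCminus x y) ∷ vecOf n (coefCplus n x y) ∷ [])) (sym ei) (sym ej) mm))))
      where
      i j : Fin n
      i = fromℕ< a<n
      j = fromℕ< b<n
      ei : toℕ i ≡ a
      ei = FP.toℕ-fromℕ< a<n
      ej : toℕ j ≡ b
      ej = FP.toℕ-fromℕ< b<n
    go : Er p q ∈L posRoots C n
    -- The cell (p , q) is ε_p - ε_q if q < n; otherwise it is ε_p + ε_b with b = h - q, which for p
    -- = b is the long root 2ε_p.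
    go with q N.<? n
    ... | yes q<n = inRow p<n q<n l (here (sym (minus≡ l q<n)))
    ... | no q≮n with NP.<-cmp p (H ∸ q)
    ... | tri< l′ _ _ = inRow p<n b<n l′ (there (here (trans (cong (Er p) (sym (NP.m∸[m∸n]≡n m))) (sym (plus≡ l′ b<n)))))
      where
      b<n : H ∸ q N.< n
      b<n = NP.≤-<-trans (NP.∸-monoʳ-≤ H (NP.≮⇒≥ q≮n)) (subst (N._< n) (sym (NP.m+n∸n≡m (N.pred n) n)) (predlt n (n>0 C n v)))
        where
        predlt : ∀ m → 0 N.< m → N.pred m N.< m
        predlt (suc m) _ = NP.≤-refl
    ... | tri≈ _ e _ = LM.∈-++⁺ʳ (concatMap row (allFin n)) (subst (_∈L L.map (λ a → vecOf n (coefC2 n (toℕ a))) (allFin n))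
        (trans (cong (λ x → vecOf n (coefC2 n x)) (FP.toℕ-fromℕ< p<n)) (trans (C2≡ p<n) (cong (Er p) (trans (cong (H ∸_) e) (NP.m∸[m∸n]≡n m)))))
        (LM.∈-map⁺ (λ a → vecOf n (coefC2 n (toℕ a))) (LM.∈-allFin (fromℕ< p<n))))
    ... | tri> _ _ gt = ⊥-elim (NP.<⇒≱ gt (NP.m+n≤o⇒m≤o∸n p c))

  mem : ∀ {p q} → p N.< q → q N.≤ H → Er p q ∈L posRoots C n
  mem {p} {q} l m with p N.+ q N.≤? H
  ... | yes c = mem-canon l m c
  ... | no nc = subst (_∈L posRoots C n) (Er-mir C n v (NP.≤-trans (NP.<⇒≤ l) m) m)
    (mem-canon (NP.∸-monoʳ-< l m) (NP.m∸n≤m H p)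
      (NP.+-cancelʳ-≤ (p N.+ q) _ _ (NP.≤-trans (NP.≤-reflexive e) (NP.+-monoʳ-≤ H (NP.<⇒≤ (NP.≰⇒> nc))))))
    where
    re : ∀ a b c d → (a N.+ b) N.+ (c N.+ d) ≡ (a N.+ d) N.+ (b N.+ c)
    re = NR.solve-∀
    e : ((H ∸ q) N.+ (H ∸ p)) N.+ (p N.+ q) ≡ H N.+ H
    e = trans (re (H ∸ q) (H ∸ p) p q) (cong₂ N._+_ (NP.m∸n+n≡m m) (NP.m∸n+n≡m (NP.≤-trans (NP.<⇒≤ l) m)))

-- Sets of roots are subsets of the indices of the list. As every root has a single index,
-- membership of an index and membership of its root agree (`in⇐`).
root-unique : ∀ t n → ValidRank t n → Unique (posRoots t n)
root-unique A n v = RootsA.unique n v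
root-unique C n v = RootsC.unique n v

root-mem : ∀ t n v {p q} → p N.< q → q N.≤ hi t n → Model.Er t n v p q ∈L posRoots t n
root-mem A n v = RootsA.mem n v
root-mem C n v = RootsC.mem n v

root-cell : ∀ t n v {u} → u ∈L posRoots t n → ∃₂ λ p q → p N.< q × q N.≤ hi t n × Can t n p q × u ≡ Model.Er t n v p q
root-cell A n v m with RootsA.cell n v m
... | p , q , l , k , e = p , q , l , k , tt , e
root-cell C n v m with RootsC.cell n v m
... | p , RootsC.canon q l k c e = p , q , l , k , c , e

-- In type C the steps 0, ..., h - 1 are odd in number, so the mirror fixes the middle one and never
-- identifies two neighbours; the step leaving h has the label n of α₀, which no other step has.
cls-adj : ∀ t n → ValidRank t n → ∀ {r} → r N.< hi t n → cls t n r ≢ cls t n (suc r)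
cls-adj A n v l e = NP.<⇒≢ NP.≤-refl e
cls-adj C n v {r} l e with suc r N.<? n
... | yes s = NP.<⇒≢ NP.≤-refl (trans (sym (cls-id C n (NP.<⇒≤ s))) (trans e (cls-id C n s)))
... | no s with suc r N.≟ hi C n
... | yes s′ = NP.<⇒≢ (cls-lt C n l) (trans e (trans (cong (cls C n) s′) (cls-hi C n v)))
... | no s′ with r N.<? n
... | yes r<n = NP.<⇒≢ (flip-lt n (NP.≮⇒≥ s) s″) (trans (cong suc (sym e′)) (NP.≤-antisym r<n (NP.≮⇒≥ s)))
  where
  s″ : suc r N.< hi C n
  s″ = NP.≤∧≢⇒< l s′
  e′ : r ≡ hi C n ∸ suc (suc r)
  e′ = trans (sym (cls-id C n r<n)) (trans e (cls-fold n (NP.≮⇒≥ s) s″))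
... | no r≮n = NP.<⇒≢ (NP.∸-monoʳ-< NP.≤-refl s″)
    (trans (sym (cls-fold n (NP.≮⇒≥ s) s″)) (trans (sym e) (cls-fold n (NP.≮⇒≥ r≮n) l)))
  where
  s″ : suc r N.< hi C n
  s″ = NP.≤∧≢⇒< l s′

lookup-simple : ∀ n (P : Fin n) k → lookup (simple n P) k ≡ eqi (toℕ k) (toℕ P)
lookup-simple n P k = trans (lookup-vecOf n (λ m → ind (m ≡ᵇ toℕ P)) k) (sym (eqi-def (toℕ k) (toℕ P)))

-- Cells of M_α and dual order ideals

module Ideals (t : RType) (n : ℕ) (valid : ValidRank t n) (ι : Fin n) (long : LongIx t n (toℕ ι)) where
  open Roots t n public
  open Cells t n valid public

  i : ℕ
  i = toℕ ι

  α : Vec ℤ n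
  α = simple n ι

  i<n : i N.< n
  i<n = FP.toℕ<n ι

  i<h : i N.< suc h
  i<h = NP.≤-trans i<n (NP.m≤n⇒m≤1+n (n≤hi t n))

  Rect : ℕ → ℕ → Set
  Rect p q = p N.≤ i × i N.< q × q N.≤ h

  rect≤ : ∀ {p q} → Rect p q → p N.< q × p N.≤ h × q N.≤ h
  rect≤ (a , b , c) = NP.≤-<-trans a b , NP.≤-trans (NP.<⇒≤ (NP.≤-<-trans a b)) c , c

  mem : ∀ {p q} → p N.< q → q N.≤ h → IsPosRoot (Er p q)
  mem = root-mem t n valid

  opaque
    idx : ∀ {p q} → p N.< q → q N.≤ h → ∃ λ j → root j ≡ Er p q
    idx l m = Any.index (mem l m) , sym (AnyP.lookup-index (mem l m))

  opaque
    cellOf : ∀ j → ∃₂ λ p q → p N.< q × q N.≤ h × Can t n p q × root j ≡ Er p q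
    cellOf j = root-cell t n valid (LM.∈-lookup j)

  opaque
    root-inj : ∀ {j j′} → root j ≡ root j′ → j ≡ j′
    root-inj {j} {j′} = lookup-unique (root-unique t n valid) j j′

  in⇒ : ∀ {J j v} → j ∈ J → root j ≡ v → v ∈R J
  in⇒ {j = j} m e = j , m , e

  in⇐ : ∀ {J j v} → v ∈R J → root j ≡ v → j ∈ J
  in⇐ {J} {j} (j′ , m , e) e′ = subst (_∈ J) (root-inj (trans e (sym e′))) m

  g-step : ∀ q k → g q k ≤ g (suc q) k
  g-step q k = ≤-by (eqi≥0 k (cls t n q)) (lem (g q k) (eqi k (cls t n q)))
    where
    lem : ∀ a b → b - + 0 ≡ (a + b) - a
    lem = solve-∀

  g-mono : ∀ {p q} k → p N.≤ q → g p k ≤ g q k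
  g-mono {p} {q} k le with NP.m≤n⇒m<n∨m≡n le
  ... | inj₂ refl = ZP.≤-refl
  g-mono {p} {suc q} k le | inj₁ (s≤s l) = ZP.≤-trans (g-mono k l) (g-step q k)

  Er-mono : ∀ {p q p′ q′} → p′ N.≤ p → q N.≤ q′ → Er p q ≼ Er p′ q′
  Er-mono {p} {q} {p′} {q′} a b k = subst₂ _≤_ (sym (lookup-Er p q k)) (sym (lookup-Er p′ q′ k))
    (ZP.+-mono-≤ (g-mono (toℕ k) b) (ZP.neg-mono-≤ (g-mono (toℕ k) a)))

  Er≥0 : ∀ {p q} → p N.≤ q → ∀ k → + 0 ≤ lookup (Er p q) k
  Er≥0 {p} {q} l k = subst (+ 0 ≤_) (sym (lookup-Er p q k)) (ZP.i≤j⇒0≤j-i (g-mono (toℕ k) l))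

  -- As α is long, it labels a single step, the one from i to i + 1; its coefficient is therefore
  -- the indicator of the paths that cross this step.
  coord : ∀ {p q} → p N.≤ h → q N.≤ h → lookup (Er p q) ι ≡ Ucell (suc i) p q
  coord {p} {q} hp hq = trans (lookup-Er p q ι) (trans (cong₂ _-_ (g-long t n valid long hq) (g-long t n valid long hp))
    (trans (cong₂ _-_ (fl q) (fl p)) (lem (lt (suc i) q) (lt (suc i) p))))
    where
    fl : ∀ r → lt r i ≡ + 1 - lt (suc i) r
    fl r = lt-compl (λ l → l) s≤s
    lem : ∀ a b → (+ 1 - a) - (+ 1 - b) ≡ b - a
    lem = solve-∀

  Ucell-1 : ∀ {k p q} → + 1 ≤ Ucell k p q → p N.< k × k N.≤ q
  Ucell-1 {k} {p} {q} le with p N.<? k | q N.<? k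
  ... | yes a | no b = a , NP.≮⇒≥ b
  ... | yes a | yes b = ⊥-elim (1≰0 (subst (+ 1 ≤_) (cong₂ _-_ (lt-yes a) (lt-yes b)) le))
  ... | no a | no b = ⊥-elim (1≰0 (subst (+ 1 ≤_) (cong₂ _-_ (lt-no (NP.≮⇒≥ a)) (lt-no (NP.≮⇒≥ b))) le))
  ... | no a | yes b with subst (+ 1 ≤_) (cong₂ _-_ (lt-no (NP.≮⇒≥ a)) (lt-yes b)) le
  ... | ()

  rect-coord : ∀ {p q} → p N.≤ h → q N.≤ h → + 1 ≤ lookup (Er p q) ι → Rect p q
  rect-coord hp hq le with Ucell-1 (subst (+ 1 ≤_) (coord hp hq) le)
  ... | s≤s a , b = a , b , hq

  coord-rect : ∀ {p q} → Rect p q → lookup (Er p q) ι ≡ + 1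
  coord-rect r@(a , b , c) = trans (coord (proj₁ (proj₂ (rect≤ r))) c) (Ucell-yes (s≤s a) b)

  InM⇒ : ∀ {j p q} → p N.≤ h → q N.≤ h → root j ≡ Er p q → InM α j → Rect p q
  InM⇒ hp hq e m = rect-coord hp hq (subst₂ _≤_ (trans (lookup-simple n ι ι) (eqi-yes refl)) (cong (λ v → lookup v ι) e) (m ι))

  ⇒InM : ∀ {j p q} → Rect p q → root j ≡ Er p q → InM α j
  ⇒InM {j} {p} {q} r e k = subst₂ _≤_ (sym (lookup-simple n ι k)) (cong (λ v → lookup v k) (sym e)) (go (toℕ k N.≟ i))
    where
    go : Dec (toℕ k ≡ i) → eqi (toℕ k) i ≤ lookup (Er p q) k
    go (yes e) = ZP.≤-reflexive (trans (eqi-yes e) (sym (trans (cong (lookup (Er p q)) (FP.toℕ-injective e)) (coord-rect r))))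
    go (no ne) = subst (_≤ lookup (Er p q) k) (sym (eqi-no ne)) (Er≥0 (NP.<⇒≤ (proj₁ (rect≤ r))) k)

  _⊆M : RSet → Set
  J ⊆M = ∀ j → j ∈ J → InM α j

  cell-rect : ∀ {J p q} → J ⊆M → p N.≤ h → q N.≤ h → Er p q ∈R J → Rect p q
  cell-rect sub hp hq (j , m , e) = InM⇒ hp hq e (sub j m)

  up : ∀ {J p q p′ q′} → DualOrderIdeal J → Er p q ∈R J → p′ N.≤ p → q N.≤ q′ → p′ N.< q′ → q′ N.≤ h → Er p′ q′ ∈R J
  up d (j , m , e) a b l c with idx l c
  ... | j′ , e′ = j′ , d j j′ m (subst₂ _≼_ (sym e) (sym e′) (Er-mono a b)) , e′

  upR : ∀ {J p q p′ q′} → DualOrderIdeal J → Rect p q → Er p q ∈R J → p′ N.≤ p → q N.≤ q′ → q′ N.≤ h → Er p′ q′ ∈R J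
  upR d r m a b c = up d m a b (NP.≤-<-trans a (NP.<-≤-trans (proj₁ (rect≤ r)) b)) c

  rect-mir : ∀ {p q} → Rect p q → Rect (mirL t n p q) (mirR t n p q)
  rect-mir = go t n valid long
    where
    go : ∀ t n (v : ValidRank t n) {i p q} → LongIx t n i → p N.≤ i × i N.< q × q N.≤ hi t n →
      mirL t n p q N.≤ i × i N.< mirR t n p q × mirR t n p q N.≤ hi t n
    go A n v l r = r
    go C (suc n) v {p = p} {q} refl (a , b , c) =
      NP.≤-trans (NP.∸-monoʳ-≤ (hi C (suc n)) b) (NP.≤-reflexive (NP.m+n∸n≡m n (suc n))) ,
      NP.≤-trans (NP.≤-reflexive (sym (NP.m+n∸m≡n n (suc n)))) (NP.∸-monoʳ-≤ (hi C (suc n)) a) ,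
      NP.m∸n≤m (hi C (suc n)) p

  Er-mirror : ∀ {p q} → p N.≤ h → q N.≤ h → Er (mirL t n p q) (mirR t n p q) ≡ Er p q
  Er-mirror = Er-mir t n valid

  y-cell : ∀ k {p q} → p N.≤ h → q N.≤ h → y k (Er p q) ≡ Ucell k p q + Ucell k (mirL t n p q) (mirR t n p q)
  y-cell = y-Er t n valid

  lookup-sub : ∀ u v (k : Fin n) → lookup (u -v v) k ≡ lookup u k - lookup v k
  lookup-sub u v k = VP.lookup-zipWith _-_ k u v

  sub-left : ∀ {p q} (P : Fin n) → toℕ P ≡ cls t n p → Er p q -v simple n P ≡ Er (suc p) q
  sub-left {p} {q} P e = lookup-ext λ k → trans (lookup-sub (Er p q) (simple n P) k)
    (trans (cong₂ _-_ (lookup-Er p q k) (trans (lookup-simple n P k) (cong (eqi (toℕ k)) e)))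
    (trans (lem (g q (toℕ k)) (g p (toℕ k)) (eqi (toℕ k) (cls t n p))) (sym (lookup-Er (suc p) q k))))
    where
    lem : ∀ a b c → (a - b) - c ≡ a - (b + c)
    lem = solve-∀

  sub-right : ∀ {p q} (P : Fin n) → toℕ P ≡ cls t n q → Er p (suc q) -v simple n P ≡ Er p q
  sub-right {p} {q} P e = lookup-ext λ k → trans (lookup-sub (Er p (suc q)) (simple n P) k)
    (trans (cong₂ _-_ (lookup-Er p (suc q) k) (trans (lookup-simple n P k) (cong (eqi (toℕ k)) e)))
    (trans (lem (g q (toℕ k)) (g p (toℕ k)) (eqi (toℕ k) (cls t n q))) (sym (lookup-Er p q k))))
    where
    lem : ∀ a b c → ((a + c) - b) - c ≡ a - b
    lem = solve-∀

  φ-sub : ∀ w u v → φ w (u -v v) ≡ φ w u - φ w v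
  φ-sub w u v = trans (ΣZ.sum-cong n (λ k → trans (cong (w (toℕ k) *_) (lookup-sub u v k)) (lem (w (toℕ k)) (lookup u k) (lookup v k)))) (ΣZ.sum-⊖ n _ _)
    where
    lem : ∀ a b c → a * (b - c) ≡ a * b - a * c
    lem = solve-∀

  φ-simple : ∀ w P → φ w (simple n P) ≡ w (toℕ P)
  φ-simple w P = trans (ΣZ.sum-cong n (λ k → cong (w (toℕ k) *_) (lookup-simple n P k))) (sumZ-eqi n w (FP.toℕ<n P))

-- Border cells: which simple roots can be subtracted inside M_α

ywt-left : ∀ t n → ValidRank t n → ∀ {i l} → LongIx t n i → l N.< i → + 1 ≤ ywt t n (suc l) l - ywt t n l l
ywt-left A n v {i} {l} _ _ = ZP.≤-trans (Z.+≤+ (s≤s z≤n)) (ZP.≤-reflexive (sym (cong₂ (λ a b → (a + a) - (b + b)) (eqi-yes {suc l} {suc l} refl) (eqi-no {suc l} {l} (λ ())))))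
ywt-left C n v {i} {l} e l<i = subst (+ 1 ≤_)
  (sym (cong₂ _-_ (cong (_+ eqi (l N.+ suc l) (hi C n)) (eqi-yes {suc l} {suc l} refl)) (cong₂ _+_ (eqi-no {suc l} {l} (λ ())) (eqi-no (NP.<⇒≢ l+l<h)))))
  (≤-by (eqi≥0 (l N.+ suc l) (hi C n)) (lem (eqi (l N.+ suc l) (hi C n))))
  where
  l+l<h : l N.+ l N.< hi C n
  l+l<h = NP.≤-pred (subst (suc (suc (l N.+ l)) N.≤_) (sym (hiC n v)) (subst (N._≤ n N.+ n) (cong suc (NP.+-suc l l)) (NP.+-mono-≤ (NP.≤-trans l<i (NP.<⇒≤ (NP.≤-reflexive e))) (NP.≤-trans l<i (NP.<⇒≤ (NP.≤-reflexive e))))))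
  lem : ∀ a → a - + 0 ≡ ((+ 1 + a) - (+ 0 + + 0)) - + 1
  lem = solve-∀

ywt-right : ∀ t n {i l} → LongIx t n i → i N.< l → l N.< n → + 1 ≤ ywt t n (suc l) l - ywt t n (suc (suc l)) l
ywt-right A n {i} {l} _ _ _ = ZP.≤-trans (Z.+≤+ (s≤s z≤n)) (ZP.≤-reflexive (sym (cong₂ (λ a b → (a + a) - (b + b)) (eqi-yes {suc l} {suc l} refl) (eqi-no {suc l} {suc (suc l)} (λ ())))))
ywt-right C n refl i<l l<n = ⊥-elim (NP.<⇒≱ i<l (NP.≤-pred l<n))

cls-left : ∀ t n {i p q l} → LongIx t n i → q N.≤ hi t n → l N.< i → p ≡ l ⊎ mirL t n p q ≡ l → i N.< q →
  l ≡ cls t n p ⊎ l ≡ cls t n (N.pred q)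
cls-left A n _ _ _ (inj₁ e) _ = inj₁ (sym e)
cls-left A n _ _ _ (inj₂ e) _ = inj₁ (sym e)
cls-left C n {l = l} e _ l<i (inj₁ refl) _ = inj₁ (sym (cls-id C n (NP.<-≤-trans l<i (NP.<⇒≤ (NP.≤-reflexive e)))))
cls-left C (suc m) {i} {q = suc q} {l} refl qh l<i (inj₂ e) (s≤s i≤q) with NP.m≤n⇒m<n∨m≡n i≤q
... | inj₁ i<q = inj₂ (sym (trans (cls-fold (suc m) i<q qh) e))
... | inj₂ refl = ⊥-elim (NP.<⇒≢ l<i (trans (sym e) (NP.m+n∸n≡m m (suc m))))

cls-right : ∀ t n {i q p l} → LongIx t n i → i N.< l → l N.< n → q ≡ suc l ⊎ mirR t n p q ≡ suc l → l ≡ cls t n (N.pred q)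
cls-right A n _ _ _ (inj₁ refl) = refl
cls-right A n _ _ _ (inj₂ refl) = refl
cls-right C n refl i<l l<n _ = ⊥-elim (NP.<⇒≱ i<l (NP.≤-pred l<n))

eqi-sum : ∀ {a b c d} → + 1 ≤ eqi a b + eqi c d → a ≡ b ⊎ c ≡ d
eqi-sum {a} {b} {c} {d} le with a N.≟ b | c N.≟ d
... | yes e | _ = inj₁ e
... | no _ | yes e = inj₂ e
... | no e | no e′ = ⊥-elim (1≰0 (subst (+ 1 ≤_) (cong₂ _+_ (eqi-no e) (eqi-no e′)) le))

module Border (t : RType) (n : ℕ) (valid : ValidRank t n) (ι : Fin n) (long : LongIx t n (toℕ ι)) where
  open Ideals t n valid ι long public

  U-left : ∀ {k p q} → Rect p q → k N.≤ suc i → Ucell k p q ≡ lt k p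
  U-left {k} {p} (a , b , c) le = trans (cong (λ z → lt k p - z) (lt-no (NP.≤-trans le b))) (lem (lt k p))
    where
    lem : ∀ a → a - + 0 ≡ a
    lem = solve-∀

  U-right : ∀ {k p q} → Rect p q → suc i N.≤ k → Ucell k p q ≡ + 1 - lt k q
  U-right {k} {p} {q} (a , b , c) le = cong (λ z → z - lt k q) (lt-yes (NP.≤-<-trans a le))

  lt-mono : ∀ {k k′} r → k N.≤ k′ → lt k r ≤ lt k′ r
  lt-mono {k} {k′} r le with NP.m≤n⇒m<n∨m≡n le
  ... | inj₂ refl = ZP.≤-refl
  lt-mono {k} {suc k′} r le | inj₁ (s≤s l) = ZP.≤-trans (lt-mono r l)
    (subst (lt k′ r ≤_) (sym (lt-suc k′ r)) (≤-by (eqi≥0 r k′) (lem (lt k′ r) (eqi r k′))))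
    where
    lem : ∀ a b → b - + 0 ≡ (a + b) - a
    lem = solve-∀

  y-rect : ∀ k {p q} → Rect p q → y k (Er p q) ≡ Ucell k p q + Ucell k (mirL t n p q) (mirR t n p q)
  y-rect k r = y-cell k (proj₁ (proj₂ (rect≤ r))) (proj₂ (proj₂ (rect≤ r)))

  y-left : ∀ k {p q} → Rect p q → k N.≤ suc i → y k (Er p q) ≡ lt k p + lt k (mirL t n p q)
  y-left k r le = trans (y-rect k r) (cong₂ _+_ (U-left r le) (U-left (rect-mir r) le))

  y-right : ∀ k {p q} → Rect p q → suc i N.≤ k → y k (Er p q) ≡ (+ 1 - lt k q) + (+ 1 - lt k (mirR t n p q))
  y-right k r le = trans (y-rect k r) (cong₂ _+_ (U-right r le) (U-right (rect-mir r) le))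

  y-sub : ∀ k {v u} P → v -v simple n P ≡ u → y k u ≡ y k v - ywt t n k (toℕ P)
  y-sub k {v} P e = trans (cong (y k) (sym e)) (trans (φ-sub (ywt t n k) v (simple n P)) (cong (λ z → y k v - z) (φ-simple (ywt t n k) P)))

  -- A simple root other than α that can be subtracted inside M_α sits at one of the two ends of the cell:
  -- the values y_k increase up to k = i + 1 and decrease afterwards.
  opaque
    ends : ∀ {p q} P → Rect p q → toℕ P ≢ i → IsPosRoot (Er p q -v simple n P) →
      toℕ P ≡ cls t n p ⊎ toℕ P ≡ cls t n (N.pred q)
    ends {p} {q} P r ne pos with root-cell t n valid pos
    ... | p′ , q′ , l′ , hq′ , _ , e = go (NP.<-cmp (toℕ P) i)
      where
      l : ℕ
      l = toℕ P
      hp′ : p′ N.≤ h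
      hp′ = NP.≤-trans (NP.<⇒≤ l′) hq′
      r′ : Rect p′ q′
      r′ = rect-coord hp′ hq′ (ZP.≤-reflexive (sym (trans (cong (λ v → lookup v ι) (sym e)) (trans (lookup-sub (Er p q) (simple n P) ι)
        (cong₂ _-_ (coord-rect r) (trans (lookup-simple n P ι) (eqi-no (ne ∘ sym))))))))
      go : Tri (toℕ P N.< i) (toℕ P ≡ i) (toℕ P N.> i) → toℕ P ≡ cls t n p ⊎ toℕ P ≡ cls t n (N.pred q)
      go (tri≈ _ c _) = ⊥-elim (ne c)
      go (tri< c _ _) = cls-left t n long (proj₂ (proj₂ r)) c (eqi-sum step) (proj₁ (proj₂ r))
        where
        m m′ : ℕ
        m = mirL t n p q
        m′ = mirL t n p′ q′
        mono : lt l p′ + lt l m′ ≤ lt (suc l) p′ + lt (suc l) m′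
        mono = ZP.+-mono-≤ (lt-mono p′ (NP.n≤1+n l)) (lt-mono m′ (NP.n≤1+n l))
        mono′ : (lt l p + lt l m) - ywt t n l l ≤ (lt (suc l) p + lt (suc l) m) - ywt t n (suc l) l
        mono′ = subst₂ _≤_
          (trans (sym (y-left l r′ (NP.<⇒≤ (NP.m<n⇒m<1+n c)))) (trans (y-sub l P e) (cong (_- ywt t n l l) (y-left l r (NP.<⇒≤ (NP.m<n⇒m<1+n c))))))
          (trans (sym (y-left (suc l) r′ (NP.m≤n⇒m≤1+n c))) (trans (y-sub (suc l) P e) (cong (_- ywt t n (suc l) l) (y-left (suc l) r (NP.m≤n⇒m≤1+n c)))))
          mono
        step : + 1 ≤ eqi p l + eqi m l
        step = ≤-by₂ mono′ (ywt-left t n valid long c)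
          (trans (cong₂ (λ a b → ((a + b) - ywt t n (suc l) l - ((lt l p + lt l m) - ywt t n l l)) + ((ywt t n (suc l) l - ywt t n l l) - + 1)) (lt-suc l p) (lt-suc l m))
            (lem (lt l p) (lt l m) (eqi p l) (eqi m l) (ywt t n (suc l) l) (ywt t n l l)))
          where
          lem : ∀ a b c d w w′ → ((((a + c) + (b + d)) - w) - ((a + b) - w′)) + ((w - w′) - + 1) ≡ (c + d) - + 1
          lem = solve-∀
      go (tri> _ _ c) = inj₂ (cls-right t n {p = p} long c (FP.toℕ<n P) (eqi-sum step))
        where
        m m′ : ℕ
        m = mirR t n p q
        m′ = mirR t n p′ q′
        mono : lt (suc l) q′ + lt (suc l) m′ ≤ lt (suc (suc l)) q′ + lt (suc (suc l)) m′
        mono = ZP.+-mono-≤ (lt-mono q′ (NP.n≤1+n (suc l))) (lt-mono m′ (NP.n≤1+n (suc l)))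
        E : ∀ k → suc i N.≤ k → ((+ 1 - lt k q) + (+ 1 - lt k m)) - ywt t n k l ≡ (+ 1 - lt k q′) + (+ 1 - lt k m′)
        E k le = trans (cong (_- ywt t n k l) (sym (y-right k r le))) (trans (sym (y-sub k P e)) (y-right k r′ le))
        step : + 1 ≤ eqi q (suc l) + eqi m (suc l)
        step = ≤-by₂ mono (ywt-right t n long c (FP.toℕ<n P))
          (trans (lem′ (lt (suc l) q′) (lt (suc l) m′) (lt (suc (suc l)) q′) (lt (suc (suc l)) m′) (ywt t n (suc l) l) (ywt t n (suc (suc l)) l))
          (trans (cong₂ (λ a b → (a - b) + ((ywt t n (suc l) l - ywt t n (suc (suc l)) l) - + 1)) (sym (E (suc l) (NP.m≤n⇒m≤1+n c))) (sym (E (suc (suc l)) (NP.m≤n⇒m≤1+n (NP.m≤n⇒m≤1+n c)))))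
          (trans (cong₂ (λ a b → ((((+ 1 - lt (suc l) q) + (+ 1 - lt (suc l) m)) - ywt t n (suc l) l) - (((+ 1 - a) + (+ 1 - b)) - ywt t n (suc (suc l)) l)) + ((ywt t n (suc l) l - ywt t n (suc (suc l)) l) - + 1)) (lt-suc (suc l) q) (lt-suc (suc l) m))
            (lem (lt (suc l) q) (lt (suc l) m) (eqi q (suc l)) (eqi m (suc l)) (ywt t n (suc l) l) (ywt t n (suc (suc l)) l)))))
          where
          lem : ∀ a b c d w w′ → ((((+ 1 - a) + (+ 1 - b)) - w) - (((+ 1 - (a + c)) + (+ 1 - (b + d))) - w′)) + ((w - w′) - + 1) ≡ (c + d) - + 1
          lem = solve-∀
          lem′ : ∀ a b c d w w′ → ((c + d) - (a + b)) + ((w - w′) - + 1) ≡ (((+ 1 - a) + (+ 1 - b)) - ((+ 1 - c) + (+ 1 - d))) + ((w - w′) - + 1)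
          lem′ = solve-∀

  opaque
    -- Among the pairs of simple roots tested by `InBorder` is the pair of labels of the two end
    -- steps of the cell, which leads to (p + 1 , q - 1).
    border⇒ : ∀ {J j p q} → J ⊆M → Rect p q → root j ≡ Er p q → InBorder J j → ¬ (Er (suc p) (N.pred q) ∈R J)
    border⇒ {J} {j} {p} {suc q} sub r e (_ , b) m = b P Q
        (subst IsPosRoot (sym eP) (mem (NP.<-≤-trans (s≤s (proj₁ r′)) (proj₁ (proj₂ r))) (proj₂ (proj₂ r))))
        (subst IsPosRoot (sym eQ) (mem (NP.≤-<-trans (proj₁ r) (proj₁ (proj₂ r′))) (proj₂ (proj₂ r′))))
        (subst (_∈R J) (sym (trans (cong (_-v simple n Q) eP) (sub-right Q (FP.toℕ-fromℕ< lQ)))) m)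
      where
      r′ : Rect (suc p) q
      r′ = cell-rect sub (NP.<-≤-trans (s≤s (proj₁ r)) (NP.≤-trans i<n (n≤hi t n))) (NP.<⇒≤ (proj₂ (proj₂ r))) m
      lP : cls t n p N.< n
      lP = cls-lt t n (NP.<-≤-trans (proj₁ (rect≤ r)) (proj₂ (proj₂ r)))
      lQ : cls t n q N.< n
      lQ = cls-lt t n (proj₂ (proj₂ r))
      P Q : Fin n
      P = fromℕ< lP
      Q = fromℕ< lQ
      eP : root j -v simple n P ≡ Er (suc p) (suc q)
      eP = trans (cong (_-v simple n P) e) (sub-left P (FP.toℕ-fromℕ< lP))
      eQ : root j -v simple n Q ≡ Er p q
      eQ = trans (cong (_-v simple n Q) e) (sub-right Q (FP.toℕ-fromℕ< lQ))

  opaque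
    -- Neither subtracted root is α, because the result still lies in M_α; so `ends` puts both at
    -- ends of the cell. Two subtractions at the same end would give Q the label of the second step
    -- from that end. But Q can also be subtracted from the cell itself, hence has the label of an
    -- end step: the neighbouring one is impossible by `cls-adj`, and the one at the other end leads
    -- to (p + 1 , q - 1) again.
    border⇐ : ∀ {J j p q} → J ⊆M → Rect p q → root j ≡ Er p q → j ∈ J → ¬ (Er (suc p) (N.pred q) ∈R J) → InBorder J j
    border⇐ {J} {j} {p} {suc q} sub r e j∈J nm = j∈J , λ P Q rP rQ m → nm (go P Q (subst IsPosRoot (cong (_-v simple n P) e) rP) (subst IsPosRoot (cong (_-v simple n Q) e) rQ)
        (subst (λ v → ((v -v simple n P) -v simple n Q) ∈R J) e m))
      where
      go : ∀ P Q → IsPosRoot (Er p (suc q) -v simple n P) → IsPosRoot (Er p (suc q) -v simple n Q) →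
        ((Er p (suc q) -v simple n P) -v simple n Q) ∈R J → Er (suc p) q ∈R J
      go P Q rP rQ γ@(k , k∈J , eγ) = assemble (ends P r P≢i rP)
        where
        co : + 1 ≤ (+ 1 - eqi i (toℕ P)) - eqi i (toℕ Q)
        co = subst₂ _≤_ (trans (lookup-simple n ι ι) (eqi-yes refl))
          (trans (cong (λ v → lookup v ι) eγ) (trans (lookup-sub (Er p (suc q) -v simple n P) (simple n Q) ι)
            (cong₂ _-_ (trans (lookup-sub (Er p (suc q)) (simple n P) ι) (cong₂ _-_ (coord-rect r) (lookup-simple n P ι))) (lookup-simple n Q ι)))) (sub k k∈J ι)
        P≢i : toℕ P ≢ i
        P≢i c = 1≰0 (≤-by₂ co (eqi≥0 i (toℕ Q)) (trans (cong (λ z → ((((+ 1 - z) - eqi i (toℕ Q)) - + 1) + (eqi i (toℕ Q) - + 0))) (eqi-yes (sym c))) (lem (eqi i (toℕ Q)))))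
          where
          lem : ∀ a → (((+ 1 - + 1) - a) - + 1) + (a - + 0) ≡ + 0 - + 1
          lem = solve-∀
        Q≢i : toℕ Q ≢ i
        Q≢i c = 1≰0 (≤-by₂ co (eqi≥0 i (toℕ P)) (trans (cong (λ z → ((((+ 1 - eqi i (toℕ P)) - z) - + 1) + (eqi i (toℕ P) - + 0))) (eqi-yes (sym c))) (lem (eqi i (toℕ P)))))
          where
          lem : ∀ a → (((+ 1 - a) - + 1) - + 1) + (a - + 0) ≡ + 0 - + 1
          lem = solve-∀
        root-k : ∀ {v} → (Er p (suc q) -v simple n P) ≡ v → IsPosRoot (v -v simple n Q)
        root-k ev = subst IsPosRoot (trans eγ (cong (_-v simple n Q) ev)) (LM.∈-lookup k)
        p<h : p N.< h
        p<h = NP.<-≤-trans (proj₁ (rect≤ r)) (proj₂ (proj₂ r))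
        finish : ∀ {v w} → (Er p (suc q) -v simple n P) ≡ v → v -v simple n Q ≡ w → w ∈R J
        finish ev ew = subst (_∈R J) (trans (cong (_-v simple n Q) ev) ew) γ
        assemble : toℕ P ≡ cls t n p ⊎ toℕ P ≡ cls t n q → Er (suc p) q ∈R J
        assemble (inj₁ c) = case1 (ends Q r₁ Q≢i (root-k ev)) (ends Q r Q≢i rQ)
          where
          ev : Er p (suc q) -v simple n P ≡ Er (suc p) (suc q)
          ev = sub-left P c
          r₁ : Rect (suc p) (suc q)
          r₁ = NP.≤∧≢⇒< (proj₁ r) (λ p≡i → P≢i (trans c (trans (cong (cls t n) p≡i) (cls-id t n i<n)))) , proj₂ r
          case1 : toℕ Q ≡ cls t n (suc p) ⊎ toℕ Q ≡ cls t n q → toℕ Q ≡ cls t n p ⊎ toℕ Q ≡ cls t n q → Er (suc p) q ∈R J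
          case1 (inj₂ d) _ = finish ev (sub-right Q d)
          case1 (inj₁ _) (inj₂ d) = finish ev (sub-right Q d)
          case1 (inj₁ d) (inj₁ d′) = ⊥-elim (cls-adj t n valid p<h (trans (sym d′) d))
        assemble (inj₂ c) = case2 (ends Q r Q≢i rQ) (ends Q (proj₁ r , i<q , NP.<⇒≤ (proj₂ (proj₂ r))) Q≢i (root-k (sub-right P c)))
          where
          i<q : i N.< q
          i<q = NP.≤∧≢⇒< (NP.≤-pred (proj₁ (proj₂ r))) (λ i≡q → P≢i (trans c (trans (cong (cls t n) (sym i≡q)) (cls-id t n i<n))))
          adj : ∀ q → q N.< h → i N.< q → toℕ Q ≡ cls t n q → toℕ Q ≡ cls t n (N.pred q) → ⊥
          adj (suc q) l _ d d′ = cls-adj t n valid (NP.<⇒≤ l) (trans (sym d′) d)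
          case2 : toℕ Q ≡ cls t n p ⊎ toℕ Q ≡ cls t n q → toℕ Q ≡ cls t n p ⊎ toℕ Q ≡ cls t n (N.pred q) → Er (suc p) q ∈R J
          case2 (inj₁ d) _ = finish (sub-right P c) (sub-left Q d)
          case2 (inj₂ _) (inj₁ d) = finish (sub-right P c) (sub-left Q d)
          case2 (inj₂ d) (inj₂ d′) = ⊥-elim (adj q (proj₂ (proj₂ r)) i<q d d′)

-- Linear functionals built from the y_k and their signs on convex hulls

module Functionals (t : RType) (n : ℕ) (valid : ValidRank t n) (ι : Fin n) (long : LongIx t n (toℕ ι)) where
  open Border t n valid ι long public

  Lin : (Vec ℚ n → ℚ) → Set
  Lin f = ∀ c → f (combQ c) ≡ sumQ NR (λ j → lookup c j Q.* f (rootQ j))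

  yQ : ℕ → Vec ℚ n → ℚ
  yQ k x = sumQ n (λ m → toQ (ywt t n k (toℕ m)) Q.* lookup x m)

  yQ-toQ : ∀ k v → yQ k (toQv v) ≡ toQ (y k v)
  yQ-toQ k v = trans (ΣQ.sum-cong n (λ m → trans (cong (toQ (ywt t n k (toℕ m)) Q.*_) (VP.lookup-map m toQ v)) (sym (toQ-* (ywt t n k (toℕ m)) (lookup v m)))))
    (sym (toQ-sum n (λ m → ywt t n k (toℕ m) * lookup v m)))

  lookup-combQ : ∀ c k → lookup (combQ c) k ≡ sumQ NR (λ j → lookup c j Q.* lookup (rootQ j) k)
  lookup-combQ c k = VP.lookup∘tabulate (λ k → sumQ NR (λ j → lookup c j Q.* lookup (rootQ j) k)) k

  yQ-lin : ∀ k → Lin (yQ k)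
  yQ-lin k c = trans (ΣQ.sum-cong n (λ m → trans (cong (toQ (ywt t n k (toℕ m)) Q.*_) (lookup-combQ c m)) (sym (ΣQ.sum-⊗ NR (w m) (λ j → lookup c j Q.* lookup (rootQ j) m)))))
    (trans (ΣQ.sum-comm n NR (λ m j → w m Q.* (lookup c j Q.* lookup (rootQ j) m)))
    (ΣQ.sum-cong NR (λ j → trans (ΣQ.sum-cong n (λ m → swap (w m) (lookup c j) (lookup (rootQ j) m))) (ΣQ.sum-⊗ n (lookup c j) (λ m → w m Q.* lookup (rootQ j) m)))))
    where
    w : Fin n → ℚ
    w m = toQ (ywt t n k (toℕ m))
    swap : ∀ a b c → a Q.* (b Q.* c) ≡ b Q.* (a Q.* c)
    swap a b c = trans (sym (QP.*-assoc a b c)) (trans (cong (Q._* c) (QP.*-comm a b)) (QP.*-assoc b a c))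

  -- Index data of y_a + y_b - y_c - y_d. This one shape covers walls, differences of walls and the
  -- indicators of rows and columns; an index 0 fills an empty slot, because y_0 vanishes.
  Quad : Set
  Quad = (ℕ × ℕ) × (ℕ × ℕ)

  q4 : Quad → Vec ℚ n → ℚ
  q4 ((a , b) , (c , d)) x = (yQ a x Q.+ yQ b x) Q.- (yQ c x Q.+ yQ d x)

  neg : Quad → Quad
  neg (k , k′) = k′ , k

  Vcell : Quad → ℕ → ℕ → ℤ
  Vcell ((a , b) , (c , d)) p q = (Ucell a p q + Ucell b p q) - (Ucell c p q + Ucell d p q)

  lin-+ : ∀ f f′ → Lin f → Lin f′ → Lin (λ x → f x Q.+ f′ x)
  lin-+ f f′ l l′ c = trans (cong₂ Q._+_ (l c) (l′ c)) (trans (sym (ΣQ.sum-⊕ NR (λ j → lookup c j Q.* f (rootQ j)) (λ j → lookup c j Q.* f′ (rootQ j))))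
    (ΣQ.sum-cong NR (λ j → sym (QP.*-distribˡ-+ (lookup c j) (f (rootQ j)) (f′ (rootQ j))))))

  lin-− : ∀ f f′ → Lin f → Lin f′ → Lin (λ x → f x Q.- f′ x)
  lin-− f f′ l l′ c = trans (cong₂ Q._-_ (l c) (l′ c)) (trans (sym (ΣQ.sum-⊖ NR (λ j → lookup c j Q.* f (rootQ j)) (λ j → lookup c j Q.* f′ (rootQ j))))
    (ΣQ.sum-cong NR (λ j → trans (cong (lookup c j Q.* f (rootQ j) Q.+_) (QP.neg-distribʳ-* (lookup c j) (f′ (rootQ j))))
      (sym (QP.*-distribˡ-+ (lookup c j) (f (rootQ j)) (Q.- f′ (rootQ j)))))))

  q4-lin : ∀ K → Lin (q4 K)
  q4-lin ((a , b) , (c , d)) = lin-− (λ x → yQ a x Q.+ yQ b x) (λ x → yQ c x Q.+ yQ d x)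
    (lin-+ (yQ a) (yQ b) (yQ-lin a) (yQ-lin b)) (lin-+ (yQ c) (yQ d) (yQ-lin c) (yQ-lin d))

  neg-neg : ∀ a b → a Q.- b ≡ Q.- (b Q.- a)
  neg-neg a b = sym (trans (QP.neg-distrib-+ b (Q.- a)) (trans (QP.+-comm (Q.- b) (Q.- (Q.- a))) (cong (Q._- b) (negQ-involutive a))))

  q4-neg : ∀ K x → q4 (neg K) x ≡ Q.- q4 K x
  q4-neg ((a , b) , (c , d)) x = neg-neg (yQ c x Q.+ yQ d x) (yQ a x Q.+ yQ b x)

  Vcell-neg : ∀ K p q → Vcell (neg K) p q ≡ - Vcell K p q
  Vcell-neg ((a , b) , (c , d)) p q = lem (Ucell a p q + Ucell b p q) (Ucell c p q + Ucell d p q)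
    where
    lem : ∀ a b → b - a ≡ - (a - b)
    lem = solve-∀

  opaque
    -- The passage from roots to cells: a lower bound on all cells of a mirror-stable set gives one
    -- on the roots, although a root determines only the sum of two cell values.
    q4-root : ∀ K {j p q} → Rect p q → root j ≡ Er p q → q4 K (rootQ j) ≡ toQ (Vcell K p q + Vcell K (mirL t n p q) (mirR t n p q))
    q4-root ((a , b) , (c , d)) {j} {p} {q} r e = trans (cong (λ v → q4 ((a , b) , (c , d)) (toQv v)) e)
      (trans (cong₂ Q._-_ (s a b) (s c d)) (trans (sym (toQ-sub ((Ucell a p q + Ucell a p′ q′) + (Ucell b p q + Ucell b p′ q′)) ((Ucell c p q + Ucell c p′ q′) + (Ucell d p q + Ucell d p′ q′))))
        (cong toQ (lem (Ucell a p q) (Ucell b p q) (Ucell c p q) (Ucell d p q) (Ucell a p′ q′) (Ucell b p′ q′) (Ucell c p′ q′) (Ucell d p′ q′)))))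
      where
      p′ q′ : ℕ
      p′ = mirL t n p q
      q′ = mirR t n p q
      s : ∀ a b → yQ a (toQv (Er p q)) Q.+ yQ b (toQv (Er p q)) ≡ toQ ((Ucell a p q + Ucell a p′ q′) + (Ucell b p q + Ucell b p′ q′))
      s a b = trans (cong₂ Q._+_ (trans (yQ-toQ a (Er p q)) (cong toQ (y-rect a r))) (trans (yQ-toQ b (Er p q)) (cong toQ (y-rect b r)))) (sym (toQ-+ (Ucell a p q + Ucell a p′ q′) (Ucell b p q + Ucell b p′ q′)))
      lem : ∀ a b c d a′ b′ c′ d′ → ((a + a′) + (b + b′)) - ((c + c′) + (d + d′)) ≡ ((a + b) - (c + d)) + ((a′ + b′) - (c′ + d′))
      lem = solve-∀

  IsCell : (Fin NR → Set) → ℕ → ℕ → Set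
  IsCell S p q = Rect p q × ∃ λ j → S j × root j ≡ Er p q

  cell-mir : ∀ {S p q} → IsCell S p q → IsCell S (mirL t n p q) (mirR t n p q)
  cell-mir (r , j , s , e) = rect-mir r , j , s , trans e (sym (Er-mirror (proj₁ (proj₂ (rect≤ r))) (proj₂ (proj₂ r))))

  q4≥0 : ∀ K {S : Fin NR → Set} → (∀ {p q} → IsCell S p q → + 0 ≤ Vcell K p q) →
    ∀ {j p q} → Rect p q → root j ≡ Er p q → S j → 0ℚ Q.≤ q4 K (rootQ j)
  q4≥0 K {S} nn {j} {p} {q} r e s = subst (0ℚ Q.≤_) (sym (q4-root K r e)) (toQ-mono (ZP.+-mono-≤ (nn c) (nn (cell-mir {S} c))))
    where
    c : IsCell S p q
    c = r , j , s , e

  ⊆Mᵖ : (Fin NR → Set) → Set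
  ⊆Mᵖ S = ∀ j → S j → InM α j

  opaque
    rectOf : ∀ j → InM α j → ∃₂ λ p q → Rect p q × Can t n p q × root j ≡ Er p q
    rectOf j m with cellOf j
    ... | p , q , l , k , c , e = p , q , InM⇒ {j} (NP.≤-trans (NP.<⇒≤ l) k) k e m , c , e

  q4≥0′ : ∀ K {S : Fin NR → Set} → ⊆Mᵖ S → (∀ {p q} → IsCell S p q → + 0 ≤ Vcell K p q) → ∀ j → S j → 0ℚ Q.≤ q4 K (rootQ j)
  q4≥0′ K {S} sub nn j s with rectOf j (sub j s)
  ... | p , q , r , _ , e = q4≥0 K {S} nn r e s

  opaque
    -- `S` need not be decidable. The split is on the sign of `f j`: a negative value shows that j
    -- is not in `S`, and there c vanishes. The same device is used for the other statements about
    -- supported coefficients.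
    supported-nonneg : ∀ {S : Fin NR → Set} {f : Fin NR → ℚ} {c} → SupportedQ S c → (∀ j → 0ℚ Q.≤ lookup c j) →
      (∀ j → S j → 0ℚ Q.≤ f j) → ∀ j → 0ℚ Q.≤ lookup c j Q.* f j
    supported-nonneg {S} {f} {c} sup c≥0 nn j with 0ℚ QP.≤? f j
    ... | yes l = QP.≤-trans (QP.≤-reflexive (sym (QP.*-zeroʳ (lookup c j)))) (QP.*-monoˡ-≤-nonNeg (lookup c j) {{Q.nonNegative (c≥0 j)}} l)
    ... | no ¬l = QP.≤-reflexive (sym (trans (cong (Q._* f j) (sup j (λ s → ¬l (nn j s)))) (QP.*-zeroˡ (f j))))

  opaque
    conv-nonneg : ∀ {S f x} → Lin f → (∀ j → S j → 0ℚ Q.≤ f (rootQ j)) → InConv S x → 0ℚ Q.≤ f x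
    conv-nonneg {f = f} l nn (c , sup , c≥0 , _ , e) = subst (0ℚ Q.≤_) (trans (sym (l c)) (cong f e))
      (sumQ-nonneg NR (supported-nonneg {c = c} sup c≥0 nn))

  q4-conv : ∀ K {S x} → ⊆Mᵖ S → (∀ {p q} → IsCell S p q → + 0 ≤ Vcell K p q) → InConv S x → 0ℚ Q.≤ q4 K x
  q4-conv K {S} sub nn = conv-nonneg {S} (q4-lin K) (q4≥0′ K {S} sub nn)

  opaque
    -- Supporting hyperplane: the functional is nonnegative on all vertices but not positive at x,
    -- so each term of the convex combination vanishes; at a vertex where the functional is at least
    -- 1 this kills the coefficient.
    wall-zero : ∀ K {S x} → ⊆Mᵖ S → (∀ {p q} → IsCell S p q → + 0 ≤ Vcell K p q) → q4 K x Q.≤ 0ℚ →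
      (ic : InConv S x) → ∀ {j p q} → Rect p q → root j ≡ Er p q → S j → + 1 ≤ Vcell K p q → lookup (proj₁ ic) j ≡ 0ℚ
    wall-zero K {S} {x} sub nn le (c , sup , c≥0 , _ , e) {j} {p} {q} r ej s one = cancel (sumQ-nonpos-zero NR nonpos tot j)
      where
      t≥0 : ∀ j → 0ℚ Q.≤ lookup c j Q.* q4 K (rootQ j)
      t≥0 = supported-nonneg {S} {c = c} sup c≥0 (q4≥0′ K {S} sub nn)
      nonpos : ∀ j → Q.- (lookup c j Q.* q4 K (rootQ j)) Q.≤ 0ℚ
      nonpos j = QP.neg-antimono-≤ (t≥0 j)
      negsum : ∀ m (f : Fin m → ℚ) → sumQ m (λ k → Q.- f k) ≡ Q.- sumQ m f
      negsum zero f = refl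
      negsum (suc m) f = trans (cong (Q.- f F.zero Q.+_) (negsum m (f ∘ F.suc))) (sym (QP.neg-distrib-+ (f F.zero) (sumQ m (f ∘ F.suc))))
      tot : 0ℚ Q.≤ sumQ NR (λ j → Q.- (lookup c j Q.* q4 K (rootQ j)))
      tot = subst (0ℚ Q.≤_) (trans (cong Q.-_ (trans (cong (q4 K) (sym e)) (q4-lin K c))) (sym (negsum NR (λ j → lookup c j Q.* q4 K (rootQ j))))) (QP.neg-antimono-≤ le)
      1≤f : 1ℚ Q.≤ q4 K (rootQ j)
      1≤f = subst (1ℚ Q.≤_) (sym (q4-root K r ej)) (toQ-mono (ZP.+-mono-≤ one (nn (cell-mir {S} (r , j , s , ej)))))
      cancel : Q.- (lookup c j Q.* q4 K (rootQ j)) ≡ 0ℚ → lookup c j ≡ 0ℚ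
      cancel z = QP.≤-antisym (QP.≤-trans (QP.≤-reflexive (sym (QP.*-identityʳ (lookup c j))))
          (QP.≤-trans (QP.*-monoˡ-≤-nonNeg (lookup c j) {{Q.nonNegative (c≥0 j)}} 1≤f)
          (QP.≤-reflexive (trans (sym (negQ-involutive (lookup c j Q.* q4 K (rootQ j)))) (cong Q.-_ z))))) (c≥0 j)

  dual-value : ∀ {S f x} → Lin f → ∀ j → (∀ k → S k → k ≢ j → f (rootQ k) ≡ 0ℚ) →
    ∀ c → SupportedQ S c → combQ c ≡ x → f x ≡ lookup c j Q.* f (rootQ j)
  dual-value {S} {f} l j van c sup e = trans (cong f (sym e)) (trans (l c) (sumQ-single NR j zeros))
    where
    zeros : ∀ k → k ≢ j → lookup c k Q.* f (rootQ k) ≡ 0ℚ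
    zeros k ne with f (rootQ k) QP.≟ 0ℚ
    ... | yes z = trans (cong (lookup c k Q.*_) z) (QP.*-zeroʳ (lookup c k))
    ... | no nz = trans (cong (Q._* f (rootQ k)) (sup k (λ s → nz (van k s ne)))) (QP.*-zeroˡ (f (rootQ k)))

  rootQ-ι : ∀ j → InM α j → lookup (rootQ j) ι ≡ 1ℚ
  rootQ-ι j m with rectOf j m
  ... | p , q , r , _ , e = trans (VP.lookup-map ι toQ (root j)) (cong toQ (trans (cong (λ v → lookup v ι) e) (coord-rect r)))

  -- α occurs with coefficient 1 in every root of M_α.
  opaque
    coord-sum : ∀ {S} → ⊆Mᵖ S → ∀ c → SupportedQ S c → lookup (combQ c) ι ≡ sumQ NR (lookup c)
    coord-sum {S} sub c sup = trans (lookup-combQ c ι) (ΣQ.sum-cong NR term)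
      where
      term : ∀ j → lookup c j Q.* lookup (rootQ j) ι ≡ lookup c j
      term j with lookup (rootQ j) ι QP.≟ 1ℚ
      ... | yes e = trans (cong (lookup c j Q.*_) e) (QP.*-identityʳ (lookup c j))
      ... | no ne = trans (cong (Q._* lookup (rootQ j) ι) z) (trans (QP.*-zeroˡ (lookup (rootQ j) ι)) (sym z))
        where
        z : lookup c j ≡ 0ℚ
        z = sup j (λ s → ne (rootQ-ι j (sub j s)))

  wall : ℕ → ℕ → Quad
  wall a b = (a , b) , (suc i , 0)

  U0 : ∀ p q → Ucell 0 p q ≡ + 0
  U0 p q = cong₂ _-_ (lt-no z≤n) (lt-no z≤n)

  Ui : ∀ {p q} → Rect p q → Ucell (suc i) p q ≡ + 1
  Ui r = trans (U-left r NP.≤-refl) (lt-yes (s≤s (proj₁ r)))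

  -- For b = d + 1 the value is [p < a] - [q ≤ d]: it is 1 on the cells that exceed (a , d) strictly
  -- at both ends, -1 on the cells below (a , d) in the root order of cells, and 0 elsewhere. An
  -- ideal without (a , d) contains no cell of the second kind, and the border of an ideal with (a ,
  -- d) none of the first.
  wall-val : ∀ {a b p q} → a N.≤ suc i → suc i N.≤ b → Rect p q → Vcell (wall a b) p q ≡ lt a p - lt b q
  wall-val {a} {b} {p} {q} la lb r = trans (cong₂ _-_ (cong₂ _+_ (U-left r la) (U-right r lb)) (cong₂ _+_ (Ui r) (U0 p q))) (lem (lt a p) (lt b q))
    where
    lem : ∀ x y → (x + (+ 1 - y)) - (+ 1 + + 0) ≡ x - y
    lem = solve-∀

  left-val : ∀ {a p q} → a N.≤ i → Rect p q → Vcell ((suc a , 0) , (a , 0)) p q ≡ eqi p a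
  left-val {a} {p} {q} la r = trans (cong₂ _-_ (cong₂ _+_ (trans (U-left r (s≤s la)) (lt-suc a p)) (U0 p q)) (cong₂ _+_ (U-left r (NP.m≤n⇒m≤1+n la)) (U0 p q)))
    (lem (lt a p) (eqi p a))
    where
    lem : ∀ x y → ((x + y) + + 0) - (x + + 0) ≡ y
    lem = solve-∀

  right-val : ∀ {d p q} → i N.< d → Rect p q → Vcell ((d , 0) , (suc d , 0)) p q ≡ eqi q d
  right-val {d} {p} {q} ld r = trans (cong₂ _-_ (cong₂ _+_ (U-right r ld) (U0 p q)) (cong₂ _+_ (trans (U-right r (NP.m≤n⇒m≤1+n ld)) (cong (λ z → + 1 - z) (lt-suc d q))) (U0 p q)))
    (lem (lt d q) (eqi q d))
    where
    lem : ∀ x y → ((+ 1 - x) + + 0) - ((+ 1 - (x + y)) + + 0) ≡ y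
    lem = solve-∀

-- Inequalities describing a border simplex; independence of the border

module Regions (t : RType) (n : ℕ) (valid : ValidRank t n) (ι : Fin n) (long : LongIx t n (toℕ ι)) where
  open Functionals t n valid ι long public

  opaque
    _∈R?_ : ∀ v J → Dec (v ∈R J)
    v ∈R? J = FP.any? (λ j → (j SP.∈? J) ×-dec VP.≡-dec ZP._≟_ (root j) v)

  IsBorderCell : RSet → ℕ → ℕ → Set
  IsBorderCell J p q = Er p q ∈R J × ¬ (Er (suc p) (N.pred q) ∈R J)

  opaque
    border-cell : ∀ {J p q} → J ⊆M → IsCell (InBorder J) p q → IsBorderCell J p q
    border-cell sub (r , j , b , e) = in⇒ (proj₁ b) e , border⇒ sub r e b

  ideal-cell : ∀ {J p q} → IsCell (_∈ J) p q → Er p q ∈R J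
  ideal-cell (_ , j , m , e) = in⇒ m e

  h<suc : ∀ {d} → i N.< d → suc i N.≤ suc d
  h<suc l = NP.m≤n⇒m≤1+n l

  opaque
    out-val : ∀ {J a d p q} → DualOrderIdeal J → Rect a d → ¬ (Er a d ∈R J) → Rect p q → Er p q ∈R J →
      + 0 ≤ Vcell (wall a (suc d)) p q
    out-val {J} {a} {d} {p} {q} ideal (la , ld , ld′) nm r m = subst (+ 0 ≤_) (sym (wall-val (NP.m≤n⇒m≤1+n la) (h<suc ld) r)) go
      where
      go : + 0 ≤ lt a p - lt (suc d) q
      go with p N.<? a
      ... | yes p<a = subst (λ z → + 0 ≤ z - lt (suc d) q) (sym (lt-yes p<a)) (ZP.i≤j⇒0≤j-i (le1 (suc d) q))
        where
        le1 : ∀ k r → lt k r ≤ + 1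
        le1 k r with r N.<? k
        ... | yes l = ZP.≤-reflexive (lt-yes l)
        ... | no l = subst (_≤ + 1) (sym (lt-no (NP.≮⇒≥ l))) (Z.+≤+ z≤n)
      ... | no p≮a with q N.≤? d
      ... | yes q≤d = ⊥-elim (nm (upR ideal r m (NP.≮⇒≥ p≮a) q≤d ld′))
      ... | no q≰d = ZP.≤-reflexive (sym (cong₂ _-_ (lt-no (NP.≮⇒≥ p≮a)) (lt-no (NP.≰⇒> q≰d))))

  opaque
    -- If p < a and d < q, then (p + 1 , q - 1) still dominates (a , d) and so lies in J, which a
    -- border cell does not allow.
    inner : ∀ {J a d p q} → DualOrderIdeal J → Rect a d → Er a d ∈R J → Rect p q → IsBorderCell J p q → p N.< a → ¬ (d N.< q)
    inner {q = suc q} ideal ra m (_ , _ , hq) (_ , nm) p<a (s≤s d≤q) = nm (upR ideal ra m p<a d≤q (NP.<⇒≤ hq))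

  opaque
    in-val : ∀ {J a d p q} → DualOrderIdeal J → Rect a d → Er a d ∈R J → Rect p q → IsBorderCell J p q →
      + 0 ≤ Vcell (neg (wall a (suc d))) p q
    in-val {J} {a} {d} {p} {q} ideal ra@(la , ld , _) m r b = subst (+ 0 ≤_) (sym (trans (Vcell-neg (wall a (suc d)) p q) (cong -_ (wall-val (NP.m≤n⇒m≤1+n la) (h<suc ld) r)))) go
      where
      go : + 0 ≤ - (lt a p - lt (suc d) q)
      go with p N.<? a
      ... | no p≮a = subst (λ z → + 0 ≤ - (z - lt (suc d) q)) (sym (lt-no (NP.≮⇒≥ p≮a))) (subst (+ 0 ≤_) (lem (lt (suc d) q)) (ge0 (suc d) q))
        where
        ge0 : ∀ k r → + 0 ≤ lt k r
        ge0 k r with r N.<? k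
        ... | yes l = subst (+ 0 ≤_) (sym (lt-yes l)) (Z.+≤+ z≤n)
        ... | no l = ZP.≤-reflexive (sym (lt-no (NP.≮⇒≥ l)))
        lem : ∀ a → a ≡ - (+ 0 - a)
        lem = solve-∀
      ... | yes p<a = ZP.≤-reflexive (sym (cong₂ (λ x y → - (x - y)) (lt-yes p<a) (lt-yes (s≤s (NP.≮⇒≥ (inner ideal ra m r b p<a))))))

  -- Inequalities valid on the convex hull of the border of J. They also suffice to make barycentric
  -- coordinates nonnegative, because each functional supplied by `dual` is, up to sign, one of
  -- those listed here.
  record Region (J : RSet) (x : Vec ℚ n) : Set where
    field
      inside : ∀ {a d} → Rect a d → Er a d ∈R J → q4 (wall a (suc d)) x Q.≤ 0ℚ
      outside : ∀ {a d} → Rect a d → ¬ (Er a d ∈R J) → 0ℚ Q.≤ q4 (wall a (suc d)) x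
      left : ∀ {a} → a N.≤ i → 0ℚ Q.≤ q4 ((suc a , 0) , (a , 0)) x
      right : ∀ {d} → i N.< d → 0ℚ Q.≤ q4 ((d , 0) , (suc d , 0)) x

  neg≥0 : ∀ K x → 0ℚ Q.≤ q4 (neg K) x → q4 K x Q.≤ 0ℚ
  neg≥0 K x l = subst (Q._≤ 0ℚ) (trans (cong Q.-_ (q4-neg K x)) (negQ-involutive (q4 K x))) (QP.neg-antimono-≤ l)

  conv-left : ∀ {S x a} → ⊆Mᵖ S → a N.≤ i → InConv S x → 0ℚ Q.≤ q4 ((suc a , 0) , (a , 0)) x
  conv-left {S} {a = a} sub la = q4-conv ((suc a , 0) , (a , 0)) {S} sub (λ {p} c → subst (+ 0 ≤_) (sym (left-val la (proj₁ c))) (eqi≥0 p a))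

  conv-right : ∀ {S x d} → ⊆Mᵖ S → i N.< d → InConv S x → 0ℚ Q.≤ q4 ((d , 0) , (suc d , 0)) x
  conv-right {S} {d = d} sub ld = q4-conv ((d , 0) , (suc d , 0)) {S} sub (λ {p} {q} c → subst (+ 0 ≤_) (sym (right-val ld (proj₁ c))) (eqi≥0 q d))

  conv-outside : ∀ {I x a d} → DualOrderIdeal I → I ⊆M → Rect a d → ¬ (Er a d ∈R I) → InConv (_∈ I) x → 0ℚ Q.≤ q4 (wall a (suc d)) x
  conv-outside {I} {a = a} {d} ideal sub r nm = q4-conv (wall a (suc d)) {_∈ I} sub (λ c → out-val ideal r nm (proj₁ c) (ideal-cell c))

  border⊆M : ∀ {J} → J ⊆M → ⊆Mᵖ (InBorder J)
  border⊆M sub j b = sub j (proj₁ b)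

  conv-mono : ∀ {S S′ x} → (∀ j → S j → S′ j) → InConv S x → InConv S′ x
  conv-mono f (c , sup , r) = c , (λ j ns → sup j (ns ∘ f j)) , r

  opaque
    border-region : ∀ {J x} → DualOrderIdeal J → J ⊆M → InConv (InBorder J) x → Region J x
    border-region {J} {x} ideal sub ic = record
      { inside = λ {a} {d} r m → neg≥0 (wall a (suc d)) x (q4-conv (neg (wall a (suc d))) {InBorder J} (border⊆M sub) (λ c → in-val ideal r m (proj₁ c) (border-cell sub c)) ic)
      ; outside = λ r nm → conv-outside ideal sub r nm (conv-mono (λ j → proj₁) ic)
      ; left = λ la → conv-left (border⊆M sub) la ic
      ; right = λ ld → conv-right (border⊆M sub) ld ic
      }

  -- Up to scale the barycentric coordinate of the border cell (a , d), as a function on cells.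
  record Dual (J : RSet) (a d : ℕ) : Set where
    field
      K : Quad
      self : Vcell K a d ≡ + 1
      other : ∀ {p q} → Rect p q → IsBorderCell J p q → (p ≡ a × q ≡ d) ⊎ Vcell K p q ≡ + 0
      pos : ∀ x → Region J x → 0ℚ Q.≤ q4 K x

  opaque
    -- The border is a lattice path, and its shape at (a , d) is decided by the cells (a + 1 , d)
    -- and (a , d - 1). If both are in J, the wall of the missing cell (a + 1 , d - 1) is dual to (a
    -- , d). If only the first is, (a , d) is the sole border cell of row a; if only the second, the
    -- sole one of column d; then the indicator of that row or column serves. If neither is, (a , d)
    -- is minimal in J and its own wall, with the sign reversed, is dual to it.
    dual : ∀ {J a d} → DualOrderIdeal J → J ⊆M → Rect a d → IsBorderCell J a d → Dual J a d
    dual {J} {a} {suc d} ideal sub ra@(la , s≤s ld , hd) (m , nm) with Er (suc a) (suc d) ∈R? J | Er a d ∈R? J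
    ... | yes m₁ | yes m₂ = record { K = wall (suc a) (suc d) ; self = self′ ; other = other′ ; pos = λ x R → Region.outside R r⁻ nm }
      where
      ah : suc a N.≤ h
      ah = NP.<-≤-trans (proj₁ (rect≤ ra)) hd
      r₁ : Rect (suc a) (suc d)
      r₁ = cell-rect sub ah hd m₁
      r₂ : Rect a d
      r₂ = cell-rect sub (NP.<⇒≤ ah) (NP.<⇒≤ hd) m₂
      r⁻ : Rect (suc a) d
      r⁻ = proj₁ r₁ , proj₁ (proj₂ r₂) , proj₂ (proj₂ r₂)
      val : ∀ {p q} → Rect p q → Vcell (wall (suc a) (suc d)) p q ≡ lt (suc a) p - lt (suc d) q
      val = wall-val (s≤s la) (s≤s ld)
      self′ : Vcell (wall (suc a) (suc d)) a (suc d) ≡ + 1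
      self′ = trans (val ra) (cong₂ _-_ (lt-yes NP.≤-refl) (lt-no NP.≤-refl))
      other′ : ∀ {p q} → Rect p q → IsBorderCell J p q → (p ≡ a × q ≡ suc d) ⊎ Vcell (wall (suc a) (suc d)) p q ≡ + 0
      other′ {p} {q} r b@(mc , nc) with p N.<? suc a | q N.<? suc d
      ... | yes x | yes y = inj₂ (trans (val r) (cong₂ _-_ (lt-yes x) (lt-yes y)))
      ... | no x | no y = inj₂ (trans (val r) (cong₂ _-_ (lt-no (NP.≮⇒≥ x)) (lt-no (NP.≮⇒≥ y))))
      ... | no x | yes y = ⊥-elim (nm (upR ideal r mc (NP.≮⇒≥ x) (NP.≤-pred y) (NP.<⇒≤ hd)))
      ... | yes x | no y with NP.m≤n⇒m<n∨m≡n (NP.≤-pred x) | NP.m≤n⇒m<n∨m≡n (NP.≮⇒≥ y)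
      ... | inj₁ p<a | _ = ⊥-elim (inner ideal r₂ m₂ r b p<a (NP.≮⇒≥ y))
      ... | inj₂ e | inj₁ d<q = ⊥-elim (inner ideal r₁ m₁ r b (subst (N._< suc a) (sym e) NP.≤-refl) d<q)
      ... | inj₂ e | inj₂ e′ = inj₁ (e , sym e′)
    ... | yes m₁ | no n₂ = record { K = (suc a , 0) , (a , 0) ; self = trans (left-val la ra) (eqi-yes refl) ; other = other′ ; pos = λ x R → Region.left R la }
      where
      r₁ : Rect (suc a) (suc d)
      r₁ = cell-rect sub (NP.<-≤-trans (proj₁ (rect≤ ra)) hd) hd m₁
      other′ : ∀ {p q} → Rect p q → IsBorderCell J p q → (p ≡ a × q ≡ suc d) ⊎ Vcell ((suc a , 0) , (a , 0)) p q ≡ + 0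
      other′ {p} {q} r b@(mc , nc) with p N.≟ a
      ... | no ne = inj₂ (trans (left-val la r) (eqi-no ne))
      ... | yes refl with NP.<-cmp q (suc d)
      ... | tri< (s≤s q≤d) _ _ = ⊥-elim (n₂ (upR ideal r mc NP.≤-refl q≤d (NP.<⇒≤ hd)))
      ... | tri≈ _ e _ = inj₁ (refl , e)
      ... | tri> _ _ g = ⊥-elim (inner ideal r₁ m₁ r b NP.≤-refl g)
    ... | no n₁ | yes m₂ = record { K = (suc d , 0) , (suc (suc d) , 0) ; self = trans (right-val (s≤s ld) ra) (eqi-yes refl) ; other = other′ ; pos = λ x R → Region.right R (s≤s ld) }
      where
      r₂ : Rect a d
      r₂ = cell-rect sub (NP.≤-trans la (NP.≤-pred i<h)) (NP.<⇒≤ hd) m₂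
      other′ : ∀ {p q} → Rect p q → IsBorderCell J p q → (p ≡ a × q ≡ suc d) ⊎ Vcell ((suc d , 0) , (suc (suc d) , 0)) p q ≡ + 0
      other′ {p} {q} r b@(mc , nc) with q N.≟ suc d
      ... | no ne = inj₂ (trans (right-val (s≤s ld) r) (eqi-no ne))
      ... | yes refl with NP.<-cmp p a
      ... | tri> _ _ g = ⊥-elim (n₁ (upR ideal r mc g NP.≤-refl hd))
      ... | tri≈ _ e _ = inj₁ (e , refl)
      ... | tri< l _ _ = ⊥-elim (inner ideal r₂ m₂ r b l NP.≤-refl)
    ... | no n₁ | no n₂ = record { K = neg (wall a (suc (suc d))) ; self = self′ ; other = other′
        ; pos = λ x R → subst (0ℚ Q.≤_) (sym (q4-neg (wall a (suc (suc d))) x)) (QP.neg-antimono-≤ (Region.inside R ra m)) }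
      where
      val : ∀ {p q} → Rect p q → Vcell (neg (wall a (suc (suc d)))) p q ≡ - (lt a p - lt (suc (suc d)) q)
      val {p} {q} r = trans (Vcell-neg (wall a (suc (suc d))) p q) (cong -_ (wall-val (NP.m≤n⇒m≤1+n la) (s≤s (NP.m≤n⇒m≤1+n ld)) r))
      self′ : Vcell (neg (wall a (suc (suc d)))) a (suc d) ≡ + 1
      self′ = trans (val ra) (cong₂ (λ x y → - (x - y)) (lt-no NP.≤-refl) (lt-yes NP.≤-refl))
      other′ : ∀ {p q} → Rect p q → IsBorderCell J p q → (p ≡ a × q ≡ suc d) ⊎ Vcell (neg (wall a (suc (suc d)))) p q ≡ + 0
      other′ {p} {q} r b@(mc , nc) with p N.<? a | q N.<? suc (suc d)
      ... | yes x | yes y = inj₂ (trans (val r) (cong₂ (λ x y → - (x - y)) (lt-yes x) (lt-yes y)))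
      ... | no x | no y = inj₂ (trans (val r) (cong₂ (λ x y → - (x - y)) (lt-no (NP.≮⇒≥ x)) (lt-no (NP.≮⇒≥ y))))
      ... | yes x | no y = ⊥-elim (inner ideal ra m r b x (NP.≮⇒≥ y))
      ... | no x | yes y with NP.m≤n⇒m<n∨m≡n (NP.≮⇒≥ x) | NP.m≤n⇒m<n∨m≡n (NP.≤-pred y)
      ... | inj₁ a<p | _ = ⊥-elim (n₁ (upR ideal r mc a<p (NP.≤-pred y) hd))
      ... | inj₂ refl | inj₁ (s≤s q≤d) = ⊥-elim (n₂ (upR ideal r mc NP.≤-refl q≤d (NP.<⇒≤ hd)))
      ... | inj₂ e | inj₂ e′ = inj₁ (sym e , e′)

  opaque
    -- The value on the root `e` is 2 when its cell is its own mirror, as always in type A, and 1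
    -- otherwise; hence only the lower bound. A different root has both of its cells different from
    -- that of `e`, so both contributions vanish.
    dual-root : ∀ {J e} → DualOrderIdeal J → J ⊆M → InBorder J e →
      Σ Quad λ K → 1ℚ Q.≤ q4 K (rootQ e) × (∀ k → InBorder J k → k ≢ e → q4 K (rootQ k) ≡ 0ℚ) × (∀ x → Region J x → 0ℚ Q.≤ q4 K x)
    dual-root {J} {e} ideal sub b with rectOf e (border⊆M sub e b)
    ... | a , d , r , _ , ee = K , 1≤ , zeros , pos
      where
      open Dual (dual ideal sub r (border-cell sub (r , e , b , ee)))
      IsB : ℕ → ℕ → Set
      IsB p q = Rect p q × IsBorderCell J p q
      mirB : ∀ {k p q} → Rect p q → InBorder J k → root k ≡ Er p q → IsB (mirL t n p q) (mirR t n p q)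
      mirB {k} rp bk ek with cell-mir {InBorder J} (rp , k , bk , ek)
      ... | c = proj₁ c , border-cell sub c
      V≥0 : ∀ {p q} → IsB p q → + 0 ≤ Vcell K p q
      V≥0 (rp , bp) with other rp bp
      ... | inj₁ (refl , refl) = subst (+ 0 ≤_) (sym self) (Z.+≤+ z≤n)
      ... | inj₂ z = ZP.≤-reflexive (sym z)
      1≤ : 1ℚ Q.≤ q4 K (rootQ e)
      1≤ = subst (1ℚ Q.≤_) (sym (q4-root K r ee)) (toQ-mono (ZP.+-mono-≤ (ZP.≤-reflexive (sym self)) (V≥0 (mirB r b ee))))
      zeros : ∀ k → InBorder J k → k ≢ e → q4 K (rootQ k) ≡ 0ℚ
      zeros k bk ne with rectOf k (border⊆M sub k bk)
      ... | p , q , rp , _ , ek = trans (q4-root K rp ek) (cong toQ (cong₂ _+_ z z′))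
        where
        z : Vcell K p q ≡ + 0
        z with other rp (border-cell sub (rp , k , bk , ek))
        ... | inj₁ (refl , refl) = ⊥-elim (ne (root-inj (trans ek (sym ee))))
        ... | inj₂ z = z
        z′ : Vcell K (mirL t n p q) (mirR t n p q) ≡ + 0
        z′ with other (proj₁ (mirB rp bk ek)) (proj₂ (mirB rp bk ek))
        ... | inj₂ z = z
        ... | inj₁ (e₁ , e₂) = ⊥-elim (ne (root-inj (trans ek (trans (sym (Er-mirror (proj₁ (proj₂ (rect≤ rp))) (proj₂ (proj₂ rp))))
          (trans (cong₂ Er e₁ e₂) (sym ee))))))

  nonneg-cancel : ∀ {a b} → 1ℚ Q.≤ b → 0ℚ Q.≤ a Q.* b → 0ℚ Q.≤ a
  nonneg-cancel {a} {b} 1≤b l = QP.*-cancelʳ-≤-pos b {{Q.positive (QP.<-≤-trans (Q.*<* (Z.+<+ (s≤s z≤n))) 1≤b)}}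
    (QP.≤-trans (QP.≤-reflexive (QP.*-zeroˡ b)) l)

  opaque
    region-nonneg : ∀ {J x} → DualOrderIdeal J → J ⊆M → Region J x → ∀ c → SupportedQ (InBorder J) c → combQ c ≡ x →
      ∀ j → 0ℚ Q.≤ lookup c j
    region-nonneg {J} {x} ideal sub R c sup e j with 0ℚ QP.≤? lookup c j
    ... | yes l = l
    ... | no ¬l = ⊥-elim (¬l (QP.≤-reflexive (sym (sup j (λ b → ¬l (go b))))))
      where
      go : InBorder J j → 0ℚ Q.≤ lookup c j
      go b with dual-root ideal sub b
      ... | K , 1≤ , zeros , pos = nonneg-cancel {lookup c j} {q4 K (rootQ j)} 1≤ (subst (0ℚ Q.≤_) (dual-value {InBorder J} {q4 K} (q4-lin K) j zeros c sup e) (pos x R))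

  yQ-zero : ∀ k → yQ k zeroQv ≡ 0ℚ
  yQ-zero k = ΣQ.sum-0 n (λ m → trans (cong (toQ (ywt t n k (toℕ m)) Q.*_) (VP.lookup-replicate m 0ℚ)) (QP.*-zeroʳ (toQ (ywt t n k (toℕ m)))))

  q4-zero : ∀ K → q4 K zeroQv ≡ 0ℚ
  q4-zero ((a , b) , (c , d)) = cong₂ Q._-_ (cong₂ Q._+_ (yQ-zero a) (yQ-zero b)) (cong₂ Q._+_ (yQ-zero c) (yQ-zero d))

  opaque
    independent : ∀ {J} → DualOrderIdeal J → J ⊆M → ∀ c → SupportedQ (InBorder J) c → combQ c ≡ zeroQv → ∀ j → lookup c j ≡ 0ℚ
    independent {J} ideal sub c sup e j with lookup c j QP.≟ 0ℚ
    ... | yes z = z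
    ... | no nz = ⊥-elim (nz (sup j (λ b → nz (go b))))
      where
      go : InBorder J j → lookup c j ≡ 0ℚ
      go b with dual-root ideal sub b
      ... | K , 1≤ , zeros , _ = QP.≤-antisym (neg≤ (nonneg-cancel {Q.- lookup c j} {q4 K (rootQ j)} 1≤ (QP.≤-reflexive (trans (sym (cong Q.-_ z)) (QP.neg-distribˡ-* (lookup c j) (q4 K (rootQ j)))))))
          (nonneg-cancel {lookup c j} {q4 K (rootQ j)} 1≤ (QP.≤-reflexive (sym z)))
        where
        z : lookup c j Q.* q4 K (rootQ j) ≡ 0ℚ
        z = trans (sym (dual-value {InBorder J} {q4 K} (q4-lin K) j zeros c sup e)) (q4-zero K)
        neg≤ : ∀ {a} → 0ℚ Q.≤ Q.- a → a Q.≤ 0ℚ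
        neg≤ {a} l = subst (Q._≤ 0ℚ) (negQ-involutive a) (QP.neg-antimono-≤ l)

-- Spanning ideals and integral bases

module Span (t : RType) (n : ℕ) (valid : ValidRank t n) (ι : Fin n) (long : LongIx t n (toℕ ι)) where
  open Regions t n valid ι long public

  Good : RSet → Set
  Good J = DualOrderIdeal J × J ⊆M × Er 0 (suc i) ∈R J × Er i h ∈R J

  i<h′ : suc i N.≤ h
  i<h′ = NP.≤-trans i<n (n≤hi t n)

  rectTop : Rect 0 (suc i)
  rectTop = z≤n , NP.≤-refl , i<h′

  rectSide : Rect i h
  rectSide = NP.≤-refl , i<h′ , NP.≤-refl

  GenZ : (Fin NR → Set) → Vec ℤ n → Set
  GenZ P x = Σ (Vec ℤ NR) λ c → SupportedZ P c × combZ c ≡ x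

  lookup-combZ : ∀ c k → lookup (combZ c) k ≡ sumZ NR (λ j → lookup c j * lookup (root j) k)
  lookup-combZ c k = VP.lookup∘tabulate (λ k → sumZ NR (λ j → lookup c j * lookup (root j) k)) k

  opaque
    gen-comb : ∀ {P m} (w : Fin m → ℤ) (v : Fin m → Vec ℤ n) → (∀ l → GenZ P (v l)) →
      ∀ x → (∀ k → sumZ m (λ l → w l * lookup (v l) k) ≡ lookup x k) → GenZ P x
    gen-comb {P} {m} w v gs x e = c , sup , lookup-ext eq
      where
      cv : Fin m → Fin NR → ℤ
      cv l j = lookup (proj₁ (gs l)) j
      c : Vec ℤ NR
      c = tabulate (λ j → sumZ m (λ l → w l * cv l j))
      lc : ∀ j → lookup c j ≡ sumZ m (λ l → w l * cv l j)
      lc j = VP.lookup∘tabulate (λ j → sumZ m (λ l → w l * cv l j)) j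
      sup : SupportedZ P c
      sup j np = trans (lc j) (ΣZ.sum-0 m (λ l → trans (cong (w l *_) (proj₁ (proj₂ (gs l)) j np)) (ZP.*-zeroʳ (w l))))
      re : ∀ r w c → r * (w * c) ≡ w * (c * r)
      re = solve-∀
      eq : ∀ k → lookup (combZ c) k ≡ lookup x k
      eq k = trans (lookup-combZ c k) (trans (ΣZ.sum-cong NR (λ j → trans (ZP.*-comm (lookup c j) (lookup (root j) k)) (trans (cong (lookup (root j) k *_) (lc j)) (sym (ΣZ.sum-⊗ m (lookup (root j) k) (λ l → w l * cv l j))))))
        (trans (ΣZ.sum-comm NR m (λ j l → lookup (root j) k * (w l * cv l j)))
        (trans (ΣZ.sum-cong m (λ l → trans (ΣZ.sum-cong NR (λ j → re (lookup (root j) k) (w l) (cv l j))) (trans (ΣZ.sum-⊗ NR (w l) (λ j → cv l j * lookup (root j) k))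
          (cong (w l *_) (trans (sym (lookup-combZ (proj₁ (gs l)) k)) (cong (λ v → lookup v k) (proj₂ (proj₂ (gs l)))))))))
        (e k))))

  opaque
    gen-root : ∀ {P j} → P j → GenZ P (root j)
    gen-root {P} {j} pj = c , sup , lookup-ext (λ k → trans (lookup-combZ c k) (trans (sumZ-single NR j (λ j′ ne → trans (cong (_* lookup (root j′) k) (trans (lc j′) (eqi-no (ne ∘ FP.toℕ-injective)))) (ZP.*-zeroˡ (lookup (root j′) k))))
        (trans (cong (_* lookup (root j) k) (trans (lc j) (eqi-yes refl))) (ZP.*-identityˡ (lookup (root j) k)))))
      where
      c : Vec ℤ NR
      c = tabulate (λ j′ → eqi (toℕ j′) (toℕ j))
      lc : ∀ j′ → lookup c j′ ≡ eqi (toℕ j′) (toℕ j)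
      lc j′ = VP.lookup∘tabulate (λ j′ → eqi (toℕ j′) (toℕ j)) j′
      sup : SupportedZ P c
      sup j′ np = trans (lc j′) (eqi-no (λ e → np (subst P (sym (FP.toℕ-injective e)) pj)))
      sumZ-single : ∀ m (k : Fin m) {f : Fin m → ℤ} → (∀ j → j ≢ k → f j ≡ + 0) → sumZ m f ≡ f k
      sumZ-single (suc m) F.zero {f} h = trans (cong (_+_ (f F.zero)) (ΣZ.sum-0 m (λ j → h (F.suc j) (λ ())))) (ZP.+-identityʳ (f F.zero))
      sumZ-single (suc m) (F.suc k) {f} h = trans (cong₂ _+_ (h F.zero (λ ())) (sumZ-single m k (λ j ne → h (F.suc j) (ne ∘ FP.suc-injective)))) (ZP.+-identityˡ (f (F.suc k)))

  opaque
    gen-3 : ∀ {P u v w} x → GenZ P u → GenZ P v → GenZ P w → (∀ k → lookup u k + lookup v k - lookup w k ≡ lookup x k) → GenZ P x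
    gen-3 {P} {u} {v} {w} x gu gv gw e = gen-comb {m = 3} coef vec gs x (λ k → trans (lem (lookup u k) (lookup v k) (lookup w k)) (e k))
      where
      coef : Fin 3 → ℤ
      coef F.zero = + 1
      coef (F.suc F.zero) = + 1
      coef (F.suc (F.suc F.zero)) = -[1+ 0 ]
      vec : Fin 3 → Vec ℤ n
      vec F.zero = u
      vec (F.suc F.zero) = v
      vec (F.suc (F.suc F.zero)) = w
      gs : ∀ l → GenZ P (vec l)
      gs F.zero = gu
      gs (F.suc F.zero) = gv
      gs (F.suc (F.suc F.zero)) = gw
      lem : ∀ a b c → + 1 * a + (+ 1 * b + (-[1+ 0 ] * c + + 0)) ≡ a + b - c
      lem = solve-∀

  -- A cell of J off the border is (a+1 , d) + (a , d-1) − (a+1 , d-1), a combination of shorter cells of J.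
  opaque
    gen-cell : ∀ {J} → DualOrderIdeal J → J ⊆M → ∀ m {a d} → d N.≤ a N.+ m → Rect a d → Er a d ∈R J → GenZ (InBorder J) (Er a d)
    gen-cell ideal sub zero {a} {d} le r _ = ⊥-elim (NP.<⇒≱ (proj₁ (rect≤ r)) (subst (d N.≤_) (NP.+-identityʳ a) le))
    gen-cell {J} ideal sub (suc m) {a} {suc d} le r@(la , ld , hd) c with Er (suc a) d ∈R? J
    ... | no nm = subst (GenZ (InBorder J)) (proj₂ (proj₂ c)) (gen-root (border⇐ sub r (proj₂ (proj₂ c)) (proj₁ (proj₂ c)) nm))
    ... | yes m⁻ = gen-3 (Er a (suc d))
        (gen-cell ideal sub m (subst (suc d N.≤_) (NP.+-suc a m) le) r₁ (upR ideal r⁻ m⁻ NP.≤-refl (NP.n≤1+n d) hd))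
        (gen-cell ideal sub m (NP.≤-pred (subst (suc d N.≤_) (NP.+-suc a m) le)) r₂ (upR ideal r⁻ m⁻ (NP.n≤1+n a) NP.≤-refl (NP.<⇒≤ hd)))
        (gen-cell ideal sub m (NP.m≤n⇒m≤1+n (NP.≤-pred (subst (suc d N.≤_) (NP.+-suc a m) le))) r⁻ m⁻)
        (λ k → trans (cong₂ _-_ (cong₂ _+_ (lookup-Er (suc a) (suc d) k) (lookup-Er a d k)) (lookup-Er (suc a) d k))
          (trans (lem (g (suc d) (toℕ k)) (g (suc a) (toℕ k)) (g d (toℕ k)) (g a (toℕ k))) (sym (lookup-Er a (suc d) k))))
      where
      ah : suc a N.≤ h
      ah = NP.<-≤-trans (proj₁ (rect≤ r)) hd
      r⁻ : Rect (suc a) d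
      r⁻ = cell-rect sub ah (NP.<⇒≤ hd) m⁻
      r₁ : Rect (suc a) (suc d)
      r₁ = proj₁ r⁻ , ld , hd
      r₂ : Rect a d
      r₂ = la , proj₁ (proj₂ r⁻) , NP.<⇒≤ hd
      lem : ∀ q p q′ p′ → (q - p) + (q′ - p′) - (q′ - p) ≡ q - p′
      lem = solve-∀

  opaque
    -- `Good` ideals contain the whole row 0 and the whole column h of M_α. For l < i, α_l is a
    -- difference of two cells of column h; for l > i, of two cells of row 0; and α itself is (i ,
    -- h) + (0 , i + 1) - (0 , h).
    gen-simple : ∀ {J} → Good J → ∀ l → GenZ (InBorder J) (simple n l)
    gen-simple {J} (ideal , sub , top , side) l = go (NP.<-cmp (toℕ l) i)
      where
      cell : ∀ {a d} → Rect a d → Er a d ∈R J → GenZ (InBorder J) (Er a d)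
      cell {a} {d} r m = gen-cell ideal sub d (NP.m≤n+m d a) r m
      sideCell : ∀ {a} → a N.≤ i → GenZ (InBorder J) (Er a h)
      sideCell la = cell (la , i<h′ , NP.≤-refl) (upR ideal rectSide side la NP.≤-refl NP.≤-refl)
      topCell : ∀ {d} → i N.< d → d N.≤ h → GenZ (InBorder J) (Er 0 d)
      topCell ld hd = cell (z≤n , ld , hd) (upR ideal rectTop top z≤n ld hd)
      coef : ∀ k → lookup (simple n l) k ≡ eqi (toℕ k) (cls t n (toℕ l))
      coef k = trans (lookup-simple n l k) (cong (eqi (toℕ k)) (sym (cls-id t n (FP.toℕ<n l))))
      three : ∀ {p q p′ q′ p″ q″} → (∀ k → (g q k - g p k) + (g q′ k - g p′ k) - (g q″ k - g p″ k) ≡ eqi k (cls t n (toℕ l))) →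
        GenZ (InBorder J) (Er p q) → GenZ (InBorder J) (Er p′ q′) → GenZ (InBorder J) (Er p″ q″) → GenZ (InBorder J) (simple n l)
      three {p} {q} {p′} {q′} {p″} {q″} e a b c = gen-3 (simple n l) a b c (λ k → trans (cong₂ _-_ (cong₂ _+_ (lookup-Er p q k) (lookup-Er p′ q′ k)) (lookup-Er p″ q″ k))
        (trans (e (toℕ k)) (sym (coef k))))
      zeroV : Vec ℤ n
      zeroV = V.replicate n (+ 0)
      gen-zero : GenZ (InBorder J) zeroV
      gen-zero = gen-comb {m = 0} (λ ()) (λ ()) (λ ()) zeroV (λ k → sym (VP.lookup-replicate k (+ 0)))
      two : ∀ {p q p″ q″} → (∀ k → (g q k - g p k) - (g q″ k - g p″ k) ≡ eqi k (cls t n (toℕ l))) →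
        GenZ (InBorder J) (Er p q) → GenZ (InBorder J) (Er p″ q″) → GenZ (InBorder J) (simple n l)
      two {p} {q} {p″} {q″} e a c = gen-3 (simple n l) a gen-zero c (λ k → trans (cong₂ _-_ (cong₂ _+_ (lookup-Er p q k) (VP.lookup-replicate k (+ 0))) (lookup-Er p″ q″ k))
        (trans (cong (_- (g q″ (toℕ k) - g p″ (toℕ k))) (ZP.+-identityʳ (g q (toℕ k) - g p (toℕ k)))) (trans (e (toℕ k)) (sym (coef k)))))
      lem₁ : ∀ a b c → (a - b) - (a - (b + c)) ≡ c
      lem₁ = solve-∀
      lem₂ : ∀ a b c → ((a + c) - b) - (a - b) ≡ c
      lem₂ = solve-∀
      lem₃ : ∀ H b c → (H - b) + ((b + c) - + 0) - (H - + 0) ≡ c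
      lem₃ = solve-∀
      go : Tri (toℕ l N.< i) (toℕ l ≡ i) (toℕ l N.> i) → GenZ (InBorder J) (simple n l)
      go (tri< c _ _) = two {toℕ l} {h} {suc (toℕ l)} {h} (λ k → lem₁ (g h k) (g (toℕ l) k) (eqi k (cls t n (toℕ l)))) (sideCell (NP.<⇒≤ c)) (sideCell c)
      go (tri> _ _ c) = two {0} {suc (toℕ l)} {0} {toℕ l} (λ k → lem₂ (g (toℕ l) k) (+ 0) (eqi k (cls t n (toℕ l))))
        (topCell (NP.m≤n⇒m≤1+n c) l<h) (topCell c (NP.<⇒≤ l<h))
        where
        l<h : suc (toℕ l) N.≤ h
        l<h = NP.≤-trans (FP.toℕ<n l) (n≤hi t n)
      go (tri≈ _ e _) = three {toℕ l} {h} {0} {suc (toℕ l)} {0} {h} (λ k → lem₃ (g h k) (g (toℕ l) k) (eqi k (cls t n (toℕ l))))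
        (sideCell (NP.≤-reflexive e)) (topCell (s≤s (NP.≤-reflexive (sym e))) (NP.≤-trans (FP.toℕ<n l) (n≤hi t n))) (sideCell z≤n)

  opaque
    delta-sum : ∀ (x : Vec ℤ n) k → sumZ n (λ l → lookup x l * lookup (simple n l) k) ≡ lookup x k
    delta-sum x k = trans (ΣZ.sum-cong n (λ l → cong₂ _*_ (xl l) (trans (lookup-simple n l k) (eqi-⇔ sym sym)))) (trans (sumZ-eqi n f (FP.toℕ<n k)) (sym (xl k)))
      where
      -- `sumZ-eqi` sums functions of natural numbers, so the coordinates of `x` are extended by 0.
      f : ℕ → ℤ
      f m with m N.<? n
      ... | yes l = lookup x (fromℕ< l)
      ... | no _ = + 0
      xl : ∀ l → lookup x l ≡ f (toℕ l)
      xl l with toℕ l N.<? n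
      ... | yes p = cong (lookup x) (FP.toℕ-injective (sym (FP.toℕ-fromℕ< p)))
      ... | no np = ⊥-elim (np (FP.toℕ<n l))

  opaque
    gen-all : ∀ {J} → Good J → ∀ x → GenZ (InBorder J) x
    gen-all good x = gen-comb (lookup x) (simple n) (gen-simple good) x (delta-sum x)

  combQ-toQ : ∀ c → combQ (V.map toQ c) ≡ toQv (combZ c)
  combQ-toQ c = lookup-ext (λ k → trans (lookup-combQ (V.map toQ c) k) (trans (ΣQ.sum-cong NR (λ j → trans (cong₂ Q._*_ (VP.lookup-map j toQ c) (VP.lookup-map k toQ (root j)))
      (sym (toQ-* (lookup c j) (lookup (root j) k)))))
    (trans (sym (toQ-sum NR (λ j → lookup c j * lookup (root j) k))) (trans (cong toQ (sym (lookup-combZ c k))) (sym (VP.lookup-map k toQ (combZ c)))))))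

  supported-toQ : ∀ {P c} → SupportedZ P c → SupportedQ P (V.map toQ c)
  supported-toQ {c = c} sup j np = trans (VP.lookup-map j toQ c) (cong toQ (sup j np))

  opaque
    zbasis : ∀ {J} → Good J → ZBasis (InBorder J)
    zbasis good@(ideal , sub , _) = gen-all good , λ c sup e j → toQ-inj (trans (sym (VP.lookup-map j toQ c))
      (independent ideal sub (V.map toQ c) (supported-toQ {c = c} sup) (trans (combQ-toQ c) (trans (cong toQv e) (VP.map-replicate toQ (+ 0) n))) j))

  opaque
    spansQ : ∀ {J} → Good J → SpansE (InBorder J)
    spansQ {J} good x = c , sup , lookup-ext eq
      where
      cz : Fin n → Vec ℤ NR
      cz l = proj₁ (gen-simple good l)
      cv : Fin n → Fin NR → ℚ
      cv l j = lookup (V.map toQ (cz l)) j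
      c : Vec ℚ NR
      c = tabulate (λ j → sumQ n (λ l → lookup x l Q.* cv l j))
      lc : ∀ j → lookup c j ≡ sumQ n (λ l → lookup x l Q.* cv l j)
      lc j = VP.lookup∘tabulate (λ j → sumQ n (λ l → lookup x l Q.* cv l j)) j
      sup : SupportedQ (InBorder J) c
      sup j np = trans (lc j) (ΣQ.sum-0 n (λ l → trans (cong (lookup x l Q.*_) (supported-toQ {c = cz l} (proj₁ (proj₂ (gen-simple good l))) j np)) (QP.*-zeroʳ (lookup x l))))
      re : ∀ r w c → r Q.* (w Q.* c) ≡ w Q.* (c Q.* r)
      re r w c = trans (QP.*-comm r (w Q.* c)) (QP.*-assoc w c r)
      col : ∀ l k → sumQ NR (λ j → cv l j Q.* lookup (rootQ j) k) ≡ toQ (lookup (simple n l) k)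
      col l k = trans (sym (lookup-combQ (V.map toQ (cz l)) k)) (trans (cong (λ v → lookup v k) (trans (combQ-toQ (cz l)) (cong toQv (proj₂ (proj₂ (gen-simple good l)))))) (VP.lookup-map k toQ (simple n l)))
      delta : ∀ k → sumQ n (λ l → lookup x l Q.* toQ (lookup (simple n l) k)) ≡ lookup x k
      delta k = trans (sumQ-single n k (λ l ne → trans (cong (λ z → lookup x l Q.* toQ z) (trans (lookup-simple n l k) (eqi-no (λ e → ne (FP.toℕ-injective (sym e)))))) (QP.*-zeroʳ (lookup x l))))
        (trans (cong (λ z → lookup x k Q.* toQ z) (trans (lookup-simple n k k) (eqi-yes refl))) (QP.*-identityʳ (lookup x k)))
      eq : ∀ k → lookup (combQ c) k ≡ lookup x k
      eq k = trans (lookup-combQ c k) (trans (ΣQ.sum-cong NR (λ j → trans (QP.*-comm (lookup c j) (lookup (rootQ j) k)) (trans (cong (lookup (rootQ j) k Q.*_) (lc j)) (sym (ΣQ.sum-⊗ n (lookup (rootQ j) k) (λ l → lookup x l Q.* cv l j))))))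
        (trans (ΣQ.sum-comm NR n (λ j l → lookup (rootQ j) k Q.* (lookup x l Q.* cv l j)))
        (trans (ΣQ.sum-cong n (λ l → trans (ΣQ.sum-cong NR (λ j → re (lookup (rootQ j) k) (lookup x l) (cv l j))) (trans (ΣQ.sum-⊗ NR (lookup x l) (λ j → cv l j Q.* lookup (rootQ j) k))
          (cong (lookup x l Q.*_) (col l k)))))
        (delta k))))

  good-spans : ∀ {J} → Good J → SpansE (_∈ J)
  good-spans good x with spansQ good x
  ... | c , sup , e = c , (λ j nm → sup j (nm ∘ proj₁)) , e

  lin-vanish : ∀ K {S x} → (∀ j → S j → q4 K (rootQ j) ≡ 0ℚ) → ∀ c → SupportedQ S c → combQ c ≡ x → q4 K x ≡ 0ℚ
  lin-vanish K {S} van c sup e = trans (cong (q4 K) (sym e)) (trans (q4-lin K c) (ΣQ.sum-0 NR term))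
    where
    term : ∀ j → lookup c j Q.* q4 K (rootQ j) ≡ 0ℚ
    term j with q4 K (rootQ j) QP.≟ 0ℚ
    ... | yes z = trans (cong (lookup c j Q.*_) z) (QP.*-zeroʳ (lookup c j))
    ... | no nz = trans (cong (Q._* q4 K (rootQ j)) (sup j (λ s → nz (van j s)))) (QP.*-zeroˡ (q4 K (rootQ j)))

  opaque
    -- A functional that vanishes on J but not on some root of M_α keeps that root out of the span.
    -- The last hypothesis prevents the mirror cell from cancelling the value 1.
    not-spanning : ∀ K {J a d} → J ⊆M → SpansE (_∈ J) → (∀ {p q} → Rect p q → Er p q ∈R J → Vcell K p q ≡ + 0) →
      Rect a d → Vcell K a d ≡ + 1 → + 0 ≤ Vcell K (mirL t n a d) (mirR t n a d) → ⊥
    not-spanning K {J} {a} {d} sub sp van r one nn with idx (proj₁ (rect≤ r)) (proj₂ (proj₂ r))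
    ... | e , ee with sp (rootQ e)
    ... | c , sup , eq = 1≰0q (subst (1ℚ Q.≤_) (lin-vanish K {_∈ J} zeros c sup eq) (subst (1ℚ Q.≤_) (sym (q4-root K r ee)) (toQ-mono (ZP.+-mono-≤ (ZP.≤-reflexive (sym one)) nn))))
      where
      1≰0q : ¬ (1ℚ Q.≤ 0ℚ)
      1≰0q (Q.*≤* (Z.+≤+ ()))
      zeros : ∀ j → j ∈ J → q4 K (rootQ j) ≡ 0ℚ
      zeros j m with rectOf j (sub j m)
      ... | p , q , rp , _ , ej = trans (q4-root K rp ej) (cong toQ (cong₂ _+_ (van rp (in⇒ m ej)) (van (rect-mir rp) (in⇒ m (trans ej (sym (Er-mirror (proj₁ (proj₂ (rect≤ rp))) (proj₂ (proj₂ rp)))))))))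

  opaque
    -- Any cell of J in column i + 1 would force (0 , i + 1) into J. If that cell is missing, the
    -- indicator of the column vanishes on J without vanishing on M_α. The same holds for row i and
    -- (i , h).
    spans-good : ∀ {J} → DualOrderIdeal J → J ⊆M → SpansE (_∈ J) → Good J
    spans-good {J} ideal sub sp = ideal , sub , top , side
      where
      top : Er 0 (suc i) ∈R J
      top with Er 0 (suc i) ∈R? J
      ... | yes m = m
      ... | no nm = ⊥-elim (not-spanning ((suc i , 0) , (suc (suc i) , 0)) sub sp
        (λ r m → trans (right-val NP.≤-refl r) (eqi-no (λ { refl → nm (upR ideal r m z≤n NP.≤-refl i<h′) })))
        rectTop (trans (right-val NP.≤-refl rectTop) (eqi-yes refl)) (subst (+ 0 ≤_) (sym (right-val NP.≤-refl (rect-mir rectTop))) (eqi≥0 (mirR t n 0 (suc i)) (suc i))))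
      side : Er i h ∈R J
      side with Er i h ∈R? J
      ... | yes m = m
      ... | no nm = ⊥-elim (not-spanning ((suc i , 0) , (i , 0)) sub sp
        (λ r m → trans (left-val NP.≤-refl r) (eqi-no (λ { refl → nm (upR ideal r m NP.≤-refl (proj₂ (proj₂ r)) NP.≤-refl) })))
        rectSide (trans (left-val NP.≤-refl rectSide) (eqi-yes refl)) (subst (+ 0 ≤_) (sym (left-val NP.≤-refl (rect-mir rectSide))) (eqi≥0 (mirL t n i h) i)))

-- y_k asks whether a path crosses the cut between k - 1 and k; the mirror moves this cut to the one
-- between h - k and h + 1 - k, and y_k counts both.
ywt-sym : ∀ n {k m} → suc k N.≤ suc (suc (hi C n)) → m N.≤ hi C n → ywt C n (suc (hi C n) ∸ k) m ≡ ywt C n k m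
ywt-sym n {k} {m} (s≤s k≤N) m≤h = trans (ZP.+-comm (eqi (suc m) (suc H ∸ k)) _) (cong₂ _+_
    (eqi-⇔ (λ e → NP.+-cancelʳ-≡ (suc H ∸ k) (suc m) k (trans (cong suc e) (sym (NP.m+[n∸m]≡n k≤N))))
           (λ { refl → NP.m+[n∸m]≡n (NP.≤-pred k≤N) }))
    (eqi-⇔ (λ e → NP.suc-injective (trans (cong (N._+ k) e) (NP.m∸n+n≡m k≤N)))
           (λ e → trans (sym (NP.m+n∸n≡m (suc m) k)) (cong (λ z → suc z ∸ k) e))))
  where
  H : ℕ
  H = hi C n

-- Only the sum of the two functionals of a wall is invariant under the mirror symmetry.
y-mirror : ∀ t n (f : ℕ → ℕ → ℚ) → (∀ k m → f k m ≡ toQ (ywt t n k m)) → ∀ {p q m} → p N.≤ hi t n → q N.≤ hi t n → m N.< n →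
  f (mirL t n p q) m Q.+ f (suc (mirR t n p q)) m ≡ f p m Q.+ f (suc q) m
y-mirror A n f ef hp hq l = refl
y-mirror C n f ef {p} {q} {m} hp hq l = trans (QP.+-comm (f (hi C n ∸ q) m) (f (suc (hi C n ∸ p)) m)) (cong₂ Q._+_
  (trans (cong (λ z → f z m) (sym (NP.+-∸-assoc 1 hp))) (s (NP.m≤n⇒m≤1+n (s≤s hp)))) (s (s≤s (s≤s hq))))
  where
  s : ∀ {k} → suc k N.≤ suc (suc (hi C n)) → f (suc (hi C n) ∸ k) m ≡ f k m
  s {k} le = trans (ef (suc (hi C n) ∸ k) m) (trans (cong toQ (ywt-sym n le (NP.≤-trans (NP.<⇒≤ l) (n≤hi C n)))) (sym (ef k m)))

can-or-mirror : ∀ t n {p q} → p N.≤ hi t n → q N.≤ hi t n → Can t n p q ⊎ Can t n (mirL t n p q) (mirR t n p q)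
can-or-mirror A n _ _ = inj₁ tt
can-or-mirror C n {p} {q} hp hq with p N.+ q N.≤? hi C n
... | yes c = inj₁ c
... | no nc = inj₂ (NP.+-cancelʳ-≤ (p N.+ q) _ _ (NP.≤-trans (NP.≤-reflexive e) (NP.+-monoʳ-≤ H (NP.<⇒≤ (NP.≰⇒> nc)))))
  where
  H : ℕ
  H = hi C n
  re : ∀ a b c d → (a N.+ b) N.+ (c N.+ d) ≡ (a N.+ d) N.+ (b N.+ c)
  re = NR.solve-∀
  e : ((H ∸ q) N.+ (H ∸ p)) N.+ (p N.+ q) ≡ H N.+ H
  e = trans (re (H ∸ q) (H ∸ p) p q) (cong₂ N._+_ (NP.m∸n+n≡m hq) (NP.m∸n+n≡m hp))

module Subsets {m : ℕ} {P : Fin m → Set} (P? : ∀ j → Dec (P j)) where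
  subset : Subset m
  subset = tabulate (λ j → does (P? j))

  ∈⇒ : ∀ {j} → j ∈ subset → P j
  ∈⇒ {j} m = go (P? j) (trans (sym (VP.lookup∘tabulate (λ j → does (P? j)) j)) (VP.[]=⇒lookup m))
    where
    go : ∀ (d : Dec (P j)) → does d ≡ true → P j
    go (yes p) _ = p

  ⇒∈ : ∀ {j} → P j → j ∈ subset
  ⇒∈ {j} p = VP.lookup⇒[]= j subset (trans (VP.lookup∘tabulate (λ j → does (P? j)) j) (dec-true (P? j) p))

-- The border simplices triangulate

module Triangulate (t : RType) (n : ℕ) (valid : ValidRank t n) (ι : Fin n) (long : LongIx t n (toℕ ι)) where
  open Span t n valid ι long public

  wall-mirror : ∀ {p q} → Rect p q → ∀ x → q4 (wall (mirL t n p q) (suc (mirR t n p q))) x ≡ q4 (wall p (suc q)) x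
  wall-mirror {p} {q} r x = cong (Q._- (yQ (suc i) x Q.+ yQ 0 x)) (trans (sym (ΣQ.sum-⊕ n (term p′) (term (suc q′)))) (trans (ΣQ.sum-cong n step) (ΣQ.sum-⊕ n (term p) (term (suc q)))))
    where
    p′ q′ : ℕ
    p′ = mirL t n p q
    q′ = mirR t n p q
    term : ℕ → Fin n → ℚ
    term k m = toQ (ywt t n k (toℕ m)) Q.* lookup x m
    step : ∀ m → term p′ m Q.+ term (suc q′) m ≡ term p m Q.+ term (suc q) m
    step m = trans (sym (QP.*-distribʳ-+ (lookup x m) (toQ (ywt t n p′ (toℕ m))) (toQ (ywt t n (suc q′) (toℕ m)))))
      (trans (cong (Q._* lookup x m) (y-mirror t n (λ k m → toQ (ywt t n k m)) (λ k m → refl) (proj₁ (proj₂ (rect≤ r))) (proj₂ (proj₂ r)) (FP.toℕ<n m)))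
        (QP.*-distribʳ-+ (lookup x m) (toQ (ywt t n p (toℕ m))) (toQ (ywt t n (suc q) (toℕ m)))))

  wallAt : Vec ℚ n → Fin NR → ℚ
  wallAt x j = q4 (wall (proj₁ (cellOf j)) (suc (proj₁ (proj₂ (cellOf j))))) x

  opaque
    -- `wallAt` uses whichever of the two cells `cellOf` returns. Mirror cells have the same wall,
    -- so the value depends on the root alone.
    wallAt-cell : ∀ x {j p q} → Rect p q → root j ≡ Er p q → wallAt x j ≡ q4 (wall p (suc q)) x
    wallAt-cell x {j} {p} {q} r e = go (cellOf j)
      where
      hp : p N.≤ h
      hp = proj₁ (proj₂ (rect≤ r))
      hq : q N.≤ h
      hq = proj₂ (proj₂ r)
      go : (c : ∃₂ λ p q → p N.< q × q N.≤ h × Can t n p q × root j ≡ Er p q) → q4 (wall (proj₁ c) (suc (proj₁ (proj₂ c)))) x ≡ q4 (wall p (suc q)) x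
      go (p₀ , q₀ , l₀ , h₀ , c₀ , e₀) = pick (can-or-mirror t n hp hq)
        where
        pick : Can t n p q ⊎ Can t n (mirL t n p q) (mirR t n p q) → q4 (wall p₀ (suc q₀)) x ≡ q4 (wall p (suc q)) x
        pick (inj₁ c) = same (Er-inj t n valid l₀ h₀ c₀ (proj₁ (rect≤ r)) hq c (trans (sym e₀) e))
          where
          same : p₀ ≡ p × q₀ ≡ q → q4 (wall p₀ (suc q₀)) x ≡ q4 (wall p (suc q)) x
          same (ep , eq) = cong₂ (λ a b → q4 (wall a (suc b)) x) ep eq
        pick (inj₂ c) = same (Er-inj t n valid l₀ h₀ c₀ (proj₁ (rect≤ (rect-mir r))) (proj₂ (proj₂ (rect-mir r))) c (trans (sym e₀) (trans e (sym (Er-mirror hp hq)))))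
          where
          same : p₀ ≡ mirL t n p q × q₀ ≡ mirR t n p q → q4 (wall p₀ (suc q₀)) x ≡ q4 (wall p (suc q)) x
          same (ep , eq) = trans (cong₂ (λ a b → q4 (wall a (suc b)) x) ep eq) (wall-mirror r x)

  -- The simplex containing x ∈ conv I: the roots whose walls are nonpositive at x.
  module Cut (I : RSet) (good : Good I) (x : Vec ℚ n) (xI : InConv (_∈ I) x) where
    idealI : DualOrderIdeal I
    idealI = proj₁ good
    subI : I ⊆M
    subI = proj₁ (proj₂ good)

    open Subsets {P = λ j → j ∈ I × wallAt x j Q.≤ 0ℚ} (λ j → (j SP.∈? I) ×-dec (wallAt x j QP.≤? 0ℚ)) renaming (subset to J) public

    J⊆I : J ⊆ I
    J⊆I j m = proj₁ (∈⇒ m)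

    subJ : J ⊆M
    subJ j m = subI j (J⊆I j m)

    member : ∀ {p q} → Rect p q → Er p q ∈R I → q4 (wall p (suc q)) x Q.≤ 0ℚ → Er p q ∈R J
    member r (j , m , e) le = j , ⇒∈ (m , subst (Q._≤ 0ℚ) (sym (wallAt-cell x r e)) le) , e

    0≤-⇒≤ : ∀ {a b} → 0ℚ Q.≤ a Q.- b → b Q.≤ a
    0≤-⇒≤ {a} {b} l = subst₂ Q._≤_ (QP.+-identityˡ b) (trans (QP.+-assoc a (Q.- b) b) (trans (cong (a Q.+_) (QP.+-inverseˡ b)) (QP.+-identityʳ a))) (QP.+-monoˡ-≤ b l)

    -- Enlarging the cell lowers its wall at points of conv I, because both ends of the difference
    -- are monotone indicators on M_α. This is why the roots with nonpositive walls form a dual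
    -- order ideal.
    wall-anti : ∀ {p q p′ q′} → Rect p q → Rect p′ q′ → p′ N.≤ p → q N.≤ q′ → q4 (wall p′ (suc q′)) x Q.≤ q4 (wall p (suc q)) x
    wall-anti {p} {q} {p′} {q′} r@(lp , lq , _) r′@(lp′ , lq′ , _) a b = QP.+-monoˡ-≤ (Q.- (yQ (suc i) x Q.+ yQ 0 x))
      (0≤-⇒≤ {yQ p x Q.+ yQ (suc q) x} {yQ p′ x Q.+ yQ (suc q′) x} (q4-conv ((p , suc q) , (p′ , suc q′)) {_∈ I} subI (λ {u} {v} c → subst (+ 0 ≤_) (sym (val c)) (pos u v)) xI))
      where
      val : ∀ {u v} → IsCell (_∈ I) u v → Vcell ((p , suc q) , (p′ , suc q′)) u v ≡ (lt p u + (+ 1 - lt (suc q) v)) - (lt p′ u + (+ 1 - lt (suc q′) v))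
      val (rc , _) = cong₂ _-_ (cong₂ _+_ (U-left rc (NP.m≤n⇒m≤1+n lp)) (U-right rc (h<suc lq))) (cong₂ _+_ (U-left rc (NP.m≤n⇒m≤1+n lp′)) (U-right rc (h<suc lq′)))
      pos : ∀ u v → + 0 ≤ (lt p u + (+ 1 - lt (suc q) v)) - (lt p′ u + (+ 1 - lt (suc q′) v))
      pos u v = ≤-by₂ (lt-mono u a) (lt-mono v (s≤s b)) (lem (lt p u) (lt p′ u) (lt (suc q) v) (lt (suc q′) v))
        where
        lem : ∀ a b c d → (a - b) + (d - c) ≡ ((a + (+ 1 - c)) - (b + (+ 1 - d))) - + 0
        lem = solve-∀

    idealJ : DualOrderIdeal J
    idealJ j k m le = go (rectOf j (subJ j m)) (rectOf k (subI k kI))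
      where
      kI : k ∈ I
      kI = idealI j k (J⊆I j m) le
      go : (∃₂ λ p q → Rect p q × Can t n p q × root j ≡ Er p q) → (∃₂ λ p q → Rect p q × Can t n p q × root k ≡ Er p q) → k ∈ J
      go (p , q , r , c , e) (p′ , q′ , r′ , c′ , e′) = in⇐ (member r′ (in⇒ kI e′) (QP.≤-trans (wall-anti r r′ (proj₁ dom) (proj₂ dom))
          (subst (Q._≤ 0ℚ) (wallAt-cell x r e) (proj₂ (∈⇒ m))))) e′
        where
        dom : p′ N.≤ p × q N.≤ q′
        dom = dominance t n valid (proj₁ (rect≤ r)) (proj₂ (proj₂ r)) c (proj₁ (rect≤ r′)) (proj₂ (proj₂ r′)) c′ (subst₂ _≼_ e e′ le)

    lt≤1 : ∀ k r → lt k r ≤ + 1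
    lt≤1 k r with r N.<? k
    ... | yes l = ZP.≤-reflexive (lt-yes l)
    ... | no l = subst (_≤ + 1) (sym (lt-no (NP.≮⇒≥ l))) (Z.+≤+ z≤n)

    lt≥0 : ∀ k r → + 0 ≤ lt k r
    lt≥0 k r with r N.<? k
    ... | yes l = subst (+ 0 ≤_) (sym (lt-yes l)) (Z.+≤+ z≤n)
    ... | no l = ZP.≤-reflexive (sym (lt-no (NP.≮⇒≥ l)))

    -- Meant for (0 , i + 1) and (i , h): no cell has p < 0 or q > h, so their walls are nonpositive
    -- on all of M_α. Hence `J` always retains these two cells and its border spans.
    extreme : ∀ {a d} → Rect a d → Er a d ∈R I → (∀ u v → v N.≤ h → + 0 ≤ - (lt a u - lt (suc d) v)) → Er a d ∈R J
    extreme {a} {d} r m nn = member r m (neg≥0 (wall a (suc d)) x (q4-conv (neg (wall a (suc d))) {_∈ I} subI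
      (λ {u} {v} c → subst (+ 0 ≤_) (sym (trans (Vcell-neg (wall a (suc d)) u v) (cong -_ (wall-val (NP.m≤n⇒m≤1+n (proj₁ r)) (h<suc (proj₁ (proj₂ r))) (proj₁ c))))) (nn u v (proj₂ (proj₂ (proj₁ c))))) xI))

    goodJ : Good J
    goodJ = idealJ , subJ ,
      extreme rectTop (proj₁ (proj₂ (proj₂ good))) (λ u v _ → subst (λ z → + 0 ≤ - (z - lt (suc (suc i)) v)) (sym (lt-no z≤n)) (subst (+ 0 ≤_) (lem (lt (suc (suc i)) v)) (lt≥0 (suc (suc i)) v))) ,
      extreme rectSide (proj₂ (proj₂ (proj₂ good))) (λ u v hv → subst (λ z → + 0 ≤ - (lt i u - z)) (sym (lt-yes (s≤s hv))) (≤-by (lt≤1 i u) (lem′ (lt i u))))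
      where
      lem : ∀ a → a ≡ - (+ 0 - a)
      lem = solve-∀
      lem′ : ∀ a → + 1 - a ≡ - (a - + 1) - + 0
      lem′ = solve-∀

    region : Region J x
    region = record
      { inside = λ r m → inside r m
      ; outside = λ r nm → outside r nm
      ; left = λ la → conv-left {_∈ I} subI la xI
      ; right = λ ld → conv-right {_∈ I} subI ld xI
      }
      where
      inside : ∀ {a d} → Rect a d → Er a d ∈R J → q4 (wall a (suc d)) x Q.≤ 0ℚ
      inside r (j , m , e) = subst (Q._≤ 0ℚ) (wallAt-cell x r e) (proj₂ (∈⇒ m))
      outside : ∀ {a d} → Rect a d → ¬ (Er a d ∈R J) → 0ℚ Q.≤ q4 (wall a (suc d)) x
      outside {a} {d} r nm with Er a d ∈R? I | q4 (wall a (suc d)) x QP.≤? 0ℚ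
      ... | no nI | _ = conv-outside idealI subI r nI xI
      ... | yes mI | yes le = ⊥-elim (nm (member r mI le))
      ... | yes mI | no gt = QP.<⇒≤ (QP.≰⇒> gt)

    inSimplex : InConv (InBorder J) x
    inSimplex = go (spansQ goodJ x)
      where
      go : (Σ (Vec ℚ NR) λ c → SupportedQ (InBorder J) c × combQ c ≡ x) → InConv (InBorder J) x
      go (c , sup , e) = c , sup , region-nonneg idealJ subJ region c sup e ,
        -- The weights add up to 1 because both combinations represent x: each total weight is the
        -- coefficient of α in x, and it is 1 for the combination given by `xI`.
        trans (sym (coord-sum {InBorder J} (border⊆M subJ) c sup)) (trans (cong (λ v → lookup v ι) (trans e (sym (proj₂ (proj₂ (proj₂ (proj₂ xI)))))))
          (trans (coord-sum {_∈ I} subI (proj₁ xI) (proj₁ (proj₂ xI))) (proj₁ (proj₂ (proj₂ (proj₂ xI)))))) , e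

  opaque
    border? : ∀ {J} → J ⊆M → ∀ j → Dec (InBorder J j)
    border? {J} sub j with j SP.∈? J
    ... | no nm = no (nm ∘ proj₁)
    ... | yes m with rectOf j (sub j m)
    ... | p , q , r , _ , e with Er (suc p) (N.pred q) ∈R? J
    ... | yes m⁻ = no (λ b → border⇒ sub r e b m⁻)
    ... | no nm⁻ = yes (border⇐ sub r e m nm⁻)

  -- A vertex of the simplex of J that is not a vertex of the simplex of J′ is separated from the latter by a wall.
  opaque
    off-common : ∀ {J J′ x} → DualOrderIdeal J → J ⊆M → DualOrderIdeal J′ → J′ ⊆M → (ic : InConv (InBorder J) x) → InConv (InBorder J′) x →
      ∀ j → InBorder J j → ¬ InBorder J′ j → lookup (proj₁ ic) j ≡ 0ℚ
    off-common {J} {J′} {x} ideal sub ideal′ sub′ ic ic′ j b nb with rectOf j (border⊆M sub j b)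
    ... | a , d , r@(la , ld , hd) , _ , e with Er a d ∈R? J′
    ... | no nm = wall-zero (neg (wall a (suc d))) {InBorder J} (border⊆M sub) (λ c → in-val ideal r (in⇒ (proj₁ b) e) (proj₁ c) (border-cell sub c))
        (subst (Q._≤ 0ℚ) (sym (q4-neg (wall a (suc d)) x)) (QP.neg-antimono-≤ (Region.outside (border-region ideal′ sub′ ic′) r nm))) ic r e b
        (ZP.≤-reflexive (sym (trans (Vcell-neg (wall a (suc d)) a d) (cong -_ (trans (wall-val (NP.m≤n⇒m≤1+n la) (h<suc ld) r) (cong₂ _-_ (lt-no NP.≤-refl) (lt-yes NP.≤-refl)))))))
    ... | yes m with Er (suc a) (N.pred d) ∈R? J′
    ... | no nm⁻ = ⊥-elim (nb (border⇐ sub′ r e (in⇐ m e) nm⁻))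
    off-common {J} {J′} {x} ideal sub ideal′ sub′ ic ic′ j b nb | a , suc d , r@(la , s≤s ld , hd) , _ , e | yes m | yes m⁻ =
        wall-zero (wall (suc a) (suc d)) {InBorder J} (border⊆M sub) (λ c → out-val ideal r⁻ (border⇒ sub r e b) (proj₁ c) (proj₁ (border-cell sub c)))
          (Region.inside (border-region ideal′ sub′ ic′) r⁻ m⁻) ic r e b
          (ZP.≤-reflexive (sym (trans (wall-val (s≤s la) (s≤s ld) r) (cong₂ _-_ (lt-yes NP.≤-refl) (lt-no NP.≤-refl)))))
      where
      r⁻ : Rect (suc a) d
      r⁻ = cell-rect sub′ (NP.<-≤-trans (proj₁ (rect≤ r)) hd) (NP.<⇒≤ hd) m⁻

  opaque
    -- The intersection is the face on the common vertices, so one `U` serves both sides. The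
    -- coefficients of x with respect to `J` themselves vanish off `U`, by `off-common`; those with
    -- respect to `J′` need not be compared with them.
    meet : ∀ {J J′} → Good J → Good J′ → Σ (Subset NR) λ U → Σ (Subset NR) λ U′ →
      (∀ j → j ∈ U → InBorder J j) × (∀ j → j ∈ U′ → InBorder J′ j) ×
      (∀ x → ((InConv (InBorder J) x × InConv (InBorder J′) x) ⇔ InConv (λ j → j ∈ U) x)
           × (InConv (λ j → j ∈ U) x ⇔ InConv (λ j → j ∈ U′) x))
    meet {J} {J′} (ideal , sub , _) (ideal′ , sub′ , _) = U , U , (λ j m → proj₁ (∈⇒ m)) , (λ j m → proj₂ (∈⇒ m)) ,
      λ x → mk⇔ (λ p → to p) (λ ic → conv-mono (λ j m → proj₁ (∈⇒ m)) ic , conv-mono (λ j m → proj₂ (∈⇒ m)) ic) , mk⇔ id id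
      where
      open Subsets {P = λ j → InBorder J j × InBorder J′ j} (λ j → border? sub j ×-dec border? sub′ j) renaming (subset to U)
      to : ∀ {x} → InConv (InBorder J) x × InConv (InBorder J′) x → InConv (λ j → j ∈ U) x
      to (ic@(c , sup , rest) , ic′) = c , sup′ , rest
        where
        sup′ : SupportedQ (λ j → j ∈ U) c
        sup′ j nm with border? sub j | border? sub′ j
        ... | no nb | _ = sup j nb
        ... | yes b | no nb′ = off-common ideal sub ideal′ sub′ ic ic′ j b nb′
        ... | yes b | yes b′ = ⊥-elim (nm (⇒∈ (b , b′)))

  good-triangulation : ∀ I → Good I → Triangulation (λ J → Good J × J ⊆ I) InBorder (InConv (_∈ I))
  good-triangulation I good =
    (λ J s c sup _ e → independent (proj₁ (proj₁ s)) (proj₁ (proj₂ (proj₁ s))) c sup e) ,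
    (λ x → mk⇔ (λ xI → Cut.J I good x xI , (Cut.goodJ I good x xI , Cut.J⊆I I good x xI) , Cut.inSimplex I good x xI)
      (λ { (J , (_ , J⊆I) , ic) → conv-mono (λ j b → J⊆I j (proj₁ b)) ic })) ,
    (λ J J′ s s′ → meet (proj₁ s) (proj₁ s′))

  InM? : ∀ j → Dec (InM α j)
  InM? j = FP.all? (λ k → lookup α k ZP.≤? lookup (root j) k)

  module M = Subsets {P = InM α} InM?

  M-good : Good M.subset
  M-good = (λ j k m le → M.⇒∈ (λ l → ZP.≤-trans (M.∈⇒ m l) (le l))) , (λ j → M.∈⇒) , inM rectTop , inM rectSide
    where
    inM : ∀ {p q} → Rect p q → Er p q ∈R M.subset
    inM r with idx (proj₁ (rect≤ r)) (proj₂ (proj₂ r))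
    ... | j , e = j , M.⇒∈ (⇒InM r e) , e

-- Coroot pairings with the affine simple roots

pcls : RType → ℕ → ℕ → ℕ
pcls t n zero = n
pcls t n (suc r) = cls t n r

label : ∀ {n} → Fin (suc n) → ℕ
label {n} F.zero = n
label (F.suc l) = toℕ l

-- The coroot pairing with the affine simple root f is x ↦ Σ x_k (κ(k) − κ(k+1)) with this potential κ.
κ : (t : RType) (n : ℕ) → Fin (suc n) → ℕ → ℤ
κ t n f r = eqi (cls t n r) (label f) - eqi (pcls t n r) (label f)

norm : (t : RType) (n : ℕ) → Fin (suc n) → ℤ
norm A n f = + 2
norm C n F.zero = + 4
norm C n (F.suc l) = + 2 + (eqi (suc (toℕ l)) n + eqi (suc (toℕ l)) n)

sumZ-eqi₀ : ∀ m (f : ℕ → ℤ) {l} → m N.≤ l → sumZ m (λ k → f (toℕ k) * eqi (toℕ k) l) ≡ + 0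
sumZ-eqi₀ m f le = ΣZ.sum-0 m (λ k → trans (cong (f (toℕ k) *_) (eqi-no (λ e → NP.<⇒≱ (FP.toℕ<n k) (subst (m N.≤_) (sym e) le)))) (ZP.*-zeroʳ (f (toℕ k))))

if-eq : ∀ {X : Set} {a b : ℕ} {x y : X} → a ≡ b → (if a ≡ᵇ b then x else y) ≡ x
if-eq {a = a} {b} e = if-true (NP.≡⇒≡ᵇ a b e)

if-neq : ∀ {X : Set} {a b : ℕ} {x y : X} → a ≢ b → (if a ≡ᵇ b then x else y) ≡ y
if-neq {a = a} {b} ne = if-false (λ c → ne (NP.≡ᵇ⇒≡ a b c))

eqi-sym : ∀ a b → eqi a b ≡ eqi b a
eqi-sym a b = eqi-⇔ sym sym

module Tridiagonal where
  data Near (i j : ℕ) : Set where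
    diag : i ≡ j → Near i j
    upper₁ : suc i ≡ j → Near i j
    lower₁ : suc j ≡ i → Near i j
    apart : i ≢ j → suc i ≢ j → suc j ≢ i → Near i j

  near : ∀ i j → Near i j
  near i j with i N.≟ j | suc i N.≟ j | suc j N.≟ i
  ... | yes a | _ | _ = diag a
  ... | no a | yes b | _ = upper₁ b
  ... | no a | no b | yes c = lower₁ c
  ... | no a | no b | no c = apart a b c

  T-∨ : ∀ {x y} → T x ⊎ T y → T (x ∨ y)
  T-∨ {true} _ = tt
  T-∨ {false} (inj₂ t) = t

  T-∨⁻ : ∀ {x y} → T (x ∨ y) → T x ⊎ T y
  T-∨⁻ {true} _ = inj₁ tt
  T-∨⁻ {false} t = inj₂ t

  adjᵇ : ∀ {i j} → suc i ≡ j ⊎ suc j ≡ i → T ((suc i ≡ᵇ j) ∨ (suc j ≡ᵇ i))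
  adjᵇ {i} {j} adj = T-∨ {suc i ≡ᵇ j} (Sum.map (NP.≡⇒≡ᵇ (suc i) j) (NP.≡⇒≡ᵇ (suc j) i) adj)

  ¬adjᵇ : ∀ {i j} → suc i ≢ j → suc j ≢ i → ¬ T ((suc i ≡ᵇ j) ∨ (suc j ≡ᵇ i))
  ¬adjᵇ {i} {j} b c t = Sum.[ (λ x → b (NP.≡ᵇ⇒≡ (suc i) j x)) , (λ x → c (NP.≡ᵇ⇒≡ (suc j) i x)) ] (T-∨⁻ {suc i ≡ᵇ j} t)

  gramA : ∀ n i j → gram A n i j ≡ + 2 * eqi j i - eqi j (suc i) - eqi (suc j) i
  gramA n i j with near i j
  ... | diag refl = trans (if-eq {a = i} refl) (sym (cong₂ _-_ (cong₂ (λ x y → + 2 * x - y) (eqi-yes {i} refl) (eqi-no {i} (λ ()))) (eqi-no {suc i} (λ ()))))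
  ... | upper₁ refl = trans (if-neq {a = i} {suc i} (λ ())) (trans (if-true (adjᵇ {i} {suc i} (inj₁ refl)))
      (sym (cong₂ _-_ (cong₂ (λ x y → + 2 * x - y) (eqi-no {suc i} {i} (λ ())) (eqi-yes {suc i} refl)) (eqi-no {suc (suc i)} {i} (λ ())))))
  ... | lower₁ refl = trans (if-neq {a = suc j} {j} (λ ())) (trans (if-true (adjᵇ {suc j} {j} (inj₂ refl)))
      (sym (cong₂ _-_ (cong₂ (λ x y → + 2 * x - y) (eqi-no {j} {suc j} (λ ())) (eqi-no {j} {suc (suc j)} (λ ()))) (eqi-yes {suc j} refl))))
  ... | apart a b c = trans (if-neq a) (trans (if-false (¬adjᵇ {i} {j} b c))
      (sym (cong₂ _-_ (cong₂ (λ x y → + 2 * x - y) (eqi-no (a ∘ sym)) (eqi-no (b ∘ sym))) (eqi-no c))))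

  gramC-diag : ∀ n i → gram C n i i ≡ + 2 + (eqi (suc i) n + eqi (suc i) n)
  gramC-diag n i = trans (if-eq {a = i} refl) (go (suc i N.≟ n))
    where
    go : Dec (suc i ≡ n) → (if suc i ≡ᵇ n then + 4 else + 2) ≡ + 2 + (eqi (suc i) n + eqi (suc i) n)
    go (yes e) = trans (if-eq e) (sym (cong (λ z → + 2 + (z + z)) (eqi-yes e)))
    go (no ne) = trans (if-neq ne) (sym (cong (λ z → + 2 + (z + z)) (eqi-no ne)))

  gramC-adj : ∀ n i j → suc i ≡ j ⊎ suc j ≡ i → suc i ≢ n ⊎ suc j ≢ n → gram C n i j ≡ - (+ 1 + (eqi (suc i) n + eqi (suc j) n))
  gramC-adj n i j adj dis = trans (if-neq (ne adj)) (trans (if-true (adjᵇ {i} {j} adj)) (go (suc i N.≟ n) (suc j N.≟ n)))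
    where
    ne : suc i ≡ j ⊎ suc j ≡ i → i ≢ j
    ne (inj₁ refl) ()
    ne (inj₂ refl) ()
    go : Dec (suc i ≡ n) → Dec (suc j ≡ n) → (if (suc i ≡ᵇ n) ∨ (suc j ≡ᵇ n) then -[1+ 1 ] else -[1+ 0 ]) ≡ - (+ 1 + (eqi (suc i) n + eqi (suc j) n))
    go (yes a) (yes b) = ⊥-elim (Sum.[ (λ f → f a) , (λ f → f b) ] dis)
    go (yes a) (no b) = trans (if-true (T-∨ {suc i ≡ᵇ n} (inj₁ (NP.≡⇒≡ᵇ (suc i) n a)))) (sym (cong₂ (λ x y → - (+ 1 + (x + y))) (eqi-yes a) (eqi-no b)))
    go (no a) (yes b) = trans (if-true (T-∨ {suc i ≡ᵇ n} (inj₂ (NP.≡⇒≡ᵇ (suc j) n b)))) (sym (cong₂ (λ x y → - (+ 1 + (x + y))) (eqi-no a) (eqi-yes b)))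
    go (no a) (no b) = trans (if-false (λ t → Sum.[ (λ x → a (NP.≡ᵇ⇒≡ (suc i) n x)) , (λ x → b (NP.≡ᵇ⇒≡ (suc j) n x)) ] (T-∨⁻ {suc i ≡ᵇ n} t)))
      (sym (cong₂ (λ x y → - (+ 1 + (x + y))) (eqi-no a) (eqi-no b)))

  gramC-far : ∀ n i j → i ≢ j → suc i ≢ j → suc j ≢ i → gram C n i j ≡ + 0
  gramC-far n i j a b c = trans (if-neq a) (if-false (¬adjᵇ {i} {j} b c))

open Tridiagonal

module Pairing (t : RType) (n : ℕ) (valid : ValidRank t n) where
  open Cells t n valid public

  -- the finite part of the affine simple root f
  αc : Fin (suc n) → ℕ → ℤ
  αc F.zero j = - g h j
  αc (F.suc l) j = eqi j (toℕ l)

  -- The pairing of α_k with the coroot of the affine simple root f, as the drop of κ along the step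
  -- from k to k + 1. `row f k` below is the inner product of the same two roots, so the two must be
  -- related by half the squared length `norm`.
  cw : Fin (suc n) → ℕ → ℤ
  cw f k = κ t n f k - κ t n f (suc k)

  row : Fin (suc n) → ℕ → ℤ
  row f i = sumZ n (λ j → gram t n i (toℕ j) * αc f (toℕ j))

pcls-simple : ∀ t n {i l} → i N.< n → l N.< n → eqi (pcls t n i) l ≡ eqi i (suc l)
pcls-simple t n {zero} hi hl = trans (eqi-no (λ e → NP.<⇒≢ hl (sym e))) (sym (eqi-no (λ ())))
pcls-simple t n {suc i} {l} hi hl = trans (cong (λ z → eqi z l) (cls-id t n (NP.<⇒≤ hi))) (eqi-⇔ (cong suc) NP.suc-injective)

cls-n : ∀ n → ValidRank C n → ∀ {i} → suc i ≡ n → suc (cls C n n) ≡ i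
cls-n (suc zero) (s≤s ()) e
cls-n (suc (suc m)) v refl = cong suc (trans (cls-fold (suc (suc m)) NP.≤-refl (n<hi (suc (suc m)) v)) (NP.m+n∸n≡m m (suc (suc m))))

cwA : ∀ n v l {i} → i N.< n → Pairing.cw A n v (F.suc l) i ≡ + 2 * eqi i (toℕ l) - eqi i (suc (toℕ l)) - eqi (suc i) (toℕ l)
cwA n v l {i} hi = trans (cong (λ z → (eqi i (toℕ l) - z) - (eqi (suc i) (toℕ l) - eqi i (toℕ l))) (pcls-simple A n hi (FP.toℕ<n l)))
  (lem (eqi i (toℕ l)) (eqi i (suc (toℕ l))) (eqi (suc i) (toℕ l)))
  where
  lem : ∀ a b c → (a - b) - (c - a) ≡ + 2 * a - b - c
  lem = solve-∀

-- At the last node the next position n is the mirror image of n − 1.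
nextC : ℕ → ℕ → ℕ → ℤ
nextC n i l = eqi (cls C n (suc i)) l

cwC : ∀ n v l {i} → i N.< n → Pairing.cw C n v (F.suc l) i ≡ + 2 * eqi i (toℕ l) - eqi i (suc (toℕ l)) - nextC n i (toℕ l)
cwC n v l {i} hi = trans (cong₂ (λ x z → (x - z) - (nextC n i (toℕ l) - x)) (cong (λ z → eqi z (toℕ l)) (cls-id C n hi)) (pcls-simple C n hi (FP.toℕ<n l)))
  (lem (eqi i (toℕ l)) (eqi i (suc (toℕ l))) (nextC n i (toℕ l)))
  where
  lem : ∀ a b c → (a - b) - (c - a) ≡ + 2 * a - b - c
  lem = solve-∀

next-mid : ∀ n {i l} → suc i N.< n → nextC n i l ≡ eqi (suc i) l
next-mid n {i} {l} hi = cong (λ z → eqi z l) (cls-id C n hi)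

next-last : ∀ n v {i l} → suc i ≡ n → nextC n i l ≡ eqi (suc l) i
next-last n v {i} {l} e = trans (cong (λ z → eqi (cls C n z) l) e) (trans (eqi-sym (cls C n n) l) (eqi-⇔ (λ x → trans (cong suc x) (cls-n n v e)) (λ x → NP.suc-injective (trans x (sym (cls-n n v e))))))

row-simple : ∀ t n v l i → Pairing.row t n v (F.suc l) i ≡ gram t n i (toℕ l)
row-simple t n v l i = sumZ-eqi n (gram t n i) (FP.toℕ<n l)

-- The Cartan matrix of C_n against its Gram matrix, checked by distance from the diagonal. The
-- entry -2 occurs in the last row, where both `eqi i (suc l)` and `nextC` count the left neighbour
-- l.
rowC : ∀ n → ValidRank C n → ∀ {i l} → i N.< n → l N.< n →
  + 2 * gram C n i l ≡ (+ 2 * eqi i l - eqi i (suc l) - nextC n i l) * (+ 2 + (eqi (suc l) n + eqi (suc l) n))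
rowC n v {i} {l} hi hl = go (near i l) (suc i N.≟ n)
  where
  L : ℤ
  L = eqi (suc l) n
  fin : ∀ {γ a b c ℓ} → gram C n i l ≡ γ → eqi i l ≡ a → eqi i (suc l) ≡ b → nextC n i l ≡ c → L ≡ ℓ →
    + 2 * γ ≡ (+ 2 * a - b - c) * (+ 2 + (ℓ + ℓ)) → + 2 * gram C n i l ≡ (+ 2 * eqi i l - eqi i (suc l) - nextC n i l) * (+ 2 + (L + L))
  fin eγ ea eb ec eℓ num = trans (cong (+ 2 *_) eγ) (trans num (sym (cong₂ (λ w z → w * (+ 2 + (z + z))) (cong₂ _-_ (cong₂ (λ x y → + 2 * x - y) ea eb) ec) eℓ)))
  lem₁ : ∀ L → + 2 * (+ 2 + (L + L)) ≡ (+ 2 * + 1 - + 0 - + 0) * (+ 2 + (L + L))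
  lem₁ = solve-∀
  lem₂ : ∀ L → + 2 * (- (+ 1 + (+ 0 + L))) ≡ (+ 2 * + 0 - + 0 - + 1) * (+ 2 + (L + L))
  lem₂ = solve-∀
  next : Dec (suc i ≡ n) → nextC n i l ≡ eqi (suc i) l ⊎ nextC n i l ≡ eqi (suc l) i × suc i ≡ n
  next (yes e) = inj₂ (next-last n v {i} {l} e , e)
  next (no ne) = inj₁ (next-mid n {i} {l} (NP.≤∧≢⇒< hi ne))
  zeroNext : Dec (suc i ≡ n) → suc i ≢ l → suc l ≢ i → nextC n i l ≡ + 0
  zeroNext d b c with next d
  ... | inj₁ x = trans x (eqi-no b)
  ... | inj₂ (x , _) = trans x (eqi-no c)
  ineq : ∀ m → suc m ≢ m
  ineq m e = NP.<⇒≢ (NP.n<1+n m) (sym e)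
  ineq₂ : ∀ m → suc (suc m) ≢ m
  ineq₂ m e = NP.<⇒≢ (NP.m<n⇒m<1+n (NP.n<1+n m)) (sym e)
  go : Near i l → Dec (suc i ≡ n) → + 2 * gram C n i l ≡ (+ 2 * eqi i l - eqi i (suc l) - nextC n i l) * (+ 2 + (L + L))
  go (diag e) d = fin (trans (cong (gram C n i) (sym e)) (trans (gramC-diag n i) (cong (λ z → + 2 + (eqi (suc z) n + eqi (suc z) n)) e)))
    (eqi-yes e) (eqi-no (λ x → ineq l (trans (sym x) e))) (zeroNext d (λ x → ineq i (trans x (sym e))) (λ x → ineq l (trans x e))) refl (lem₁ L)
  go (upper₁ e) d = fin (trans (gramC-adj n i l (inj₁ e) (inj₁ i≢)) (cong (λ z → - (+ 1 + (z + L))) (eqi-no i≢)))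
    (eqi-no (λ x → ineq i (trans e (sym x)))) (eqi-no (λ x → ineq₂ i (trans (cong suc e) (sym x)))) (trans (next-mid n (NP.≤∧≢⇒< hi i≢)) (eqi-yes e)) refl (lem₂ L)
    where
    i≢ : suc i ≢ n
    i≢ x = NP.<⇒≢ hl (trans (sym e) x)
  go (lower₁ e) (no ne) = fin (trans (gramC-adj n i l (inj₂ e) (inj₂ l≢)) (cong₂ (λ x y → - (+ 1 + (x + y))) (eqi-no ne) (eqi-no l≢)))
    (eqi-no (λ x → ineq l (trans e x))) (eqi-yes (sym e)) (trans (next-mid n (NP.≤∧≢⇒< hi ne)) (eqi-no (λ x → ineq₂ l (trans (cong suc e) x)))) (eqi-no l≢) refl
    where
    l≢ : suc l ≢ n
    l≢ x = NP.<⇒≢ hi (trans (sym e) x)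
  go (lower₁ e) (yes y) = fin (trans (gramC-adj n i l (inj₂ e) (inj₂ l≢)) (cong₂ (λ x y → - (+ 1 + (x + y))) (eqi-yes y) (eqi-no l≢)))
    (eqi-no (λ x → ineq l (trans e x))) (eqi-yes (sym e)) (trans (next-last n v {i} {l} y) (eqi-yes e)) (eqi-no l≢) refl
    where
    l≢ : suc l ≢ n
    l≢ x = NP.<⇒≢ hi (trans (sym e) x)
  go (apart a b c) d = fin (gramC-far n i l a b c) (eqi-no a) (eqi-no (c ∘ sym)) (zeroNext d b c) refl (lem₀ L)
    where
    lem₀ : ∀ L → + 2 * + 0 ≡ (+ 2 * + 0 - + 0 - + 0) * (+ 2 + (L + L))
    lem₀ = solve-∀

module RowZero (t : RType) (n : ℕ) (valid : ValidRank t n) where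
  -- Sum of one row of a tridiagonal matrix; `s` and `p` are 0 at the ends of the diagram, where the
  -- right or the left neighbour is missing.
  tri-sum : ∀ {i} → i N.< n → ∀ a b c {s p} →
    (suc i N.< n × s ≡ + 1 ⊎ suc i ≡ n × s ≡ + 0) → (i ≡ 0 × p ≡ + 0 ⊎ (∃ λ i′ → i ≡ suc i′) × p ≡ + 1) →
    sumZ n (λ j → (c * eqi (toℕ j) i - a * eqi (toℕ j) (suc i)) - b * eqi (suc (toℕ j)) i) ≡ (c - a * s) - b * p
  tri-sum {i} hi a b c {s} {p} ds dp = trans (ΣZ.sum-⊖ n (λ j → c * eqi (toℕ j) i - a * eqi (toℕ j) (suc i)) (λ j → b * eqi (suc (toℕ j)) i))
    (cong₂ _-_ (trans (ΣZ.sum-⊖ n (λ j → c * eqi (toℕ j) i) (λ j → a * eqi (toℕ j) (suc i))) (cong₂ _-_ (sumZ-eqi n (λ _ → c) hi) (up ds))) (down dp))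
    where
    up : (suc i N.< n × s ≡ + 1 ⊎ suc i ≡ n × s ≡ + 0) → sumZ n (λ j → a * eqi (toℕ j) (suc i)) ≡ a * s
    up (inj₁ (l , refl)) = trans (sumZ-eqi n (λ _ → a) l) (sym (ZP.*-identityʳ a))
    up (inj₂ (e , refl)) = trans (sumZ-eqi₀ n (λ _ → a) (NP.≤-reflexive (sym e))) (sym (ZP.*-zeroʳ a))
    down : (i ≡ 0 × p ≡ + 0 ⊎ (∃ λ i′ → i ≡ suc i′) × p ≡ + 1) → sumZ n (λ j → b * eqi (suc (toℕ j)) i) ≡ b * p
    down (inj₁ (refl , refl)) = trans (ΣZ.sum-0 n (λ j → trans (cong (b *_) (eqi-no {suc (toℕ j)} {0} (λ ()))) (ZP.*-zeroʳ b))) (sym (ZP.*-zeroʳ b))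
    down (inj₂ ((i′ , refl) , refl)) = trans (ΣZ.sum-cong n (λ j → cong (b *_) (eqi-⇔ NP.suc-injective (cong suc))))
      (trans (sumZ-eqi n (λ _ → b) (NP.<⇒≤ hi)) (sym (ZP.*-identityʳ b)))

g-top : ∀ n v {j} → j N.< n → Model.g A n v n j ≡ + 1
g-top n v {j} l = trans (gA n v n j) (lt-yes l)

gC-top : ∀ n v {j} → suc j N.< n → Model.g C n v (hi C n) j ≡ + 2
gC-top n v {j} l = trans (gC n v (hi C n) j NP.≤-refl l) (cong₂ _+_ (lt-yes (NP.≤-trans (NP.<⇒≤ l) (n≤hi C n)))
  (lt-yes (NP.∸-monoʳ-< {hi C n} (s≤s z≤n) (NP.≤-trans (NP.<⇒≤ l) (n≤hi C n)))))

gC-top-last : ∀ n v {j} → suc j ≡ n → Model.g C n v (hi C n) j ≡ + 1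
gC-top-last n v {j} e = trans (gC-long n v (hi C n) j NP.≤-refl e) (lt-yes (NP.≤-trans (NP.≤-reflexive e) (n≤hi C n)))

cw-zero : ∀ t n v {i} → i N.< n → Pairing.cw t n v F.zero i ≡ - eqi (pcls t n i) n - eqi (cls t n (suc i)) n
cw-zero t n v {i} hi = trans (cong (λ z → (z - eqi (pcls t n i) n) - (eqi (cls t n (suc i)) n - z)) (eqi-no (λ e → NP.<⇒≢ hi (trans (sym (cls-id t n hi)) e))))
  (lem (eqi (pcls t n i) n) (eqi (cls t n (suc i)) n))
  where
  lem : ∀ a b → (+ 0 - a) - (b - + 0) ≡ - a - b
  lem = solve-∀

row-zero : ∀ t n v {i} → i N.< n → + 2 * Pairing.row t n v F.zero i ≡ Pairing.cw t n v F.zero i * norm t n F.zero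
row-zero A n v {i} hi = trans (cong (+ 2 *_) (trans (ΣZ.sum-cong n (λ j → trans (cong₂ (λ x y → x * (- y)) (gramA n i (toℕ j)) (g-top n v (FP.toℕ<n j)))
    (lem (eqi (toℕ j) i) (eqi (toℕ j) (suc i)) (eqi (suc (toℕ j)) i)))) (RowZero.tri-sum A n v hi (- + 1) (- + 1) (- + 2) up down)))
  (trans (lem₂ S P) (cong (_* + 2) (trans (cong₂ (λ x y → - x - y) P′ S′) (sym (cw-zero A n v hi)))))
  where
  S P : ℤ
  S = + 1 - eqi (suc i) n
  P = + 1 - eqi i 0
  lem : ∀ a b c → (+ 2 * a - b - c) * (- + 1) ≡ ((- + 2) * a - (- + 1) * b) - (- + 1) * c
  lem = solve-∀
  lem₂ : ∀ s p → + 2 * ((- + 2 - (- + 1) * s) - (- + 1) * p) ≡ (- (+ 1 - p) - (+ 1 - s)) * + 2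
  lem₂ = solve-∀
  inv : ∀ a → + 1 - (+ 1 - a) ≡ a
  inv = solve-∀
  S′ : + 1 - S ≡ eqi (suc i) n
  S′ = inv (eqi (suc i) n)
  P′ : + 1 - P ≡ eqi (pcls A n i) n
  P′ = trans (inv (eqi i 0)) (go i hi)
    where
    go : ∀ i → i N.< n → eqi i 0 ≡ eqi (pcls A n i) n
    go zero _ = trans (eqi-yes {0} refl) (sym (eqi-yes {n} refl))
    go (suc i) l = trans (eqi-no {suc i} {0} (λ ())) (sym (eqi-no (NP.<⇒≢ (NP.<⇒≤ l))))
  up : suc i N.< n × S ≡ + 1 ⊎ suc i ≡ n × S ≡ + 0
  up with suc i N.≟ n
  ... | yes e = inj₂ (e , cong (λ z → + 1 - z) (eqi-yes e))
  ... | no ne = inj₁ (NP.≤∧≢⇒< hi ne , cong (λ z → + 1 - z) (eqi-no ne))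
  down : i ≡ 0 × P ≡ + 0 ⊎ (∃ λ i′ → i ≡ suc i′) × P ≡ + 1
  down = go i
    where
    go : ∀ i → i ≡ 0 × + 1 - eqi i 0 ≡ + 0 ⊎ (∃ λ i′ → i ≡ suc i′) × + 1 - eqi i 0 ≡ + 1
    go zero = inj₁ (refl , cong (λ z → + 1 - z) (eqi-yes {0} refl))
    go (suc i) = inj₂ ((i , refl) , cong (λ z → + 1 - z) (eqi-no {suc i} {0} (λ ())))
row-zero C n v {i} i<n = trans (cong (+ 2 *_) (trans (ΣZ.sum-cong n (λ j → term (toℕ j) (FP.toℕ<n j))) (RowZero.tri-sum C n v i<n (- + 2) (- (+ 2 + (L + L))) (- + 4) (up (suc i N.≟ n)) (down i))))
  (trans (num i i<n (suc i N.≟ n)) (cong (_* + 4) (sym (trans (cw-zero C n v i<n) (cong (λ z → - eqi (pcls C n i) n - z) next0)))))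
  where
  L S P : ℤ
  L = eqi (suc i) n
  S = + 1 - L
  P = + 1 - eqi i 0
  ineq : ∀ m → suc m ≢ m
  ineq m e = NP.<⇒≢ (NP.n<1+n m) (sym e)
  ineq₂ : ∀ m → suc (suc m) ≢ m
  ineq₂ m e = NP.<⇒≢ (NP.m<n⇒m<1+n (NP.n<1+n m)) (sym e)
  next0 : eqi (cls C n (suc i)) n ≡ + 0
  next0 = eqi-no (λ e → NP.<⇒≢ (cls-lt C n (NP.≤-<-trans i<n (n<hi n v))) e)
  fin : ∀ j {γ a b c} → gram C n i j ≡ γ → eqi j i ≡ a → eqi j (suc i) ≡ b → eqi (suc j) i ≡ c → ∀ {t′} → Model.g C n v (hi C n) j ≡ t′ →
    γ * (- t′) ≡ ((- + 4) * a - (- + 2) * b) - (- (+ 2 + (L + L))) * c →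
    gram C n i j * (- Model.g C n v (hi C n) j) ≡ ((- + 4) * eqi j i - (- + 2) * eqi j (suc i)) - (- (+ 2 + (L + L))) * eqi (suc j) i
  fin j eγ ea eb ec et num = trans (cong₂ (λ x y → x * (- y)) eγ et) (trans num (sym (cong₂ _-_ (cong₂ (λ x y → (- + 4) * x - (- + 2) * y) ea eb) (cong (λ z → (- (+ 2 + (L + L))) * z) ec))))
  -- Multiplied by the coefficients 2, ..., 2, 1 of -θ up to sign, the entries of the row become
  -- uniform: -4 on the diagonal and 2 on its right. Only the entry on the left remembers the last
  -- row, through `L`.
  term : ∀ j → j N.< n → gram C n i j * (- Model.g C n v (hi C n) j) ≡ ((- + 4) * eqi j i - (- + 2) * eqi j (suc i)) - (- (+ 2 + (L + L))) * eqi (suc j) i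
  term j hj = go (near i j) (suc j N.≟ n)
    where
    top : Dec (suc j ≡ n) → Σ ℤ λ t′ → Model.g C n v (hi C n) j ≡ t′ × t′ ≡ + 2 - eqi (suc j) n
    top (yes e) = + 1 , gC-top-last n v e , sym (cong (λ z → + 2 - z) (eqi-yes e))
    top (no ne) = + 2 , gC-top n v (NP.≤∧≢⇒< hj ne) , sym (cong (λ z → + 2 - z) (eqi-no ne))
    go : Near i j → Dec (suc j ≡ n) → gram C n i j * (- Model.g C n v (hi C n) j) ≡ ((- + 4) * eqi j i - (- + 2) * eqi j (suc i)) - (- (+ 2 + (L + L))) * eqi (suc j) i
    go (diag e) (yes y) = fin j (trans (cong (gram C n i) (sym e)) (trans (gramC-diag n i) (cong (λ z → + 2 + (z + z)) (eqi-yes (trans (cong suc e) y)))))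
      (eqi-yes (sym e)) (eqi-no (λ x → ineq i (trans (sym x) (sym e)))) (eqi-no (λ x → ineq j (trans x e))) (gC-top-last n v y) (lem L)
      where
      lem : ∀ L → (+ 2 + (+ 1 + + 1)) * (- + 1) ≡ ((- + 4) * + 1 - (- + 2) * + 0) - (- (+ 2 + (L + L))) * + 0
      lem = solve-∀
    go (diag e) (no y) = fin j (trans (cong (gram C n i) (sym e)) (trans (gramC-diag n i) (cong (λ z → + 2 + (z + z)) (eqi-no (λ x → y (trans (cong suc (sym e)) x))))))
      (eqi-yes (sym e)) (eqi-no (λ x → ineq i (trans (sym x) (sym e)))) (eqi-no (λ x → ineq j (trans x e))) (gC-top n v (NP.≤∧≢⇒< hj y)) (lem L)
      where
      lem : ∀ L → (+ 2 + (+ 0 + + 0)) * (- + 2) ≡ ((- + 4) * + 1 - (- + 2) * + 0) - (- (+ 2 + (L + L))) * + 0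
      lem = solve-∀
    go (upper₁ e) (yes y) = fin j (trans (gramC-adj n i j (inj₁ e) (inj₁ i≢)) (cong₂ (λ x z → - (+ 1 + (x + z))) (eqi-no i≢) (eqi-yes y)))
      (eqi-no (λ x → ineq i (trans e x))) (eqi-yes (sym e)) (eqi-no (λ x → ineq₂ i (trans (cong suc e) x))) (gC-top-last n v y) (lem L)
      where
      i≢ : suc i ≢ n
      i≢ x = NP.<⇒≢ hj (trans (sym e) x)
      lem : ∀ L → (- (+ 1 + (+ 0 + + 1))) * (- + 1) ≡ ((- + 4) * + 0 - (- + 2) * + 1) - (- (+ 2 + (L + L))) * + 0
      lem = solve-∀
    go (upper₁ e) (no y) = fin j (trans (gramC-adj n i j (inj₁ e) (inj₂ y)) (cong₂ (λ x z → - (+ 1 + (x + z))) (eqi-no (λ x → NP.<⇒≢ hj (trans (sym e) x))) (eqi-no y)))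
      (eqi-no (λ x → ineq i (trans e x))) (eqi-yes (sym e)) (eqi-no (λ x → ineq₂ i (trans (cong suc e) x))) (gC-top n v (NP.≤∧≢⇒< hj y)) (lem L)
      where
      lem : ∀ L → (- (+ 1 + (+ 0 + + 0))) * (- + 2) ≡ ((- + 4) * + 0 - (- + 2) * + 1) - (- (+ 2 + (L + L))) * + 0
      lem = solve-∀
    go (lower₁ e) _ = fin j (trans (gramC-adj n i j (inj₂ e) (inj₂ y)) (cong (λ z → - (+ 1 + (L + z))) (eqi-no y)))
      (eqi-no (λ x → ineq j (trans e (sym x)))) (eqi-no (λ x → ineq₂ j (trans (cong suc e) (sym x)))) (eqi-yes e) (gC-top n v (subst (N._< n) (sym e) i<n)) (lem L)
      where
      y : suc j ≢ n
      y x = NP.<⇒≢ i<n (trans (sym e) x)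
      lem : ∀ L → (- (+ 1 + (L + + 0))) * (- + 2) ≡ ((- + 4) * + 0 - (- + 2) * + 0) - (- (+ 2 + (L + L))) * + 1
      lem = solve-∀
    go (apart a b c) d = fin j (gramC-far n i j a b c) (eqi-no (a ∘ sym)) (eqi-no (b ∘ sym)) (eqi-no c) (proj₁ (proj₂ (top d))) (lem L (proj₁ (top d)))
      where
      lem : ∀ L t → + 0 * (- t) ≡ ((- + 4) * + 0 - (- + 2) * + 0) - (- (+ 2 + (L + L))) * + 0
      lem = solve-∀
  up : Dec (suc i ≡ n) → suc i N.< n × S ≡ + 1 ⊎ suc i ≡ n × S ≡ + 0
  up (yes e) = inj₂ (e , cong (λ z → + 1 - z) (eqi-yes e))
  up (no ne) = inj₁ (NP.≤∧≢⇒< i<n ne , cong (λ z → + 1 - z) (eqi-no ne))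
  down : ∀ i → i ≡ 0 × + 1 - eqi i 0 ≡ + 0 ⊎ (∃ λ i′ → i ≡ suc i′) × + 1 - eqi i 0 ≡ + 1
  down zero = inj₁ (refl , cong (λ z → + 1 - z) (eqi-yes {0} refl))
  down (suc i) = inj₂ ((i , refl) , cong (λ z → + 1 - z) (eqi-no {suc i} {0} (λ ())))
  expr : ℤ → ℤ → ℤ
  expr p L = + 2 * ((- + 4 - (- + 2) * (+ 1 - L)) - (- (+ 2 + (L + L))) * (+ 1 - p))
  num : ∀ i → i N.< n → Dec (suc i ≡ n) → expr (eqi i 0) (eqi (suc i) n) ≡ (- eqi (pcls C n i) n - + 0) * + 4
  num zero l (yes e) = ⊥-elim (NP.<⇒≱ v (NP.≤-reflexive (sym e)))
  num zero l (no ne) = trans (cong₂ expr (eqi-yes {0} refl) (eqi-no ne)) (sym (cong (λ z → (- z - + 0) * + 4) (eqi-yes {n} refl)))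
  num (suc i) l d = trans (cong (λ p → expr p (eqi (suc (suc i)) n)) (eqi-no {suc i} {0} (λ ()))) (trans (lem (eqi (suc (suc i)) n))
      (sym (cong (λ z → (- z - + 0) * + 4) (eqi-no (λ e → NP.<⇒≢ (NP.<⇒≤ l) (trans (sym (cls-id C n (NP.<⇒≤ l))) e))))))
    where
    lem : ∀ L → + 2 * ((- + 4 - (- + 2) * (+ 1 - L)) - (- (+ 2 + (L + L))) * (+ 1 - + 0)) ≡ (- + 0 - + 0) * + 4
    lem = solve-∀

cls-mirror : ∀ n → ValidRank C n → ∀ {r} → r N.< hi C n → cls C n (hi C n ∸ suc r) ≡ cls C n r
cls-mirror n v {r} l with r N.<? n
... | no r≮n = trans (cls-id C n (NP.<⇒≤ (flip-lt n (NP.≮⇒≥ r≮n) l))) (sym (cls-fold n (NP.≮⇒≥ r≮n) l))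
... | yes r<n with suc r N.<? n
... | yes s = trans (cls-fold n (flip-ge n v s) (NP.∸-monoʳ-< (s≤s z≤n) l)) (trans (trans (cong (hi C n ∸_) (sym (NP.+-∸-assoc 1 l))) (NP.m∸[m∸n]≡n (NP.<⇒≤ l))) (sym (cls-id C n r<n)))
... | no s = cong (cls C n) (trans (cong (λ m → N.pred m N.+ m ∸ suc r) (NP.≤-antisym (NP.≮⇒≥ s) r<n)) (NP.m+n∸n≡m r (suc r)))

pcls≢cls : ∀ t n → ValidRank t n → ∀ {r} → r N.≤ hi t n → pcls t n r ≢ cls t n r
pcls≢cls t n v {zero} l e = NP.<⇒≢ (cls-lt t n {0} (NP.<-≤-trans (n>0 t n v) (n≤hi t n))) (sym e)
pcls≢cls t n v {suc r} l e = cls-adj t n v l e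

-- On the steps below n this is the definition of `cw`. A folded step reduces to its mirror image:
-- the mirror exchanges the labels of the steps into and out of a position, so κ changes sign and
-- its drop along a reversed step stays the same.
κ-pot : ∀ t n v f {r} → r N.< hi t n → Pairing.cw t n v f (cls t n r) ≡ κ t n f r - κ t n f (suc r)
κ-pot A n v f l = refl
κ-pot C n v f {r} l with r N.<? n
... | yes r<n = cong (λ m → κ C n f m - κ C n f (suc m)) (cls-id C n r<n)
... | no r≮n = trans (cong (λ m → κ C n f m - κ C n f (suc m)) (cls-fold n (NP.≮⇒≥ r≮n) l)) (go r l (NP.≤-<-trans z≤n (NP.<-≤-trans (n>0 C n v) (NP.≮⇒≥ r≮n))))
  where
  H : ℕ
  H = hi C n
  lab : ℕ
  lab = label f
  lem : ∀ a b c → (a - b) - (c - a) ≡ (a - c) - (b - a)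
  lem = solve-∀
  prev : ∀ r → r N.< H → pcls C n (H ∸ suc r) ≡ cls C n (suc r)
  prev r l with NP.m≤n⇒m<n∨m≡n l
  ... | inj₂ e = trans (cong (pcls C n) (trans (cong (_∸ suc r) (sym e)) (NP.n∸n≡0 (suc r)))) (trans (sym (cls-hi C n v)) (cong (cls C n) (sym e)))
  ... | inj₁ l′ = trans (cong (pcls C n) (NP.+-∸-assoc 1 l′)) (cls-mirror n v l′)
  go : ∀ r → r N.< H → 0 N.< r → κ C n f (H ∸ suc r) - κ C n f (suc (H ∸ suc r)) ≡ κ C n f r - κ C n f (suc r)
  go (suc r) l _ = trans (cong₂ (λ x y → (x - y) - (eqi (cls C n (suc (H ∸ suc (suc r)))) lab - x)) (cong (λ z → eqi z lab) (cls-mirror n v l)) (cong (λ z → eqi z lab) (prev (suc r) l)))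
    (trans (cong (λ z → (eqi (cls C n (suc r)) lab - eqi (cls C n (suc (suc r))) lab) - (z - eqi (cls C n (suc r)) lab)) (cong (λ z → eqi z lab) (trans (cong (cls C n) (sym (NP.+-∸-assoc 1 l))) (cls-mirror n v (NP.<⇒≤ l)))))
    (lem (eqi (cls C n (suc r)) lab) (eqi (cls C n (suc (suc r))) lab) (eqi (cls C n r) lab)))

-- The affine Weyl group as permutations of positions

module Reflections (t : RType) (n : ℕ) (valid : ValidRank t n) where
  open Roots t n public
  open Pairing t n valid public

  αl : Fin (suc n) → ℤ
  αl F.zero = + 1
  αl (F.suc _) = + 0

  αv : Fin (suc n) → Vec ℤ n
  αv f = vecOf n (αc f)

  -- The root lattice with integral multiples of δ. It is stable under the reflections, so words are
  -- evaluated over ℤ and the results transported by `toA`.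
  AffZ : Set
  AffZ = Vec ℤ n × ℤ

  toA : AffZ → AffVec
  toA (v , k) = toQv v , toQ k

  c : Fin (suc n) → Vec ℤ n → ℤ
  c f = φ (cw f)

  opaque
    θ≡ : θ ≡ Er 0 h
    θ≡ = go t n valid
      where
      go : ∀ t n v → highest t n ≡ Model.Er t n v 0 (hi t n)
      go A n v = trans (vecOf-cong n {λ _ → + 1} {λ k → Model.g A n v n k - + 0} (λ k l → sym (cong (λ z → z - + 0) (g-top n v l)))) (sym (Model.Er-def A n v 0 n))
      go C n v = CoeffsC.C2≡ n v (n>0 C n v)

  row-all : ∀ f {i} → i N.< n → + 2 * row f i ≡ cw f i * norm t n f
  row-all = go t n valid
    where
    go : ∀ t n v f {i} → i N.< n → + 2 * Pairing.row t n v f i ≡ Pairing.cw t n v f i * norm t n f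
    go t n v F.zero l = row-zero t n v l
    go A n v (F.suc f) {i} l = trans (cong (+ 2 *_) (trans (row-simple A n v f i) (trans (Tridiagonal.gramA n i (toℕ f)) (cong₂ _-_ (cong₂ (λ x y → + 2 * x - y) (eqi-sym (toℕ f) i) (eqi-sym (toℕ f) (suc i))) (eqi-sym (suc (toℕ f)) i)))))
      (trans (ZP.*-comm (+ 2) (+ 2 * eqi i (toℕ f) - eqi (suc i) (toℕ f) - eqi i (suc (toℕ f)))) (cong (_* + 2) (trans (lem (eqi i (toℕ f)) (eqi (suc i) (toℕ f)) (eqi i (suc (toℕ f)))) (sym (cwA n v f l)))))
      where
      lem : ∀ a b c → + 2 * a - b - c ≡ + 2 * a - c - b
      lem = solve-∀
    go C n v (F.suc f) {i} l = trans (cong (+ 2 *_) (row-simple C n v f i)) (trans (rowC n v l (FP.toℕ<n f)) (cong (_* (+ 2 + (eqi (suc (toℕ f)) n + eqi (suc (toℕ f)) n))) (sym (cwC n v f l))))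

  ipZ : Vec ℤ n → Vec ℤ n → ℤ
  ipZ x b = sumZ n (λ i → sumZ n (λ j → lookup x i * gram t n (toℕ i) (toℕ j) * lookup b j))

  opaque
    ip-toQ : ∀ x b → ip t n (toQv x) (toQv b) ≡ toQ (ipZ x b)
    ip-toQ x b = trans (ΣQ.sum-cong n (λ i → trans (ΣQ.sum-cong n (λ j → trans (cong₂ (λ u v → u Q.* toQ (gram t n (toℕ i) (toℕ j)) Q.* v) (VP.lookup-map i toQ x) (VP.lookup-map j toQ b))
        (trans (cong (Q._* toQ (lookup b j)) (sym (toQ-* (lookup x i) (gram t n (toℕ i) (toℕ j))))) (sym (toQ-* (lookup x i * gram t n (toℕ i) (toℕ j)) (lookup b j))))))
      (sym (toQ-sum n (λ j → lookup x i * gram t n (toℕ i) (toℕ j) * lookup b j)))))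
      (sym (toQ-sum n (λ i → sumZ n (λ j → lookup x i * gram t n (toℕ i) (toℕ j) * lookup b j))))

    ipZ-pairing : ∀ x f → + 2 * ipZ x (αv f) ≡ c f x * norm t n f
    ipZ-pairing x f = trans (sym (ΣZ.sum-⊗ n (+ 2) (λ i → sumZ n (λ j → lookup x i * gram t n (toℕ i) (toℕ j) * lookup (αv f) j))))
      (trans (ΣZ.sum-cong n (λ i → trans (cong (+ 2 *_) (inner i)) (trans (lem₁ (lookup x i) (row f (toℕ i))) (trans (cong (lookup x i *_) (row-all f (FP.toℕ<n i))) (lem₂ (lookup x i) (cw f (toℕ i)) (norm t n f))))))
      (trans (ΣZ.sum-⊗ n (norm t n f) (λ i → cw f (toℕ i) * lookup x i)) (ZP.*-comm (norm t n f) (c f x))))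
      where
      lem₁ : ∀ x r → + 2 * (x * r) ≡ x * (+ 2 * r)
      lem₁ = solve-∀
      lem₂ : ∀ x w m → x * (w * m) ≡ m * (w * x)
      lem₂ = solve-∀
      inner : ∀ i → sumZ n (λ j → lookup x i * gram t n (toℕ i) (toℕ j) * lookup (αv f) j) ≡ lookup x i * row f (toℕ i)
      inner i = trans (ΣZ.sum-cong n (λ j → trans (cong (lookup x i * gram t n (toℕ i) (toℕ j) *_) (lookup-vecOf n (αc f) j)) (ZP.*-assoc (lookup x i) (gram t n (toℕ i) (toℕ j)) (αc f (toℕ j)))))
        (ΣZ.sum-⊗ n (lookup x i) (λ j → gram t n (toℕ i) (toℕ j) * αc f (toℕ j)))

    c-Er : ∀ f {p q} → p N.≤ h → q N.≤ h → c f (Er p q) ≡ κ t n f p - κ t n f q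
    c-Er f = φ-Er (cw f) (κ t n f) (κ-pot t n valid f)

    αv-zero : ∀ j → lookup (αv F.zero) j ≡ - lookup (Er 0 h) j
    αv-zero j = trans (lookup-vecOf n (αc F.zero) j) (cong -_ (sym (trans (lookup-Er 0 h j) (lem (g h (toℕ j))))))
      where
      lem : ∀ a → a - + 0 ≡ a
      lem = solve-∀

    c-neg : ∀ f u v → (∀ j → lookup u j ≡ - lookup v j) → c f u ≡ - c f v
    c-neg f u v e = trans (ΣZ.sum-cong n (λ j → trans (cong (cw f (toℕ j) *_) (e j)) (lem (cw f (toℕ j)) (lookup v j))))
      (trans (ΣZ.sum-⊗ n (- + 1) (λ j → cw f (toℕ j) * lookup v j)) (ZP.-1*i≡-i (c f v)))
      where
      lem : ∀ a b → a * (- b) ≡ (- + 1) * (a * b)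
      lem = solve-∀

    c-self : ∀ f → c f (αv f) ≡ + 2
    c-self F.zero = trans (c-neg F.zero (αv F.zero) (Er 0 h) αv-zero) (cong -_ (trans (c-Er F.zero z≤n NP.≤-refl)
      (cong₂ (λ a b → a - b) (cong₂ _-_ (eqi-no (λ e → NP.<⇒≢ (cls-lt t n {0} (NP.<-≤-trans (n>0 t n valid) (n≤hi t n))) e)) (eqi-yes {n} refl))
        (cong₂ _-_ (eqi-yes (cls-hi t n valid)) (eqi-no (λ e → pcls≢cls t n valid {h} NP.≤-refl (trans e (sym (cls-hi t n valid)))))))))
    c-self (F.suc l) = trans (ΣZ.sum-cong n (λ j → cong (cw (F.suc l) (toℕ j) *_) (lookup-vecOf n (αc (F.suc l)) j))) (trans (sumZ-eqi n (cw (F.suc l)) l<n)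
      (cong₂ _-_ (cong₂ _-_ (eqi-yes id-l) (eqi-no (λ e → pcls≢cls t n valid l≤h (trans e (sym id-l))))) (cong₂ _-_ (eqi-no (λ e → cls-adj t n valid l<h (trans id-l (sym e)))) (eqi-yes id-l))))
      where
      l<n : toℕ l N.< n
      l<n = FP.toℕ<n l
      l<h : toℕ l N.< h
      l<h = NP.<-≤-trans l<n (n≤hi t n)
      l≤h : toℕ l N.≤ h
      l≤h = NP.<⇒≤ l<h
      id-l : cls t n (toℕ l) ≡ toℕ l
      id-l = cls-id t n l<n

    ipZ-self : ∀ f → ipZ (αv f) (αv f) ≡ norm t n f
    ipZ-self f = ZP.*-cancelˡ-≡ (+ 2) _ _ (trans (ipZ-pairing (αv f) f) (cong (_* norm t n f) (c-self f)))

    norm≢0 : ∀ f → norm t n f ≢ + 0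
    norm≢0 = go t
      where
      go : ∀ t f → norm t n f ≢ + 0
      go A f ()
      go C F.zero ()
      go C (F.suc l) e with suc (toℕ l) N.≟ n
      ... | yes q with trans (sym (cong (λ z → + 2 + (z + z)) (eqi-yes q))) e
      ... | ()
      go C (F.suc l) e | no q with trans (sym (cong (λ z → + 2 + (z + z)) (eqi-no q))) e
      ... | ()

    affSimple≡ : ∀ f → affSimple f ≡ toA (αv f , αl f)
    affSimple≡ F.zero = cong₂ _,_ (lookup-ext (λ j → trans (VP.lookup-map j Q.-_ (toQv θ)) (trans (cong Q.-_ (VP.lookup-map j toQ θ))
      (trans (sym (toQ-neg (lookup θ j))) (trans (cong toQ (trans (cong (λ v → - lookup v j) θ≡) (sym (αv-zero j)))) (sym (VP.lookup-map j toQ (αv F.zero)))))))) refl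
    affSimple≡ (F.suc l) = cong₂ _,_ (cong toQv (vecOf-cong n (λ k _ → sym (eqi-def k (toℕ l))))) refl

  srefZ : Fin (suc n) → AffZ → AffZ
  srefZ f (v , k) = tabulate (λ j → lookup v j - c f v * lookup (αv f) j) , k - c f v * αl f

  -- Determines the reflection coefficient by z (b,b) = 2 (x,b), which removes the division inside
  -- `sref`; the condition on (b,b) excludes its default branch.
  sref-by : ∀ b m x k z → ip t n b b ≢ 0ℚ → toQ (+ 2) Q.* ip t n x b ≡ z Q.* ip t n b b →
    sref (b , m) (x , k) ≡ (V.zipWith (λ xi bi → xi Q.- z Q.* bi) x b , k Q.- z Q.* m)
  sref-by b m x k z ne e with ip t n b b QP.≟ 0ℚ
  ... | yes q = ⊥-elim (ne q)
  ... | no nz = cong (λ c → V.zipWith (λ xi bi → xi Q.- c Q.* bi) x b , k Q.- c Q.* m)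
     (trans (cong (Q._* inv) e) (trans (QP.*-assoc z (ip t n b b) inv) (trans (cong (z Q.*_) (QP.*-inverseʳ (ip t n b b) {{Q.≢-nonZero nz}})) (QP.*-identityʳ z))))
     where
     inv : ℚ
     inv = Q.1/_ (ip t n b b) {{Q.≢-nonZero nz}}

  opaque
    sref-toA : ∀ f u → sref (affSimple f) (toA u) ≡ toA (srefZ f u)
    sref-toA f (v , k) = trans (cong (λ s → sref s (toA (v , k))) (affSimple≡ f))
      (trans (sref-by (toQv (αv f)) (toQ (αl f)) (toQv v) (toQ k) (toQ (c f v)) (λ e → norm≢0 f (toQ-inj (trans (sym self) e)))
        (trans (cong (toQ (+ 2) Q.*_) (ip-toQ v (αv f))) (trans (sym (toQ-* (+ 2) (ipZ v (αv f)))) (trans (cong toQ (ipZ-pairing v f)) (trans (toQ-* (c f v) (norm t n f)) (cong (toQ (c f v) Q.*_) (sym self)))))))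
      (cong₂ _,_ (lookup-ext (λ j → trans (VP.lookup-zipWith (λ xi bi → xi Q.- toQ (c f v) Q.* bi) j (toQv v) (toQv (αv f)))
          (trans (cong₂ (λ x b → x Q.- toQ (c f v) Q.* b) (VP.lookup-map j toQ v) (VP.lookup-map j toQ (αv f)))
          (trans (back (lookup v j) (lookup (αv f) j)) (sym (trans (VP.lookup-map j toQ (proj₁ (srefZ f (v , k)))) (cong toQ (VP.lookup∘tabulate (λ j → lookup v j - c f v * lookup (αv f) j) j)))))))) (back k (αl f))))
      where
      self : ip t n (toQv (αv f)) (toQv (αv f)) ≡ toQ (norm t n f)
      self = trans (ip-toQ (αv f) (αv f)) (cong toQ (ipZ-self f))
      back : ∀ a b → toQ a Q.- toQ (c f v) Q.* toQ b ≡ toQ (a - c f v * b)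
      back a b = trans (cong (λ z → toQ a Q.- z) (sym (toQ-* (c f v) b))) (sym (toQ-sub a (c f v * b)))

  actZ : Word → AffZ → AffZ
  actZ w u = L.foldl (λ y f → srefZ f y) u w

  act-toA : ∀ w u → actInv w (toA u) ≡ toA (actZ w u)
  act-toA [] u = refl
  act-toA (f ∷ w) u = trans (cong (actInv w) (sref-toA f u)) (act-toA w (srefZ f u))

  Pos : Set
  Pos = ℕ × ℤ

  Valid : Pos → Set
  Valid (r , _) = r N.≤ h

  sucP : Pos → Pos
  sucP (r , k) with r N.<? h
  ... | yes _ = suc r , k
  ... | no _ = 0 , k + + 1

  preP : Pos → Pos
  preP (zero , k) = h , k - + 1
  preP (suc r , k) = r , k

  -- Exchanges the two ends of every step labelled f: one step per period, or two mirror steps for a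
  -- short simple root of type C. These steps never share an end, because consecutive labels differ.
  σ : Fin (suc n) → Pos → Pos
  σ f (r , k) with cls t n r N.≟ label f | pcls t n r N.≟ label f
  ... | yes _ | _ = sucP (r , k)
  ... | no _ | yes _ = preP (r , k)
  ... | no _ | no _ = r , k

  sucP-valid : ∀ P → Valid (sucP P)
  sucP-valid (r , k) with r N.<? h
  ... | yes l = l
  ... | no _ = z≤n

  preP-valid : ∀ P → Valid P → Valid (preP P)
  preP-valid (zero , k) _ = NP.≤-refl
  preP-valid (suc r , k) l = NP.<⇒≤ l

  σ-valid : ∀ f P → Valid P → Valid (σ f P)
  σ-valid f (r , k) v with cls t n r N.≟ label f | pcls t n r N.≟ label f
  ... | yes _ | _ = sucP-valid (r , k)
  ... | no _ | yes _ = preP-valid (r , k) v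
  ... | no _ | no _ = v

  -- The position (r , k) stands for ε_r − k δ.
  ξ : Pos → Pos → AffZ
  ξ (p , k) (q , m) = Er p q , m - k

  label-suc : (f : Fin (suc n)) → label f N.< n → ∃ λ l → f ≡ F.suc l
  label-suc F.zero l = ⊥-elim (NP.<-irrefl refl l)
  label-suc (F.suc l) _ = l , refl

  label-zero : (f : Fin (suc n)) → label f ≡ n → f ≡ F.zero
  label-zero F.zero e = refl
  label-zero (F.suc l) e = ⊥-elim (NP.<⇒≢ (FP.toℕ<n l) e)

  opaque
    sucP-step : ∀ f r k → r N.≤ h → cls t n r ≡ label f →
      (∀ j → g (proj₁ (sucP (r , k))) j ≡ g r j + αc f j) × proj₂ (sucP (r , k)) ≡ k + αl f
    sucP-step f r k v e with r N.<? h
    ... | yes l with label-suc f (subst (N._< n) e (cls-lt t n l))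
    ... | m , refl = (λ j → cong (λ z → g r j + eqi j z) e) , sym (ZP.+-identityʳ k)
    sucP-step f r k v e | no nl with label-zero f (trans (sym e) (trans (cong (cls t n) (NP.≤-antisym v (NP.≮⇒≥ nl))) (cls-hi t n valid)))
    ... | refl = (λ j → sym (trans (cong (λ z → g r j - g z j) (sym (NP.≤-antisym v (NP.≮⇒≥ nl)))) (ZP.+-inverseʳ (g r j)))) , refl

    preP-step : ∀ f r k → r N.≤ h → pcls t n r ≡ label f →
      (∀ j → g (proj₁ (preP (r , k))) j ≡ g r j - αc f j) × proj₂ (preP (r , k)) ≡ k - αl f
    preP-step f zero k v e with label-zero f (sym e)
    ... | refl = (λ j → lem (g h j)) , refl
      where
      lem : ∀ a → a ≡ + 0 - (- a)
      lem = solve-∀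
    preP-step f (suc r) k v e with label-suc f (subst (N._< n) e (cls-lt t n v))
    ... | m , refl = (λ j → trans (lem (g r j) (eqi j (cls t n r))) (cong (λ z → g r j + eqi j (cls t n r) - eqi j z) e)) , lem₀ k
      where
      lem : ∀ a b → a ≡ a + b - b
      lem = solve-∀
      lem₀ : ∀ a → a ≡ a - + 0
      lem₀ = solve-∀

    σ-step : ∀ f r k → r N.≤ h →
      (∀ j → g (proj₁ (σ f (r , k))) j ≡ g r j + κ t n f r * αc f j) × proj₂ (σ f (r , k)) ≡ k + κ t n f r * αl f
    σ-step f r k v with cls t n r N.≟ label f | pcls t n r N.≟ label f
    ... | yes a | _ = (λ j → trans (proj₁ (sucP-step f r k v a) j) (one (g r j) (αc f j))) , trans (proj₂ (sucP-step f r k v a)) (one k (αl f))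
      where
      one : ∀ x y → x + y ≡ x + κ t n f r * y
      one x y = trans (lem x y) (sym (cong (λ z → x + z * y) (cong₂ _-_ (eqi-yes a) (eqi-no (λ b → pcls≢cls t n valid v (trans b (sym a)))))))
        where
        lem : ∀ x y → x + y ≡ x + (+ 1 - + 0) * y
        lem = solve-∀
    ... | no a | yes b = (λ j → trans (proj₁ (preP-step f r k v b) j) (one (g r j) (αc f j))) , trans (proj₂ (preP-step f r k v b)) (one k (αl f))
      where
      one : ∀ x y → x - y ≡ x + κ t n f r * y
      one x y = trans (lem x y) (sym (cong (λ z → x + z * y) (cong₂ _-_ (eqi-no a) (eqi-yes b))))
        where
        lem : ∀ x y → x - y ≡ x + (+ 0 - + 1) * y
        lem = solve-∀
    ... | no a | no b = (λ j → one (g r j) (αc f j)) , one k (αl f)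
      where
      one : ∀ x y → x ≡ x + κ t n f r * y
      one x y = trans (lem x y) (sym (cong (λ z → x + z * y) (cong₂ _-_ (eqi-no a) (eqi-no b))))
        where
        lem : ∀ x y → x ≡ x + (+ 0 - + 0) * y
        lem = solve-∀

    -- A position is displaced by κ(r) times the simple root, and the pairing of `ξ P Q` is κ(p) -
    -- κ(q); so the reflection acts on the two ends separately.
    srefZ-ξ : ∀ f P Q → Valid P → Valid Q → srefZ f (ξ P Q) ≡ ξ (σ f P) (σ f Q)
    srefZ-ξ f (p , k) (q , m) vp vq = cong₂ _,_
      (lookup-ext (λ j → trans (VP.lookup∘tabulate (λ j → lookup (Er p q) j - c f (Er p q) * lookup (αv f) j) j)
        (trans (cong₂ (λ x y → x - c f (Er p q) * y) (lookup-Er p q j) (lookup-vecOf n (αc f) j))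
        (trans (comb (g q (toℕ j)) (g p (toℕ j)) (αc f (toℕ j)))
        (trans (sym (cong₂ _-_ (proj₁ (σ-step f q m vq) (toℕ j)) (proj₁ (σ-step f p k vp) (toℕ j)))) (sym (lookup-Er (proj₁ (σ f (p , k))) (proj₁ (σ f (q , m))) j)))))))
      (trans (comb m k (αl f)) (sym (cong₂ _-_ (proj₂ (σ-step f q m vq)) (proj₂ (σ-step f p k vp)))))
      where
      comb : ∀ a b s → (a - b) - c f (Er p q) * s ≡ (a + κ t n f q * s) - (b + κ t n f p * s)
      comb a b s = trans (cong (λ z → (a - b) - z * s) (c-Er f vp vq)) (lem a b s (κ t n f p) (κ t n f q))
        where
        lem : ∀ a b s x y → (a - b) - (x - y) * s ≡ (a + y * s) - (b + x * s)
        lem = solve-∀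

  act : Word → Pos → Pos
  act w P = L.foldl (λ P f → σ f P) P w

  act-valid : ∀ w P → Valid P → Valid (act w P)
  act-valid [] P v = v
  act-valid (f ∷ w) P v = act-valid w (σ f P) (σ-valid f P v)

  actZ-ξ : ∀ w P Q → Valid P → Valid Q → actZ w (ξ P Q) ≡ ξ (act w P) (act w Q)
  actZ-ξ [] P Q vp vq = refl
  actZ-ξ (f ∷ w) P Q vp vq = trans (cong (actZ w) (srefZ-ξ f P Q vp vq)) (actZ-ξ w (σ f P) (σ f Q) (σ-valid f P vp) (σ-valid f Q vq))

-- Inversion sets read off from the permutation of ℤ

module Inversions (t : RType) (n : ℕ) (valid : ValidRank t n) (ι : Fin n) (long : LongIx t n (toℕ ι)) where
  open Span t n valid ι long public
  open Reflections t n valid public using (AffZ; toA; αv; αc; αl; c; srefZ; actZ; act-toA; Pos; Valid; sucP; preP; σ; sucP-valid; preP-valid; σ-valid; ξ; act; act-valid; actZ-ξ; c-Er; θ≡)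

  H : ℤ
  H = + suc h

  num : Pos → ℤ
  num (r , k) = + r + k * H

  _⊕_ : Pos → ℤ → Pos
  (r , k) ⊕ m = r , k + m

  num-⊕ : ∀ P m → num (P ⊕ m) ≡ num P + m * H
  num-⊕ (r , k) m = lem (+ r) k m H
    where
    lem : ∀ r k m H → r + (k + m) * H ≡ (r + k * H) + m * H
    lem = solve-∀

  H-mono : ∀ {k m} → k ≤ m → k * H ≤ m * H
  H-mono le = ZP.*-monoʳ-≤-nonNeg H le

  num-lt : ∀ P Q → Valid P → proj₂ P < proj₂ Q → num P < num Q
  num-lt (p , k) (q , m) vp l = +1≤⇒< (≤-by₃ (Z.+≤+ vp) (H-mono (<⇒+1≤ l)) (Z.+≤+ {0} {q} z≤n) (lem (+ p) (+ h) k m (+ q)))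
    where
    lem : ∀ p h k m q → (h - p) + (m * (+ 1 + h) - (k + + 1) * (+ 1 + h)) + (q - + 0) ≡ (q + m * (+ 1 + h)) - (p + k * (+ 1 + h) + + 1)
    lem = solve-∀

  level-≤ : ∀ P Q → Valid Q → num P < num Q → proj₂ P ≤ proj₂ Q
  level-≤ P Q vq l = ZP.≮⇒≥ (λ m<k → ZP.<-asym l (num-lt Q P vq m<k))

  level-< : ∀ P Q → Valid Q → num P < num Q → proj₁ Q N.≤ proj₁ P → proj₂ P < proj₂ Q
  level-< P@(p , k) Q@(q , m) vq l q≤p = ZP.≤∧≢⇒< (level-≤ P Q vq l) (λ { refl → ZP.<⇒≱ l (ZP.+-monoˡ-≤ (k * H) (Z.+≤+ q≤p)) })

  num-inj : ∀ P Q → Valid P → Valid Q → num P ≡ num Q → P ≡ Q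
  num-inj P@(p , k) Q@(q , m) vp vq e with ZP.<-cmp k m
  ... | tri< l _ _ = ⊥-elim (ZP.<⇒≢ (num-lt P Q vp l) e)
  ... | tri> _ _ l = ⊥-elim (ZP.<⇒≢ (num-lt Q P vq l) (sym e))
  ... | tri≈ _ refl _ = cong (_, k) (ZP.+-injective (trans (lem (+ p) (k * H)) (trans (cong (_- k * H) e) (sym (lem (+ q) (k * H))))))
    where
    lem : ∀ a b → a ≡ a + b - b
    lem = solve-∀

  num-suc : ∀ P → Valid P → num (sucP P) ≡ num P + + 1
  num-suc (r , k) v with r N.<? h
  ... | yes l = lem (+ r) (k * H)
    where
    lem : ∀ r x → (+ 1 + r) + x ≡ (r + x) + + 1
    lem = solve-∀
  ... | no nl = trans (lem k (+ h)) (cong (λ z → + z + k * H + + 1) (sym (NP.≤-antisym v (NP.≮⇒≥ nl))))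
    where
    lem : ∀ k h → + 0 + (k + + 1) * (+ 1 + h) ≡ h + k * (+ 1 + h) + + 1
    lem = solve-∀

  num-pre : ∀ P → num (preP P) ≡ num P - + 1
  num-pre (zero , k) = lem k (+ h)
    where
    lem : ∀ k h → h + (k - + 1) * (+ 1 + h) ≡ + 0 + k * (+ 1 + h) - + 1
    lem = solve-∀
  num-pre (suc r , k) = lem (+ r) (k * H)
    where
    lem : ∀ r x → r + x ≡ (+ 1 + r) + x - + 1
    lem = solve-∀

  pcls-suc : ∀ P → Valid P → pcls t n (proj₁ (sucP P)) ≡ cls t n (proj₁ P)
  pcls-suc (r , k) v with r N.<? h
  ... | yes l = refl
  ... | no nl = sym (trans (cong (cls t n) (NP.≤-antisym v (NP.≮⇒≥ nl))) (cls-hi t n valid))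

  cls-pre : ∀ P → cls t n (proj₁ (preP P)) ≡ pcls t n (proj₁ P)
  cls-pre (zero , k) = cls-hi t n valid
  cls-pre (suc r , k) = refl

  pre-suc : ∀ P → Valid P → preP (sucP P) ≡ P
  pre-suc P v = num-inj _ P (preP-valid (sucP P) (sucP-valid P)) v (trans (num-pre (sucP P)) (trans (cong (_- + 1) (num-suc P v)) (lem (num P))))
    where
    lem : ∀ a → a + + 1 - + 1 ≡ a
    lem = solve-∀

  suc-pre : ∀ P → Valid P → sucP (preP P) ≡ P
  suc-pre P v = num-inj _ P (sucP-valid (preP P)) v (trans (num-suc (preP P) (preP-valid P v)) (trans (cong (_+ + 1) (num-pre P)) (lem (num P))))
    where
    lem : ∀ a → a - + 1 + + 1 ≡ a
    lem = solve-∀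

  σ-suc : ∀ f P → cls t n (proj₁ P) ≡ label f → σ f P ≡ sucP P
  σ-suc f (r , k) e with cls t n r N.≟ label f | pcls t n r N.≟ label f
  ... | yes _ | _ = refl
  ... | no a | _ = ⊥-elim (a e)

  σ-pre : ∀ f P → Valid P → pcls t n (proj₁ P) ≡ label f → σ f P ≡ preP P
  σ-pre f (r , k) v e with cls t n r N.≟ label f | pcls t n r N.≟ label f
  ... | yes a | _ = ⊥-elim (pcls≢cls t n valid v (trans e (sym a)))
  ... | no _ | yes _ = refl
  ... | no _ | no b = ⊥-elim (b e)

  σ-fix : ∀ f P → cls t n (proj₁ P) ≢ label f → pcls t n (proj₁ P) ≢ label f → σ f P ≡ P
  σ-fix f (r , k) a b with cls t n r N.≟ label f | pcls t n r N.≟ label f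
  ... | yes x | _ = ⊥-elim (a x)
  ... | no _ | yes x = ⊥-elim (b x)
  ... | no _ | no _ = refl

  σσ : ∀ f P → Valid P → σ f (σ f P) ≡ P
  σσ f P v = go (cls t n (proj₁ P) N.≟ label f) (pcls t n (proj₁ P) N.≟ label f)
    where
    go : Dec (cls t n (proj₁ P) ≡ label f) → Dec (pcls t n (proj₁ P) ≡ label f) → σ f (σ f P) ≡ P
    go (yes a) _ = trans (cong (σ f) (σ-suc f P a)) (trans (σ-pre f (sucP P) (sucP-valid P) (trans (pcls-suc P v) a)) (pre-suc P v))
    go (no _) (yes b) = trans (cong (σ f) (σ-pre f P v b)) (trans (σ-suc f (preP P) (trans (cls-pre P) b)) (suc-pre P v))
    go (no a) (no b) = trans (cong (σ f) (σ-fix f P a b)) (σ-fix f P a b)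

  act-inj : ∀ w P Q → Valid P → Valid Q → act w P ≡ act w Q → P ≡ Q
  act-inj [] P Q vp vq e = e
  act-inj (f ∷ w) P Q vp vq e = trans (sym (σσ f P vp)) (trans (cong (σ f) (act-inj w (σ f P) (σ f Q) (σ-valid f P vp) (σ-valid f Q vq) e)) (σσ f Q vq))

  suc-⊕ : ∀ P m → sucP (P ⊕ m) ≡ sucP P ⊕ m
  suc-⊕ (r , k) m with r N.<? h
  ... | yes _ = refl
  ... | no _ = cong (0 ,_) (lem k m)
    where
    lem : ∀ k m → k + m + + 1 ≡ k + + 1 + m
    lem = solve-∀

  pre-⊕ : ∀ P m → preP (P ⊕ m) ≡ preP P ⊕ m
  pre-⊕ (zero , k) m = cong (h ,_) (lem k m)
    where
    lem : ∀ k m → k + m - + 1 ≡ k - + 1 + m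
    lem = solve-∀
  pre-⊕ (suc r , k) m = refl

  σ-⊕ : ∀ f P m → σ f (P ⊕ m) ≡ σ f P ⊕ m
  σ-⊕ f (r , k) m with cls t n r N.≟ label f | pcls t n r N.≟ label f
  ... | yes _ | _ = suc-⊕ (r , k) m
  ... | no _ | yes _ = pre-⊕ (r , k) m
  ... | no _ | no _ = refl

  act-⊕ : ∀ w P m → act w (P ⊕ m) ≡ act w P ⊕ m
  act-⊕ [] P m = refl
  act-⊕ (f ∷ w) P m = trans (cong (act w) (σ-⊕ f P m)) (act-⊕ w (σ f P) m)

  at : ℕ → Pos
  at p = p , + 0

  ν : Word → ℕ → ℤ
  ν w p = num (act w (at p))

  num-act : ∀ w p k → num (act w (p , k)) ≡ ν w p + k * H
  num-act w p k = trans (cong (λ z → num (act w (p , z))) (sym (ZP.+-identityˡ k))) (trans (cong num (act-⊕ w (at p) k)) (num-⊕ (act w (at p)) k))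

  ν-inj : ∀ w {p q k} → p N.≤ h → q N.≤ h → ν w p ≡ ν w q + k * H → p ≡ q × k ≡ + 0
  ν-inj w {p} {q} {k} vp vq e with act-inj w (at p) (q , k) vp vq (num-inj _ _ (act-valid w (at p) vp) (act-valid w (q , k) vq) (trans e (sym (num-act w q k))))
  ... | refl = refl , refl

  res-distinct : ∀ w {p q k m} → p N.≤ h → q N.≤ h → p ≢ q → proj₁ (act w (p , k)) ≢ proj₁ (act w (q , m))
  res-distinct w {p} {q} {k} {m} vp vq ne e = ne (cong proj₁ (act-inj w (p , k + d) (q , m) vp vq (trans (act-⊕ w (p , k) d) (pair {act w (p , k)} {act w (q , m)} {d} e (lem (proj₂ (act w (p , k))) (proj₂ (act w (q , m))))))))
    where
    d : ℤ
    d = proj₂ (act w (q , m)) - proj₂ (act w (p , k))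
    lem : ∀ a b → a + (b - a) ≡ b
    lem = solve-∀
    pair : ∀ {P Q : Pos} {x} → proj₁ P ≡ proj₁ Q → proj₂ P + x ≡ proj₂ Q → P ⊕ x ≡ Q
    pair {p , k} {q , m} e e′ = cong₂ _,_ e e′

  toQv-inj : ∀ {u v : Vec ℤ n} → toQv u ≡ toQv v → u ≡ v
  toQv-inj {u} {v} e = lookup-ext (λ j → toQ-inj (trans (sym (VP.lookup-map j toQ u)) (trans (cong (λ x → lookup x j) e) (VP.lookup-map j toQ v))))

  toA-inj : ∀ {u v} → toA u ≡ toA v → u ≡ v
  toA-inj e = cong₂ _,_ (toQv-inj (cong proj₁ e)) (toQ-inj (cong proj₂ e))

  negQv : ∀ (u : Vec ℤ n) → V.map Q.-_ (toQv u) ≡ toQv (V.map -_ u)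
  negQv u = lookup-ext (λ j → trans (VP.lookup-map j Q.-_ (toQv u)) (trans (cong Q.-_ (VP.lookup-map j toQ u)) (trans (sym (toQ-neg (lookup u j)))
    (trans (cong toQ (sym (VP.lookup-map j -_ u))) (sym (VP.lookup-map j toQ (V.map -_ u)))))))

  Er-neg : ∀ p q → V.map -_ (Er p q) ≡ Er q p
  Er-neg p q = lookup-ext (λ j → trans (VP.lookup-map j -_ (Er p q)) (trans (cong -_ (lookup-Er p q j)) (trans (lem (g q (toℕ j)) (g p (toℕ j))) (sym (lookup-Er q p j)))))
    where
    lem : ∀ a b → - (a - b) ≡ b - a
    lem = solve-∀

  negA-ξ : ∀ P Q → negA (toA (ξ P Q)) ≡ toA (ξ Q P)
  negA-ξ (p , k) (q , m) = cong₂ _,_ (trans (negQv (Er p q)) (cong toQv (Er-neg p q))) (trans (sym (toQ-neg (m - k))) (cong toQ (lem m k)))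
    where
    lem : ∀ a b → - (a - b) ≡ b - a
    lem = solve-∀

  -- The height with respect to the affine simple roots. θ has height h and δ has height h + 1, the
  -- Coxeter number in both types, so α₀ too has height 1.
  ht : AffZ → ℤ
  ht (v , k) = φ (λ _ → + 1) v + k * H

  ht-ξ : ∀ P Q → Valid P → Valid Q → ht (ξ P Q) ≡ num Q - num P
  ht-ξ (p , k) (q , m) vp vq = trans (cong (_+ (m - k) * H) (φ-Er (λ _ → + 1) (λ r → - (+ r)) (λ {r} _ → lem₁ (+ r)) vp vq)) (lem₂ (+ p) (+ q) k m H)
    where
    lem₁ : ∀ r → + 1 ≡ - r - (- (+ 1 + r))
    lem₁ = solve-∀
    lem₂ : ∀ p q k m H → (- p - (- q)) + (m - k) * H ≡ (q + m * H) - (p + k * H)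
    lem₂ = solve-∀

  pos-pair : ∀ {j a d} m → root j ≡ Er a d → (rootQ j , nat m) ≡ toA (ξ (a , - (+ m)) (at d))
  pos-pair m e = cong₂ _,_ (cong toQv e) (cong toQ (lem (+ m)))
    where
    lem : ∀ m → m ≡ + 0 - (- m)
    lem = solve-∀

  neg-pair : ∀ {j a d} m → root j ≡ Er a d → (V.map Q.-_ (rootQ j) , nat m) ≡ toA (ξ (d , - (+ m)) (at a))
  neg-pair {j} {a} {d} m e = cong₂ _,_ (trans (negQv (root j)) (cong toQv (trans (cong (V.map (λ z → - z)) e) (Er-neg a d)))) (cong toQ (lem (+ m)))
    where
    lem : ∀ m → m ≡ + 0 - (- m)
    lem = solve-∀

  opaque
    pos-ht : ∀ u → IsPosAffRoot (toA u) → + 0 < ht u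
    pos-ht u (j , m , inj₁ e) with cellOf j
    ... | a , d , l , hd , _ , ej = subst (λ x → + 0 < ht x) (sym (toA-inj {u} {ξ (a , - (+ m)) (at d)} (trans e (pos-pair m ej)))) (subst (+ 0 <_) (sym (ht-ξ (a , - (+ m)) (at d) (NP.≤-trans (NP.<⇒≤ l) hd) hd))
      (+1≤⇒< (≤-by₂ (Z.+≤+ l) (H-mono (Z.+≤+ {0} {m} z≤n)) (lem (+ a) (+ d) (+ m) H))))
      where
      lem : ∀ a d m H → (d - (+ 1 + a)) + (m * H - + 0 * H) ≡ ((d + + 0 * H) - (a + (- m) * H)) - (+ 0 + + 1)
      lem = solve-∀
    pos-ht u (j , m , inj₂ e) with cellOf j
    ... | a , d , l , hd , _ , ej = subst (λ x → + 0 < ht x) (sym (toA-inj {u} {ξ (d , - (+ suc m)) (at a)} (trans e (neg-pair (suc m) ej)))) (subst (+ 0 <_) (sym (ht-ξ (d , - (+ suc m)) (at a) hd (NP.≤-trans (NP.<⇒≤ l) hd)))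
      (+1≤⇒< (≤-by₃ (Z.+≤+ hd) (H-mono (Z.+≤+ {0} {m} z≤n)) (Z.+≤+ {0} {a} z≤n) (lem (+ a) (+ d) (+ m) (+ h)))))
      where
      lem : ∀ a d m h → (h - d) + (m * (+ 1 + h) - + 0 * (+ 1 + h)) + (a - + 0) ≡ ((a + + 0 * (+ 1 + h)) - (d + (- (+ 1 + m)) * (+ 1 + h))) - (+ 0 + + 1)
      lem = solve-∀

    -- Different residues make `ξ P Q` a real root and not a multiple of δ; the order of the
    -- residues decides between β + mδ and -β + (m + 1)δ.
    pos-root : ∀ P Q → Valid P → Valid Q → num P < num Q → proj₁ P ≢ proj₁ Q → IsPosAffRoot (toA (ξ P Q))
    pos-root P@(p , k) Q@(q , m) vp vq l ne with NP.<-cmp p q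
    ... | tri≈ _ e _ = ⊥-elim (ne e)
    ... | tri< p<q _ _ with idx p<q vq
    ... | j , e = j , Z.∣ m - k ∣ , inj₁ (cong₂ _,_ (cong toQv (sym e)) (cong toQ (sym (ZP.0≤i⇒+∣i∣≡i {m - k} (ZP.i≤j⇒0≤j-i (level-≤ P Q vq l))))))
    pos-root P@(p , k) Q@(q , m) vp vq l ne | tri> _ _ q<p with idx q<p vp
    ... | j , e = j , Z.∣ m - k - + 1 ∣ , inj₂ (cong₂ _,_ (trans (cong toQv (trans (sym (Er-neg q p)) (cong (V.map (λ z → - z)) (sym e)))) (sym (negQv (root j))))
      (cong toQ (trans (lem m k) (cong (λ z → + 1 + z) (sym (ZP.0≤i⇒+∣i∣≡i {m - k - + 1} (≤-by (<⇒+1≤ (level-< P Q vq l (NP.<⇒≤ q<p))) (lem₂ m k))))))))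
      where
      lem : ∀ m k → m - k ≡ + 1 + (m - k - + 1)
      lem = solve-∀
      lem₂ : ∀ m k → m - (k + + 1) ≡ (m - k - + 1) - + 0
      lem₂ = solve-∀

  0≮-1 : ¬ (+ 0 < - + 1)
  0≮-1 ()

  -- The condition N(w) = { δ - β | β ∈ I } in terms of images of positions. With β = ε_a - ε_d, the
  -- root mδ - β is inverted exactly when ν d exceeds ν a + mH. `C1` says that β is not inverted,
  -- `C2` and `C3` settle δ - β, and `C4` excludes 2δ - β; larger multiples of δ follow.
  record Inv (ν : ℕ → ℤ) (I : RSet) : Set where
    field
      C1 : ∀ {a d} → a N.< d → d N.≤ h → ν a < ν d
      C2 : ∀ {a d} → a N.< d → d N.≤ h → Er a d ∈R I → ν a + H < ν d
      C3 : ∀ {a d} → a N.< d → d N.≤ h → ¬ (Er a d ∈R I) → ν d < ν a + H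
      C4 : ∀ {a d} → a N.< d → d N.≤ h → ν d < ν a + (H + H)

  act-pair : ∀ w P Q → Valid P → Valid Q → actInv w (toA (ξ P Q)) ≡ toA (ξ (act w P) (act w Q))
  act-pair w P Q vp vq = trans (act-toA w (ξ P Q)) (cong toA (actZ-ξ w P Q vp vq))

  opaque
    neg-act : ∀ w P Q → Valid P → Valid Q → IsNegAffRoot (actInv w (toA (ξ P Q))) → num (act w Q) < num (act w P)
    neg-act w P Q vp vq ng = +1≤⇒< (≤-by (<⇒+1≤ (subst (+ 0 <_) (ht-ξ (act w Q) (act w P) (act-valid w Q vq) (act-valid w P vp))
        (pos-ht (ξ (act w Q) (act w P)) (subst IsPosAffRoot (trans (cong negA (act-pair w P Q vp vq)) (negA-ξ (act w P) (act w Q))) ng)))) (lem (num (act w P)) (num (act w Q))))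
      where
      lem : ∀ a b → (a - b) - (+ 0 + + 1) ≡ a - (b + + 1)
      lem = solve-∀

    act-neg : ∀ w P Q → Valid P → Valid Q → proj₁ P ≢ proj₁ Q → num (act w Q) < num (act w P) → IsNegAffRoot (actInv w (toA (ξ P Q)))
    act-neg w P Q vp vq ne l = subst IsPosAffRoot (sym (trans (cong negA (act-pair w P Q vp vq)) (negA-ξ (act w P) (act w Q))))
      (pos-root (act w Q) (act w P) (act-valid w Q vq) (act-valid w P vp) l (res-distinct w vq vp (ne ∘ sym)))

    inversions⇒ : ∀ w I → InversionSetIs w I → Inv (ν w) I
    inversions⇒ w I inv = record { C1 = C1 ; C2 = C2 ; C3 = C3 ; C4 = C4 }
      where
      C1 : ∀ {a d} → a N.< d → d N.≤ h → ν w a < ν w d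
      C1 {a} {d} l hd with ν w a ZP.<? ν w d
      ... | yes x = x
      ... | no x = ⊥-elim (absurd (Equivalence.to (inv (toA (ξ (at a) (at d)))) (pos-root (at a) (at d) ha hd (ZP.+-monoˡ-< (+ 0 * H) (Z.+<+ l)) (NP.<⇒≢ l) ,
          act-neg w (at a) (at d) ha hd (NP.<⇒≢ l) (ZP.≤∧≢⇒< (ZP.≮⇒≥ x) (λ e → NP.<⇒≢ l (sym (proj₁ (ν-inj w {d} {a} {+ 0} hd ha (trans e (lem (ν w a) H))))))))))
        where
        ha : a N.≤ h
        ha = NP.≤-trans (NP.<⇒≤ l) hd
        lem : ∀ x H → x ≡ x + + 0 * H
        lem = solve-∀
        absurd : (Σ (Fin NR) λ j → j ∈ I × toA (ξ (at a) (at d)) ≡ (V.map Q.-_ (rootQ j) , 1ℚ)) → ⊥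
        absurd (j , _ , e) = 0≢1 (toQ-inj {+ 0} {+ 1} (cong proj₂ e))
          where
          0≢1 : + 0 ≢ + 1
          0≢1 ()
      C2 : ∀ {a d} → a N.< d → d N.≤ h → Er a d ∈R I → ν w a + H < ν w d
      C2 {a} {d} l hd (j , m , e) = +1≤⇒< (≤-by (<⇒+1≤ (neg-act w (d , - (+ 1)) (at a) hd ha (subst (λ v → IsNegAffRoot (actInv w v)) (neg-pair 1 e)
          (proj₂ (Equivalence.from (inv (V.map Q.-_ (rootQ j) , 1ℚ)) (j , m , refl)))))) (trans (cong (_- (ν w a + + 1)) (num-act w d (- (+ 1)))) (lem (ν w a) (ν w d) H)))
        where
        ha : a N.≤ h
        ha = NP.≤-trans (NP.<⇒≤ l) hd
        lem : ∀ a d H → (d + (- (+ 1)) * H) - (a + + 1) ≡ d - (a + H + + 1)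
        lem = solve-∀
      -- If ν d reaches ν a + mH, then mδ - β is an inversion and must have the form δ - β′ with β′
      -- ∈ I. For m = 1 this puts β into I; for m = 2 the coefficient of δ is wrong.
      beyond : ∀ m → 1 N.≤ m → ∀ {a d} → a N.< d → d N.≤ h → ¬ (ν w d < ν w a + + m * H) →
        Σ (Fin NR) λ j → j ∈ I × toA (ξ (d , - (+ m)) (at a)) ≡ (V.map Q.-_ (rootQ j) , 1ℚ)
      beyond m 1≤m {a} {d} l hd nl = Equivalence.to (inv (toA (ξ (d , - (+ m)) (at a)))) (pos-root (d , - (+ m)) (at a) hd ha small (NP.<⇒≢ l ∘ sym) ,
          act-neg w (d , - (+ m)) (at a) hd ha (NP.<⇒≢ l ∘ sym) (+1≤⇒< (≤-by (<⇒+1≤ big) (trans (lem₂ (ν w a) (ν w d) (+ m) H) (cong (_- (ν w a + + 1)) (sym (num-act w d (- (+ m)))))))))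
        where
        ha : a N.≤ h
        ha = NP.≤-trans (NP.<⇒≤ l) hd
        small : num (d , - (+ m)) < num (at a)
        small = +1≤⇒< (≤-by₃ (Z.+≤+ hd) (H-mono (Z.+≤+ 1≤m)) (Z.+≤+ {0} {a} z≤n) (lem (+ a) (+ d) (+ m) (+ h)))
          where
          lem : ∀ a d m h → (h - d) + (m * (+ 1 + h) - + 1 * (+ 1 + h)) + (a - + 0) ≡ (a + + 0 * (+ 1 + h)) - (d + (- m) * (+ 1 + h) + + 1)
          lem = solve-∀
        big : ν w a + + m * H < ν w d
        big = ZP.≤∧≢⇒< (ZP.≮⇒≥ nl) (λ e → NP.<⇒≢ l (sym (proj₁ (ν-inj w {d} {a} {+ m} hd ha (sym e)))))
        lem₂ : ∀ a d m H → d - (a + m * H + + 1) ≡ (d + (- m) * H) - (a + + 1)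
        lem₂ = solve-∀
      C3 : ∀ {a d} → a N.< d → d N.≤ h → ¬ (Er a d ∈R I) → ν w d < ν w a + H
      C3 {a} {d} l hd nm = go (ν w d ZP.<? (ν w a + + 1 * H))
        where
        map-neg² : ∀ (v : Vec ℚ n) → V.map Q.-_ (V.map Q.-_ v) ≡ v
        map-neg² v = lookup-ext (λ k → trans (VP.lookup-map k Q.-_ (V.map Q.-_ v)) (trans (cong Q.-_ (VP.lookup-map k Q.-_ v)) (negQ-involutive (lookup v k))))
        absurd : (Σ (Fin NR) λ j → j ∈ I × toA (ξ (d , - (+ 1)) (at a)) ≡ (V.map Q.-_ (rootQ j) , 1ℚ)) → ⊥
        absurd (j , m , e) = nm (j , m , toQv-inj {root j} {Er a d} (trans (trans (sym (map-neg² (rootQ j))) (cong (V.map (λ z → Q.- z)) (sym (cong proj₁ e)))) (trans (negQv (Er d a)) (cong toQv (Er-neg d a)))))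
        go : Dec (ν w d < ν w a + + 1 * H) → ν w d < ν w a + H
        go (yes x) = subst (λ z → ν w d < ν w a + z) (ZP.*-identityˡ H) x
        go (no x) = ⊥-elim (absurd (beyond 1 NP.≤-refl l hd x))
      C4 : ∀ {a d} → a N.< d → d N.≤ h → ν w d < ν w a + (H + H)
      C4 {a} {d} l hd = go (ν w d ZP.<? (ν w a + + 2 * H))
        where
        two : ∀ H → + 2 * H ≡ H + H
        two = solve-∀
        2≢1 : + 2 ≢ + 1
        2≢1 ()
        absurd : (Σ (Fin NR) λ j → j ∈ I × toA (ξ (d , - (+ 2)) (at a)) ≡ (V.map Q.-_ (rootQ j) , 1ℚ)) → ⊥
        absurd (j , m , e) = 2≢1 (toQ-inj {+ 2} {+ 1} (cong proj₂ e))
        go : Dec (ν w d < ν w a + + 2 * H) → ν w d < ν w a + (H + H)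
        go (yes x) = subst (λ z → ν w d < ν w a + z) (two H) x
        go (no x) = ⊥-elim (absurd (beyond 2 (s≤s z≤n) l hd x))

    ⇒inversions : ∀ w I → Inv (ν w) I → InversionSetIs w I
    ⇒inversions w I inv v = mk⇔ to from
      where
      open Inv inv
      to : IsPosAffRoot v × IsNegAffRoot (actInv w v) → Σ (Fin NR) λ j → j ∈ I × v ≡ (V.map Q.-_ (rootQ j) , 1ℚ)
      to ((j , m , inj₁ e) , ng) with cellOf j
      ... | a , d , l , hd , _ , ej = ⊥-elim (0≮-1 (+1≤⇒< (≤-by₃ (<⇒+1≤ (neg-act w (a , - (+ m)) (at d) ha hd (subst (λ v → IsNegAffRoot (actInv w v)) (trans e (pos-pair m ej)) ng)))
          (<⇒+1≤ (C1 l hd)) (H-mono (Z.+≤+ {0} {m} z≤n)) (trans (cong (λ z → (z - (ν w d + + 1)) + (ν w d - (ν w a + + 1)) + (+ m * H - + 0 * H)) (num-act w a (- (+ m)))) (lem (ν w a) (ν w d) (+ m) H)))))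
        where
        ha : a N.≤ h
        ha = NP.≤-trans (NP.<⇒≤ l) hd
        lem : ∀ a d m H → ((a + (- m) * H) - (d + + 1)) + (d - (a + + 1)) + (m * H - + 0 * H) ≡ - + 1 - (+ 0 + + 1)
        lem = solve-∀
      to ((j , m , inj₂ e) , ng) with cellOf j
      ... | a , d , l , hd , _ , ej = go m (subst (λ z → ν w a < z) (num-act w d (- (+ suc m))) (neg-act w (d , - (+ suc m)) (at a) hd ha (subst (λ v → IsNegAffRoot (actInv w v)) (trans e (neg-pair (suc m) ej)) ng))) e
        where
        ha : a N.≤ h
        ha = NP.≤-trans (NP.<⇒≤ l) hd
        go : ∀ m → ν w a < ν w d + (- (+ suc m)) * H → v ≡ (V.map Q.-_ (rootQ j) , nat (suc m)) → Σ (Fin NR) λ j → j ∈ I × v ≡ (V.map Q.-_ (rootQ j) , 1ℚ)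
        go zero lt e with Er a d ∈R? I
        ... | yes x = j , in⇐ x ej , e
        ... | no x = ⊥-elim (0≮-1 (+1≤⇒< (≤-by₂ (<⇒+1≤ lt) (<⇒+1≤ (C3 l hd x)) (lem (ν w a) (ν w d) H))))
          where
          lem : ∀ a d H → ((d + (- + 1) * H) - (a + + 1)) + ((a + H) - (d + + 1)) ≡ - + 1 - (+ 0 + + 1)
          lem = solve-∀
        go (suc m) lt e = ⊥-elim (0≮-1 (+1≤⇒< (≤-by₃ (<⇒+1≤ lt) (<⇒+1≤ (C4 l hd)) (H-mono (Z.+≤+ {0} {m} z≤n)) (lem (ν w a) (ν w d) (+ m) H))))
          where
          lem : ∀ a d m H → ((d + (- (+ 1 + (+ 1 + m))) * H) - (a + + 1)) + ((a + (H + H)) - (d + + 1)) + (m * H - + 0 * H) ≡ - + 1 - (+ 0 + + 1)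
          lem = solve-∀
      from : (Σ (Fin NR) λ j → j ∈ I × v ≡ (V.map Q.-_ (rootQ j) , 1ℚ)) → IsPosAffRoot v × IsNegAffRoot (actInv w v)
      from (j , m , e) with cellOf j
      ... | a , d , l , hd , _ , ej = (j , 0 , inj₂ e) , subst (λ v → IsNegAffRoot (actInv w v)) (sym (trans e (neg-pair 1 ej)))
          (act-neg w (d , - (+ 1)) (at a) hd (NP.≤-trans (NP.<⇒≤ l) hd) (NP.<⇒≢ l ∘ sym)
            (+1≤⇒< (≤-by (<⇒+1≤ (C2 l hd (in⇒ m ej))) (trans (lem (ν w a) (ν w d) H) (cong (_- (ν w a + + 1)) (sym (num-act w d (- (+ 1)))))))))
        where
        lem : ∀ a d H → d - (a + H + + 1) ≡ (d + (- (+ 1)) * H) - (a + + 1)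
        lem = solve-∀

-- Necessity: the shape of an ideal with w⁻¹(2δ - θ) = α

telescope : ∀ m (B : ℕ → ℤ) → sumZ m (λ p → B (suc (toℕ p)) - B (toℕ p)) ≡ B m - B 0
telescope zero B = sym (ZP.+-inverseʳ (B 0))
telescope (suc m) B = trans (cong (_+_ (B 1 - B 0)) (telescope m (B ∘ suc))) (lem (B 1) (B 0) (B (suc m)))
  where
  lem : ∀ a b c → (a - b) + (c - a) ≡ c - b
  lem = solve-∀

sumZ-const : ∀ m c → sumZ m (λ _ → c) ≡ + m * c
sumZ-const zero c = sym (ZP.*-zeroˡ c)
sumZ-const (suc m) c = trans (cong (_+_ c) (sumZ-const m c)) (lem c (+ m))
  where
  lem : ∀ c m → c + m * c ≡ (+ 1 + m) * c
  lem = solve-∀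

sumZ-nonneg : ∀ m {f : Fin m → ℤ} → (∀ k → + 0 ≤ f k) → + 0 ≤ sumZ m f
sumZ-nonneg m {f} nn = subst (_≤ sumZ m f) (ΣZ.sum-0 m (λ _ → refl)) (sumZ-mono m nn)

sumZ-zero-terms : ∀ m {f : Fin m → ℤ} → (∀ k → + 0 ≤ f k) → sumZ m f ≡ + 0 → ∀ k → f k ≡ + 0
sumZ-zero-terms (suc m) {f} nn e F.zero = ZP.≤-antisym (≤-by (sumZ-nonneg m (nn ∘ F.suc)) (trans (lem (f F.zero) (sumZ m (f ∘ F.suc))) (cong (_- f F.zero) e))) (nn F.zero)
  where
  lem : ∀ a b → b - + 0 ≡ (a + b) - a
  lem = solve-∀
sumZ-zero-terms (suc m) {f} nn e (F.suc k) = sumZ-zero-terms m (nn ∘ F.suc) (ZP.≤-antisym (≤-by (nn F.zero) (trans (lem (f F.zero) (sumZ m (f ∘ F.suc))) (cong (_- sumZ m (f ∘ F.suc)) e))) (sumZ-nonneg m (nn ∘ F.suc))) k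
  where
  lem : ∀ a b → a - + 0 ≡ (a + b) - b
  lem = solve-∀

-- With values between 0 and 1 and first term 0, the sum is between 0 and m; the only multiple of m
-- + 1 in that range is 0.
small-multiple : ∀ m {f : Fin (suc m) → ℤ} D → (∀ k → + 0 ≤ f k) → (∀ k → f k ≤ + 1) → f F.zero ≡ + 0 →
  sumZ (suc m) f ≡ + suc m * D → ∀ k → f k ≡ + 0
small-multiple m {f} D nn le z e = sumZ-zero-terms (suc m) nn (trans e (trans (cong (+ suc m *_) D≡0) (ZP.*-zeroʳ (+ suc m))))
  where
  total≤ : sumZ (suc m) f ≤ + m
  total≤ = subst₂ _≤_ (cong (_+ sumZ m (f ∘ F.suc)) (sym z)) (trans (ZP.+-identityˡ (sumZ m (λ _ → + 1))) (trans (sumZ-const m (+ 1)) (ZP.*-identityʳ (+ m)))) (ZP.+-monoʳ-≤ (+ 0) (sumZ-mono m (le ∘ F.suc)))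
  pos : ∀ {D} → + 1 ≤ D → ¬ (+ suc m * D ≤ + m)
  pos {D} l l′ = 1≰0 (≤-by₂ (ZP.*-monoˡ-≤-nonNeg (+ suc m) l) l′ (lem (+ m) (+ suc m * D)))
    where
    lem : ∀ m x → (x - (+ 1 + m) * + 1) + (m - x) ≡ + 0 - + 1
    lem = solve-∀
  neg : ∀ {D} → D + + 1 ≤ + 0 → ¬ (+ 0 ≤ + suc m * D)
  neg {D} l l′ = 1≰0 (≤-by₃ (ZP.*-monoˡ-≤-nonNeg (+ suc m) l) l′ (Z.+≤+ {0} {m} z≤n) (lem (+ m) D))
    where
    lem : ∀ m D → ((+ 1 + m) * + 0 - (+ 1 + m) * (D + + 1)) + ((+ 1 + m) * D - + 0) + (m - + 0) ≡ + 0 - + 1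
    lem = solve-∀
  D≡0 : D ≡ + 0
  D≡0 with ZP.<-cmp D (+ 0)
  ... | tri≈ _ e _ = e
  ... | tri> _ _ l = ⊥-elim (pos (<⇒+1≤ l) (subst (_≤ + m) e total≤))
  ... | tri< l _ _ = ⊥-elim (neg (<⇒+1≤ l) (subst (+ 0 ≤_) e (sumZ-nonneg (suc m) nn)))

module Necessity (t : RType) (n : ℕ) (valid : ValidRank t n) (ι : Fin n) (long : LongIx t n (toℕ ι)) where
  open Inversions t n valid ι long public

  -- The coefficient of α in the affine root ξ P Q with respect to the affine simple roots is level P Q = F Q − F P.
  F′ : Pos → ℤ
  F′ (r , k) = lt r i + k

  D : AffZ → ℤ
  D (v , k) = lookup v ι + k

  g-i : ∀ {r} → r N.≤ h → g r i ≡ lt r i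
  g-i le = g-long t n valid long le

  D-ξ : ∀ P Q → Valid P → Valid Q → D (ξ P Q) ≡ F′ Q - F′ P
  D-ξ (p , k) (q , m) vp vq = trans (cong (_+ (m - k)) (trans (lookup-Er p q ι) (cong₂ _-_ (g-i vq) (g-i vp)))) (lem (lt q i) (lt p i) m k)
    where
    lem : ∀ a b m k → (a - b) + (m - k) ≡ (a + m) - (b + k)
    lem = solve-∀

  lt-range : ∀ k r → + 0 ≤ lt k r × lt k r ≤ + 1
  lt-range k r with r N.<? k
  ... | yes l = subst (λ z → + 0 ≤ z × z ≤ + 1) (sym (lt-yes l)) (Z.+≤+ z≤n , ZP.≤-refl)
  ... | no l = subst (λ z → + 0 ≤ z × z ≤ + 1) (sym (lt-no (NP.≮⇒≥ l))) (ZP.≤-refl , Z.+≤+ z≤n)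

  -- F′ counts, up to a constant, the α-steps below a position in the linear order of positions;
  -- there is one such step in each period.
  F-mono : ∀ P Q → Valid P → Valid Q → num P ≤ num Q → F′ P ≤ F′ Q
  F-mono P@(p , k) Q@(q , m) vp vq le with ZP.<-cmp k m
  ... | tri> _ _ l = ⊥-elim (ZP.<⇒≱ (num-lt Q P vq l) le)
  ... | tri< l _ _ = ≤-by₃ (proj₂ (lt-range p i)) (<⇒+1≤ l) (proj₁ (lt-range q i)) (lem (lt p i) (lt q i) k m)
    where
    lem : ∀ a b k m → (+ 1 - a) + (m - (k + + 1)) + (b - + 0) ≡ (b + m) - (a + k)
    lem = solve-∀
  ... | tri≈ _ refl _ = ZP.+-monoˡ-≤ k (lt-mono i (NP.≮⇒≥ (λ q<p → ZP.<⇒≱ (ZP.+-monoˡ-< (k * H) (Z.+<+ q<p)) le)))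

  φ-sum : ∀ {m} w u (us : Fin m → Vec ℤ n) → (∀ j → lookup u j ≡ sumZ m (λ l → lookup (us l) j)) → φ w u ≡ sumZ m (λ l → φ w (us l))
  φ-sum {m} w u us e = trans (ΣZ.sum-cong n (λ j → trans (cong (w (toℕ j) *_) (e j)) (sym (ΣZ.sum-⊗ m (w (toℕ j)) (λ l → lookup (us l) j)))))
    (ΣZ.sum-comm n m (λ j l → w (toℕ j) * lookup (us l) j))

  IsSum : ∀ {m} → AffZ → (Fin m → AffZ) → Set
  IsSum {m} u us = (∀ j → lookup (proj₁ u) j ≡ sumZ m (λ l → lookup (proj₁ (us l)) j)) × proj₂ u ≡ sumZ m (λ l → proj₂ (us l))

  look-sref : ∀ f v j → lookup (tabulate (λ j → lookup v j - c f v * lookup (αv f) j)) j ≡ lookup v j - c f v * lookup (αv f) j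
  look-sref f v j = VP.lookup∘tabulate (λ j → lookup v j - c f v * lookup (αv f) j) j

  opaque
    srefZ-sum : ∀ {m} f u (us : Fin m → AffZ) → IsSum u us → IsSum (srefZ f u) (λ l → srefZ f (us l))
    srefZ-sum {m} f (v , k) us (ev , ek) = (λ j → trans (look-sref f v j) (trans (comb (ev j) (lookup (αv f) j))
        (ΣZ.sum-cong m (λ l → sym (look-sref f (proj₁ (us l)) j))))) , comb ek (αl f)
      where
      comb : ∀ {x} {y : Fin m → ℤ} → x ≡ sumZ m y → ∀ s → x - c f v * s ≡ sumZ m (λ l → y l - c f (proj₁ (us l)) * s)
      comb {x} {y} e s = trans (cong₂ (λ a b → a - b * s) e (φ-sum (λ k → κ t n f k - κ t n f (suc k)) v (proj₁ ∘ us) ev))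
        (trans (cong (λ z → sumZ m y - z) (trans (ZP.*-comm (sumZ m (λ l → c f (proj₁ (us l)))) s) (trans (sym (ΣZ.sum-⊗ m s (λ l → c f (proj₁ (us l))))) (ΣZ.sum-cong m (λ l → ZP.*-comm s (c f (proj₁ (us l))))))))
          (sym (ΣZ.sum-⊖ m y (λ l → c f (proj₁ (us l)) * s))))

    actZ-sum : ∀ {m} w u (us : Fin m → AffZ) → IsSum u us → IsSum (actZ w u) (λ l → actZ w (us l))
    actZ-sum [] u us s = s
    actZ-sum (f ∷ w) u us s = actZ-sum w (srefZ f u) (λ l → srefZ f (us l)) (srefZ-sum f u us s)

    D-sum : ∀ {m} u (us : Fin m → AffZ) → IsSum u us → D u ≡ sumZ m (λ l → D (us l))
    D-sum {m} u us (ev , ek) = trans (cong₂ _+_ (ev ι) ek) (sym (ΣZ.sum-⊕ m (λ l → lookup (proj₁ (us l)) ι) (λ l → proj₂ (us l))))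

  -- The sum of the vectors ε₀ − ε_p: every Weyl group element fixes it modulo H = h + 1.
  family : Fin (suc h) → AffZ
  family p = ξ (at 0) (at (toℕ p))

  total : AffZ
  total = tabulate (λ j → sumZ (suc h) (λ p → lookup (proj₁ (family p)) j)) , sumZ (suc h) (λ p → proj₂ (family p))

  opaque
    total-sum : IsSum total family
    total-sum = (λ j → VP.lookup∘tabulate (λ j → sumZ (suc h) (λ p → lookup (proj₁ (family p)) j)) j) , refl

    -- κ(p) is the label indicator of the step out of p minus that of the step into p, so it sums to
    -- 0 over a period. Only the h + 1 copies of κ(0) remain, and a reflection therefore changes the
    -- total by a multiple of H.
    c-total : ∀ f → c f (proj₁ total) ≡ H * κ t n f 0
    c-total f = trans (φ-sum (λ k → κ t n f k - κ t n f (suc k)) (proj₁ total) (proj₁ ∘ family) (proj₁ total-sum))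
      (trans (ΣZ.sum-cong (suc h) (λ p → c-Er f z≤n (NP.≤-pred (FP.toℕ<n p))))
      (trans (ΣZ.sum-⊖ (suc h) (λ _ → κ t n f 0) (λ p → κ t n f (toℕ p))) (trans (cong₂ _-_ (sumZ-const (suc h) (κ t n f 0)) tele) (lem (H * κ t n f 0)))))
      where
      B : ℕ → ℤ
      B p = eqi (pcls t n p) (label f)
      lem : ∀ a → a - + 0 ≡ a
      lem = solve-∀
      tele : sumZ (suc h) (λ p → κ t n f (toℕ p)) ≡ + 0
      tele = trans (telescope (suc h) B) (trans (cong (λ z → eqi z (label f) - eqi n (label f)) (cls-hi t n valid)) (ZP.+-inverseʳ (eqi n (label f))))

  Congruent : AffZ → Set
  Congruent u = Σ AffZ λ z → (∀ j → lookup (proj₁ u) j ≡ lookup (proj₁ total) j + H * lookup (proj₁ z) j) × proj₂ u ≡ proj₂ total + H * proj₂ z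

  opaque
    srefZ-congruent : ∀ f u → Congruent u → Congruent (srefZ f u)
    srefZ-congruent f (v , k) ((z , kz) , ev , ek) = (tabulate (λ j → lookup z j - e * lookup (αv f) j) , kz - e * αl f) ,
        (λ j → trans (look-sref f v j) (trans (comb (lookup (proj₁ total) j) (lookup z j) (ev j) (lookup (αv f) j)) (cong (λ y → lookup (proj₁ total) j + H * y) (sym (VP.lookup∘tabulate (λ j → lookup z j - e * lookup (αv f) j) j))))) , comb (proj₂ total) kz ek (αl f)
      where
      e : ℤ
      e = κ t n f 0 + c f z
      cv : c f v ≡ H * e
      cv = trans (ΣZ.sum-cong n (λ j → trans (cong (w (toℕ j) *_) (ev j)) (lem (w (toℕ j)) (lookup (proj₁ total) j) H (lookup z j))))
        (trans (ΣZ.sum-⊕ n (λ j → w (toℕ j) * lookup (proj₁ total) j) (λ j → H * (w (toℕ j) * lookup z j))) (trans (cong₂ _+_ (c-total f) (ΣZ.sum-⊗ n H (λ j → w (toℕ j) * lookup z j))) (sym (ZP.*-distribˡ-+ H (κ t n f 0) (c f z)))))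
        where
        w : ℕ → ℤ
        w k = κ t n f k - κ t n f (suc k)
        lem : ∀ w a H z → w * (a + H * z) ≡ w * a + H * (w * z)
        lem = solve-∀
      comb : ∀ {x} a y → x ≡ a + H * y → ∀ s → x - c f v * s ≡ a + H * (y - e * s)
      comb {x} a y eq s = trans (cong₂ (λ x c → x - c * s) eq cv) (lem a H y e s)
        where
        lem : ∀ a H y e s → (a + H * y) - (H * e) * s ≡ a + H * (y - e * s)
        lem = solve-∀

    actZ-congruent : ∀ w u → Congruent u → Congruent (actZ w u)
    actZ-congruent [] u cg = cg
    actZ-congruent (f ∷ w) u cg = actZ-congruent w (srefZ f u) (srefZ-congruent f u cg)

    total-congruent : Congruent total
    total-congruent = (V.replicate n (+ 0) , + 0) , (λ j → trans (lem (lookup (proj₁ total) j)) (cong (λ y → lookup (proj₁ total) j + H * y) (sym (VP.lookup-replicate j (+ 0))))) , lem (proj₂ total)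
      where
      lem : ∀ a → a ≡ a + H * + 0
      lem a = sym (trans (cong (_+_ a) (ZP.*-zeroʳ H)) (ZP.+-identityʳ a))

    level-sum : ∀ w → Σ ℤ λ z → sumZ (suc h) (λ p → F′ (act w (at (toℕ p))) - F′ (act w (at 0))) ≡ sumZ (suc h) (λ p → lt (toℕ p) i) + H * z
    level-sum w = go (actZ-congruent w total total-congruent)
      where
      valid-at : ∀ (p : Fin (suc h)) → Valid (at (toℕ p))
      valid-at p = NP.≤-pred (FP.toℕ<n p)
      lhs : D (actZ w total) ≡ sumZ (suc h) (λ p → F′ (act w (at (toℕ p))) - F′ (act w (at 0)))
      lhs = trans (D-sum (actZ w total) (λ p → actZ w (family p)) (actZ-sum w total family total-sum))
        (ΣZ.sum-cong (suc h) (λ p → trans (cong D (actZ-ξ w (at 0) (at (toℕ p)) z≤n (valid-at p))) (D-ξ (act w (at 0)) (act w (at (toℕ p))) (act-valid w (at 0) z≤n) (act-valid w (at (toℕ p)) (valid-at p)))))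
      rhs : D total ≡ sumZ (suc h) (λ p → lt (toℕ p) i)
      rhs = trans (D-sum total family total-sum) (ΣZ.sum-cong (suc h) (λ p → trans (D-ξ (at 0) (at (toℕ p)) z≤n (valid-at p)) (trans (cong (λ z → (lt (toℕ p) i + + 0) - (z + + 0)) (lt-no z≤n)) (lem (lt (toℕ p) i)))))
        where
        lem : ∀ a → (a + + 0) - (+ 0 + + 0) ≡ a
        lem = solve-∀
      go : Congruent (actZ w total) → Σ ℤ λ z → sumZ (suc h) (λ p → F′ (act w (at (toℕ p))) - F′ (act w (at 0))) ≡ sumZ (suc h) (λ p → lt (toℕ p) i) + H * z
      go ((z , kz) , ev , ek) = lookup z ι + kz , trans (sym lhs) (trans (cong₂ _+_ (ev ι) ek) (trans (lem (lookup (proj₁ total) ι) (proj₂ total) H (lookup z ι) kz) (cong (_+ H * (lookup z ι + kz)) rhs)))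
        where
        lem : ∀ a b H x y → (a + H * x) + (b + H * y) ≡ (a + b) + H * (x + y)
        lem = solve-∀

  module _ (I : RSet) (w : Word) (inv : Inv (ν w) I)
    (final : actInv w (V.map Q.-_ (toQv θ) , toQ (+ 2)) ≡ (toQv α , 0ℚ)) where
    open Inv inv

    -- -θ + 2δ is `ξ` of the positions (h , -2) and (0 , 0); these are the images of its two ends
    -- under w⁻¹.
    Pθ P₀ : Pos
    Pθ = act w (h , - (+ 2))
    P₀ = act w (at 0)

    vA : Valid Pθ
    vA = act-valid w (h , - (+ 2)) NP.≤-refl

    vB : Valid P₀
    vB = act-valid w (at 0) z≤n

    opaque
      ξ-final : ξ Pθ P₀ ≡ (α , + 0)
      ξ-final = toA-inj {ξ Pθ P₀} {α , + 0} (trans (sym (act-pair w (h , - (+ 2)) (at 0) NP.≤-refl z≤n)) (trans (cong (actInv w) (sym start)) final))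
        where
        start : (V.map Q.-_ (toQv θ) , toQ (+ 2)) ≡ toA (ξ (h , - (+ 2)) (at 0))
        start = cong₂ _,_ (trans (cong (λ v → V.map Q.-_ (toQv v)) θ≡) (trans (negQv (Er 0 h)) (cong toQv (Er-neg 0 h)))) refl

      ν-ends : ν w 0 ≡ ν w h - (H + H) + + 1
      ν-ends = trans (lem (ν w 0) (num Pθ)) (trans (cong₂ (λ x y → y + x) num-diff (num-act w h (- (+ 2)))) (lem₂ (ν w h) H))
        where
        num-diff : num P₀ - num Pθ ≡ + 1
        num-diff = trans (sym (ht-ξ Pθ P₀ vA vB)) (trans (cong ht ξ-final) (trans (cong (_+ + 0 * H) (φ-simple (λ _ → + 1) ι)) (lem₁ H)))
          where
          lem₁ : ∀ H → + 1 + + 0 * H ≡ + 1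
          lem₁ = solve-∀
        lem : ∀ b a → b ≡ a + (b - a)
        lem = solve-∀
        lem₂ : ∀ x H → (x + (- + 2) * H) + + 1 ≡ x - (H + H) + + 1
        lem₂ = solve-∀

    F : ℕ → ℤ
    F p = F′ (act w (at p))

    F-act : ∀ p k → F′ (act w (p , k)) ≡ F p + k
    F-act p k = trans (cong (λ z → F′ (act w (p , z))) (sym (ZP.+-identityˡ k))) (trans (cong F′ (act-⊕ w (at p) k)) (lem (lt (proj₁ (act w (at p))) i) (proj₂ (act w (at p))) k))
      where
      lem : ∀ a b k → a + (b + k) ≡ (a + b) + k
      lem = solve-∀

    F-le : ∀ {p q} k → p N.≤ h → q N.≤ h → ν w p + k * H ≤ ν w q → F p + k ≤ F q
    F-le {p} {q} k vp vq le = subst (_≤ F q) (F-act p k) (F-mono (act w (p , k)) (act w (at q)) (act-valid w (p , k) vp) (act-valid w (at q) vq) (subst (_≤ ν w q) (sym (num-act w p k)) le))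

    opaque
      F-ends : F h ≡ F 0 + + 1
      F-ends = trans (lem (F 0) (F h)) (trans (cong (λ z → F 0 + + 2 - z) (trans (cong (λ z → F 0 - z) (sym (F-act h (- (+ 2))))) step)) (lem₂ (F 0)))
        where
        step : F′ P₀ - F′ Pθ ≡ + 1
        step = trans (sym (D-ξ Pθ P₀ vA vB)) (trans (cong D ξ-final) (cong (_+ + 0) (trans (lookup-simple n ι ι) (eqi-yes refl))))
        lem : ∀ a b → b ≡ a + + 2 - (a - (b + (- + 2)))
        lem = solve-∀
        lem₂ : ∀ a → a + + 2 - + 1 ≡ a + + 1
        lem₂ = solve-∀

      F-weak : ∀ {p q} → p N.≤ q → q N.≤ h → F p ≤ F q
      F-weak {p} {q} le hq with NP.m≤n⇒m<n∨m≡n le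
      ... | inj₂ refl = ZP.≤-refl
      ... | inj₁ l = subst (_≤ F q) (ZP.+-identityʳ (F p)) (F-le (+ 0) (NP.≤-trans le hq) hq (ZP.≤-trans (ZP.≤-reflexive (lem (ν w p) H)) (ZP.<⇒≤ (C1 l hq))))
        where
        lem : ∀ a H → a + + 0 * H ≡ a
        lem = solve-∀

      x-range : ∀ {p} → p N.≤ h → + 0 ≤ F p - F 0 × F p - F 0 ≤ + 1
      x-range {p} hp = ZP.i≤j⇒0≤j-i (F-weak z≤n hp) , ≤-by (F-weak hp NP.≤-refl) (trans (cong (_- F p) F-ends) (lem (F 0) (F p)))
        where
        lem : ∀ a b → (a + + 1) - b ≡ + 1 - (b - a)
        lem = solve-∀

      -- The levels F p are determined by their sum, which is known modulo h + 1.
      levels : ∀ {p} → p N.≤ h → F p ≡ F 0 + lt p i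
      levels {p} hp = go (level-sum w) (F (suc i) - F 0 ZP.≟ + 1)
        where
        x : Fin (suc h) → ℤ
        x q = F (toℕ q) - F 0
        y′ : Fin (suc h) → ℤ
        y′ q = lt (toℕ q) i
        hq : ∀ (q : Fin (suc h)) → toℕ q N.≤ h
        hq q = NP.≤-pred (FP.toℕ<n q)
        pf : Fin (suc h)
        pf = fromℕ< (s≤s hp)
        ep : toℕ pf ≡ p
        ep = FP.toℕ-fromℕ< (s≤s hp)
        sf : Fin (suc h)
        sf = fromℕ< (s≤s i<h′)
        es : toℕ sf ≡ suc i
        es = FP.toℕ-fromℕ< (s≤s i<h′)
        rearr : ∀ a b z → a ≡ b + H * z → a - b ≡ H * z
        rearr a b z e = trans (cong (_- b) e) (lem b (H * z))
          where
          lem : ∀ b y → b + y - b ≡ y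
          lem = solve-∀
        rearr′ : ∀ a b z → a ≡ b + H * z → b - a ≡ H * (- z)
        rearr′ a b z e = trans (cong (λ a → b - a) e) (lem b H z)
          where
          lem : ∀ b H z → b - (b + H * z) ≡ H * (- z)
          lem = solve-∀
        -- `x` and `y′` are nondecreasing 0/1 sequences starting at 0, and `y′` jumps between i and
        -- i + 1. If `x` is 1 at i + 1 it dominates `y′`, otherwise it is dominated by it; in either
        -- case the difference is again 0/1-valued with sum divisible by h + 1, hence zero. In the
        -- second case this is absurd, since the difference is 1 at i + 1.
        go : (Σ ℤ λ z → sumZ (suc h) x ≡ sumZ (suc h) y′ + H * z) → Dec (F (suc i) - F 0 ≡ + 1) → F p ≡ F 0 + lt p i
        go (z , e) (yes one) = fromDiff (subst (λ q → F q - F 0 - lt q i ≡ + 0) ep (small-multiple h z nn le zer (trans (ΣZ.sum-⊖ (suc h) x y′) (rearr (sumZ (suc h) x) (sumZ (suc h) y′) z e)) pf))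
          where
          fromDiff : F p - F 0 - lt p i ≡ + 0 → F p ≡ F 0 + lt p i
          fromDiff e = trans (lem (F p) (F 0) (lt p i)) (trans (cong (_+ (F 0 + lt p i)) e) (ZP.+-identityˡ (F 0 + lt p i)))
            where
            lem : ∀ a b c → a ≡ (a - b - c) + (b + c)
            lem = solve-∀
          nn : ∀ q → + 0 ≤ x q - y′ q
          nn q with i N.<? toℕ q
          ... | yes l = subst (λ z → + 0 ≤ x q - z) (sym (lt-yes l)) (≤-by (F-weak l (hq q)) (trans (lem (F (toℕ q)) (F (suc i)) (F 0)) (cong (λ z → (x q - z) - + 0) one)))
            where
            lem : ∀ a b c → a - b ≡ ((a - c) - (b - c)) - + 0
            lem = solve-∀
          ... | no l = subst (λ z → + 0 ≤ x q - z) (sym (lt-no (NP.≮⇒≥ l))) (subst (+ 0 ≤_) (lem (x q)) (proj₁ (x-range (hq q))))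
            where
            lem : ∀ a → a ≡ a - + 0
            lem = solve-∀
          le : ∀ q → x q - y′ q ≤ + 1
          le q = ≤-by₂ (proj₂ (x-range (hq q))) (proj₁ (lt-range (toℕ q) i)) (lem (x q) (y′ q))
            where
            lem : ∀ a b → (+ 1 - a) + (b - + 0) ≡ + 1 - (a - b)
            lem = solve-∀
          zer : x F.zero - y′ F.zero ≡ + 0
          zer = trans (cong (λ z → (F 0 - F 0) - z) (lt-no z≤n)) (lem (F 0))
            where
            lem : ∀ a → (a - a) - + 0 ≡ + 0
            lem = solve-∀
        go (z , e) (no ¬one) = ⊥-elim (1≢0 (trans (sym (trans (cong₂ (λ u v → u - v) (trans (cong (λ q → lt q i) es) (lt-yes NP.≤-refl)) (trans (cong (λ q → F q - F 0) es) x₁)) refl))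
            (small-multiple h (- z) nn le zer (trans (ΣZ.sum-⊖ (suc h) y′ x) (rearr′ (sumZ (suc h) x) (sumZ (suc h) y′) z e)) sf)))
          where
          1≢0 : + 1 - + 0 ≢ + 0
          1≢0 ()
          x₁ : F (suc i) - F 0 ≡ + 0
          x₁ = bit (x-range i<h′) ¬one
            where
            bit : ∀ {a} → + 0 ≤ a × a ≤ + 1 → a ≢ + 1 → a ≡ + 0
            bit {a} (l , u) ne = ZP.≤-antisym (≤-by (<⇒+1≤ (ZP.≤∧≢⇒< u ne)) (lem a)) l
              where
              lem : ∀ a → + 1 - (a + + 1) ≡ + 0 - a
              lem = solve-∀
          nn : ∀ q → + 0 ≤ y′ q - x q
          nn q with i N.<? toℕ q
          ... | yes l = subst (λ z → + 0 ≤ z - x q) (sym (lt-yes l)) (ZP.i≤j⇒0≤j-i (proj₂ (x-range (hq q))))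
          ... | no l = ≤-by₂ (F-weak (NP.m≤n⇒m≤1+n (NP.≮⇒≥ l)) i<h′) (proj₁ (lt-range (toℕ q) i)) (trans (lem (F (suc i)) (F (toℕ q)) (F 0) (y′ q)) (trans (cong (λ z → (y′ q - x q) - + 0 + z) x₁) (ZP.+-identityʳ ((y′ q - x q) - + 0))))
            where
            lem : ∀ a b c y → (a - b) + (y - + 0) ≡ (y - (b - c)) - + 0 + (a - c)
            lem = solve-∀
          le : ∀ q → y′ q - x q ≤ + 1
          le q = ≤-by₂ (proj₂ (lt-range (toℕ q) i)) (proj₁ (x-range (hq q))) (lem (x q) (y′ q))
            where
            lem : ∀ a b → (+ 1 - b) + (a - + 0) ≡ + 1 - (b - a)
            lem = solve-∀
          zer : y′ F.zero - x F.zero ≡ + 0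
          zer = trans (cong (λ z → z - (F 0 - F 0)) (lt-no z≤n)) (lem (F 0))
            where
            lem : ∀ a → + 0 - (a - a) ≡ + 0
            lem = solve-∀

      -- A gap of H between two images raises the level by at least 1. For a cell (a , d) of I this
      -- forces a ≤ i < d. If (0 , i + 1) were missing, `C3` and `ν-ends` would leave a gap of H
      -- between the images of i + 1 and h, which have the same level; if (i , h) were missing,
      -- between those of 0 and i.
      good : DualOrderIdeal I → Good I
      good ideal = ideal , sub , top , side
        where
        sub : I ⊆M
        sub j m = go (cellOf j)
          where
          go : (∃₂ λ p q → p N.< q × q N.≤ h × Can t n p q × root j ≡ Er p q) → InM α j
          go (a , d , l , hd , _ , e) = ⇒InM (NP.≮⇒≥ (λ x → 1≰0 (≤-by₂ step (proj₂ (lt-range d i)) (trans (cong (λ z → (lt d i - (z + + 1)) + (+ 1 - lt d i)) (lt-yes x)) (lem₁ (lt d i))))) ,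
              NP.≰⇒> (λ x → 1≰0 (≤-by₂ step (proj₁ (lt-range a i)) (trans (cong (λ z → (z - (lt a i + + 1)) + (lt a i - + 0)) (lt-no x)) (lem₂ (lt a i))))) , hd) e
            where
            ha : a N.≤ h
            ha = NP.≤-trans (NP.<⇒≤ l) hd
            lem₀ : ∀ x H → x + + 1 * H ≡ x + H
            lem₀ = solve-∀
            lem₁ : ∀ x → (x - (+ 1 + + 1)) + (+ 1 - x) ≡ + 0 - + 1
            lem₁ = solve-∀
            lem₂ : ∀ x → (+ 0 - (x + + 1)) + (x - + 0) ≡ + 0 - + 1
            lem₂ = solve-∀
            lem₃ : ∀ f x y → (f + y) - (f + x + + 1) ≡ y - (x + + 1)
            lem₃ = solve-∀
            step : lt a i + + 1 ≤ lt d i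
            step = ≤-by (subst₂ (λ u v → u + + 1 ≤ v) (levels ha) (levels hd) (F-le (+ 1) ha hd (ZP.≤-trans (ZP.≤-reflexive (lem₀ (ν w a) H)) (ZP.<⇒≤ (C2 l hd (in⇒ m e)))))) (lem₃ (F 0) (lt a i) (lt d i))
        top : Er 0 (suc i) ∈R I
        top with Er 0 (suc i) ∈R? I
        ... | yes m = m
        ... | no nm = ⊥-elim (1≰0 (≤-by (F-le {suc i} {h} (+ 1) i<h′ NP.≤-refl (≤-by (<⇒+1≤ (C3 (s≤s z≤n) i<h′ nm)) (trans (cong (λ z → (z + H) - (ν w (suc i) + + 1)) ν-ends) (lem (ν w h) H (ν w (suc i))))))
            (trans (cong₂ (λ u v → u - (v + + 1)) F-ends (trans (levels i<h′) (cong (_+_ (F 0)) (lt-yes NP.≤-refl)))) (lem₂ (F 0)))))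
          where
          lem : ∀ x H y → ((x - (H + H) + + 1) + H) - (y + + 1) ≡ x - (y + + 1 * H)
          lem = solve-∀
          lem₂ : ∀ f → (f + + 1) - ((f + + 1) + + 1) ≡ + 0 - + 1
          lem₂ = solve-∀
        side : Er i h ∈R I
        side with Er i h ∈R? I
        ... | yes m = m
        ... | no nm = ⊥-elim (1≰0 (≤-by (F-le {0} {i} (+ 1) z≤n (NP.<⇒≤ i<h′) (≤-by (<⇒+1≤ (C3 i<h′ NP.≤-refl nm)) (trans (lem (ν w h) H (ν w i)) (cong (λ z → ν w i - (z + + 1 * H)) (sym ν-ends)))))
            (trans (cong (λ v → v - (F 0 + + 1)) (trans (levels (NP.<⇒≤ i<h′)) (cong (_+_ (F 0)) (lt-no NP.≤-refl)))) (lem₂ (F 0)))))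
          where
          lem : ∀ x H y → (y + H) - (x + + 1) ≡ y - ((x - (H + H) + + 1) + + 1 * H)
          lem = solve-∀
          lem₂ : ∀ f → (f + + 0) - (f + + 1) ≡ + 0 - + 1
          lem₂ = solve-∀

  iab⇒good : ∀ {I} → Iab α I → Good I
  iab⇒good {I} ((ideal , _) , w , inv , final) = good I w (inversions⇒ w I inv) final ideal

-- Sufficiency: mirror symmetry of words, row and column lengths, corners

IsThr : (ℕ → Set) → ℕ → ℕ → Set
IsThr P m τ = τ N.≤ m × (∀ k → k N.< m → (P k → k N.< τ) × (k N.< τ → P k))

thr-mono : ∀ {P Q m τ τ′} → IsThr P m τ → IsThr Q m τ′ → (∀ k → k N.< m → P k → Q k) → τ N.≤ τ′
thr-mono {τ = τ} {τ′} (le , f) (le′ , f′) imp = NP.≮⇒≥ (λ l → NP.<-irrefl refl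
  (proj₁ (f′ τ′ (NP.<-≤-trans l le)) (imp τ′ (NP.<-≤-trans l le) (proj₂ (f τ′ (NP.<-≤-trans l le)) l))))

thr-unique : ∀ {P m τ τ′} → IsThr P m τ → IsThr P m τ′ → τ ≡ τ′
thr-unique t t′ = NP.≤-antisym (thr-mono t t′ (λ _ _ p → p)) (thr-mono t′ t (λ _ _ p → p))

thr-exists : ∀ (P : ℕ → Set) → (∀ k → Dec (P k)) → ∀ m → (∀ {k l} → k N.≤ l → l N.< m → P l → P k) → ∃ (IsThr P m)
thr-exists P P? zero down = 0 , z≤n , λ k ()
thr-exists P P? (suc m) down = go (thr-exists P P? m (λ a b → down a (NP.m<n⇒m<1+n b))) (P? m)
  where
  go : ∃ (IsThr P m) → Dec (P m) → ∃ (IsThr P (suc m))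
  go (τ , le , f) (yes p) = suc m , NP.≤-refl , λ k l → (λ _ → l) , (λ _ → down (NP.≤-pred l) NP.≤-refl p)
  go (τ , le , f) (no np) = τ , NP.m≤n⇒m≤1+n le , λ k l → below k (NP.m≤n⇒m<n∨m≡n (NP.≤-pred l))
    where
    below : ∀ k → k N.< m ⊎ k ≡ m → (P k → k N.< τ) × (k N.< τ → P k)
    below k (inj₁ l) = f k l
    below k (inj₂ refl) = (λ p → ⊥-elim (np p)) , (λ l → ⊥-elim (NP.<⇒≱ l le))

IsC : RType → Set
IsC A = ⊥
IsC C = ⊤

cls-inj : ∀ t n → ValidRank t n → ∀ {r s} → r N.≤ hi t n → s N.≤ hi t n → cls t n r ≡ cls t n s →
  r ≡ s ⊎ IsC t × r N.< hi t n × s ≡ hi t n ∸ suc r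
cls-inj A n v _ _ e = inj₁ e
cls-inj C n v {r} {s} lr ls e = go (r N.≟ H) (s N.≟ H)
  where
  H : ℕ
  H = hi C n
  go : Dec (r ≡ H) → Dec (s ≡ H) → r ≡ s ⊎ ⊤ × r N.< H × s ≡ H ∸ suc r
  go (yes a) (yes b) = inj₁ (trans a (sym b))
  go (yes a) (no b) = ⊥-elim (NP.<⇒≢ (cls-lt C n (NP.≤∧≢⇒< ls b)) (trans (sym e) (trans (cong (cls C n) a) (cls-hi C n v))))
  go (no a) (yes b) = ⊥-elim (NP.<⇒≢ (cls-lt C n (NP.≤∧≢⇒< lr a)) (trans e (trans (cong (cls C n) b) (cls-hi C n v))))
  go (no a) (no b) = low (r N.<? n) (s N.<? n)
    where
    r<H : r N.< H
    r<H = NP.≤∧≢⇒< lr a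
    s<H : s N.< H
    s<H = NP.≤∧≢⇒< ls b
    back : ∀ {x y} → x N.< H → H ∸ suc x ≡ y → x ≡ H ∸ suc y
    back {x} l refl = sym (trans (cong (H ∸_) (sym (NP.+-∸-assoc 1 l))) (NP.m∸[m∸n]≡n (NP.<⇒≤ l)))
    low : Dec (r N.< n) → Dec (s N.< n) → r ≡ s ⊎ ⊤ × r N.< H × s ≡ H ∸ suc r
    low (yes x) (yes y) = inj₁ (trans (sym (cls-id C n x)) (trans e (cls-id C n y)))
    low (yes x) (no y) = inj₂ (tt , r<H , back s<H (trans (sym (cls-fold n (NP.≮⇒≥ y) s<H)) (trans (sym e) (cls-id C n x))))
    low (no x) (yes y) = inj₂ (tt , r<H , trans (sym (cls-id C n y)) (trans (sym e) (cls-fold n (NP.≮⇒≥ x) r<H)))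
    low (no x) (no y) = inj₁ (trans (back r<H (trans (sym (cls-fold n (NP.≮⇒≥ x) r<H)) (trans e (cls-fold n (NP.≮⇒≥ y) s<H))))
      (trans (cong (H ∸_) (sym (NP.+-∸-assoc 1 s<H))) (NP.m∸[m∸n]≡n (NP.<⇒≤ s<H))))

cls-flip : ∀ t n → ValidRank t n → IsC t → ∀ {r} → r N.≤ hi t n → cls t n (hi t n ∸ r) ≡ pcls t n r
cls-flip C n v _ {zero} l = cls-hi C n v
cls-flip C n v _ {suc r} l = cls-mirror n v l

pcls-flip : ∀ t n → ValidRank t n → IsC t → ∀ {r} → r N.≤ hi t n → pcls t n (hi t n ∸ r) ≡ cls t n r
pcls-flip C n v _ {r} l with NP.m≤n⇒m<n∨m≡n l
... | inj₁ l′ = trans (cong (pcls C n) (NP.+-∸-assoc 1 l′)) (cls-mirror n v l′)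
... | inj₂ e = trans (cong (pcls C n) (trans (cong (_∸ r) (sym e)) (NP.n∸n≡0 r))) (sym (trans (cong (cls C n) e) (cls-hi C n v)))

mirLR : ∀ t n {p q} → IsC t → mirL t n p q ≡ hi t n ∸ q × mirR t n p q ≡ hi t n ∸ p
mirLR C n _ = refl , refl

mir-invol : ∀ t n {p q} → p N.≤ hi t n → q N.≤ hi t n →
  mirL t n (mirL t n p q) (mirR t n p q) ≡ p × mirR t n (mirL t n p q) (mirR t n p q) ≡ q
mir-invol A n _ _ = refl , refl
mir-invol C n hp hq = NP.m∸[m∸n]≡n hp , NP.m∸[m∸n]≡n hq

mir-anti : ∀ t n {a d p q} → p N.≤ hi t n → q N.≤ hi t n → d N.≤ hi t n → mirL t n a d N.≤ p → q N.≤ mirR t n a d →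
  a N.≤ hi t n → a N.≤ mirL t n p q × mirR t n p q N.≤ d
mir-anti A n _ _ _ la lq _ = la , lq
mir-anti C n {a} {d} {p} {q} hp hq hd la lq ha = Flip.flip≤ (hi C n) ha lq , NP.≤-trans (NP.∸-monoʳ-≤ (hi C n) la) (NP.≤-reflexive (NP.m∸[m∸n]≡n hd))

module Sufficiency (t : RType) (n : ℕ) (valid : ValidRank t n) (ι : Fin n) (long : LongIx t n (toℕ ι)) where
  open Necessity t n valid ι long public

  mirP : Pos → Pos
  mirP (r , k) = h ∸ r , - k

  mirP-valid : ∀ P → Valid (mirP P)
  mirP-valid (r , k) = NP.m∸n≤m h r

  +h∸ : ∀ {r} → r N.≤ h → + (h ∸ r) ≡ + h - + r
  +h∸ {r} l = trans (sym (ZP.⊖-≥ l)) (sym (ZP.m-n≡m⊖n h r))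

  num-mir : ∀ P → Valid P → num (mirP P) ≡ + h - num P
  num-mir (r , k) v = trans (cong (_+ (- k) * H) (+h∸ v)) (lem (+ h) (+ r) k H)
    where
    lem : ∀ h r k H → (h - r) + (- k) * H ≡ h - (r + k * H)
    lem = solve-∀

  mir-suc : ∀ P → Valid P → mirP (sucP P) ≡ preP (mirP P)
  mir-suc P v = num-inj _ _ (mirP-valid (sucP P)) (preP-valid (mirP P) (mirP-valid P)) (trans (num-mir (sucP P) (sucP-valid P)) (trans (cong (λ z → + h - z) (num-suc P v))
    (trans (lem (+ h) (num P)) (sym (trans (num-pre (mirP P)) (cong (_- + 1) (num-mir P v)))))))
    where
    lem : ∀ a b → a - (b + + 1) ≡ (a - b) - + 1
    lem = solve-∀

  mir-pre : ∀ P → Valid P → mirP (preP P) ≡ sucP (mirP P)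
  mir-pre P v = num-inj _ _ (mirP-valid (preP P)) (sucP-valid (mirP P)) (trans (num-mir (preP P) (preP-valid P v)) (trans (cong (λ z → + h - z) (num-pre P))
    (trans (lem (+ h) (num P)) (sym (trans (num-suc (mirP P) (mirP-valid P)) (cong (_+ + 1) (num-mir P v)))))))
    where
    lem : ∀ a b → a - (b - + 1) ≡ (a - b) + + 1
    lem = solve-∀

  -- The mirror exchanges the labels into and out of a position and reverses the order of positions,
  -- so up-moves and down-moves correspond. Thus words of type C act by permutations commuting with
  -- the mirror.
  σ-mir : IsC t → ∀ f P → Valid P → σ f (mirP P) ≡ mirP (σ f P)
  σ-mir ic f P v = go (cls t n (proj₁ P) N.≟ label f) (pcls t n (proj₁ P) N.≟ label f)
    where
    go : Dec (cls t n (proj₁ P) ≡ label f) → Dec (pcls t n (proj₁ P) ≡ label f) → σ f (mirP P) ≡ mirP (σ f P)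
    go (yes a) _ = trans (σ-pre f (mirP P) (mirP-valid P) (trans (pcls-flip t n valid ic v) a)) (trans (sym (mir-suc P v)) (cong mirP (sym (σ-suc f P a))))
    go (no _) (yes b) = trans (σ-suc f (mirP P) (trans (cls-flip t n valid ic v) b)) (trans (sym (mir-pre P v)) (cong mirP (sym (σ-pre f P v b))))
    go (no a) (no b) = trans (σ-fix f (mirP P) (λ x → b (trans (sym (cls-flip t n valid ic v)) x)) (λ x → a (trans (sym (pcls-flip t n valid ic v)) x))) (cong mirP (sym (σ-fix f P a b)))

  act-mir : IsC t → ∀ w P → Valid P → act w (mirP P) ≡ mirP (act w P)
  act-mir ic [] P v = refl
  act-mir ic (f ∷ w) P v = trans (cong (act w) (σ-mir ic f P v)) (act-mir ic w (σ f P) (σ-valid f P v))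

  act-snoc : ∀ w f P → act (w L.++ f ∷ []) P ≡ σ f (act w P)
  act-snoc [] f P = refl
  act-snoc (f′ ∷ w) f P = act-snoc w f (σ f′ P)

  res-inj : ∀ w {p q k m} → p N.≤ h → q N.≤ h → proj₁ (act w (p , k)) ≡ proj₁ (act w (q , m)) → p ≡ q
  res-inj w {p} {q} vp vq e with p N.≟ q
  ... | yes x = x
  ... | no x = ⊥-elim (res-distinct w vp vq x e)

  UpClosed : RSet → Set
  UpClosed I = ∀ {p q p′ q′} → Rect p q → Er p q ∈R I → p′ N.≤ p → q N.≤ q′ → q′ N.≤ h → Er p′ q′ ∈R I

  -- Rows are read inward from the far end h and columns from 0, so that an up-closed set meets each
  -- of them in an initial segment, whose length is the threshold of `IsThr`.
  Prow Pcol : RSet → ℕ → ℕ → Set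
  Prow I a k = Er a (h ∸ k) ∈R I
  Pcol I d k = Er k d ∈R I

  record Realizes (w : Word) (I : RSet) : Set where
    field
      left : ∀ {a τ} → a N.≤ i → IsThr (Prow I a) (h ∸ i) τ → ν w a ≡ + a - + τ
      right : ∀ {d τ} → i N.< d → d N.≤ h → IsThr (Pcol I d) (suc i) τ → ν w d ≡ + d + + τ

  row-k : ∀ {k} → k N.< h ∸ i → i N.< h ∸ k
  row-k {k} l = NP.m+n≤o⇒m≤o∸n (suc i) (subst (N._≤ h) (cong suc (NP.+-comm k i)) (NP.m≤o∸n⇒m+n≤o (suc k) (NP.<⇒≤ i<h′) l))

  row-d : ∀ {d} → i N.< d → d N.≤ h → h ∸ d N.< h ∸ i
  row-d l m = NP.∸-monoʳ-< l m

  thr-row : ∀ I → UpClosed I → ∀ a → a N.≤ i → ∃ (IsThr (Prow I a) (h ∸ i))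
  thr-row I u a la = thr-exists (Prow I a) (λ k → Er a (h ∸ k) ∈R? I) (h ∸ i) (λ {k} {l} k≤l l< m → u (la , row-k l< , NP.m∸n≤m h l) m NP.≤-refl (NP.∸-monoʳ-≤ h k≤l) (NP.m∸n≤m h k))

  thr-col : ∀ I → UpClosed I → ∀ d → i N.< d → d N.≤ h → ∃ (IsThr (Pcol I d) (suc i))
  thr-col I u d ld hd = thr-exists (Pcol I d) (λ k → Er k d ∈R? I) (suc i) (λ {k} {l} k≤l l< m → u (NP.≤-pred l< , ld , hd) m k≤l NP.≤-refl hd)

  Corner : RSet → ℕ → ℕ → Set
  Corner I a d = Rect a d × Er a d ∈R I × (∀ {p q} → Rect p q → Er p q ∈R I → a N.≤ p → q N.≤ d → p ≡ a × q ≡ d)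

  find-corner : ∀ {I} → UpClosed I → I ⊆M → ∀ m {a d} → d N.≤ m N.+ a → Rect a d → Er a d ∈R I → ∃₂ (Corner I)
  find-corner u sub zero le r _ = ⊥-elim (NP.<⇒≱ (proj₁ (rect≤ r)) le)
  find-corner {I} u sub (suc m) {a} {suc d} le r@(la , s≤s ld , hd) c with Er (suc a) (suc d) ∈R? I | Er a d ∈R? I
  ... | yes x | _ = find-corner u sub m (subst (suc d N.≤_) (sym (NP.+-suc m a)) le) (cell-rect sub (NP.<-≤-trans (proj₁ (rect≤ r)) hd) hd x) x
  ... | no _ | yes x = find-corner u sub m (NP.≤-pred le) (cell-rect sub (NP.≤-trans la (NP.<⇒≤ i<h′)) (NP.<⇒≤ hd) x) x
  ... | no x | no y = a , suc d , r , c , min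
    where
    min : ∀ {p q} → Rect p q → Er p q ∈R I → a N.≤ p → q N.≤ suc d → p ≡ a × q ≡ suc d
    min {p} {q} rp m a≤p q≤d with NP.m≤n⇒m<n∨m≡n a≤p | NP.m≤n⇒m<n∨m≡n q≤d
    ... | inj₁ l | _ = ⊥-elim (x (u rp m l q≤d hd))
    ... | inj₂ e | inj₁ l = ⊥-elim (y (u rp m (NP.≤-reflexive e) (NP.≤-pred l) (NP.<⇒≤ hd)))
    ... | inj₂ e | inj₂ e′ = sym e , e′

  corner-mir : ∀ {I a d} → Corner I a d → Corner I (mirL t n a d) (mirR t n a d)
  corner-mir {I} {a} {d} (r , m , min) = rect-mir r , subst (_∈R I) (sym (Er-mirror ha hd)) m , min′
    where
    ha : a N.≤ h
    ha = proj₁ (proj₂ (rect≤ r))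
    hd : d N.≤ h
    hd = proj₂ (proj₂ r)
    min′ : ∀ {p q} → Rect p q → Er p q ∈R I → mirL t n a d N.≤ p → q N.≤ mirR t n a d → p ≡ mirL t n a d × q ≡ mirR t n a d
    min′ {p} {q} rp mp la lq with mir-anti t n (proj₁ (proj₂ (rect≤ rp))) (proj₂ (proj₂ rp)) hd la lq ha
    ... | x , y with min (rect-mir rp) (subst (_∈R I) (sym (Er-mirror (proj₁ (proj₂ (rect≤ rp))) (proj₂ (proj₂ rp)))) mp) x y | mir-invol t n (proj₁ (proj₂ (rect≤ rp))) (proj₂ (proj₂ rp))
    ... | e₁ , e₂ | i₁ , i₂ = trans (sym i₁) (cong₂ (mirL t n) e₁ e₂) , trans (sym i₂) (cong₂ (mirR t n) e₁ e₂)

  opaque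
    cell-eq : ∀ {p q p′ q′} → Rect p q → Rect p′ q′ → Er p q ≡ Er p′ q′ → (p ≡ p′ × q ≡ q′) ⊎ (p ≡ mirL t n p′ q′ × q ≡ mirR t n p′ q′)
    cell-eq {p} {q} {p′} {q′} r r′ e = go (can-or-mirror t n hp hq) (can-or-mirror t n hp′ hq′)
      where
      hp : p N.≤ h
      hp = proj₁ (proj₂ (rect≤ r))
      hq : q N.≤ h
      hq = proj₂ (proj₂ r)
      hp′ : p′ N.≤ h
      hp′ = proj₁ (proj₂ (rect≤ r′))
      hq′ : q′ N.≤ h
      hq′ = proj₂ (proj₂ r′)
      inj : ∀ {a b a′ b′} → Rect a b → Rect a′ b′ → Can t n a b → Can t n a′ b′ → Er a b ≡ Er a′ b′ → a ≡ a′ × b ≡ b′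
      inj x y c c′ e = Er-inj t n valid (proj₁ (rect≤ x)) (proj₂ (proj₂ x)) c (proj₁ (rect≤ y)) (proj₂ (proj₂ y)) c′ e
      go : Can t n p q ⊎ Can t n (mirL t n p q) (mirR t n p q) → Can t n p′ q′ ⊎ Can t n (mirL t n p′ q′) (mirR t n p′ q′) → (p ≡ p′ × q ≡ q′) ⊎ (p ≡ mirL t n p′ q′ × q ≡ mirR t n p′ q′)
      go (inj₁ c) (inj₁ c′) = inj₁ (inj r r′ c c′ e)
      go (inj₁ c) (inj₂ c′) = inj₂ (inj r (rect-mir r′) c c′ (trans e (sym (Er-mirror hp′ hq′))))
      go (inj₂ c) (inj₁ c′) = inj₂ (back (inj (rect-mir r) r′ c c′ (trans (Er-mirror hp hq) e)))
        where
        back : mirL t n p q ≡ p′ × mirR t n p q ≡ q′ → p ≡ mirL t n p′ q′ × q ≡ mirR t n p′ q′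
        back (x , y) = trans (sym (proj₁ (mir-invol t n hp hq))) (cong₂ (mirL t n) x y) , trans (sym (proj₂ (mir-invol t n hp hq))) (cong₂ (mirR t n) x y)
      go (inj₂ c) (inj₂ c′) = inj₁ (back (inj (rect-mir r) (rect-mir r′) c c′ (trans (Er-mirror hp hq) (trans e (sym (Er-mirror hp′ hq′))))))
        where
        back : mirL t n p q ≡ mirL t n p′ q′ × mirR t n p q ≡ mirR t n p′ q′ → p ≡ p′ × q ≡ q′
        back (x , y) = trans (sym (proj₁ (mir-invol t n hp hq))) (trans (cong₂ (mirL t n) x y) (proj₁ (mir-invol t n hp′ hq′))) ,
          trans (sym (proj₂ (mir-invol t n hp hq))) (trans (cong₂ (mirR t n) x y) (proj₂ (mir-invol t n hp′ hq′)))

label-of : ∀ n {m} → m N.≤ n → Σ (Fin (suc n)) λ f → label f ≡ m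
label-of n {m} le with NP.m≤n⇒m<n∨m≡n le
... | inj₁ l = F.suc (fromℕ< l) , FP.toℕ-fromℕ< l
... | inj₂ e = F.zero , sym e

cls≤n : ∀ t n → ValidRank t n → ∀ {r} → r N.≤ hi t n → cls t n r N.≤ n
cls≤n t n v {r} le with NP.m≤n⇒m<n∨m≡n le
... | inj₁ l = NP.<⇒≤ (cls-lt t n l)
... | inj₂ refl = NP.≤-reflexive (cls-hi t n v)

IsC? : ∀ t n {a d} → (mirL t n a d ≡ a × mirR t n a d ≡ d) ⊎ IsC t
IsC? A n = inj₁ (refl , refl)
IsC? C n = inj₂ tt

-- Building w_I by adding corners

module Words (t : RType) (n : ℕ) (valid : ValidRank t n) (ι : Fin n) (long : LongIx t n (toℕ ι)) where
  open Sufficiency t n valid ι long public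

  res-suc : ∀ P Q → proj₁ P ≡ proj₁ Q → proj₁ (sucP P) ≡ proj₁ (sucP Q)
  res-suc (r , k) (.r , m) refl with r N.<? h
  ... | yes _ = refl
  ... | no _ = refl

  res-suc-< : ∀ P → proj₁ P N.< h → proj₁ (sucP P) ≡ suc (proj₁ P)
  res-suc-< (r , k) l with r N.<? h
  ... | yes _ = refl
  ... | no nl = ⊥-elim (nl l)

  swap< : ∀ {d k} → d N.≤ h → k N.< h ∸ d → d N.< h ∸ k
  swap< {d} {k} hd l = NP.m+n≤o⇒m≤o∸n (suc d) (subst (N._≤ h) (cong suc (NP.+-comm k d)) (NP.m≤o∸n⇒m+n≤o (suc k) hd l))

  swap≤ : ∀ {d k} → d N.≤ h → h ∸ d N.≤ k → h ∸ k N.≤ d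
  swap≤ hd l = NP.≤-trans (NP.∸-monoʳ-≤ h l) (NP.≤-reflexive (NP.m∸[m∸n]≡n hd))

  -- Adding the root of a corner e to I′ = I ∖ {e} multiplies w by one simple reflection.
  module Step (I I′ : RSet) (u : UpClosed I) (sub : I ⊆M) (a d : ℕ) (corner : Corner I a d)
    (I′⇒ : ∀ {p q} → Er p q ∈R I′ → Er p q ∈R I × Er p q ≢ Er a d) (⇒I′ : ∀ {p q} → Er p q ∈R I → Er p q ≢ Er a d → Er p q ∈R I′)
    (w′ : Word) (real : Realizes w′ I′) where

    -- In type C a root removes two mirror cells at once. What follows is proved for either of them
    -- and used at `e₁` and `e₂`, which coincide when the cell is its own mirror.
    record Cor (a* d* : ℕ) : Set where
      field
        cor : Corner I a* d*
        same : Er a* d* ≡ Er a d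
        cor~ : Corner I (mirL t n a* d*) (mirR t n a* d*)

      rect* : Rect a* d*
      rect* = proj₁ cor
      min* : ∀ {p q} → Rect p q → Er p q ∈R I → a* N.≤ p → q N.≤ d* → p ≡ a* × q ≡ d*
      min* = proj₂ (proj₂ cor)
      ha* : a* N.≤ h
      ha* = proj₁ (proj₂ (rect≤ rect*))
      hd* : d* N.≤ h
      hd* = proj₂ (proj₂ rect*)

      -- The other cell of the removed root is also a corner, that is, minimal in I. A minimal cell
      -- that dominates (a* , d*) equals it, so the remaining cells above the corner survive in
      -- `I′`.
      distinct : ∀ {p q} → Rect p q → p N.≤ a* → d* N.≤ q → ¬ (p ≡ a* × q ≡ d*) → Er p q ≢ Er a d
      distinct {p} {q} rp lp lq ne e = go (cell-eq rp rect* (trans e (sym same)))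
        where
        go : (p ≡ a* × q ≡ d*) ⊎ (p ≡ mirL t n a* d* × q ≡ mirR t n a* d*) → ⊥
        go (inj₁ x) = ne x
        go (inj₂ (x , y)) = ne (trans x (sym (proj₁ z)) , trans y (sym (proj₂ z)))
          where
          z : a* ≡ mirL t n a* d* × d* ≡ mirR t n a* d*
          z = proj₂ (proj₂ cor~) rect* (proj₁ (proj₂ cor)) (subst (N._≤ a*) x lp) (subst (d* N.≤_) y lq)

      rowThr′ : IsThr (Prow I′ a*) (h ∸ i) (h ∸ d*)
      rowThr′ = NP.<⇒≤ (row-d (proj₁ (proj₂ rect*)) hd*) , λ k k< → (λ m → NP.≰⇒> (λ le → absurd k k< m le)) ,
        (λ l → ⇒I′ (u rect* (proj₁ (proj₂ cor)) NP.≤-refl (NP.<⇒≤ (swap< hd* l)) (NP.m∸n≤m h k))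
          (distinct (proj₁ rect* , row-k k< , NP.m∸n≤m h k) NP.≤-refl (NP.<⇒≤ (swap< hd* l)) (λ x → NP.<⇒≢ (swap< hd* l) (sym (proj₂ x)))))
        where
        absurd : ∀ k → k N.< h ∸ i → Er a* (h ∸ k) ∈R I′ → h ∸ d* N.≤ k → ⊥
        absurd k k< m le with min* (proj₁ rect* , row-k k< , NP.m∸n≤m h k) (proj₁ (I′⇒ m)) NP.≤-refl (swap≤ hd* le)
        ... | _ , e = proj₂ (I′⇒ m) (trans (cong (Er a*) e) same)

      rowThr : IsThr (Prow I a*) (h ∸ i) (suc (h ∸ d*))
      rowThr = row-d (proj₁ (proj₂ rect*)) hd* , λ k k< → (λ m → NP.≰⇒> (λ le → absurd k k< m le)) ,
        (λ l → u rect* (proj₁ (proj₂ cor)) NP.≤-refl (NP.≤-trans (NP.≤-reflexive (sym (NP.m∸[m∸n]≡n hd*))) (NP.∸-monoʳ-≤ h (NP.≤-pred l))) (NP.m∸n≤m h k))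
        where
        absurd : ∀ k → k N.< h ∸ i → Er a* (h ∸ k) ∈R I → suc (h ∸ d*) N.≤ k → ⊥
        absurd k k< m le with min* (proj₁ rect* , row-k k< , NP.m∸n≤m h k) m NP.≤-refl (swap≤ hd* (NP.<⇒≤ le))
        ... | _ , e = NP.<⇒≢ le (trans (cong (h ∸_) (sym e)) (NP.m∸[m∸n]≡n (NP.≤-trans (NP.<⇒≤ k<) (NP.m∸n≤m h i))))

      colThr′ : IsThr (Pcol I′ d*) (suc i) a*
      colThr′ = NP.m≤n⇒m≤1+n (proj₁ rect*) , λ k k< → (λ m → NP.≰⇒> (λ le → absurd k k< m le)) ,
        (λ l → ⇒I′ (u rect* (proj₁ (proj₂ cor)) (NP.<⇒≤ l) NP.≤-refl hd*) (distinct (NP.≤-pred k< , proj₂ rect*) (NP.<⇒≤ l) NP.≤-refl (λ x → NP.<⇒≢ l (proj₁ x))))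
        where
        absurd : ∀ k → k N.< suc i → Er k d* ∈R I′ → a* N.≤ k → ⊥
        absurd k k< m le with min* (NP.≤-pred k< , proj₂ rect*) (proj₁ (I′⇒ m)) le NP.≤-refl
        ... | e , _ = proj₂ (I′⇒ m) (trans (cong (λ z → Er z d*) e) same)

      colThr : IsThr (Pcol I d*) (suc i) (suc a*)
      colThr = s≤s (proj₁ rect*) , λ k k< → (λ m → NP.≰⇒> (λ le → NP.<⇒≢ le (sym (proj₁ (min* (NP.≤-pred k< , proj₂ rect*) m (NP.<⇒≤ le) NP.≤-refl))))) ,
        (λ l → u rect* (proj₁ (proj₂ cor)) (NP.≤-pred l) NP.≤-refl hd*)

      ν-left : ν w′ a* ≡ + a* - + (h ∸ d*)
      ν-left = Realizes.left real (proj₁ rect*) rowThr′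

      ν-right : ν w′ d* ≡ + d* + + a*
      ν-right = Realizes.right real (proj₁ (proj₂ rect*)) hd* colThr′

      before : Pos
      before = act w′ (d* , - (+ 1))

      v-before : Valid before
      v-before = act-valid w′ (d* , - (+ 1)) hd*

      -- Before the corner is added, row a* has h - d* cells and column d* has a* cells. So ν(a*) =
      -- a* - h + d*, while the image of d* one period lower is a* + d* - (h + 1), its predecessor:
      -- a single simple reflection exchanges the two.
      adjacent : act w′ (at a*) ≡ sucP before
      adjacent = num-inj (act w′ (at a*)) (sucP before) (act-valid w′ (at a*) ha*) (sucP-valid before) (trans ν-left (trans (cong (λ z → + a* - z) (+h∸ hd*))
        (trans (lem (+ a*) (+ h) (+ d*)) (sym (trans (num-suc before v-before) (cong (_+ + 1) (trans (num-act w′ d* (- (+ 1))) (cong (_+ (- (+ 1)) * H) ν-right))))))))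
        where
        lem : ∀ a h d → a - (h - d) ≡ (d + a) + (- + 1) * (+ 1 + h) + + 1
        lem = solve-∀

      res-before : proj₁ (act w′ (at d*)) ≡ proj₁ before
      res-before = sym (cong proj₁ (act-⊕ w′ (at d*) (- (+ 1))))

    e₁ : Cor a d
    e₁ = record { cor = corner ; same = refl ; cor~ = corner-mir corner }

    r₁ : Rect a d
    r₁ = proj₁ corner

    e₂ : Cor (mirL t n a d) (mirR t n a d)
    e₂ = record { cor = corner-mir corner ; same = Er-mirror (proj₁ (proj₂ (rect≤ r₁))) (proj₂ (proj₂ r₁))
                ; cor~ = subst₂ (Corner I) (sym (proj₁ inv)) (sym (proj₂ inv)) corner }
      where
      inv : mirL t n (mirL t n a d) (mirR t n a d) ≡ a × mirR t n (mirL t n a d) (mirR t n a d) ≡ d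
      inv = mir-invol t n (proj₁ (proj₂ (rect≤ r₁))) (proj₂ (proj₂ r₁))

    module E₁ = Cor e₁
    module E₂ = Cor e₂

    R : ℕ
    R = proj₁ E₁.before

    f : Fin (suc n)
    f = proj₁ (label-of n (cls≤n t n valid E₁.v-before))

    label-f : label f ≡ cls t n R
    label-f = proj₂ (label-of n (cls≤n t n valid E₁.v-before))

    w : Word
    w = w′ L.++ f ∷ []

    -- `w′` commutes with the mirror, so the mirror corner sits at the mirror step, which has the
    -- same label: one reflection handles both cells.
    cls₂ : cls t n (proj₁ E₂.before) ≡ label f
    cls₂ = trans (go (IsC? t n {a} {d})) (sym label-f)
      where
      go : (mirL t n a d ≡ a × mirR t n a d ≡ d) ⊎ IsC t → cls t n (proj₁ E₂.before) ≡ cls t n R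
      go (inj₁ (_ , y)) = cong (λ z → cls t n (proj₁ (act w′ (z , - (+ 1))))) y
      go (inj₂ ic) = trans (cong (cls t n) res-E₂) (trans (cls-flip t n valid ic (act-valid w′ (at a) E₁.ha*)) (trans (cong (λ z → pcls t n (proj₁ z)) E₁.adjacent) (pcls-suc E₁.before E₁.v-before)))
        where
        res-E₂ : proj₁ E₂.before ≡ h ∸ proj₁ (act w′ (at a))
        res-E₂ = trans (cong proj₁ (act-⊕ w′ (at (mirR t n a d)) (- (+ 1)))) (trans (cong (λ z → proj₁ (act w′ (at z))) (proj₂ (mirLR t n {a} {d} ic))) (cong proj₁ (act-mir ic w′ (at a) E₁.ha*)))

    -- Only the step at `R` and its mirror carry the label of `f`. So the reflection moves just the
    -- rows and columns of the two corners, in agreement with the unchanged lengths elsewhere.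
    up-case : ∀ {p} → p N.≤ h → cls t n (proj₁ (act w′ (at p))) ≡ label f → p ≡ d ⊎ p ≡ mirR t n a d
    up-case {p} hp e = go (cls-inj t n valid E₁.v-before (act-valid w′ (at p) hp) (trans (sym label-f) (sym e)))
      where
      go : R ≡ proj₁ (act w′ (at p)) ⊎ IsC t × R N.< h × proj₁ (act w′ (at p)) ≡ h ∸ suc R → p ≡ d ⊎ p ≡ mirR t n a d
      go (inj₁ x) = inj₁ (sym (res-inj w′ E₁.hd* hp x))
      go (inj₂ (ic , l , x)) = inj₂ (trans (res-inj w′ {p} {h ∸ a} {+ 0} {+ 0} hp (NP.m∸n≤m h a) (trans x (trans (cong (h ∸_) (sym (trans (cong proj₁ E₁.adjacent) (res-suc-< E₁.before l))))
        (sym (cong proj₁ (act-mir ic w′ (at a) E₁.ha*)))))) (sym (proj₂ (mirLR t n {a} {d} ic))))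

    down-case : ∀ {p} → p N.≤ h → pcls t n (proj₁ (act w′ (at p))) ≡ label f → p ≡ a ⊎ p ≡ mirL t n a d
    down-case {p} hp e = go (cls-inj t n valid E₁.v-before (preP-valid P vP) (trans (sym label-f) (trans (sym e) (sym (cls-pre P)))))
      where
      P : Pos
      P = act w′ (at p)
      vP : Valid P
      vP = act-valid w′ (at p) hp
      go : R ≡ proj₁ (preP P) ⊎ IsC t × R N.< h × proj₁ (preP P) ≡ h ∸ suc R → p ≡ a ⊎ p ≡ mirL t n a d
      go (inj₁ x) = inj₁ (res-inj w′ {p} {a} {+ 0} {+ 0} hp E₁.ha* (trans (cong proj₁ (sym (suc-pre P vP))) (trans (res-suc (preP P) E₁.before (sym x)) (cong proj₁ (sym E₁.adjacent)))))
      go (inj₂ (ic , l , x)) = inj₂ (trans (res-inj w′ {p} {h ∸ d} {+ 0} {+ 1} hp (NP.m∸n≤m h d) (trans (cong proj₁ (sym (suc-pre P vP)))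
          (trans (res-suc-< (preP P) (subst (N._< h) (sym x) (NP.∸-monoʳ-< (s≤s z≤n) l))) (trans (cong suc x) (trans (sym (NP.+-∸-assoc 1 l)) (sym (cong proj₁ (act-mir ic w′ (d , - (+ 1)) E₁.hd*))))))))
        (sym (proj₁ (mirLR t n {a} {d} ic))))

    ν-w : ∀ p → ν w p ≡ num (σ f (act w′ (at p)))
    ν-w p = cong num (act-snoc w′ f (at p))

    module _ {a* d*} (E : Cor a* d*) (ce : cls t n (proj₁ (Cor.before E)) ≡ label f) where
      open Cor E

      left-moved : ∀ {τ} → IsThr (Prow I a*) (h ∸ i) τ → ν w a* ≡ + a* - + τ
      left-moved {τ} thr = trans (ν-w a*) (trans (cong num (σ-pre f (act w′ (at a*)) (act-valid w′ (at a*) ha*) (trans (cong (λ z → pcls t n (proj₁ z)) adjacent) (trans (pcls-suc before v-before) ce))))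
        (trans (num-pre (act w′ (at a*))) (trans (cong (_- + 1) ν-left) (trans (lem (+ a*) (+ (h ∸ d*))) (cong (λ z → + a* - + z) (thr-unique rowThr thr))))))
        where
        lem : ∀ a x → a - x - + 1 ≡ a - (+ 1 + x)
        lem = solve-∀

      right-moved : ∀ {τ} → IsThr (Pcol I d*) (suc i) τ → ν w d* ≡ + d* + + τ
      right-moved {τ} thr = trans (ν-w d*) (trans (cong num (σ-suc f (act w′ (at d*)) (trans (cong (cls t n) res-before) ce)))
        (trans (num-suc (act w′ (at d*)) (act-valid w′ (at d*) hd*)) (trans (cong (_+ + 1) ν-right) (trans (lem (+ d*) (+ a*)) (cong (λ z → + d* + + z) (thr-unique colThr thr))))))
        where
        lem : ∀ d a → d + a + + 1 ≡ d + (+ 1 + a)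
        lem = solve-∀

    fixed : ∀ {p} → p N.≤ h → p ≢ a → p ≢ mirL t n a d → p ≢ d → p ≢ mirR t n a d → ν w p ≡ ν w′ p
    fixed {p} hp n₁ n₂ n₃ n₄ = trans (ν-w p) (cong num (σ-fix f (act w′ (at p)) (λ x → Sum.[ n₃ , n₄ ] (up-case hp x)) (λ x → Sum.[ n₁ , n₂ ] (down-case hp x))))

    thr-same : ∀ {P Q : ℕ → Set} {m τ} → (∀ k → k N.< m → P k → Q k) → (∀ k → k N.< m → Q k → P k) → IsThr P m τ → IsThr Q m τ
    thr-same to from (le , g) = le , λ k l → (λ q → proj₁ (g k l) (from k l q)) , (λ x → to k l (proj₂ (g k l) x))

    realizes : Realizes w I
    realizes = record { left = left ; right = right }
      where
      left : ∀ {p τ} → p N.≤ i → IsThr (Prow I p) (h ∸ i) τ → ν w p ≡ + p - + τ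
      left {p} {τ} lp thr = go (p N.≟ a) (p N.≟ mirL t n a d)
        where
        go : Dec (p ≡ a) → Dec (p ≡ mirL t n a d) → ν w p ≡ + p - + τ
        go (yes e) _ = subst (λ z → IsThr (Prow I z) (h ∸ i) τ → ν w z ≡ + z - + τ) (sym e) (left-moved e₁ (sym label-f)) thr
        go (no _) (yes e) = subst (λ z → IsThr (Prow I z) (h ∸ i) τ → ν w z ≡ + z - + τ) (sym e) (left-moved e₂ cls₂) thr
        go (no x) (no y) = trans (fixed (NP.≤-trans lp (NP.<⇒≤ i<h′)) x y (λ e → NP.<⇒≱ (proj₁ (proj₂ r₁)) (subst (N._≤ i) e lp)) (λ e → NP.<⇒≱ (proj₁ (proj₂ (rect-mir r₁))) (subst (N._≤ i) e lp)))
          (Realizes.left real lp (thr-same (λ k l m → ⇒I′ m (λ e → Sum.[ (λ z → x (proj₁ z)) , (λ z → y (proj₁ z)) ] (cell-eq (lp , row-k l , NP.m∸n≤m h k) r₁ e))) (λ k l m → proj₁ (I′⇒ m)) thr))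
      right : ∀ {q τ} → i N.< q → q N.≤ h → IsThr (Pcol I q) (suc i) τ → ν w q ≡ + q + + τ
      right {q} {τ} lq hq thr = go (q N.≟ d) (q N.≟ mirR t n a d)
        where
        go : Dec (q ≡ d) → Dec (q ≡ mirR t n a d) → ν w q ≡ + q + + τ
        go (yes e) _ = subst (λ z → IsThr (Pcol I z) (suc i) τ → ν w z ≡ + z + + τ) (sym e) (right-moved e₁ (sym label-f)) thr
        go (no _) (yes e) = subst (λ z → IsThr (Pcol I z) (suc i) τ → ν w z ≡ + z + + τ) (sym e) (right-moved e₂ cls₂) thr
        go (no x) (no y) = trans (fixed hq (λ e → NP.<⇒≱ lq (subst (N._≤ i) (sym e) (proj₁ r₁))) (λ e → NP.<⇒≱ lq (subst (N._≤ i) (sym e) (proj₁ (rect-mir r₁)))) x y)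
          (Realizes.right real lq hq (thr-same (λ k l m → ⇒I′ m (λ e → Sum.[ (λ z → x (proj₂ z)) , (λ z → y (proj₂ z)) ] (cell-eq (NP.≤-pred l , lq , hq) r₁ e))) (λ k l m → proj₁ (I′⇒ m)) thr))

  thr-empty : ∀ {P m τ} → (∀ k → k N.< m → ¬ P k) → IsThr P m τ → τ ≡ 0
  thr-empty none thr = thr-unique thr (z≤n , λ k l → (λ p → ⊥-elim (none k l p)) , (λ ()))

  opaque
    word : ∀ m I → S.∣ I ∣ N.≤ m → UpClosed I → I ⊆M → ∃ λ w → Realizes w I
    word m I le u sub with SP.nonempty? I
    ... | no empty = [] , record
        { left = λ {a} la thr → trans (lem (+ a) H) (cong (λ z → + a - + z) (sym (thr-empty (λ k l x → empty (proj₁ x , proj₁ (proj₂ x))) thr)))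
        ; right = λ {d} ld hd thr → trans (lem₂ (+ d) H) (cong (λ z → + d + + z) (sym (thr-empty (λ k l x → empty (proj₁ x , proj₁ (proj₂ x))) thr))) }
      where
      lem : ∀ a H → a + + 0 * H ≡ a - + 0
      lem = solve-∀
      lem₂ : ∀ a H → a + + 0 * H ≡ a + + 0
      lem₂ = solve-∀
    word zero I le u sub | yes (j , m) = ⊥-elim (NP.<⇒≱ (NP.≤-<-trans z≤n (SP.x∈p⇒∣p-x∣<∣p∣ m)) le)
    word (suc m) I le u sub | yes (j₀ , m₀) with rectOf j₀ (sub j₀ m₀)
    ... | p₀ , q₀ , r₀ , _ , e₀ with find-corner u sub q₀ (NP.m≤m+n q₀ p₀) r₀ (in⇒ m₀ e₀)
    ... | a , d , corner@(r , (je , me , ee) , min) = step (word m I′ (NP.≤-pred (NP.<-≤-trans smaller le)) u′ (λ j x → sub j (proj₁ (∈⇒ x))))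
      where
      open Subsets {P = λ j → j ∈ I × j ≢ je} (λ j → (j SP.∈? I) ×-dec ¬? (j FP.≟ je)) renaming (subset to I′)
      I′⇒ : ∀ {p q} → Er p q ∈R I′ → Er p q ∈R I × Er p q ≢ Er a d
      I′⇒ (j , x , e) = (j , proj₁ (∈⇒ x) , e) , (λ y → proj₂ (∈⇒ x) (root-inj (trans e (trans y (sym ee)))))
      ⇒I′ : ∀ {p q} → Er p q ∈R I → Er p q ≢ Er a d → Er p q ∈R I′
      ⇒I′ (j , x , e) ne = j , ⇒∈ (x , (λ { refl → ne (trans (sym e) ee) })) , e
      smaller : S.∣ I′ ∣ N.< S.∣ I ∣
      smaller = SP.p⊂q⇒∣p∣<∣q∣ ((λ x → proj₁ (∈⇒ x)) , je , me , (λ x → proj₂ (∈⇒ x) refl))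
      u′ : UpClosed I′
      u′ {p} {q} {p′} {q′} rp x lp lq hq = ⇒I′ (u rp (proj₁ (I′⇒ x)) lp lq hq) (λ e → go (cell-eq (NP.≤-trans lp (proj₁ rp) , NP.<-≤-trans (proj₁ (proj₂ rp)) lq , hq) r e))
        where
        go : (p′ ≡ a × q′ ≡ d) ⊎ (p′ ≡ mirL t n a d × q′ ≡ mirR t n a d) → ⊥
        go (inj₁ (y , z)) = proj₂ (I′⇒ x) (cong₂ Er (proj₁ eq) (proj₂ eq))
          where
          eq : p ≡ a × q ≡ d
          eq = min rp (proj₁ (I′⇒ x)) (subst (N._≤ p) y lp) (subst (q N.≤_) z lq)
        go (inj₂ (y , z)) = proj₂ (I′⇒ x) (trans (cong₂ Er (proj₁ eq) (proj₂ eq)) (Er-mirror (proj₁ (proj₂ (rect≤ r))) (proj₂ (proj₂ r))))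
          where
          eq : p ≡ mirL t n a d × q ≡ mirR t n a d
          eq = proj₂ (proj₂ (corner-mir corner)) rp (proj₁ (I′⇒ x)) (subst (N._≤ p) y lp) (subst (q N.≤_) z lq)
      step : (∃ λ w → Realizes w I′) → ∃ λ w → Realizes w I
      step (w′ , real) = Step.w I I′ u sub a d corner I′⇒ ⇒I′ w′ real , Step.realizes I I′ u sub a d corner I′⇒ ⇒I′ w′ real

    -- With a ↦ a − (row a) and d ↦ d + (column d), the inversions inside M_α are exactly the cells of I.
    realized-inv : ∀ {w I} → UpClosed I → I ⊆M → Realizes w I → Inv (ν w) I
    realized-inv {w} {I} u sub real = record { C1 = C1 ; C2 = C2 ; C3 = C3 ; C4 = C4 }
      where
      row : ∀ a → a N.≤ i → ∃ λ τ → IsThr (Prow I a) (h ∸ i) τ × ν w a ≡ + a - + τ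
      row a la with thr-row I u a la
      ... | τ , thr = τ , thr , Realizes.left real la thr
      col : ∀ d → i N.< d → d N.≤ h → ∃ λ τ → IsThr (Pcol I d) (suc i) τ × ν w d ≡ + d + + τ
      col d ld hd with thr-col I u d ld hd
      ... | τ , thr = τ , thr , Realizes.right real ld hd thr
      h-i : + (h ∸ i) ≡ + h - + i
      h-i = +h∸ (NP.<⇒≤ i<h′)
      -- A row has at most h - i cells and a column at most i + 1. These bounds give `C4`, and `C3`
      -- for two positions on the same side of α, where there is no cell of M_α.
      upper : ∀ p → p N.≤ h → ν w p ≤ + p + + suc i
      upper p hp with p N.≤? i
      ... | yes l with row p l
      ... | τ , _ , e = subst (_≤ + p + + suc i) (sym e) (≤-by₂ (Z.+≤+ {0} {τ} z≤n) (Z.+≤+ {0} {suc i} z≤n) (lem (+ p) (+ τ) (+ suc i)))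
        where
        lem : ∀ p τ s → (τ - + 0) + (s - + 0) ≡ (p + s) - (p - τ)
        lem = solve-∀
      upper p hp | no l with col p (NP.≰⇒> l) hp
      ... | τ , (le , _) , e = subst (_≤ + p + + suc i) (sym e) (ZP.+-monoʳ-≤ (+ p) (Z.+≤+ le))
      lower : ∀ p → p N.≤ h → + p - (+ h - + i) ≤ ν w p
      lower p hp with p N.≤? i
      ... | yes l with row p l
      ... | τ , (le , _) , e = subst (+ p - (+ h - + i) ≤_) (sym e) (≤-by (subst (+ τ ≤_) h-i (Z.+≤+ le)) (lem (+ p) (+ τ) (+ h - + i)))
        where
        lem : ∀ p τ x → x - τ ≡ (p - τ) - (p - x)
        lem = solve-∀
      lower p hp | no l with col p (NP.≰⇒> l) hp
      ... | τ , _ , e = subst (+ p - (+ h - + i) ≤_) (sym e) (≤-by₂ (Z.+≤+ {0} {τ} z≤n) (Z.+≤+ (NP.<⇒≤ i<h′)) (lem (+ p) (+ τ) (+ h) (+ i)))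
        where
        lem : ∀ p τ h i → (τ - + 0) + (h - i) ≡ (p + τ) - (p - (h - i))
        lem = solve-∀
      left≤ : ∀ p → p N.≤ i → ν w p ≤ + p
      left≤ p l with row p l
      ... | τ , _ , e = subst (_≤ + p) (sym e) (≤-by (Z.+≤+ {0} {τ} z≤n) (lem (+ p) (+ τ)))
        where
        lem : ∀ p τ → τ - + 0 ≡ p - (p - τ)
        lem = solve-∀
      right≥ : ∀ p → i N.< p → p N.≤ h → + p ≤ ν w p
      right≥ p l hp with col p l hp
      ... | τ , _ , e = subst (+ p ≤_) (sym e) (≤-by (Z.+≤+ {0} {τ} z≤n) (lem (+ p) (+ τ)))
        where
        lem : ∀ p τ → τ - + 0 ≡ (p + τ) - p
        lem = solve-∀
      C1 : ∀ {a d} → a N.< d → d N.≤ h → ν w a < ν w d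
      C1 {a} {d} l hd = go (a N.≤? i) (d N.≤? i)
        where
        ha : a N.≤ h
        ha = NP.≤-trans (NP.<⇒≤ l) hd
        go : Dec (a N.≤ i) → Dec (d N.≤ i) → ν w a < ν w d
        go (yes x) (yes y) with row a x | row d y
        ... | τ , thr , e | τ′ , thr′ , e′ = subst₂ _<_ (sym e) (sym e′) (+1≤⇒< (≤-by₂ (Z.+≤+ l) (Z.+≤+ (thr-mono thr′ thr (λ k k< m → u (y , row-k k< , NP.m∸n≤m h k) m (NP.<⇒≤ l) NP.≤-refl (NP.m∸n≤m h k)))) (lem (+ a) (+ d) (+ τ) (+ τ′))))
          where
          lem : ∀ a d τ τ′ → (d - (+ 1 + a)) + (τ - τ′) ≡ (d - τ′) - (a - τ + + 1)
          lem = solve-∀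
        go (yes x) (no y) = ZP.≤-<-trans (left≤ a x) (ZP.<-≤-trans (Z.+<+ l) (right≥ d (NP.≰⇒> y) hd))
        go (no x) (yes y) = ⊥-elim (x (NP.≤-trans (NP.<⇒≤ l) y))
        go (no x) (no y) with col a (NP.≰⇒> x) ha | col d (NP.≰⇒> y) hd
        ... | τ , thr , e | τ′ , thr′ , e′ = subst₂ _<_ (sym e) (sym e′) (+1≤⇒< (≤-by₂ (Z.+≤+ l) (Z.+≤+ (thr-mono thr thr′ (λ k k< m → u (NP.≤-pred k< , NP.≰⇒> x , ha) m NP.≤-refl (NP.<⇒≤ l) hd))) (lem (+ a) (+ d) (+ τ) (+ τ′))))
          where
          lem : ∀ a d τ τ′ → (d - (+ 1 + a)) + (τ′ - τ) ≡ (d + τ′) - (a + τ + + 1)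
          lem = solve-∀
      C2 : ∀ {a d} → a N.< d → d N.≤ h → Er a d ∈R I → ν w a + H < ν w d
      C2 {a} {d} l hd m = go (cell-rect sub (NP.≤-trans (NP.<⇒≤ l) hd) hd m)
        where
        go : Rect a d → ν w a + H < ν w d
        go r@(la , ld , _) with row a la | col d ld hd
        ... | τ , (_ , f) , e | τ′ , (_ , f′) , e′ = subst₂ (λ x y → x + H < y) (sym e) (sym e′) (+1≤⇒< (≤-by₂ (subst (λ z → + 1 + z ≤ + τ) (+h∸ hd) (Z.+≤+ (proj₁ (f (h ∸ d) (row-d ld hd)) (subst (λ z → Er a z ∈R I) (sym (NP.m∸[m∸n]≡n hd)) m))))
            (Z.+≤+ (proj₁ (f′ a (s≤s la)) m)) (lem (+ a) (+ d) (+ h) (+ τ) (+ τ′))))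
          where
          lem : ∀ a d h τ τ′ → (τ - (+ 1 + (h - d))) + (τ′ - (+ 1 + a)) ≡ (d + τ′) - (a - τ + (+ 1 + h) + + 1)
          lem = solve-∀
      C3 : ∀ {a d} → a N.< d → d N.≤ h → ¬ (Er a d ∈R I) → ν w d < ν w a + H
      C3 {a} {d} l hd nm = go (a N.≤? i) (d N.≤? i)
        where
        ha : a N.≤ h
        ha = NP.≤-trans (NP.<⇒≤ l) hd
        go : Dec (a N.≤ i) → Dec (d N.≤ i) → ν w d < ν w a + H
        go (no x) (yes y) = ⊥-elim (x (NP.≤-trans (NP.<⇒≤ l) y))
        go (yes x) (yes y) = +1≤⇒< (≤-by₃ (left≤ d y) (lower a ha) (Z.+≤+ (NP.≤-trans y (NP.m≤n+m i a))) (lem (+ a) (+ d) (+ i) (+ h) (ν w a) (ν w d)))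
          where
          lem : ∀ a d i h x y → (d - y) + (x - (a - (h - i))) + ((a + i) - d) ≡ (x + (+ 1 + h)) - (y + + 1)
          lem = solve-∀
        go (no x) (no y) = +1≤⇒< (≤-by₃ (upper d hd) (right≥ a (NP.≰⇒> x) ha) (Z.+≤+ (NP.+-mono-≤ (NP.≰⇒> x) hd)) (lem (+ a) (+ d) (+ i) (+ h) (ν w a) (ν w d)))
          where
          lem : ∀ a d i h x y → ((d + (+ 1 + i)) - y) + (x - a) + ((a + h) - ((+ 1 + i) + d)) ≡ (x + (+ 1 + h)) - (y + + 1)
          lem = solve-∀
        go (yes x) (no y) with row a x | col d (NP.≰⇒> y) hd
        ... | τ , (_ , f) , e | τ′ , (_ , f′) , e′ = subst₂ (λ u v → v < u + H) (sym e) (sym e′) (+1≤⇒< (≤-by₂ (subst (+ τ ≤_) (+h∸ hd) (Z.+≤+ (NP.≮⇒≥ (λ z → nm (subst (λ z → Er a z ∈R I) (NP.m∸[m∸n]≡n hd) (proj₂ (f (h ∸ d) (row-d (NP.≰⇒> y) hd)) z))))))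
            (Z.+≤+ (NP.≮⇒≥ (λ z → nm (proj₂ (f′ a (s≤s x)) z)))) (lem (+ a) (+ d) (+ h) (+ τ) (+ τ′))))
          where
          lem : ∀ a d h τ τ′ → ((h - d) - τ) + (a - τ′) ≡ (a - τ + (+ 1 + h)) - (d + τ′ + + 1)
          lem = solve-∀
      C4 : ∀ {a d} → a N.< d → d N.≤ h → ν w d < ν w a + (H + H)
      C4 {a} {d} l hd = +1≤⇒< (≤-by₃ (upper d hd) (lower a (NP.≤-trans (NP.<⇒≤ l) hd)) (Z.+≤+ (NP.≤-trans hd (NP.m≤m+n h a))) (lem (+ a) (+ d) (+ i) (+ h) (ν w a) (ν w d)))
        where
        lem : ∀ a d i h x y → ((d + (+ 1 + i)) - y) + (x - (a - (h - i))) + ((h + a) - d) ≡ (x + ((+ 1 + h) + (+ 1 + h))) - (y + + 1)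
        lem = solve-∀

-- The four statements, and long simple roots

module Main (t : RType) (n : ℕ) (valid : ValidRank t n) (ι : Fin n) (long : LongIx t n (toℕ ι)) where
  open Words t n valid ι long public
  open Triangulate t n valid ι long using (good-triangulation; module M; M-good)

  coord≤1 : ∀ v → IsPosRoot v → + 0 ≤ lookup v ι × lookup v ι ≤ + 1
  coord≤1 v pos with root-cell t n valid pos
  ... | p , q , l , hq , _ , refl = Er≥0 (NP.<⇒≤ l) ι , subst (_≤ + 1) (sym (coord hp hq)) (≤-by₂ (proj₂ (lt-range (suc i) p)) (proj₁ (lt-range (suc i) q)) (lem (lt (suc i) p) (lt (suc i) q)))
    where
    hp : p N.≤ h
    hp = NP.≤-trans (NP.<⇒≤ l) hq
    lem : ∀ a b → (+ 1 - a) + (b - + 0) ≡ + 1 - (a - b)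
    lem = solve-∀

  root-ι : ∀ j → InM α j → lookup (root j) ι ≡ + 1
  root-ι j m = go (rectOf j m)
    where
    go : (∃₂ λ p q → Rect p q × Can t n p q × root j ≡ Er p q) → lookup (root j) ι ≡ + 1
    go (p , q , r , _ , e) = trans (cong (λ v → lookup v ι) e) (coord-rect r)

  -- The sum has α-coefficient 2, which exceeds the bound 1 for positive roots; its negative has a
  -- negative coefficient.
  abelian : ∀ {I} → I ⊆M → ∀ j k → j ∈ I → k ∈ I → ¬ IsRoot (root j +v root k)
  abelian {I} sub j k mj mk = Sum.[ (λ pos → no₁ (subst (_≤ + 1) two (proj₂ (coord≤1 (root j +v root k) pos)))) ,
      (λ ng → no₂ (subst (+ 0 ≤_) (trans (VP.lookup-map ι -_ (root j +v root k)) (cong -_ two)) (proj₁ (coord≤1 (V.map -_ (root j +v root k)) ng)))) ]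
    where
    two : lookup (root j +v root k) ι ≡ + 2
    two = trans (VP.lookup-zipWith _+_ ι (root j) (root k)) (cong₂ _+_ (root-ι j (sub j mj)) (root-ι k (sub k mk)))
    no₁ : ¬ (+ 2 ≤ + 1)
    no₁ (Z.+≤+ (s≤s ()))
    no₂ : ¬ (+ 0 ≤ - + 2)
    no₂ ()

  opaque
    -- `Good` makes column h and row 0 full, of lengths i + 1 and h - i. Hence (h , -2) goes to h +
    -- (i + 1) - 2(h + 1), which is position i one period down, and 0 goes to -(h - i), which is i +
    -- 1 one period down. The image of 2δ - θ is therefore the step from i to i + 1, that is α.
    final : ∀ {w I} → Good I → Realizes w I → actInv w (V.map Q.-_ (toQv θ) , toQ (+ 2)) ≡ (toQv α , 0ℚ)
    final {w} {I} (ideal , sub , top , side) real = trans (cong (actInv w) start) (trans (act-pair w (h , - (+ 2)) (at 0) NP.≤-refl z≤n)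
        (trans (cong toA (cong₂ ξ actH act0)) (cong₂ _,_ (cong toQv Er≡α) refl)))
      where
      start : (V.map Q.-_ (toQv θ) , toQ (+ 2)) ≡ toA (ξ (h , - (+ 2)) (at 0))
      start = cong₂ _,_ (trans (cong (λ v → V.map Q.-_ (toQv v)) θ≡) (trans (negQv (Er 0 h)) (cong toQv (Er-neg 0 h)))) refl
      fullCol : IsThr (Pcol I h) (suc i) (suc i)
      fullCol = NP.≤-refl , λ k l → (λ _ → l) , (λ _ → upR ideal rectSide side (NP.≤-pred l) NP.≤-refl NP.≤-refl)
      fullRow : IsThr (Prow I 0) (h ∸ i) (h ∸ i)
      fullRow = NP.≤-refl , λ k l → (λ _ → l) , (λ _ → upR ideal rectTop top z≤n (row-k l) (NP.m∸n≤m h k))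
      actH : act w (h , - (+ 2)) ≡ (i , - (+ 1))
      actH = num-inj (act w (h , - (+ 2))) (i , - (+ 1)) (act-valid w (h , - (+ 2)) NP.≤-refl) (NP.<⇒≤ i<h′) (trans (num-act w h (- (+ 2)))
        (trans (cong (_+ (- (+ 2)) * H) (Realizes.right real i<h′ NP.≤-refl fullCol)) (lem (+ i) (+ h))))
        where
        lem : ∀ i h → (h + (+ 1 + i)) + (- + 2) * (+ 1 + h) ≡ i + (- + 1) * (+ 1 + h)
        lem = solve-∀
      act0 : act w (at 0) ≡ (suc i , - (+ 1))
      act0 = num-inj (act w (at 0)) (suc i , - (+ 1)) (act-valid w (at 0) z≤n) i<h′ (trans (Realizes.left real z≤n fullRow) (trans (cong (λ z → + 0 - z) (+h∸ (NP.<⇒≤ i<h′))) (lem (+ i) (+ h))))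
        where
        lem : ∀ i h → + 0 - (h - i) ≡ (+ 1 + i) + (- + 1) * (+ 1 + h)
        lem = solve-∀
      Er≡α : Er i (suc i) ≡ α
      Er≡α = lookup-ext (λ j → trans (lookup-Er i (suc i) j) (trans (lem (g i (toℕ j)) (eqi (toℕ j) (cls t n i))) (trans (cong (eqi (toℕ j)) (cls-id t n i<n)) (sym (lookup-simple n ι j)))))
        where
        lem : ∀ a b → (a + b) - a ≡ b
        lem = solve-∀

    good⇒iab : ∀ {I} → Good I → Iab α I
    good⇒iab {I} good@(ideal , sub , _) = (ideal , abelian sub) , go (word S.∣ I ∣ I NP.≤-refl up′ sub)
      where
      up′ : UpClosed I
      up′ = upR ideal
      go : (∃ λ w → Realizes w I) → Σ Word λ w → InversionSetIs w I × actInv w (V.map Q.-_ (toQv θ) , toQ (+ 2)) ≡ (toQv α , 0ℚ)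
      go (w , real) = w , ⇒inversions w I (realized-inv up′ sub real) , final good real

  triangulation-resp : ∀ {Sel Sel′ : RSet → Set} {V′ : RSet → Fin NR → Set} {Q Q′ : Vec ℚ n → Set} →
    (∀ J → Sel′ J → Sel J) → (∀ J → Sel J → Sel′ J) → (∀ x → Q′ x → Q x) → (∀ x → Q x → Q′ x) →
    Triangulation Sel V′ Q → Triangulation Sel′ V′ Q′
  triangulation-resp s s⁻ q q⁻ (indep , cover , meet′) = (λ J sel → indep J (s J sel)) ,
    (λ x → mk⇔ (λ qx → case Equivalence.to (cover x) (q x qx) of λ { (J , sel , ic) → J , s⁻ J sel , ic })
      (λ { (J , sel , ic) → q⁻ x (Equivalence.from (cover x) (J , s J sel , ic)) })) ,
    (λ J J′ sel sel′ → meet′ J J′ (s J sel) (s J′ sel′))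

  part₁ : ∀ I → DualOrderIdeal I → (∀ j → j ∈ I → InM α j) → SpansE (λ j → j ∈ I) ⇔ Iab α I
  part₁ I ideal sub = mk⇔ (λ sp → good⇒iab (spans-good ideal sub sp)) (λ iab → good-spans (iab⇒good iab))

  part₃ : ∀ I → Iab α I → Triangulation (λ J → Iab α J × J ⊆ I) InBorder (InConv (λ j → j ∈ I))
  part₃ I iab = triangulation-resp (λ J s → iab⇒good (proj₁ s) , proj₂ s) (λ J s → good⇒iab (proj₁ s) , proj₂ s) (λ x q → q) (λ x q → q)
    (good-triangulation I (iab⇒good iab))

  part₄ : Triangulation (Iab α) InBorder (InConv (InM α))
  part₄ = triangulation-resp (λ J s → iab⇒good s , (λ j m → M.⇒∈ (proj₁ (proj₂ (iab⇒good s)) j m))) (λ J s → good⇒iab (proj₁ s))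
    (λ x → conv-mono (λ j → M.⇒∈)) (λ x → conv-mono (λ j → M.∈⇒)) (good-triangulation M.subset M-good)

-- In type C, (θ,θ) is obtained from the affine node, whose finite part is -θ: it equals 4, whereas
-- a simple root other than the last has squared length 2.
long-index : ∀ t n → ValidRank t n → (i : Fin n) → Roots.IsLong t n (simple n i) → LongIx t n (toℕ i)
long-index A n v i _ = FP.toℕ<n i
long-index C n v i e = go (suc (toℕ i) N.≟ n)
  where
  open Reflections C n v
  simple≡ : simple n i ≡ αv (F.suc i)
  simple≡ = vecOf-cong n (λ k _ → sym (eqi-def k (toℕ i)))
  ipZ-neg : ∀ u u′ → (∀ j → lookup u′ j ≡ - lookup u j) → ipZ u u ≡ ipZ u′ u′
  ipZ-neg u u′ en = ΣZ.sum-cong n (λ j → ΣZ.sum-cong n (λ k → sym (trans (cong₂ (λ x y → x * gram C n (toℕ j) (toℕ k) * y) (en j) (en k)) (lem (lookup u j) (gram C n (toℕ j) (toℕ k)) (lookup u k)))))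
    where
    lem : ∀ a m b → (- a) * m * (- b) ≡ a * m * b
    lem = solve-∀
  θ-norm : ipZ θ θ ≡ + 4
  θ-norm = trans (cong₂ ipZ θ≡ θ≡) (trans (ipZ-neg (Er 0 (hi C n)) (αv F.zero) αv-zero) (ipZ-self F.zero))
  norms : + 2 + (eqi (suc (toℕ i)) n + eqi (suc (toℕ i)) n) ≡ + 4
  norms = toQ-inj (trans (cong toQ (sym (trans (cong₂ ipZ simple≡ simple≡) (ipZ-self (F.suc i))))) (trans (sym (ip-toQ (simple n i) (simple n i))) (trans e (trans (ip-toQ θ θ) (cong toQ θ-norm)))))
  2≢4 : + 2 ≢ + 4
  2≢4 ()
  go : Dec (suc (toℕ i) ≡ n) → suc (toℕ i) ≡ n
  go (yes p) = p
  go (no np) = ⊥-elim (2≢4 (trans (sym (cong (λ z → + 2 + (z + z)) (eqi-no np))) norms))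

theorem5p8 : (t : RType) (n : ℕ) → ValidRank t n →
    let open Roots t n in
    (i : Fin n) → IsLong (simple n i) →
    let α = simple n i in
    -- (1)
    (∀ (I : RSet) → DualOrderIdeal I → (∀ j → j ∈ I → InM α j) →
       (SpansE (λ j → j ∈ I) ⇔ Iab α I))
    -- (2)
    × (∀ (I : RSet) → Iab α I → ZBasis (InBorder I))
    -- (3)
    × (∀ (I : RSet) → Iab α I →
         Triangulation (λ J → Iab α J × J ⊆ I) InBorder (InConv (λ j → j ∈ I)))
    -- in particular: triangulation of F_α = conv(M_α)
    × Triangulation (Iab α) InBorder (InConv (InM α))
theorem5p8 t n v i isLong = part₁ , (λ I iab → zbasis (iab⇒good iab)) , part₃ , part₄
  where
  open Main t n v i (long-index t n v i isLong)
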